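{- There is $\Delta_0\in\mathbb{N}$ such that if $G$ is a Borel graph of finite maximum degree $\Delta\geq\Delta_0$ and $\mathrm{asi}(G)<\infty$, then $\chi'_{\mathsf{B}}(G)\leq\Delta+\sqrt{\Delta}\,\log^3\Delta$.
   Context: All graphs are undirected and simple; $\mathbb{N}=\{0,1,2,\dots\}$, and $q\in\mathbb{N}$ is identified with $\{0,\dots,q-1\}$. $\log$ is the natural logarithm and $\log^3\Delta=(\log\Delta)^3$. A Borel graph is a graph $G$ whose vertex set $V(G)$ is a standard Borel space and whose adjacency relation is a Borel subset of $V(G)^2$; equivalently, the edge set $E(G)$ is a Borel subset of the standard Borel space $[V(G)]^2$ of two-element subsets of $V(G)$. The Borel chromatic index $\chi'_{\mathsf{B}}(G)$ is the smallest $q\in\mathbb{N}$ such that there is a Borel function $f\colon E(G)\to q$ with $f(e)\neq f(e')$ for all distinct edges $e,e'$ sharing a vertex ($\infty$ if no such $q$ exists). A graph is component-finite if all its connected components are finite. $G[U]$ denotes the subgraph induced by $U\subseteq V(G)$. For a Borel graph $G$, the separation index $\mathrm{si}(G)$ is the smallest $s\in\mathbb{N}$ for which there is a partition $V(G)=U_0\sqcup\dots\sqcup U_s$ into $s+1$ Borel sets such that every $G[U_i]$ is component-finite ($\infty$ if no such $s$ exists). For $R\in\mathbb{N}$, $G^R$ is the graph on $V(G)$ in which two distinct vertices are adjacent iff they are joined by a path of at most $R$ edges in $G$. The asymptotic separation index is $\mathrm{asi}(G)=\sup_{R\in\mathbb{N}}\mathrm{si}(G^R)$. -}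

module Defs where

open import Algebra.Bundles using (CommutativeMonoid)
open import Axiom.ExcludedMiddle public using (ExcludedMiddle)
open import Data.Fin.Base using (Fin)
open import Data.Integer.Base as ℤ using (+_)
open import Data.List.Base using (List; []; _∷_; _∷ʳ_; length)
open import Data.List.Membership.Propositional using () renaming (_∈_ to _∈ˡ_)
open import Data.List.Relation.Binary.Permutation.Propositional
  using (_↭_; prep; ↭-refl; ↭-trans; ↭-reflexive; ↭⇒↭ₛ)
open import Data.List.Relation.Binary.Permutation.Propositional.Properties using (∷↭∷ʳ)
open import Data.List.Relation.Binary.Permutation.Setoid.Properties using (Unique-resp-↭)
open import Data.List.Relation.Unary.Unique.Propositional using (Unique)
open import Data.Maybe.Base using (Maybe; just)
open import Data.Nat.Base as ℕ using (ℕ; zero; suc; _!)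
import Data.Nat.Properties as ℕ
open import Data.Product.Base using (Σ; Σ-syntax; ∃; ∃-syntax; _×_; _,_; proj₁; proj₂)
open import Data.Product using (∃!)
open import Data.Rational.Base as ℚ using (ℚ; 0ℚ; 1ℚ; ½; ∣_∣)
import Data.Rational.Properties as ℚ
open import Data.Refinement.Base using (Refinement-syntax; value)
open import Function.Bundles using (_⇔_)
open import Level using (0ℓ; _⊔_) renaming (suc to lsuc)
open import Relation.Binary.Core using (Rel)
open import Relation.Binary.Definitions using (Symmetric; Irreflexive)
open import Relation.Binary.PropositionalEquality
  using (_≡_; _≢_; refl; sym; cong; cong₂; subst; setoid; module ≡-Reasoning)
open import Relation.Unary using (Pred; _∈_; _≐_; ∅; ∁; ⋃; _⟨×⟩_)

------------------------------------------------------------------------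
-- Real numbers: Cauchy sequences of rationals.  Equality of reals is the
-- equivalence relation _≃_, not _≡_.

IsCauchyℚ : (ℕ → ℚ) → Set
IsCauchyℚ u =
  ∀ ε → 0ℚ ℚ.< ε → ∃[ N ] (∀ m n → N ℕ.≤ m → N ℕ.≤ n → ∣ u m ℚ.- u n ∣ ℚ.≤ ε)

record ℝ : Set where
  constructor mkℝ
  field
    approx : ℕ → ℚ
    cauchy : IsCauchyℚ approx
open ℝ

fromℚ : ℚ → ℝ
fromℚ q = mkℝ (λ _ → q) λ ε ε>0 → 0 , λ _ _ _ _ →
  subst (λ z → ∣ z ∣ ℚ.≤ ε) (sym (ℚ.+-inverseʳ q)) (ℚ.<⇒≤ ε>0)

fromℕ : ℕ → ℝ
fromℕ n = fromℚ (+ n ℚ./ 1)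

0ℝ 1ℝ : ℝ
0ℝ = fromℕ 0
1ℝ = fromℕ 1

infix 4 _≤ᵣ_ _≃_

_≤ᵣ_ _≃_ : Rel ℝ 0ℓ
x ≤ᵣ y =
  ∀ ε → 0ℚ ℚ.< ε → ∃[ N ] (∀ n → N ℕ.≤ n → approx x n ℚ.≤ approx y n ℚ.+ ε)
x ≃ y = (x ≤ᵣ y) × (y ≤ᵣ x)

private
  telescope : ∀ p q r → (p ℚ.- q) ℚ.+ (q ℚ.- r) ≡ p ℚ.- r
  telescope p q r = begin
    (p ℚ.- q) ℚ.+ (q ℚ.- r)       ≡⟨ ℚ.+-assoc p (ℚ.- q) (q ℚ.- r) ⟩
    p ℚ.+ (ℚ.- q ℚ.+ (q ℚ.- r))   ≡⟨ cong (p ℚ.+_) (sym (ℚ.+-assoc (ℚ.- q) q (ℚ.- r))) ⟩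
    p ℚ.+ ((ℚ.- q ℚ.+ q) ℚ.- r)   ≡⟨ cong (λ z → p ℚ.+ (z ℚ.- r)) (ℚ.+-inverseˡ q) ⟩
    p ℚ.+ (0ℚ ℚ.- r)              ≡⟨ cong (p ℚ.+_) (ℚ.+-identityˡ (ℚ.- r)) ⟩
    p ℚ.- r                       ∎
    where open ≡-Reasoning

  split : ∀ p q → p ≡ q ℚ.+ (p ℚ.- q)
  split p q = begin
    p                        ≡⟨ sym (ℚ.+-identityʳ p) ⟩
    p ℚ.+ 0ℚ                 ≡⟨ cong (p ℚ.+_) (sym (ℚ.+-inverseˡ q)) ⟩
    p ℚ.+ (ℚ.- q ℚ.+ q)      ≡⟨ sym (ℚ.+-assoc p (ℚ.- q) q) ⟩
    (p ℚ.- q) ℚ.+ q          ≡⟨ ℚ.+-comm (p ℚ.- q) q ⟩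
    q ℚ.+ (p ℚ.- q)          ∎
    where open ≡-Reasoning

  sum-difference : ∀ a b c d →
    (a ℚ.+ b) ℚ.- (c ℚ.+ d) ≡ (a ℚ.- c) ℚ.+ (b ℚ.- d)
  sum-difference a b c d = begin
    (a ℚ.+ b) ℚ.- (c ℚ.+ d)          ≡⟨ cong ((a ℚ.+ b) ℚ.+_) (ℚ.neg-distrib-+ c d) ⟩
    (a ℚ.+ b) ℚ.+ (ℚ.- c ℚ.- d)      ≡⟨ interchange a b (ℚ.- c) (ℚ.- d) ⟩
    (a ℚ.- c) ℚ.+ (b ℚ.- d)          ∎
    where
    open ≡-Reasoning
    open import Algebra.Properties.CommutativeSemigroup
      (CommutativeMonoid.commutativeSemigroup ℚ.+-0-commutativeMonoid)
      using (interchange)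

  product-difference : ∀ a b c d →
    a ℚ.* b ℚ.- c ℚ.* d ≡ a ℚ.* (b ℚ.- d) ℚ.+ (a ℚ.- c) ℚ.* d
  product-difference a b c d = sym (begin
    a ℚ.* (b ℚ.- d) ℚ.+ (a ℚ.- c) ℚ.* d
      ≡⟨ cong₂ ℚ._+_ (ℚ.*-distribˡ-+ a b (ℚ.- d)) (ℚ.*-distribʳ-+ d a (ℚ.- c)) ⟩
    (a ℚ.* b ℚ.+ a ℚ.* ℚ.- d) ℚ.+ (a ℚ.* d ℚ.+ ℚ.- c ℚ.* d)
      ≡⟨ cong₂ (λ x y → (a ℚ.* b ℚ.+ x) ℚ.+ (a ℚ.* d ℚ.+ y))
           (sym (ℚ.neg-distribʳ-* a d)) (sym (ℚ.neg-distribˡ-* c d)) ⟩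
    (a ℚ.* b ℚ.- a ℚ.* d) ℚ.+ (a ℚ.* d ℚ.- c ℚ.* d)
      ≡⟨ telescope (a ℚ.* b) (a ℚ.* d) (c ℚ.* d) ⟩
    a ℚ.* b ℚ.- c ℚ.* d ∎)
    where open ≡-Reasoning

  half+half : ∀ ε → ε ℚ.* ½ ℚ.+ ε ℚ.* ½ ≡ ε
  half+half ε = begin-equality
    ε ℚ.* ½ ℚ.+ ε ℚ.* ½ ≡⟨ sym (ℚ.*-distribˡ-+ ε ½ ½) ⟩
    ε ℚ.* 1ℚ            ≡⟨ ℚ.*-identityʳ ε ⟩
    ε                   ∎
    where open ℚ.≤-Reasoning

  *-pos : ∀ {p q} → 0ℚ ℚ.< p → 0ℚ ℚ.< q → 0ℚ ℚ.< p ℚ.* q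
  *-pos {p} {q} p>0 q>0 =
    subst (ℚ._< p ℚ.* q) (ℚ.*-zeroˡ q)
      (ℚ.*-monoˡ-<-pos q {{ℚ.positive q>0}} p>0)

  *-mono-≤ : ∀ {p q r s} → 0ℚ ℚ.≤ r → 0ℚ ℚ.≤ q →
             p ℚ.≤ q → r ℚ.≤ s → p ℚ.* r ℚ.≤ q ℚ.* s
  *-mono-≤ {p} {q} {r} {s} r≥0 q≥0 p≤q r≤s = ℚ.≤-trans
    (ℚ.*-monoʳ-≤-nonNeg r {{ℚ.nonNegative r≥0}} p≤q)
    (ℚ.*-monoˡ-≤-nonNeg q {{ℚ.nonNegative q≥0}} r≤s)

  0<1 : 0ℚ ℚ.< 1ℚ
  0<1 = ℚ.positive⁻¹ 1ℚ

  0<½ : 0ℚ ℚ.< ½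
  0<½ = ℚ.positive⁻¹ ½

  eventually-bounded : ∀ u → IsCauchyℚ u →
    ∃[ A ] (0ℚ ℚ.< A) × ∃[ N ] (∀ n → N ℕ.≤ n → ∣ u n ∣ ℚ.≤ A)
  eventually-bounded u cu with N , close ← cu 1ℚ 0<1 =
    ∣ u N ∣ ℚ.+ 1ℚ , ℚ.+-mono-≤-< (ℚ.0≤∣p∣ (u N)) 0<1 , N , λ n N≤n → begin
      ∣ u n ∣                       ≡⟨ cong ∣_∣ (split (u n) (u N)) ⟩
      ∣ u N ℚ.+ (u n ℚ.- u N) ∣     ≤⟨ ℚ.∣p+q∣≤∣p∣+∣q∣ (u N) (u n ℚ.- u N) ⟩
      ∣ u N ∣ ℚ.+ ∣ u n ℚ.- u N ∣   ≤⟨ ℚ.+-monoʳ-≤ ∣ u N ∣ (close n N N≤n ℕ.≤-refl) ⟩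
      ∣ u N ∣ ℚ.+ 1ℚ                ∎
    where open ℚ.≤-Reasoning

  +-cauchy : ∀ u v → IsCauchyℚ u → IsCauchyℚ v → IsCauchyℚ (λ n → u n ℚ.+ v n)
  +-cauchy u v cu cv ε ε>0
    with M , closeᵘ ← cu (ε ℚ.* ½) (*-pos ε>0 0<½)
    with N , closeᵛ ← cv (ε ℚ.* ½) (*-pos ε>0 0<½) =
    M ℕ.⊔ N , λ m n m≥ n≥ → begin
      ∣ (u m ℚ.+ v m) ℚ.- (u n ℚ.+ v n) ∣
        ≡⟨ cong ∣_∣ (sum-difference (u m) (v m) (u n) (v n)) ⟩
      ∣ (u m ℚ.- u n) ℚ.+ (v m ℚ.- v n) ∣
        ≤⟨ ℚ.∣p+q∣≤∣p∣+∣q∣ (u m ℚ.- u n) (v m ℚ.- v n) ⟩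
      ∣ u m ℚ.- u n ∣ ℚ.+ ∣ v m ℚ.- v n ∣
        ≤⟨ ℚ.+-mono-≤
             (closeᵘ m n (ℕ.m⊔n≤o⇒m≤o M N m≥) (ℕ.m⊔n≤o⇒m≤o M N n≥))
             (closeᵛ m n (ℕ.m⊔n≤o⇒n≤o M N m≥) (ℕ.m⊔n≤o⇒n≤o M N n≥)) ⟩
      ε ℚ.* ½ ℚ.+ ε ℚ.* ½
        ≡⟨ half+half ε ⟩
      ε ∎
    where open ℚ.≤-Reasoning

  *-cauchy : ∀ u v → IsCauchyℚ u → IsCauchyℚ v → IsCauchyℚ (λ n → u n ℚ.* v n)
  *-cauchy u v cu cv ε ε>0
    with A , A>0 , K , boundᵘ ← eventually-bounded u cu
    with B , B>0 , L , boundᵛ ← eventually-bounded v cv =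
    (K ℕ.⊔ L) ℕ.⊔ (M ℕ.⊔ N) , λ m n m≥ n≥ →
      let m≥M⊔N = ℕ.m⊔n≤o⇒n≤o (K ℕ.⊔ L) (M ℕ.⊔ N) m≥
          n≥M⊔N = ℕ.m⊔n≤o⇒n≤o (K ℕ.⊔ L) (M ℕ.⊔ N) n≥
          m≥K   = ℕ.m⊔n≤o⇒m≤o K L (ℕ.m⊔n≤o⇒m≤o (K ℕ.⊔ L) (M ℕ.⊔ N) m≥)
          n≥L   = ℕ.m⊔n≤o⇒n≤o K L (ℕ.m⊔n≤o⇒m≤o (K ℕ.⊔ L) (M ℕ.⊔ N) n≥)
      in begin
      ∣ u m ℚ.* v m ℚ.- u n ℚ.* v n ∣
        ≡⟨ cong ∣_∣ (product-difference (u m) (v m) (u n) (v n)) ⟩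
      ∣ u m ℚ.* (v m ℚ.- v n) ℚ.+ (u m ℚ.- u n) ℚ.* v n ∣
        ≤⟨ ℚ.∣p+q∣≤∣p∣+∣q∣ (u m ℚ.* (v m ℚ.- v n)) ((u m ℚ.- u n) ℚ.* v n) ⟩
      ∣ u m ℚ.* (v m ℚ.- v n) ∣ ℚ.+ ∣ (u m ℚ.- u n) ℚ.* v n ∣
        ≡⟨ cong₂ ℚ._+_ (ℚ.∣p*q∣≡∣p∣*∣q∣ (u m) (v m ℚ.- v n))
                       (ℚ.∣p*q∣≡∣p∣*∣q∣ (u m ℚ.- u n) (v n)) ⟩
      ∣ u m ∣ ℚ.* ∣ v m ℚ.- v n ∣ ℚ.+ ∣ u m ℚ.- u n ∣ ℚ.* ∣ v n ∣
        ≤⟨ ℚ.+-mono-≤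
             (*-mono-≤ (ℚ.0≤∣p∣ (v m ℚ.- v n)) (ℚ.<⇒≤ A>0) (boundᵘ m m≥K)
               (closeᵛ m n (ℕ.m⊔n≤o⇒n≤o M N m≥M⊔N) (ℕ.m⊔n≤o⇒n≤o M N n≥M⊔N)))
             (*-mono-≤ (ℚ.0≤∣p∣ (v n)) (ℚ.<⇒≤ δ>0)
               (closeᵘ m n (ℕ.m⊔n≤o⇒m≤o M N m≥M⊔N) (ℕ.m⊔n≤o⇒m≤o M N n≥M⊔N))
               (boundᵛ n n≥L)) ⟩
      A ℚ.* δ ℚ.+ δ ℚ.* B
        ≡⟨ collect ⟩
      ε ℚ.* (C⁻¹ ℚ.* C)
        ≡⟨ cong (ε ℚ.*_) (ℚ.*-inverseˡ C {{C≢0}}) ⟩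
      ε ℚ.* 1ℚ
        ≡⟨ ℚ.*-identityʳ ε ⟩
      ε ∎
    where
    open ℚ.≤-Reasoning
    C = A ℚ.+ B
    C>0 : 0ℚ ℚ.< C
    C>0 = ℚ.+-mono-< A>0 B>0
    C≢0 : ℚ.NonZero C
    C≢0 = ℚ.pos⇒nonZero C {{ℚ.positive C>0}}
    C⁻¹ = (ℚ.1/ C) {{C≢0}}
    δ = ε ℚ.* C⁻¹
    δ>0 : 0ℚ ℚ.< δ
    δ>0 = *-pos ε>0 (ℚ.positive⁻¹ C⁻¹ {{ℚ.1/pos⇒pos C {{ℚ.positive C>0}}}})
    M = proj₁ (cu δ δ>0)
    closeᵘ = proj₂ (cu δ δ>0)
    N = proj₁ (cv δ δ>0)
    closeᵛ = proj₂ (cv δ δ>0)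
    collect : A ℚ.* δ ℚ.+ δ ℚ.* B ≡ ε ℚ.* (C⁻¹ ℚ.* C)
    collect = begin-equality
      A ℚ.* δ ℚ.+ δ ℚ.* B   ≡⟨ cong (ℚ._+ δ ℚ.* B) (ℚ.*-comm A δ) ⟩
      δ ℚ.* A ℚ.+ δ ℚ.* B   ≡⟨ sym (ℚ.*-distribˡ-+ δ A B) ⟩
      ε ℚ.* C⁻¹ ℚ.* C       ≡⟨ ℚ.*-assoc ε C⁻¹ C ⟩
      ε ℚ.* (C⁻¹ ℚ.* C)     ∎

infixl 6 _+ᵣ_
infixl 7 _*ᵣ_
infixr 8 _^ᵣ_

_+ᵣ_ _*ᵣ_ : ℝ → ℝ → ℝ
mkℝ u cu +ᵣ mkℝ v cv = mkℝ (λ n → u n ℚ.+ v n) (+-cauchy u v cu cv)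
mkℝ u cu *ᵣ mkℝ v cv = mkℝ (λ n → u n ℚ.* v n) (*-cauchy u v cu cv)

_^ᵣ_ : ℝ → ℕ → ℝ
x ^ᵣ zero  = 1ℝ
x ^ᵣ suc n = x *ᵣ x ^ᵣ n

infix 4 _⟶_

_⟶_ : (ℕ → ℝ) → ℝ → Set
u ⟶ y = ∀ ε → 0ℚ ℚ.< ε →
  ∃[ N ] (∀ n → N ℕ.≤ n → (u n ≤ᵣ y +ᵣ fromℚ ε) × (y ≤ᵣ u n +ᵣ fromℚ ε))

-- expPartialSum x n  is  Σ_{k < n} xᵏ / k!
expPartialSum : ℝ → ℕ → ℝ
expPartialSum x zero    = 0ℝ
expPartialSum x (suc n) =
  expPartialSum x n +ᵣ fromℚ ((+ 1 ℚ./ n !) {{n ℕ.!≢0}}) *ᵣ x ^ᵣ n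

infix 4 _IsSqrtOf_ _IsLogOf_

-- The square root and the natural logarithm (the inverse of
-- exp x = Σ_k xᵏ / k!) are given by their graphs; both determine the
-- value uniquely up to _≃_.
_IsSqrtOf_ _IsLogOf_ : Rel ℝ 0ℓ
s IsSqrtOf x = (0ℝ ≤ᵣ s) × (s *ᵣ s ≃ x)
l IsLogOf  x = expPartialSum l ⟶ x

------------------------------------------------------------------------
-- Standard Borel spaces

-- The σ-algebra generated by 𝓖.  Subsets are predicates, considered up to
-- extensional equality _≐_.
data σ⟨_⟩ {ℓ} {X : Set} (𝓖 : Pred (Pred X 0ℓ) ℓ) : Pred (Pred X 0ℓ) (lsuc 0ℓ ⊔ ℓ) where
  generator  : ∀ {A} → A ∈ 𝓖 → A ∈ σ⟨ 𝓖 ⟩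
  empty      : ∅ ∈ σ⟨ 𝓖 ⟩
  complement : ∀ {A} → A ∈ σ⟨ 𝓖 ⟩ → ∁ A ∈ σ⟨ 𝓖 ⟩
  union      : ∀ (A : ℕ → Pred X 0ℓ) → (∀ n → A n ∈ σ⟨ 𝓖 ⟩) → ⋃ ℕ A ∈ σ⟨ 𝓖 ⟩
  respects   : ∀ {A B} → A ≐ B → A ∈ σ⟨ 𝓖 ⟩ → B ∈ σ⟨ 𝓖 ⟩

record PolishMetric (X : Set) : Set where
  field
    d        : X → X → ℝ
    d-nonneg : ∀ x y → 0ℝ ≤ᵣ d x y
    d-zero   : ∀ x y → d x y ≃ 0ℝ ⇔ x ≡ y
    d-sym    : ∀ x y → d x y ≃ d y x
    triangle : ∀ x y z → d x z ≤ᵣ d x y +ᵣ d y z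
    complete : ∀ (u : ℕ → X) →
      (∀ ε → 0ℚ ℚ.< ε → ∃[ N ] (∀ m n → N ℕ.≤ m → N ℕ.≤ n → d (u m) (u n) ≤ᵣ fromℚ ε)) →
      ∃[ x ] (∀ ε → 0ℚ ℚ.< ε → ∃[ N ] (∀ n → N ℕ.≤ n → d (u n) x ≤ᵣ fromℚ ε))
    -- Maybe, so that the empty space is allowed.
    dense     : ℕ → Maybe X
    separable : ∀ x ε → 0ℚ ℚ.< ε → ∃[ n ] ∃[ y ] (dense n ≡ just y × d x y ≤ᵣ fromℚ ε)

  IsOpen : Pred (Pred X 0ℓ) 0ℓ
  IsOpen U = ∀ x → x ∈ U → ∃[ ε ] (0ℚ ℚ.< ε) × (∀ y → d x y ≤ᵣ fromℚ ε → y ∈ U)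

-- The Polish topology is only required to exist; the structure that matters
-- is the σ-algebra.
record StandardBorelSpace : Set (lsuc (lsuc 0ℓ)) where
  field
    Carrier  : Set
    IsBorel  : Pred (Pred Carrier 0ℓ) (lsuc 0ℓ)
    standard : Σ[ ρ ∈ PolishMetric Carrier ]
                 (∀ A → A ∈ IsBorel ⇔ A ∈ σ⟨ PolishMetric.IsOpen ρ ⟩)

  Rectangle : Pred (Pred (Carrier × Carrier) 0ℓ) (lsuc 0ℓ)
  Rectangle R = ∃[ A ] ∃[ B ] (A ∈ IsBorel) × (B ∈ IsBorel) × (R ≐ (A ⟨×⟩ B))

  IsBorel² : Pred (Pred (Carrier × Carrier) 0ℓ) (lsuc 0ℓ)
  IsBorel² = σ⟨ Rectangle ⟩

------------------------------------------------------------------------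
-- Graphs

record Graph (V : Set) : Set₁ where
  field
    Adj        : Rel V 0ℓ
    adj-sym    : Symmetric Adj
    adj-irrefl : Irreflexive _≡_ Adj

module _ {V : Set} (G : Graph V) where
  open Graph G

  data Walk : V → V → ℕ → Set where
    []  : ∀ {x} → Walk x x 0
    _∷_ : ∀ {x y z n} → Adj x y → Walk y z n → Walk x z (suc n)

  vertices : ∀ {x y n} → Walk x y n → List V
  vertices {x} []      = x ∷ []
  vertices {x} (_ ∷ w) = x ∷ vertices w

  -- Paths with n edges.
  Path : V → V → ℕ → Set
  Path x y n = Σ[ w ∈ Walk x y n ] Unique (vertices w)

  ComponentFinite : Set
  ComponentFinite =
    ∀ x → ∃[ ys ] (∀ y → (∃[ n ] Path x y n) → y ∈ˡ ys)

  HasDegree : V → ℕ → Set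
  HasDegree x n =
    ∃[ ys ] Unique ys × (∀ y → y ∈ˡ ys ⇔ Adj x y) × length ys ≡ n

  HasMaximumDegree : ℕ → Set
  HasMaximumDegree Δ =
    (∀ x → ∃[ n ] HasDegree x n × n ℕ.≤ Δ) × (∃[ x ] HasDegree x Δ)

-- The proof of membership in U is irrelevant, so that equality of vertices
-- of G[U] is equality of vertices of G.
induced : ∀ {V} → Graph V → (U : Pred V 0ℓ) → Graph [ x ∈ V ∣ U x ]
induced G U = record
  { Adj        = λ x y → Adj (value x) (value y)
  ; adj-sym    = adj-sym
  ; adj-irrefl = λ { refl → adj-irrefl refl }
  } where open Graph G

private
  module Reversal {V : Set} (G : Graph V) where
    open Graph G

    snoc : ∀ {x y z n} → Walk G x y n → Adj y z → Walk G x z (suc n)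
    snoc []      e = e ∷ []
    snoc (f ∷ w) e = f ∷ snoc w e

    rev : ∀ {x y n} → Walk G x y n → Walk G y x n
    rev []      = []
    rev (e ∷ w) = snoc (rev w) (adj-sym e)

    vertices-snoc : ∀ {x y z n} (w : Walk G x y n) (e : Adj y z) →
                    vertices G (snoc w e) ≡ vertices G w ∷ʳ z
    vertices-snoc []      e = refl
    vertices-snoc (f ∷ w) e = cong (_ ∷_) (vertices-snoc w e)

    vertices-rev : ∀ {x y n} (w : Walk G x y n) → vertices G w ↭ vertices G (rev w)
    vertices-rev []          = ↭-refl
    vertices-rev {x} (e ∷ w) = ↭-trans (prep x (vertices-rev w))
      (↭-trans (∷↭∷ʳ x (vertices G (rev w)))
        (↭-reflexive (sym (vertices-snoc (rev w) (adj-sym e)))))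

    reversePath : ∀ {x y n} → Path G x y n → Path G y x n
    reversePath (w , u) = rev w , Unique-resp-↭ (setoid V) (↭⇒↭ₛ (vertices-rev w)) u

infixl 8 _^ᴳ_

_^ᴳ_ : ∀ {V} → Graph V → ℕ → Graph V
G ^ᴳ R = record
  { Adj        = λ x y → x ≢ y × ∃[ n ] n ℕ.≤ R × Path G x y n
  ; adj-sym    = λ (x≢y , n , n≤R , p) →
                   (λ y≡x → x≢y (sym y≡x)) , n , n≤R , Reversal.reversePath G p
  ; adj-irrefl = λ x≡y (x≢y , _) → x≢y x≡y
  }

record BorelGraph (V : StandardBorelSpace) : Set₁ where
  open StandardBorelSpace V
  field
    graph     : Graph Carrier
    adj-borel : (λ (x , y) → Graph.Adj graph x y) ∈ IsBorel²

------------------------------------------------------------------------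
-- Borel chromatic index and (asymptotic) separation index.  A parameter with
-- values in ℕ ∪ {∞} is the predicate of being its value in ℕ; no natural
-- number satisfies the predicate exactly when the parameter is ∞.

IsLeast : ∀ {ℓ} → Pred ℕ ℓ → Pred ℕ ℓ
IsLeast P n = P n × (∀ m → P m → n ℕ.≤ m)

module _ {V : StandardBorelSpace} where
  open StandardBorelSpace V

  -- A function on edges is a function of oriented edges invariant under
  -- reversal (hence also independent of the proof of adjacency).  A set of
  -- two-element subsets of V is Borel in [V]² iff the symmetric set of ordered
  -- pairs corresponding to it is Borel in V × V.
  record BorelEdgeColouring (G : Graph Carrier) (q : ℕ) : Set₁ where
    open Graph G
    field
      colour     : ∀ {x y} → Adj x y → Fin q
      colour-sym : ∀ {x y} (e : Adj x y) (e′ : Adj y x) → colour e ≡ colour e′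
      borel      : ∀ c → (λ (x , y) → Σ[ e ∈ Adj x y ] colour e ≡ c) ∈ IsBorel²
      proper     : ∀ {x y z} (e : Adj x y) (e′ : Adj x z) → y ≢ z →
                   colour e ≢ colour e′

  IsBorelChromaticIndex : BorelGraph V → Pred ℕ (lsuc 0ℓ)
  IsBorelChromaticIndex G = IsLeast (BorelEdgeColouring (BorelGraph.graph G))

  -- Defined for an arbitrary graph on V, since it is applied to the powers of
  -- a Borel graph.
  record BorelSeparation (G : Graph Carrier) (s : ℕ) : Set₁ where
    field
      U         : Fin (suc s) → Pred Carrier 0ℓ
      partition : ∀ x → ∃! _≡_ (λ i → x ∈ U i)
      borel     : ∀ i → U i ∈ IsBorel
      finite    : ∀ i → ComponentFinite (induced G (U i))

  IsSeparationIndex : Graph Carrier → Pred ℕ (lsuc 0ℓ)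
  IsSeparationIndex G = IsLeast (BorelSeparation G)

  IsAsymptoticSeparationIndex : BorelGraph V → Pred ℕ (lsuc 0ℓ)
  IsAsymptoticSeparationIndex G = IsLeast λ b →
    ∀ R → ∃[ s ] IsSeparationIndex (BorelGraph.graph G ^ᴳ R) s × s ℕ.≤ b

{-# OPTIONS --safe #-}

-- By Lusin–Novikov the neighbours of a vertex are listed by finitely many Borel
-- maps, and finite asymptotic separation index allows a local problem that is
-- solvable on finite components to be solved in a Borel way, one layer after
-- another.  A derandomised local lemma then yields a Borel bipartition of the
-- vertices in which every vertex has at most half of its neighbours, up to
-- O(√Δ log Δ), on either side.  It does not depend on the value of the
-- separation index: a first pass leaves a graph of linear growth, which splits
-- into only two layers.  The edges between the sides form a bipartite graph and
-- are coloured by Euler splitting: pairing the edges at every vertex decomposes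
-- the graph into lines, which are cut by removing edges of bounded degree and
-- then coloured alternately.  A bipartite graph of degree D thereby costs
-- D + O(√Δ log Δ) colours.  Recursing log Δ times on the edges inside the
-- sides gives Δ + O(√Δ log² Δ).
module Submission where

open import Defs
open import Data.Bool.Base using (Bool; true; false; if_then_else_; not; _∧_; _xor_)
open import Data.Empty using (⊥; ⊥-elim)
open import Data.Fin.Base using (Fin; zero; suc; toℕ; fromℕ<)
import Data.Fin.Properties as Finₚ
open import Data.List.Base using (List; []; _∷_; _++_; map; concatMap; length; tabulate; allFin; upTo;
  cartesianProductWith; filter)
import Data.List.Properties as Listₚ
open import Data.List.Membership.Propositional using (_∈_; _∉_; find; lose)
open import Data.List.Membership.Propositional.Properties using (∈-map⁺; ∈-map⁻; ∈-++⁺ˡ; ∈-++⁺ʳ; ∈-++⁻;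
  ∈-concat⁺′; ∈-concat⁻′; ∈-∃++; ∈-tabulate⁺; ∈-tabulate⁻; ∈-allFin; ∈-cartesianProductWith⁺;
  ∈-cartesianProductWith⁻; ∈-filter⁺; ∈-filter⁻; ∈-upTo⁺; ∈-upTo⁻)
open import Data.List.Relation.Unary.All using (All; []; _∷_) renaming (lookup to All-lookup;
  tabulate to All-tabulate; map to All-map)
import Data.List.Relation.Unary.All.Properties as Allₚ
open import Data.List.Relation.Unary.AllPairs using (AllPairs; []; _∷_)
open import Data.List.Relation.Unary.Any using (Any; here; there) renaming (map to Any-map)
import Data.List.Relation.Unary.Any.Properties as Anyₚ
open import Data.List.Relation.Unary.Unique.Propositional using (Unique)
open import Data.Maybe.Base using (Maybe; just; nothing)
open import Data.Nat.Base using (ℕ; zero; suc; _+_; _*_; _∸_; _^_; _≤_; _<_; z≤n; s≤s; pred; ⌊_/2⌋; NonZero;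
  >-nonZero; _!; _⊔_)
open import Data.Nat.Properties using (_!≢0; *-assoc; *-cancelʳ-≤; *-cancelˡ-<; *-cancelˡ-≤; *-comm;
  *-distribʳ-+; *-distribʳ-∸; *-distribˡ-+; *-identityʳ; *-identityˡ; *-mono-≤; *-monoʳ-≤; *-monoˡ-<;
  *-monoˡ-≤; *-suc; *-zeroʳ; +-assoc; +-cancelʳ-≤; +-cancelˡ-≡; +-cancelˡ-≤; +-comm; +-identityʳ; +-mono-<-≤;
  +-mono-≤; +-monoʳ-<; +-monoʳ-≤; +-monoˡ-≤; +-suc; 1+n≰n; <-asym; <-trans; <⇒≢; <⇒≤; <⇒≱; ^-*-assoc;
  ^-distribˡ-+-*; ^-monoʳ-<; ^-monoʳ-≤; ^-monoˡ-≤; m+[n∸m]≡n; m+n∸m≡n; m<m+n; m<n⇒0<n∸m; m^n>0; m^n≢0;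
  m∸n+n≡m; m∸n≤m; m≤m*n; m≤m+n; m≤m⊔n; m≤n+m; m≤n⇒m<n∨m≡n; m≤n⇒m≤1+n; m≤n⊔m; m⊔n≤o⇒m≤o; m⊔n≤o⇒n≤o; n<1+n;
  n≡⌊n+n/2⌋; n≤0⇒n≡0; n≤1+n; n≮0; suc-injective; suc-pred; ∸-monoʳ-≤; ∸-monoˡ-<; ≤-<-trans;
  module ≤-Reasoning; ≤-antisym; ≤-pred; ≤-refl; ≤-reflexive; ≤-total; ≤-trans; ≤ᵇ⇒≤; ≤∧≢⇒<; ≮⇒≥; ≰⇒>;
  ⌊n/2⌋+⌈n/2⌉≡n; ⌊n/2⌋-mono; ⌊n/2⌋≤n; ⌊n/2⌋≤⌈n/2⌉)
open import Data.Nat.ListAction using (sum; product)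
open import Data.Nat.Tactic.RingSolver using (solve-∀)
open import Data.Product using (Σ; Σ-syntax; ∃; ∃-syntax; _×_; _,_; proj₁; proj₂; map₂)
import Data.Rational.Base as ℚ
open import Data.Rational.Base using (ℚ; 0ℚ; 1ℚ; ½)
import Data.Rational.Properties as ℚ
import Data.Sum.Base as Sum
open import Data.Sum.Base using (_⊎_; inj₁; inj₂; [_,_]′)
open import Data.Unit.Base using (⊤; tt)
open import Data.Vec.Base using (Vec; []; _∷_; lookup) renaming (tabulate to tabulateⱽ)
import Data.Vec.Properties as Vecₚ
open import Function.Base using (_∘_; id)
open import Function.Bundles using (Equivalence)
open import Level using (0ℓ)
open import Relation.Binary.Construct.Closure.ReflexiveTransitive using (Star; _◅_; _◅◅_) renaming (ε to stop)
open import Relation.Binary.PropositionalEquality using (_≡_; _≢_; refl; sym; trans; cong; cong₂; subst;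
  subst₂; module ≡-Reasoning; _≗_)
open import Relation.Nullary using (¬_; Dec; yes; no; does)
open import Relation.Unary using (Pred)
import Data.Integer.Base as ℤ
import Data.Integer.Properties as ℤ
import Data.Rational.Unnormalised.Base as ℚᵘ
import Data.Rational.Unnormalised.Properties as ℚᵘ
open import Data.Nat.Coprimality using (1-coprimeTo)
open import Data.List.Relation.Unary.Unique.Propositional.Properties using () renaming (filter⁺ to Unique-filter; ++⁺ to Unique-++; allFin⁺ to Unique-allFin; upTo⁺ to Unique-upTo)
open import Relation.Nullary.Decidable using (toSum)
open import Data.Nat.DivMod using (_/_; _%_; m≡m%n+[m/n]*n; m%n<n; m/n*n≤m)
import Data.Rational.Solver
open import Data.Refinement.Base using (Refinement) renaming (_,_ to _⊩_)
open import Data.Irrelevant using ([_])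

module Classical (em : ∀ {ℓ} → ExcludedMiddle ℓ) where

 dec : ∀ {ℓ} (P : Set ℓ) → Dec P
 dec P = em

 by-contradiction : ∀ {ℓ} {P : Set ℓ} → ¬ ¬ P → P
 by-contradiction {P = P} ¬¬p with dec P
 ... | yes p = p
 ... | no ¬p = ⊥-elim (¬¬p ¬p)

 ¬∀⇒∃¬ : ∀ {a b} {A : Set a} {P : A → Set b} → ¬ (∀ x → P x) → ∃[ x ] ¬ P x
 ¬∀⇒∃¬ ¬∀ = by-contradiction λ ¬∃ → ¬∀ λ x → by-contradiction λ ¬p → ¬∃ (x , ¬p)

 ⟦_⟧ : ∀ {ℓ} → Set ℓ → Bool
 ⟦ P ⟧ = does (dec P)

 ⟦⟧⁺ : ∀ {ℓ} {P : Set ℓ} → P → ⟦ P ⟧ ≡ true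
 ⟦⟧⁺ {P = P} p with dec P
 ... | yes _ = refl
 ... | no ¬p = ⊥-elim (¬p p)

 ⟦⟧⁻ : ∀ {ℓ} {P : Set ℓ} → ⟦ P ⟧ ≡ true → P
 ⟦⟧⁻ {P = P} eq with dec P
 ... | yes p = p
 ⟦⟧⁻ () | no _

 ¬⟦⟧⁺ : ∀ {ℓ} {P : Set ℓ} → ¬ P → ⟦ P ⟧ ≡ false
 ¬⟦⟧⁺ {P = P} ¬p with dec P
 ... | yes p = ⊥-elim (¬p p)
 ... | no _ = refl

 ¬⟦⟧⁻ : ∀ {ℓ} {P : Set ℓ} → ⟦ P ⟧ ≡ false → ¬ P
 ¬⟦⟧⁻ {P = P} eq with dec P
 ... | no ¬p = ¬p
 ¬⟦⟧⁻ () | yes _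

 if-yes : ∀ {a ℓ} {A : Set a} {P : Set ℓ} {x y : A} → P → (if ⟦ P ⟧ then x else y) ≡ x
 if-yes {P = P} p with dec P
 ... | yes _ = refl
 ... | no ¬p = ⊥-elim (¬p p)

 if-no : ∀ {a ℓ} {A : Set a} {P : Set ℓ} {x y : A} → ¬ P → (if ⟦ P ⟧ then x else y) ≡ y
 if-no {P = P} ¬p with dec P
 ... | yes p = ⊥-elim (¬p p)
 ... | no _ = refl

 least : ∀ {ℓ} (P : ℕ → Set ℓ) → ∃ P → ∃[ n ] P n × (∀ m → P m → n ≤ m)
 least P (n , Pn) = [ id , (λ none → ⊥-elim (none n (n<1+n n) Pn)) ]′ (below (suc n))
  where
  below : ∀ n → (∃[ k ] P k × (∀ m → P m → k ≤ m)) ⊎ (∀ m → m < n → ¬ P m)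
  below zero = inj₂ λ _ ()
  below (suc n) with below n | dec (P n)
  ... | inj₁ found | _ = inj₁ found
  ... | inj₂ none | yes Pn = inj₁ (n , Pn , λ m Pm → ≮⇒≥ λ m<n → none m m<n Pm)
  ... | inj₂ none | no ¬Pn = inj₂ λ m m<1+n Pm →
   [ (λ m<n → none m m<n Pm) , (λ m≡n → ¬Pn (subst P m≡n Pm)) ]′ (m≤n⇒m<n∨m≡n (≤-pred m<1+n))

 -- Enumerations

 record Enumerable (A : Set) : Set where
  field
   enum : ℕ → A
   enum-surjective : ∀ a → ∃[ n ] enum n ≡ a
 open Enumerable

 unpair : ℕ → ℕ × ℕ
 unpair zero = 0 , 0
 unpair (suc n) with unpair n
 ... | zero , b = suc b , 0
 ... | suc a , b = a , suc b

 unpair-surjective : ∀ a b → ∃[ n ] unpair n ≡ (a , b)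
 unpair-surjective a b =
  let n , eq = column (a + b) in b + n , trans (slide b a 0 n (trans eq (cong (_, 0) (+-comm a b)))) (cong (a ,_) (+-identityʳ b))
  where
  slide : ∀ b a c n → unpair n ≡ (b + a , c) → unpair (b + n) ≡ (a , b + c)
  slide zero a c n eq = eq
  slide (suc b) a c n eq
   rewrite slide b (suc a) c n (trans eq (cong (_, c) (sym (+-suc b a)))) = refl

  column : ∀ s → ∃[ n ] unpair n ≡ (s , 0)
  column zero = 0 , refl
  column (suc s) = let n , eq = column s in suc (s + n) , next s n eq
   where
   next : ∀ s n → unpair n ≡ (s , 0) → unpair (suc (s + n)) ≡ (suc s , 0)
   next s n eq
    rewrite slide s 0 0 n (trans eq (cong (_, 0) (sym (+-identityʳ s)))) | +-identityʳ s = refl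

 ℕ-enumerable : Enumerable ℕ
 ℕ-enumerable = record { enum = id ; enum-surjective = λ n → n , refl }

 Bool-enumerable : Enumerable Bool
 Bool-enumerable = record { enum = λ { zero → false ; (suc _) → true } ; enum-surjective = λ { false → 0 , refl ; true → 1 , refl } }

 ×-enumerable : ∀ {A B} → Enumerable A → Enumerable B → Enumerable (A × B)
 ×-enumerable {A} {B} EA EB = record
  { enum = λ n → enum EA (proj₁ (unpair n)) , enum EB (proj₂ (unpair n))
  ; enum-surjective = onto }
  where
  onto : ∀ p → ∃[ n ] (enum EA (proj₁ (unpair n)) , enum EB (proj₂ (unpair n))) ≡ p
  onto (a , b) with enum-surjective EA a | enum-surjective EB b
  ... | i , refl | j , refl with unpair-surjective i j
  ... | n , eq = n , cong (λ q → enum EA (proj₁ q) , enum EB (proj₂ q)) eq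

 List-enumerable : ∀ {A} → Enumerable A → Enumerable (List A)
 List-enumerable {A} EA = record
  { enum = λ n → decode (proj₁ (unpair n)) (proj₂ (unpair n)) ; enum-surjective = onto }
  where
  decode : ℕ → ℕ → List A
  decode zero n = []
  decode (suc k) n = enum EA (proj₁ (unpair n)) ∷ decode k (proj₂ (unpair n))
  onto-decode : ∀ as → ∃[ n ] decode (length as) n ≡ as
  onto-decode [] = 0 , refl
  onto-decode (a ∷ as) with enum-surjective EA a | onto-decode as
  ... | i , eqᵢ | j , eqⱼ with unpair-surjective i j
  ... | n , eq = n , cong₂ _∷_ (trans (cong (enum EA ∘ proj₁) eq) eqᵢ) (trans (cong (decode (length as) ∘ proj₂) eq) eqⱼ)
  onto : ∀ as → ∃[ n ] decode (proj₁ (unpair n)) (proj₂ (unpair n)) ≡ as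
  onto as with onto-decode as
  ... | j , eqⱼ with unpair-surjective (length as) j
  ... | n , eq = n , trans (cong (λ q → decode (proj₁ q) (proj₂ q)) eq) eqⱼ

 record BorelSpace : Set₂ where
  field
   Point : Set
   Bor : Pred Point 0ℓ → Set₁
   bor-∅ : Bor (λ _ → ⊥)
   bor-∁ : ∀ {A} → Bor A → Bor (λ x → ¬ A x)
   bor-∃ℕ : (A : ℕ → Pred Point 0ℓ) → (∀ n → Bor (A n)) → Bor (λ x → ∃[ n ] A n x)
   bor-⇔ : ∀ {A B} → (∀ x → A x → B x) → (∀ x → B x → A x) → Bor A → Bor B
   sep : ℕ → Pred Point 0ℓ
   sep-bor : ∀ n → Bor (sep n)
   sep-separates : ∀ {x y} → x ≢ y → ∃[ n ] sep n x × ¬ sep n y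

  bor-const : ∀ (P : Set) → Bor (λ _ → P)
  bor-const P with dec P
  ... | yes p = bor-⇔ (λ _ _ → p) (λ _ _ ()) (bor-∁ bor-∅)
  ... | no ¬p = bor-⇔ (λ _ ()) (λ _ p → ¬p p) bor-∅

  bor-∪ : ∀ {A B} → Bor A → Bor B → Bor (λ x → A x ⊎ B x)
  bor-∪ {A} {B} a b = bor-⇔
   (λ { x (zero , p) → inj₁ p ; x (suc _ , p) → inj₂ p })
   (λ { x (inj₁ p) → 0 , p ; x (inj₂ p) → 1 , p })
   (bor-∃ℕ (λ { zero → A ; (suc _) → B }) (λ { zero → a ; (suc _) → b }))

  bor-∩ : ∀ {A B} → Bor A → Bor B → Bor (λ x → A x × B x)
  bor-∩ a b = bor-⇔
   (λ x ¬∪ → by-contradiction (¬∪ ∘ inj₁) , by-contradiction (¬∪ ∘ inj₂))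
   (λ { x (p , q) (inj₁ ¬p) → ¬p p ; x (p , q) (inj₂ ¬q) → ¬q q })
   (bor-∁ (bor-∪ (bor-∁ a) (bor-∁ b)))

  bor-→ : ∀ {A B} → Bor A → Bor B → Bor (λ x → A x → B x)
  bor-→ {A} {B} a b = bor-⇔
   (λ { x (inj₁ ¬p) p → ⊥-elim (¬p p) ; x (inj₂ q) _ → q })
   (λ x f → to x f (dec (A x)))
   (bor-∪ (bor-∁ a) b)
   where
   to : ∀ x → (A x → B x) → Dec (A x) → ¬ A x ⊎ B x
   to x f (yes p) = inj₂ (f p)
   to x f (no ¬p) = inj₁ ¬p

  bor-∀ℕ : (A : ℕ → Pred Point 0ℓ) → (∀ n → Bor (A n)) → Bor (λ x → ∀ n → A n x)
  bor-∀ℕ A a = bor-⇔ (λ x ¬∃ n → by-contradiction λ ¬p → ¬∃ (n , ¬p)) (λ { x ∀p (n , ¬p) → ¬p (∀p n) })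
   (bor-∁ (bor-∃ℕ (λ n x → ¬ A n x) (λ n → bor-∁ (a n))))

  bor-All : ∀ {I : Set} {A : I → Pred Point 0ℓ} (is : List I) → All (λ i → Bor (A i)) is → Bor (λ x → All (λ i → A i x) is)
  bor-All [] [] = bor-⇔ (λ _ _ → []) (λ _ _ → tt) (bor-const ⊤)
  bor-All (i ∷ is) (a ∷ as) = bor-⇔ (λ { x (p , q) → p ∷ q }) (λ { x (p ∷ q) → p , q }) (bor-∩ a (bor-All is as))

  bor-Any : ∀ {I : Set} {A : I → Pred Point 0ℓ} (is : List I) → All (λ i → Bor (A i)) is → Bor (λ x → Any (λ i → A i x) is)
  bor-Any [] [] = bor-⇔ (λ _ ()) (λ _ ()) bor-∅
  bor-Any (i ∷ is) (a ∷ as) = bor-⇔ (λ { x (inj₁ p) → here p ; x (inj₂ p) → there p })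
   (λ { x (here p) → inj₁ p ; x (there p) → inj₂ p }) (bor-∪ a (bor-Any is as))

 open BorelSpace

 BorelMap : (𝒳 𝒴 : BorelSpace) → (Point 𝒳 → Point 𝒴) → Set₁
 BorelMap 𝒳 𝒴 f = ∀ A → Bor 𝒴 A → Bor 𝒳 (A ∘ f)

 bor-id : ∀ {𝒳} → BorelMap 𝒳 𝒳 id
 bor-id _ a = a

 record Countable (L : Set) : Set₂ where
  field
   bor-∃ : ∀ 𝒳 (B : L → Pred (Point 𝒳) 0ℓ) → (∀ l → Bor 𝒳 (B l)) → Bor 𝒳 (λ x → ∃[ l ] B l x)
 open Countable {{...}}

 instance
  ℕ-countable : Countable ℕ
  ℕ-countable = record { bor-∃ = bor-∃ℕ }

  Bool-countable : Countable Bool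
  Bool-countable = record { bor-∃ = λ 𝒳 B b → bor-⇔ 𝒳
   (λ { x (inj₁ p) → true , p ; x (inj₂ p) → false , p })
   (λ { x (true , p) → inj₁ p ; x (false , p) → inj₂ p })
   (bor-∪ 𝒳 (b true) (b false)) }

  Fin-countable : ∀ {n} → Countable (Fin n)
  Fin-countable {zero} = record { bor-∃ = λ 𝒳 B b → bor-⇔ 𝒳 (λ _ ()) (λ { x (() , _) }) (bor-∅ 𝒳) }
  Fin-countable {suc n} = record { bor-∃ = λ 𝒳 B b → bor-⇔ 𝒳
   (λ { x (inj₁ p) → zero , p ; x (inj₂ (i , p)) → suc i , p })
   (λ { x (zero , p) → inj₁ p ; x (suc i , p) → inj₂ (i , p) })
   (bor-∪ 𝒳 (b zero) (Countable.bor-∃ Fin-countable 𝒳 (B ∘ suc) (b ∘ suc))) }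

  ×-countable : ∀ {L M} → {{Countable L}} → {{Countable M}} → Countable (L × M)
  ×-countable = record { bor-∃ = λ 𝒳 B b → bor-⇔ 𝒳
   (λ { x (l , m , p) → (l , m) , p }) (λ { x ((l , m) , p) → l , m , p })
   (bor-∃ 𝒳 _ λ l → bor-∃ 𝒳 _ λ m → b (l , m)) }

  List-countable : ∀ {L} → {{Countable L}} → Countable (List L)
  List-countable {L} = record { bor-∃ = λ 𝒳 B b → bor-⇔ 𝒳
   (λ { x (n , as , _ , p) → as , p }) (λ { x (as , p) → length as , as , refl , p })
   (bor-∃ 𝒳 _ λ n → ofLength 𝒳 n B b) }
   where
   ofLength : ∀ 𝒳 n (B : List L → Pred (Point 𝒳) 0ℓ) → (∀ as → Bor 𝒳 (B as)) → Bor 𝒳 (λ x → ∃[ as ] length as ≡ n × B as x)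
   ofLength 𝒳 zero B b = bor-⇔ 𝒳 (λ x p → [] , refl , p) (λ { x ([] , _ , p) → p }) (b [])
   ofLength 𝒳 (suc n) B b = bor-⇔ 𝒳
    (λ { x (a , as , refl , p) → a ∷ as , refl , p })
    (λ { x (a ∷ as , refl , p) → a , as , refl , p })
    (bor-∃ 𝒳 _ λ a → ofLength 𝒳 n (B ∘ (a ∷_)) (b ∘ (a ∷_)))

  Vec-countable : ∀ {L n} → {{Countable L}} → Countable (Vec L n)
  Vec-countable {n = zero} = record { bor-∃ = λ 𝒳 B b → bor-⇔ 𝒳 (λ x p → [] , p) (λ { x ([] , p) → p }) (b []) }
  Vec-countable {n = suc n} = record { bor-∃ = λ 𝒳 B b → bor-⇔ 𝒳
   (λ { x (a , as , p) → a ∷ as , p }) (λ { x (a ∷ as , p) → a , as , p })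
   (bor-∃ 𝒳 _ λ a → Countable.bor-∃ Vec-countable 𝒳 (B ∘ (a ∷_)) (b ∘ (a ∷_))) }

 module Measurability (𝒳 : BorelSpace) where
  private X = Point 𝒳

  Meas : {L : Set} → (X → L) → Set₁
  Meas σ = ∀ (P : Pred _ 0ℓ) → Bor 𝒳 (P ∘ σ)

  meas-const : ∀ {L} (l : L) → Meas (λ _ → l)
  meas-const l P = bor-const 𝒳 (P l)

  meas-map : ∀ {L M σ} (f : L → M) → Meas σ → Meas (f ∘ σ)
  meas-map f m P = m (P ∘ f)

  meas-≗ : ∀ {L} {σ τ : X → L} → σ ≗ τ → Meas σ → Meas τ
  meas-≗ eq m P = bor-⇔ 𝒳 (λ x → subst P (eq x)) (λ x → subst P (sym (eq x))) (m P)

  meas-map₂ : ∀ {L M N} {{_ : Countable L}} {σ : X → L} {τ : X → M} (f : L → M → N) → Meas σ → Meas τ → Meas (λ x → f (σ x) (τ x))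
  meas-map₂ {σ = σ} {τ} f m n P = bor-⇔ 𝒳 (λ { x (l , refl , p) → p }) (λ x p → σ x , refl , p)
   (bor-∃ 𝒳 _ λ l → bor-∩ 𝒳 (m (_≡ l)) (n (λ t → P (f l t))))

  meas-⟦⟧ : ∀ {A} → Bor 𝒳 A → Meas (λ x → ⟦ A x ⟧)
  meas-⟦⟧ {A} a P = bor-⇔ 𝒳
   (λ { x (inj₁ (p , q)) → subst P (sym (⟦⟧⁺ p)) q ; x (inj₂ (p , q)) → subst P (sym (¬⟦⟧⁺ p)) q })
   (λ x → to x)
   (bor-∪ 𝒳 (bor-∩ 𝒳 a (bor-const 𝒳 (P true))) (bor-∩ 𝒳 (bor-∁ 𝒳 a) (bor-const 𝒳 (P false))))
   where
   to : ∀ x → P ⟦ A x ⟧ → A x × P true ⊎ ¬ A x × P false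
   to x p with dec (A x)
   ... | yes q = inj₁ (q , p)
   ... | no ¬q = inj₂ (¬q , p)

  meas-if : ∀ {L} {A : Pred X 0ℓ} {σ τ : X → L} → Bor 𝒳 A → Meas σ → Meas τ → Meas (λ x → if ⟦ A x ⟧ then σ x else τ x)
  meas-if {A = A} {σ} {τ} a m n P = bor-⇔ 𝒳
   (λ { x (inj₁ (p , q)) → subst (λ b → P (if b then _ else _)) (sym (⟦⟧⁺ p)) q
     ; x (inj₂ (p , q)) → subst (λ b → P (if b then _ else _)) (sym (¬⟦⟧⁺ p)) q })
   (λ x → to x)
   (bor-∪ 𝒳 (bor-∩ 𝒳 a (m P)) (bor-∩ 𝒳 (bor-∁ 𝒳 a) (n P)))
   where
   to : ∀ x → P (if ⟦ A x ⟧ then σ x else τ x) → A x × P (σ x) ⊎ ¬ A x × P (τ x)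
   to x p with dec (A x)
   ... | yes q = inj₁ (q , p)
   ... | no ¬q = inj₂ (¬q , p)

  meas-list : ∀ {L : Set} {{_ : Countable L}} {I : Set} {σ : I → X → L} (is : List I) → All (λ i → Meas (σ i)) is → Meas (λ x → map (λ i → σ i x) is)
  meas-list [] [] = meas-const []
  meas-list (i ∷ is) (m ∷ ms) = meas-map₂ _∷_ m (meas-list is ms)

  meas-vec : ∀ {L : Set} {{_ : Countable L}} {n} {σ : Fin n → X → L} → (∀ i → Meas (σ i)) → Meas (λ x → tabulateⱽ (λ i → σ i x))
  meas-vec {n = zero} m = meas-const []
  meas-vec {n = suc n} m = meas-map₂ _∷_ (m zero) (meas-vec (m ∘ suc))

  meas-∘ : ∀ {L} {σ : X → L} {f : X → X} → BorelMap 𝒳 𝒳 f → Meas σ → Meas (σ ∘ f)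
  meas-∘ bf m P = bf _ (m P)

  bor-select : ∀ {L : Set} {{_ : Countable L}} {𝒴} {σ : X → L} {f : L → X → Point 𝒴} →
   Meas σ → (∀ l → BorelMap 𝒳 𝒴 (f l)) → BorelMap 𝒳 𝒴 (λ x → f (σ x) x)
  bor-select {σ = σ} m bf A a = bor-⇔ 𝒳 (λ { x (l , refl , p) → p }) (λ x p → σ x , refl , p)
   (bor-∃ 𝒳 _ λ l → bor-∩ 𝒳 (m (_≡ l)) (bf l A a))

 bor-≡ : ∀ {𝒳 𝒴} {f g : Point 𝒳 → Point 𝒴} → BorelMap 𝒳 𝒴 f → BorelMap 𝒳 𝒴 g → Bor 𝒳 (λ x → f x ≡ g x)
 bor-≡ {𝒳} {𝒴} {f} {g} bf bg = bor-⇔ 𝒳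
  (λ x ∀n → by-contradiction λ f≢g → let n , p , ¬q = sep-separates 𝒴 f≢g in ¬q (∀n n p))
  (λ x eq n → subst (sep 𝒴 n) eq)
  (bor-∀ℕ 𝒳 _ λ n → bor-→ 𝒳 (bf _ (sep-bor 𝒴 n)) (bg _ (sep-bor 𝒴 n)))

 -- Finite families of self-maps, generating an equivalence relation

 module _ {X : Set} where

  nb : List (X → X) → X → List X
  nb ts x = map (λ t → t x) ts

  All-nb : ∀ {ℓ} (P : Pred X ℓ) ts {x y} → y ∈ nb ts x → All (λ t → P (t x)) ts → P y
  All-nb P (t ∷ ts) (here refl) (p ∷ _) = p
  All-nb P (t ∷ ts) (there i) (_ ∷ ps) = All-nb P ts i ps

  Symmetricᵐ : List (X → X) → Set
  Symmetricᵐ ts = ∀ {x y} → y ∈ nb ts x → x ∈ nb ts y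

  Orb : List (X → X) → X → X → Set
  Orb ts = Star (λ x y → y ∈ nb ts x)

  FiniteOrbits : List (X → X) → Set
  FiniteOrbits ts = ∀ x → ∃[ ys ] (∀ y → Orb ts x y → y ∈ ys)

  orb-sym : ∀ {ts} → Symmetricᵐ ts → ∀ {x y} → Orb ts x y → Orb ts y x
  orb-sym s stop = stop
  orb-sym s (p ◅ ps) = orb-sym s ps ◅◅ (s p ◅ stop)

 module _ (𝒳 : BorelSpace) where
  private X = Point 𝒳
  open Measurability 𝒳

  bor-Orb : ∀ {ts} → All (BorelMap 𝒳 𝒳) ts → ∀ {A} → Bor 𝒳 A → Bor 𝒳 (λ x → ∀ y → Orb ts x y → A y)
  bor-Orb {ts} bts {A} a = bor-⇔ 𝒳 (λ x p y o → along o p zero) (λ x p n → unroll n x p) (bor-∀ℕ 𝒳 Within within-bor)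
   where
   Within : ℕ → Pred X 0ℓ
   Within zero x = A x
   Within (suc n) x = All (λ t → Within n (t x)) ts
   within-bor : ∀ n → Bor 𝒳 (Within n)
   within-bor zero = a
   within-bor (suc n) = bor-All 𝒳 ts (All-map (λ bt → bt _ (within-bor n)) bts)
   along : ∀ {x y} → Orb ts x y → (∀ n → Within n x) → ∀ n → Within n y
   along stop p = p
   along (s ◅ o) p = along o λ n → All-nb (Within n) ts s (p (suc n))
   unroll : ∀ n x → (∀ y → Orb ts x y → A y) → Within n x
   unroll zero x p = p x stop
   unroll (suc n) x p = All-tabulate λ i → unroll n _ λ y o → p y (∈-map⁺ _ i ◅ o)

  Code : Set
  Code = List (List ℕ × ℕ)

  simple : Code → X → ℕ
  simple [] x = 0
  simple ((c , l) ∷ cs) x = if ⟦ All (λ n → sep 𝒳 n x) c ⟧ then l else simple cs x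

  simple-meas : ∀ c → Meas (simple c)
  simple-meas [] = meas-const 0
  simple-meas ((c , l) ∷ cs) = meas-if (bor-All 𝒳 c (All-tabulate λ {n} _ → sep-bor 𝒳 n)) (meas-const l) (simple-meas cs)

  isolating : ∀ y zs → ∃[ c ] All (λ n → sep 𝒳 n y) c × (∀ {z} → z ∈ zs → All (λ n → sep 𝒳 n z) c → y ≡ z)
  isolating y [] = [] , [] , λ ()
  isolating y (z ∷ zs) with dec (y ≡ z) | isolating y zs
  ... | yes y≡z | c , y∈ , only = c , y∈ , λ { (here refl) _ → y≡z ; (there i) → only i }
  ... | no y≢z | c , y∈ , only = let n , p , ¬q = sep-separates 𝒳 y≢z in
   n ∷ c , p ∷ y∈ , λ { (here refl) (q ∷ _) → ⊥-elim (¬q q) ; (there i) (_ ∷ qs) → only i qs }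

  simple-interpolates : ∀ (σ : X → ℕ) ys → ∃[ c ] (∀ {y} → y ∈ ys → simple c y ≡ σ y)
  simple-interpolates σ ys = map (λ y → proj₁ (isolating y ys) , σ y) ys , λ i → correct ys i i
   where
   correct : ∀ zs {y} → y ∈ zs → y ∈ ys → simple (map (λ y → proj₁ (isolating y ys) , σ y) zs) y ≡ σ y
   correct (z ∷ zs) {y} i j with dec (All (λ n → sep 𝒳 n y) (proj₁ (isolating z ys)))
   ... | yes p = cong σ (proj₂ (proj₂ (isolating z ys)) j p)
   correct (z ∷ zs) {y} (here refl) j | no ¬p = ⊥-elim (¬p (proj₁ (proj₂ (isolating y ys))))
   correct (z ∷ zs) {y} (there i) j | no ¬p = correct zs i j

  -- Local problems with finite components have Borel solutions.
  select : ∀ {L} → Enumerable L → ∀ {ts} → All (BorelMap 𝒳 𝒳) ts → Symmetricᵐ ts → FiniteOrbits ts →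
   (Good : (X → L) → X → Set) →
   (∀ σ → Meas σ → Bor 𝒳 (Good σ)) →
   (∀ σ τ x → (∀ y → Orb ts x y → σ y ≡ τ y) → Good σ x → Good τ x) →
   (∀ x → ∃[ σ ] (∀ y → Orb ts x y → Good σ y)) →
   ∃[ σ ] Meas σ × (∀ x → Good σ x)
  select {L} EL {ts} bts ts-sym fin Good good-bor good-local exist = σ , σ-meas , good
   where
   open Enumerable
   EC = List-enumerable (×-enumerable (List-enumerable ℕ-enumerable) ℕ-enumerable)
   candidate : ℕ → X → L
   candidate m x = enum EL (simple (enum EC m) x)
   candidate-meas : ∀ m → Meas (candidate m)
   candidate-meas m = meas-map (enum EL) (simple-meas (enum EC m))
   Solves : X → ℕ → Set
   Solves x m = ∀ y → Orb ts x y → Good (candidate m) y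
   solution : ∀ x → ∃ (Solves x)
   solution x =
    let τ , τ-good = exist x
        ys , orb⊆ys = fin x
        c , agree = simple-interpolates (λ y → proj₁ (enum-surjective EL (τ y))) ys
        m , eqₘ = enum-surjective EC c
    in m , λ y o → good-local τ (candidate m) y
     (λ z o' → sym (trans (cong (λ c → enum EL (simple c z)) eqₘ)
      (trans (cong (enum EL) (agree (orb⊆ys z (o ◅◅ o')))) (proj₂ (enum-surjective EL (τ z))))))
     (τ-good y o)
   index : X → ℕ
   index x = proj₁ (least (Solves x) (solution x))
   index-solves : ∀ x → Solves x (index x)
   index-solves x = proj₁ (proj₂ (least (Solves x) (solution x)))
   index-least : ∀ x m → Solves x m → index x ≤ m
   index-least x = proj₂ (proj₂ (least (Solves x) (solution x)))
   index-≤ : ∀ {x y} → Orb ts x y → index x ≤ index y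
   index-≤ {x} {y} o = index-least x (index y) λ z o' → index-solves y z (orb-sym ts-sym o ◅◅ o')
   index-orb : ∀ {x y} → Orb ts x y → index x ≡ index y
   index-orb o = ≤-antisym (index-≤ o) (index-≤ (orb-sym ts-sym o))
   solves-bor : ∀ m → Bor 𝒳 (λ x → Solves x m)
   solves-bor m = bor-Orb bts (good-bor _ (candidate-meas m))
   index≡-bor : ∀ m → Bor 𝒳 (λ x → index x ≡ m)
   index≡-bor m = bor-⇔ 𝒳
    (λ x (s , ¬earlier) → ≤-antisym (index-least x m s) (≮⇒≥ λ i<m → ¬earlier (index x , i<m , index-solves x)))
    (λ { x refl → index-solves x , λ (k , k<i , s) → <⇒≱ k<i (index-least x k s) })
    (bor-∩ 𝒳 (solves-bor m) (bor-∁ 𝒳 (bor-∃ℕ 𝒳 _ λ k → bor-∩ 𝒳 (bor-const 𝒳 (k < m)) (solves-bor k))))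
   index-meas : Meas index
   index-meas P = bor-⇔ 𝒳 (λ { x (m , refl , p) → p }) (λ x p → index x , refl , p)
    (bor-∃ℕ 𝒳 _ λ m → bor-∩ 𝒳 (index≡-bor m) (bor-const 𝒳 (P m)))
   σ : X → L
   σ x = candidate (index x) x
   σ-meas : Meas σ
   σ-meas P = bor-⇔ 𝒳 (λ { x (m , refl , p) → p }) (λ x p → index x , refl , p)
    (bor-∃ℕ 𝒳 _ λ m → bor-∩ 𝒳 (index≡-bor m) (candidate-meas m P))
   good : ∀ x → Good σ x
   good x = good-local (candidate (index x)) σ x
    (λ y o → cong (λ m → candidate m y) (index-orb o)) (index-solves x x stop)

 module _ where
  open ℝ

  recip : ℕ → ℚ
  recip n = ℚ.mkℚ (ℤ.+ 1) n (1-coprimeTo (suc n))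

  0<recip : ∀ n → 0ℚ ℚ.< recip n
  0<recip n = ℚ.positive⁻¹ (recip n)

  archimedean : ∀ p → 0ℚ ℚ.< p → ∃[ n ] recip n ℚ.≤ p
  archimedean (ℚ.mkℚ (ℤ.+ zero) q c) (ℚ.*<* (ℤ.+<+ ()))
  archimedean (ℚ.mkℚ (ℤ.+ suc p) q c) 0<p = q , ℚ.*≤* (ℤ.*-monoʳ-≤-nonNeg (ℤ.+ suc q) {ℤ.+ 1} {ℤ.+ suc p} (ℤ.+≤+ (s≤s z≤n)))
  archimedean (ℚ.mkℚ ℤ.-[1+ p ] q c) (ℚ.*<* ())

  recip-halves : ∀ n → recip (suc (n + n)) ℚ.+ recip (suc (n + n)) ℚ.≤ recip n
  recip-halves n = ℚ.toℚᵘ-cancel-≤ (ℚᵘ.≤-respˡ-≃ (ℚᵘ.≃-sym (ℚ.toℚᵘ-homo-+ r r)) (ℚᵘ.*≤* (ℤ.+≤+ (≤-reflexive (eq n)))))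
   where
   r = recip (suc (n + n))
   eq : ∀ n → ((1 * suc (suc (n + n)) + 1 * suc (suc (n + n))) * suc n) ≡ 1 * (suc (suc (n + n)) * suc (suc (n + n)))
   eq = solve-∀

  recip-antitone : ∀ {m n} → m ≤ n → recip n ℚ.≤ recip m
  recip-antitone m≤n = ℚ.*≤* (ℤ.*-monoˡ-≤-nonNeg (ℤ.+ 1) (ℤ.+≤+ (s≤s m≤n)))

  0<half : ∀ {p} → 0ℚ ℚ.< p → 0ℚ ℚ.< p ℚ.* ½
  0<half {p} 0<p = subst (ℚ._< p ℚ.* ½) (ℚ.*-zeroˡ ½) (ℚ.*-monoˡ-<-pos ½ 0<p)

  halves : ∀ p → p ℚ.* ½ ℚ.+ p ℚ.* ½ ≡ p
  halves p = trans (sym (ℚ.*-distribˡ-+ p ½ ½)) (ℚ.*-identityʳ p)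

  ≤ᵣ-weaken : ∀ x p q → p ℚ.≤ q → x ≤ᵣ fromℚ p → x ≤ᵣ fromℚ q
  ≤ᵣ-weaken x p q p≤q x≤p ε 0<ε =
   let N , bound = x≤p ε 0<ε in N , λ n N≤n → ℚ.≤-trans (bound n N≤n) (ℚ.+-monoˡ-≤ ε p≤q)

  ≤ᵣ-trans : ∀ {x y z} → x ≤ᵣ y → y ≤ᵣ z → x ≤ᵣ z
  ≤ᵣ-trans {x} {y} {z} x≤y y≤z ε 0<ε =
   let δ = ε ℚ.* ½
       M , x≤ = x≤y δ (0<half 0<ε)
       N , y≤ = y≤z δ (0<half 0<ε)
   in M ⊔ N , λ n ≤n → ℚ.≤-trans (x≤ n (m⊔n≤o⇒m≤o M N ≤n))
    (subst (approx y n ℚ.+ δ ℚ.≤_) (trans (ℚ.+-assoc (approx z n) δ δ) (cong (approx z n ℚ.+_) (halves ε)))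
     (ℚ.+-monoˡ-≤ δ (y≤ n (m⊔n≤o⇒n≤o M N ≤n))))

  +-≤ᵣ : ∀ x y p q → x ≤ᵣ fromℚ p → y ≤ᵣ fromℚ q → (x +ᵣ y) ≤ᵣ fromℚ (p ℚ.+ q)
  +-≤ᵣ x y p q x≤p y≤q ε 0<ε =
   let δ = ε ℚ.* ½
       M , x≤ = x≤p δ (0<half 0<ε)
       N , y≤ = y≤q δ (0<half 0<ε)
   in M ⊔ N , λ n ≤n → subst (approx (x +ᵣ y) n ℚ.≤_)
    (trans (interchange p δ q δ) (cong ((p ℚ.+ q) ℚ.+_) (halves ε)))
    (ℚ.+-mono-≤ (x≤ n (m⊔n≤o⇒m≤o M N ≤n)) (y≤ n (m⊔n≤o⇒n≤o M N ≤n)))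
   where
   open import Algebra.Bundles using (CommutativeMonoid)
   open import Algebra.Properties.CommutativeSemigroup
    (CommutativeMonoid.commutativeSemigroup ℚ.+-0-commutativeMonoid) using (interchange)

  ≤ᵣ-limit : ∀ x p → (∀ n → x ≤ᵣ fromℚ (p ℚ.+ recip n)) → x ≤ᵣ fromℚ p
  ≤ᵣ-limit x p x≤ ε 0<ε =
   let δ = ε ℚ.* ½
       m , rm≤δ = archimedean δ (0<half 0<ε)
       N , bound = x≤ m δ (0<half 0<ε)
   in N , λ n N≤n → ℚ.≤-trans (bound n N≤n) (subst ((p ℚ.+ recip m) ℚ.+ δ ℚ.≤_)
    (trans (ℚ.+-assoc p δ δ) (cong (p ℚ.+_) (halves ε)))
    (ℚ.+-monoˡ-≤ δ (ℚ.+-monoʳ-≤ p rm≤δ)))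

 module Metric {X : Set} (ρ : PolishMetric X) where
  open PolishMetric ρ

  double : ℕ → ℕ
  double n = suc (n + n)

  -- Near n x y : the distance is at most 1/(n+1).
  Near : ℕ → X → X → Set
  Near n x y = d x y ≤ᵣ fromℚ (recip n)

  near-refl : ∀ n x → Near n x x
  near-refl n x = ≤ᵣ-trans {d x x} {0ℝ} {fromℚ (recip n)} (proj₁ (Equivalence.from (d-zero x x) refl))
   λ ε 0<ε → 0 , λ _ _ → ℚ.≤-trans (ℚ.<⇒≤ (0<recip n)) (subst (ℚ._≤ recip n ℚ.+ ε) (ℚ.+-identityʳ (recip n)) (ℚ.+-monoʳ-≤ (recip n) (ℚ.<⇒≤ 0<ε)))

  near-sym : ∀ {n x y} → Near n x y → Near n y x
  near-sym {n} {x} {y} near = ≤ᵣ-trans {d y x} {d x y} {fromℚ (recip n)} (proj₂ (d-sym x y)) near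

  near-trans : ∀ {n x y z} → Near (double n) x y → Near (double n) y z → Near n x z
  near-trans {n} {x} {y} {z} p q = ≤ᵣ-weaken (d x z) (recip (double n) ℚ.+ recip (double n)) (recip n) (recip-halves n)
   (≤ᵣ-trans {d x z} {d x y +ᵣ d y z} {fromℚ (recip (double n) ℚ.+ recip (double n))} (triangle x y z) (+-≤ᵣ (d x y) (d y z) (recip (double n)) (recip (double n)) p q))

  near-antitone : ∀ {m n x y} → m ≤ n → Near n x y → Near m x y
  near-antitone {m} {n} {x} {y} m≤n = ≤ᵣ-weaken (d x y) (recip n) (recip m) (recip-antitone m≤n)

  near-≡ : ∀ {x y} → (∀ n → Near n x y) → x ≡ y
  near-≡ {x} {y} near = Equivalence.to (d-zero x y)
   ( ≤ᵣ-limit (d x y) 0ℚ (λ n → subst (λ p → d x y ≤ᵣ fromℚ p) (sym (ℚ.+-identityˡ (recip n))) (near n))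
   , d-nonneg x y)

  near-closed : ∀ {n x z} → (∀ m → ∃[ y ] Near m y x × Near n y z) → Near n x z
  near-closed {n} {x} {z} approximable = ≤ᵣ-limit (d x z) (recip n) λ m →
   let y , near-x , near-z = approximable m
   in subst (λ p → d x z ≤ᵣ fromℚ p) (ℚ.+-comm (recip m) (recip n))
      (≤ᵣ-trans {d x z} {d x y +ᵣ d y z} {fromℚ (recip m ℚ.+ recip n)} (triangle x y z) (+-≤ᵣ (d x y) (d y z) (recip m) (recip n) (near-sym {m} near-x) near-z))

  Converges : (ℕ → X) → X → Set
  Converges u x = ∀ k → ∃[ N ] (∀ n → N ≤ n → Near k (u n) x)

  near-complete : (u : ℕ → X) → (∀ k → ∃[ N ] (∀ m n → N ≤ m → N ≤ n → Near k (u m) (u n))) → ∃[ x ] Converges u x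
  near-complete u cauchy =
   let x , lim = complete u λ ε 0<ε →
        let k , rk≤ε = archimedean ε 0<ε
            N , close = cauchy k
        in N , λ m n N≤m N≤n → ≤ᵣ-weaken (d (u m) (u n)) (recip k) ε rk≤ε (close m n N≤m N≤n)
   in x , λ k → lim (recip k) (0<recip k)

  near-dense : ∀ x n → ∃[ i ] ∃[ y ] dense i ≡ just y × Near n x y
  near-dense x n = separable x (recip n) (0<recip n)

  near-open : ∀ {U} → IsOpen U → ∀ {x} → U x → ∃[ n ] (∀ y → Near n x y → U y)
  near-open open-U {x} Ux =
   let ε , 0<ε , ball = open-U x Ux
       n , rn≤ε = archimedean ε 0<ε
   in n , λ y near → ball y (≤ᵣ-weaken (d x y) (recip n) ε rn≤ε near)

  far-open : ∀ n z → IsOpen (λ y → ¬ Near n y z)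
  far-open n z y far = by-contradiction λ no-ball → far (near-closed λ m → by-contradiction λ none →
   no-ball (recip m , 0<recip m , λ y' near far' → none (y' , near-sym {m} near , far')))

 Baire : Set
 Baire = ℕ → ℕ

 _⇝_ : (ℕ → Baire) → Baire → Set
 αs ⇝ α = ∀ k → ∃[ N ] (∀ n → N ≤ n → αs n k ≡ α k)

 pair : ℕ → ℕ → ℕ
 pair i k = proj₁ (unpair-surjective i k)

 unpair-pair : ∀ i k → unpair (pair i k) ≡ (i , k)
 unpair-pair i k = proj₂ (unpair-surjective i k)

 record ConvergenceSpace : Set₁ where
  field
   Carrier : Set
   _↝_ : (ℕ → Carrier) → Carrier → Set
   ↝-const : ∀ x → (λ _ → x) ↝ x
   ↝-shift : ∀ {xs x} N → xs ↝ x → (λ n → xs (N + n)) ↝ x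

 ⇝-shift : ∀ {αs α} N → αs ⇝ α → (λ n → αs (N + n)) ⇝ α
 ⇝-shift N lim k = let M , eq = lim k in M , λ n M≤n → eq (N + n) (≤-trans M≤n (m≤n+m n N))

 module Analyticity (𝒞 : ConvergenceSpace) where
  open ConvergenceSpace 𝒞 renaming (Carrier to X)

  Closed : (X → Baire → Set) → Set
  Closed C = ∀ {xs x αs α} → xs ↝ x → αs ⇝ α → (∀ n → C (xs n) (αs n)) → C x α

  closed-tail : ∀ {C} → Closed C → ∀ {xs x αs α} N → xs ↝ x → αs ⇝ α → (∀ n → N ≤ n → C (xs n) (αs n)) → C x α
  closed-tail closed N x-lim α-lim c = closed (↝-shift N x-lim) (⇝-shift N α-lim) λ n → c (N + n) (m≤m+n N n)

  closed-≗ : ∀ {C} → Closed C → ∀ {x α β} → α ≗ β → C x α → C x β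
  closed-≗ closed {x} eq c = closed (↝-const x) (λ k → 0 , λ _ _ → eq k) λ _ → c

  record Analytic (A : Pred X 0ℓ) : Set₁ where
   field
    Witness : X → Baire → Set
    closed : Closed Witness
    witness : ∀ {x} → A x → ∃[ α ] Witness x α
    sound : ∀ {x α} → Witness x α → A x
  open Analytic public

  analytic-⇔ : ∀ {A B} → (∀ x → A x → B x) → (∀ x → B x → A x) → Analytic A → Analytic B
  analytic-⇔ to from a = record { Witness = Witness a ; closed = closed a ; witness = witness a ∘ from _ ; sound = to _ ∘ sound a }

  analytic-const : ∀ P → Analytic (λ _ → P)
  analytic-const P = record { Witness = λ _ _ → P ; closed = λ _ _ c → c 0 ; witness = λ p → id , p ; sound = id }

  analytic-∃ℕ : ∀ {A : ℕ → Pred X 0ℓ} → (∀ n → Analytic (A n)) → Analytic (λ x → ∃[ n ] A n x)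
  analytic-∃ℕ a = record
   { Witness = λ x α → Witness (a (α 0)) x (α ∘ suc)
   ; closed = λ {xs} {x} {αs} {α} x-lim α-lim c → let N , eq = α-lim 0 in
     closed-tail (closed (a (α 0))) N x-lim (λ k → α-lim (suc k))
      λ n N≤n → subst (λ i → Witness (a i) (xs n) (αs n ∘ suc)) (eq n N≤n) (c n)
   ; witness = λ (n , p) → let α , w = witness (a n) p in (λ { zero → n ; (suc k) → α k }) , w
   ; sound = λ {x} {α} w → α 0 , sound (a (α 0)) w }

  analytic-∀ℕ : ∀ {A : ℕ → Pred X 0ℓ} → (∀ n → Analytic (A n)) → Analytic (λ x → ∀ n → A n x)
  analytic-∀ℕ a = record
   { Witness = λ x α → ∀ i → Witness (a i) x (λ k → α (pair i k))
   ; closed = λ x-lim α-lim c i → closed (a i) x-lim (λ k → α-lim (pair i k)) λ n → c n i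
   ; witness = λ p → (λ m → proj₁ (witness (a (proj₁ (unpair m))) (p _)) (proj₂ (unpair m))) ,
     λ i → closed-≗ (closed (a i)) (λ k → sym (cong (λ (i , k) → proj₁ (witness (a i) (p i)) k) (unpair-pair i k))) (proj₂ (witness (a i) (p i)))
   ; sound = λ w n → sound (a n) (w n) }

  analytic-× : ∀ {A B} → Analytic A → Analytic B → Analytic (λ x → A x × B x)
  analytic-× {A} {B} a b = analytic-⇔ (λ x p → p 0 , p 1) (λ { x (p , q) zero → p ; x (p , q) (suc _) → q })
   (analytic-∀ℕ {λ { zero → A ; (suc _) → B }} λ { zero → a ; (suc _) → b })

  analytic-All : ∀ {I : Set} {A : I → Pred X 0ℓ} is → All (λ i → Analytic (A i)) is → Analytic (λ x → All (λ i → A i x) is)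
  analytic-All [] [] = analytic-⇔ (λ _ _ → []) (λ _ _ → tt) (analytic-const ⊤)
  analytic-All (i ∷ is) (a ∷ as) = analytic-⇔ (λ { _ (p , q) → p ∷ q }) (λ { _ (p ∷ q) → p , q }) (analytic-× a (analytic-All is as))

  record Bianalytic (A : Pred X 0ℓ) : Set₁ where
   field
    inside : Analytic A
    outside : Analytic (λ x → ¬ A x)
  open Bianalytic public

  σ-bianalytic : ∀ {ℓ} {𝓖 : Pred (Pred X 0ℓ) ℓ} → (∀ {A} → 𝓖 A → Bianalytic A) → ∀ {A} → σ⟨ 𝓖 ⟩ A → Bianalytic A
  σ-bianalytic gen (generator g) = gen g
  σ-bianalytic gen empty = record { inside = analytic-⇔ (λ _ p → p) (λ _ p → p) (analytic-const ⊥) ; outside = analytic-⇔ (λ _ p → p) (λ _ p → p) (analytic-const (¬ ⊥)) }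
  σ-bianalytic gen (complement s) = let b = σ-bianalytic gen s in
   record { inside = outside b ; outside = analytic-⇔ (λ _ p ¬p → ¬p p) (λ _ → by-contradiction) (inside b) }
  σ-bianalytic gen (union A s) = record
   { inside = analytic-∃ℕ λ n → inside (σ-bianalytic gen (s n))
   ; outside = analytic-⇔ (λ { x ¬p (n , p) → ¬p n p }) (λ x ¬∃ n p → ¬∃ (n , p)) (analytic-∀ℕ λ n → outside (σ-bianalytic gen (s n))) }
  σ-bianalytic gen (respects (A⊆B , B⊆A) s) = let b = σ-bianalytic gen s in
   record { inside = analytic-⇔ (λ _ → A⊆B) (λ _ → B⊆A) (inside b)
       ; outside = analytic-⇔ (λ _ ¬a b → ¬a (B⊆A b)) (λ _ ¬b a → ¬b (A⊆B a)) (outside b) }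

 module _ {𝒞 𝒟 : ConvergenceSpace} where
  open ConvergenceSpace
  open Analyticity

  analytic-pullback : (f : Carrier 𝒞 → Carrier 𝒟) → (∀ {xs x} → _↝_ 𝒞 xs x → _↝_ 𝒟 (f ∘ xs) (f x)) →
   ∀ {A} → Analytic 𝒟 A → Analytic 𝒞 (A ∘ f)
  analytic-pullback f cont a = record
   { Witness = λ x → Witness a (f x) ; closed = λ x-lim → closed a (cont x-lim)
   ; witness = witness a ; sound = sound a }

  bianalytic-pullback : (f : Carrier 𝒞 → Carrier 𝒟) → (∀ {xs x} → _↝_ 𝒞 xs x → _↝_ 𝒟 (f ∘ xs) (f x)) →
   ∀ {A} → Bianalytic 𝒟 A → Bianalytic 𝒞 (A ∘ f)
  bianalytic-pullback f cont b = record
   { inside = analytic-pullback f cont (inside b) ; outside = analytic-pullback f cont (outside b) }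

 module Polish {X : Set} (ρ : PolishMetric X) where
  open PolishMetric ρ using (dense; IsOpen)
  open Metric ρ

  space : ConvergenceSpace
  space = record
   { Carrier = X ; _↝_ = Converges ; ↝-const = λ x k → 0 , λ _ _ → near-refl k x
   ; ↝-shift = λ N lim k → let M , near = lim k in M , λ n M≤n → near (N + n) (≤-trans M≤n (m≤n+m n N)) }

  space² : ConvergenceSpace
  space² = record
   { Carrier = X × X ; _↝_ = λ ps p → Converges (proj₁ ∘ ps) (proj₁ p) × Converges (proj₂ ∘ ps) (proj₂ p)
   ; ↝-const = λ (x , y) → ConvergenceSpace.↝-const space x , ConvergenceSpace.↝-const space y
   ; ↝-shift = λ N (l , r) → ConvergenceSpace.↝-shift space N l , ConvergenceSpace.↝-shift space N r }

  open Analyticity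
  module 𝟏 = Analyticity space
  module 𝟐 = Analyticity space²

  Codes : Baire → X → Set
  Codes α x = ∀ k → ∃[ z ] dense (α k) ≡ just z × Near k x z

  code : ∀ x → ∃[ α ] Codes α x
  code x = (λ k → proj₁ (near-dense x k)) , λ k → let z , eq , near = proj₂ (near-dense x k) in z , eq , near

  just-injective : ∀ {a b : X} → just a ≡ just b → a ≡ b
  just-injective refl = refl

  codes-limit : ∀ {αs α xs} → αs ⇝ α → (∀ n → Codes (αs n) (xs n)) → ∃[ x ] Converges xs x × Codes α x
  codes-limit {αs} {α} {xs} lim codes = x , x-lim , x-coded
   where
   cauchy : ∀ k → ∃[ N ] (∀ m n → N ≤ m → N ≤ n → Near k (xs m) (xs n))
   cauchy k with lim (double k)
   ... | N , eq = N , close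
    where
    close : ∀ m n → N ≤ m → N ≤ n → Near k (xs m) (xs n)
    close m n N≤m N≤n with codes m (double k) | codes n (double k)
    ... | z , eqz , near | w , eqw , near'
     with just-injective (trans (sym eqz) (trans (cong dense (trans (eq m N≤m) (sym (eq n N≤n)))) eqw))
    ... | refl = near-trans near (near-sym {double k} near')
   x = proj₁ (near-complete xs cauchy)
   x-lim = proj₂ (near-complete xs cauchy)
   x-coded : Codes α x
   x-coded k with lim k
   ... | N , eq with codes N k
   ... | z , eqz , _ = z , trans (cong dense (sym (eq N ≤-refl))) eqz , near-closed λ m →
    let M , near = x-lim m
        w , eqw , near-w = codes (N ⊔ M) k
    in xs (N ⊔ M) , near (N ⊔ M) (m≤n⊔m N M) ,
      subst (Near k (xs (N ⊔ M))) (just-injective (trans (sym eqw) (trans (cong dense (trans (eq (N ⊔ M) (m≤m⊔n N M)) (sym (eq N ≤-refl)))) eqz))) near-w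

  open-bianalytic : ∀ {U} → IsOpen U → 𝟏.Bianalytic U
  open-bianalytic {U} open-U = record { inside = in-U ; outside = not-U }
   where
   InBall : X → Baire → Set
   InBall x α = ∃[ z ] dense (α 0) ≡ just z × Near (α 1) x z × (∀ y → Near (α 1) y z → U y)
   in-U : 𝟏.Analytic U
   in-U = record
    { Witness = InBall
    ; closed = ball-closed
    ; witness = λ {x} Ux →
      let n , ball = near-open open-U Ux
          i , z , eq , near = near-dense x (double n)
      in (λ { zero → i ; (suc _) → double n }) , z , eq , near , λ y near' → ball y (near-trans near (near-sym {double n} near'))
    ; sound = λ { {x} (z , _ , near , ball) → ball x near } }
    where
    ball-closed : 𝟏.Closed InBall
    ball-closed {xs} {x} {αs} {α} x-lim α-lim c with α-lim 0 | α-lim 1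
    ... | M , eq₀ | N , eq₁ with c (M ⊔ N)
    ... | z , eqz , _ , ball =
     z , eqz₀ , near-closed (λ m →
      let K , near = x-lim m
          P = (M ⊔ N) ⊔ K
          P≥ = m≤m⊔n (M ⊔ N) K
          w , eqw , near-w , _ = c P
      in xs P , near P (m≤n⊔m (M ⊔ N) K) ,
        subst₂ (λ k w → Near k (xs P) w) (eq₁ P (m⊔n≤o⇒n≤o M N P≥))
         (just-injective (trans (sym eqw) (trans (cong dense (eq₀ P (m⊔n≤o⇒m≤o M N P≥))) eqz₀))) near-w)
      , λ y near → ball y (subst (λ k → Near k y z) (sym (eq₁ _ (m≤n⊔m M N))) near)
     where
     eqz₀ : dense (α 0) ≡ just z
     eqz₀ = trans (cong dense (sym (eq₀ _ (m≤m⊔n M N)))) eqz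
   not-U : 𝟏.Analytic (λ x → ¬ U x)
   not-U = record
    { Witness = λ x _ → ¬ U x
    ; closed = λ {xs} {x} x-lim _ c Ux →
      let n , ball = near-open open-U Ux
          N , near = x-lim n
      in c N (ball (xs N) (near-sym {n} (near N ≤-refl)))
    ; witness = λ ¬u → id , ¬u
    ; sound = id }

  evens odds : Baire → Baire
  evens α k = α (k + k)
  odds α k = α (suc (k + k))

  interleave : Baire → Baire → Baire
  interleave α β zero = α 0
  interleave α β (suc n) = interleave β (α ∘ suc) n

  evens-interleave : ∀ α β k → evens (interleave α β) k ≡ α k
  odds-interleave : ∀ α β k → odds (interleave α β) k ≡ β k
  evens-interleave α β zero = refl
  evens-interleave α β (suc k) rewrite +-suc k k = evens-interleave (α ∘ suc) (β ∘ suc) k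
  odds-interleave α β k = evens-interleave β (α ∘ suc) k

  analytic-projection : ∀ {A : Pred (X × X) 0ℓ} → 𝟐.Analytic A → 𝟏.Analytic (λ x → ∃[ y ] A (x , y))
  analytic-projection a = record
   { Witness = λ x α → ∃[ y ] Codes (evens α) y × 𝟐.Witness a (x , y) (odds α)
   ; closed = λ x-lim α-lim c →
     let y , y-lim , y-coded = codes-limit (λ k → α-lim (k + k)) (λ n → proj₁ (proj₂ (c n)))
     in y , y-coded , 𝟐.closed a (x-lim , y-lim) (λ k → α-lim (suc (k + k))) λ n → proj₂ (proj₂ (c n))
   ; witness = λ (y , p) →
     let α , y-coded = code y
         β , w = 𝟐.witness a p
     in interleave α β , y
      , (λ k → let z , eq , near = y-coded k in z , trans (cong dense (evens-interleave α β k)) eq , near)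
      , 𝟐.closed-≗ (𝟐.closed a) (λ k → sym (odds-interleave α β k)) w
   ; sound = λ (y , _ , w) → y , 𝟐.sound a w }

  -- Lusin's separation theorem

  Borel : Pred X 0ℓ → Set₁
  Borel A = σ⟨ IsOpen ⟩ A

  ball-borel : ∀ n z → Borel (λ x → Near n x z)
  ball-borel n z = respects ((λ ¬¬p → by-contradiction ¬¬p) , λ p ¬p → ¬p p) (complement (generator (far-open n z)))

  record Separated (A B : Pred X 0ℓ) : Set₁ where
   constructor separated
   field
    S : Pred X 0ℓ
    S-borel : Borel S
    contains : ∀ {x} → A x → S x
    avoids : ∀ {x} → B x → ¬ S x
  open Separated public

  separated-⋃ : ∀ {A B : ℕ → Pred X 0ℓ} {A' B'} → (∀ {x} → A' x → ∃[ m ] A m x) → (∀ {x} → B' x → ∃[ n ] B n x) →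
   (∀ m n → Separated (A m) (B n)) → Separated A' B'
  separated-⋃ {A} {B} A'⊆ B'⊆ s = separated (λ x → ∃[ m ] ¬ (∃[ n ] ¬ S (s m n) x))
   (union _ λ m → complement (union _ λ n → complement (S-borel (s m n))))
   (λ a → let m , a' = A'⊆ a in m , λ (n , ¬p) → ¬p (contains (s m n) a'))
   (λ b (m , ¬∃) → let n , b' = B'⊆ b in ¬∃ (n , avoids (s m n) b'))

  cons : ℕ → Baire → Baire
  cons k α zero = k
  cons k α (suc n) = α n

  -- prepend l α puts the reversed list l in front of α.
  prepend : List ℕ → Baire → Baire
  prepend [] α = α
  prepend (k ∷ l) α = prepend l (cons k α)

  prepend-≗ : ∀ l {α β} → α ≗ β → prepend l α ≗ prepend l β
  prepend-≗ [] eq = eq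
  prepend-≗ (k ∷ l) eq = prepend-≗ l λ { zero → refl ; (suc n) → eq n }

  cons-η : ∀ α → α ≗ cons (α 0) (α ∘ suc)
  cons-η α zero = refl
  cons-η α (suc n) = refl

  prepend-length : ∀ l α j → prepend l α (length l + j) ≡ α j
  prepend-length [] α j = refl
  prepend-length (k ∷ l) α j = trans (cong (prepend l (cons k α)) (sym (+-suc (length l) j))) (prepend-length l (cons k α) (suc j))

  lusin-separation : ∀ {A B} → 𝟏.Analytic A → 𝟏.Analytic B → (∀ {x} → A x → ¬ B x) → Separated A B
  lusin-separation {A} {B} a b disjoint = by-contradiction λ ¬sep → absurd (λ s → ¬sep (separated-⋃
    {λ _ → Piece a []} {λ _ → Piece b []} (λ p → 0 , piece a p) (λ q → 0 , piece b q) λ _ _ → s))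
   where
   CodedWitness : ∀ {A} → 𝟏.Analytic A → X → Baire → Set
   CodedWitness a x α = Codes (evens α) x × 𝟏.Witness a x (odds α)
   Piece : ∀ {A} → 𝟏.Analytic A → List ℕ → Pred X 0ℓ
   Piece a l x = ∃[ α ] CodedWitness a x (prepend l α)
   coded-≗ : ∀ {A} (a : 𝟏.Analytic A) {x α β} → α ≗ β → CodedWitness a x α → CodedWitness a x β
   coded-≗ a eq (codes , w) = (λ k → let z , eqz , near = codes k in z , trans (cong dense (sym (eq (k + k)))) eqz , near)
    , 𝟏.closed-≗ (𝟏.closed a) (λ k → eq (suc (k + k))) w
   piece : ∀ {A} (a : 𝟏.Analytic A) {x} → A x → Piece a [] x
   piece a {x} p =
    let α , coded = code x
        β , w = 𝟏.witness a p
    in interleave α β , (λ k → let z , eq , near = coded k in z , trans (cong dense (evens-interleave α β k)) eq , near)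
      , 𝟏.closed-≗ (𝟏.closed a) (λ k → sym (odds-interleave α β k)) w
   split : ∀ {A} (a : 𝟏.Analytic A) l {x} → Piece a l x → ∃[ k ] Piece a (k ∷ l) x
   split a l (α , w) = α 0 , α ∘ suc , coded-≗ a (prepend-≗ l (cons-η α)) w

   module _ (¬sep : ¬ Separated (Piece a []) (Piece b [])) where
    State : Set₁
    State = ∃[ l ] ∃[ l' ] ¬ Separated (Piece a l) (Piece b l')
    refine : ∀ l l' → ¬ Separated (Piece a l) (Piece b l') → ∃[ k ] ∃[ k' ] ¬ Separated (Piece a (k ∷ l)) (Piece b (k' ∷ l'))
    refine l l' ¬s = by-contradiction λ none → ¬s (separated-⋃ (split a l) (split b l') λ m n →
     by-contradiction λ ¬s' → none (m , n , ¬s'))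
    state : ℕ → State
    state zero = [] , [] , ¬sep
    state (suc n) = let l , l' , ¬s = state n ; k , k' , ¬s' = refine l l' ¬s in k ∷ l , k' ∷ l' , ¬s'
    left right : ℕ → List ℕ
    left n = proj₁ (state n)
    right n = proj₁ (proj₂ (state n))
    inseparable : ∀ n → ¬ Separated (Piece a (left n)) (Piece b (right n))
    inseparable n = proj₂ (proj₂ (state n))
    length-left : ∀ n → length (left n) ≡ n
    length-left zero = refl
    length-left (suc n) = cong suc (length-left n)
    length-right : ∀ n → length (right n) ≡ n
    length-right zero = refl
    length-right (suc n) = cong suc (length-right n)
    α β : Baire
    α n = proj₁ (refine (left n) (right n) (inseparable n))
    β n = proj₁ (proj₂ (refine (left n) (right n) (inseparable n)))

    agrees : (side : ℕ → List ℕ) (γ : Baire) → (∀ n → side (suc n) ≡ γ n ∷ side n) → (∀ n → length (side n) ≡ n) →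
     ∀ n i → i < n → ∀ δ → prepend (side n) δ i ≡ γ i
    agrees side γ side-suc len (suc n) i i<1+n δ rewrite side-suc n with m≤n⇒m<n∨m≡n (≤-pred i<1+n)
    ... | inj₁ i<n = agrees side γ side-suc len n i i<n (cons (γ n) δ)
    ... | inj₂ refl = trans (cong (prepend (side n) (cons (γ n) δ)) (sym (trans (+-identityʳ _) (len n))))
     (prepend-length (side n) (cons (γ n) δ) 0)

    nonemptyˡ : ∀ n → ∃ (Piece a (left n))
    nonemptyˡ n = by-contradiction λ ¬∃ → inseparable n (separated _ empty (λ p → ⊥-elim (¬∃ (_ , p))) λ _ ())
    nonemptyʳ : ∀ n → ∃ (Piece b (right n))
    nonemptyʳ n = by-contradiction λ ¬∃ → inseparable n (separated _ (complement empty) (λ _ ()) λ q → ⊥-elim (¬∃ (_ , q)))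

    limit : ∀ {A} (a : 𝟏.Analytic A) (side : ℕ → List ℕ) (γ : Baire) →
     (∀ n i → i < n → ∀ δ → prepend (side n) δ i ≡ γ i) → (∀ n → ∃ (Piece a (side n))) →
     ∃[ x ] A x × Codes (evens γ) x
    limit a side γ agree nonempty =
     let x , x-lim , x-coded = codes-limit (λ k → lim (k + k)) (λ n → proj₁ (proj₂ (proj₂ (nonempty n))))
     in x , 𝟏.sound a (𝟏.closed a x-lim (λ k → lim (suc (k + k))) λ n → proj₂ (proj₂ (proj₂ (nonempty n)))) , x-coded
     where
     lim : (λ n → prepend (side n) (proj₁ (proj₂ (nonempty n)))) ⇝ γ
     lim k = suc k , λ n k<n → agree n k k<n _

    agreeˡ = agrees left α (λ _ → refl) length-left
    agreeʳ = agrees right β (λ _ → refl) length-right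

    absurd : ⊥
    absurd =
     let x , Ax , x-coded = limit a left α agreeˡ nonemptyˡ
         y , By , y-coded = limit b right β agreeʳ nonemptyʳ
         k , far = ¬∀⇒∃¬ λ near → disjoint Ax (subst B (sym (near-≡ {x} {y} near)) By)
         κ = double (double k)
         n = suc (κ + κ)
         z , eqz , x-near = x-coded κ
         w , eqw , y-near = y-coded κ
     in inseparable n (separated (λ x' → Near κ x' z) (ball-borel κ z)
      (λ { {x'} (δ , codes , _) → let z' , eqz' , near = codes κ in
        subst (Near κ x') (just-injective (trans (sym eqz') (trans (cong dense (agreeˡ n (κ + κ) ≤-refl δ)) eqz))) near })
      (λ { {y'} (δ , codes , _) y'-near-z → let w' , eqw' , near = codes κ
                                                y'-near-w = subst (Near κ y') (just-injective (trans (sym eqw') (trans (cong dense (agreeʳ n (κ + κ) ≤-refl δ)) eqw))) near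
         in far (near-trans (near-trans x-near (near-sym {κ} y'-near-z)) (near-trans y'-near-w (near-sym {κ} y-near))) }))

 module _ (𝒳 : BorelSpace) where
  open Measurability 𝒳

  first : (ℕ → Pred (Point 𝒳) 0ℓ) → Point 𝒳 → ℕ
  first R x with dec (∃[ n ] R n x)
  ... | yes ∃R = proj₁ (least (λ n → R n x) ∃R)
  ... | no _ = 0

  first-sound : ∀ (R : ℕ → Pred (Point 𝒳) 0ℓ) {x} → ∃[ n ] R n x → R (first R x) x
  first-sound R {x} ∃R with dec (∃[ n ] R n x)
  ... | yes ∃R' = proj₁ (proj₂ (least (λ n → R n x) ∃R'))
  ... | no ¬∃R = ⊥-elim (¬∃R ∃R)

  first-meas : ∀ (R : ℕ → Pred (Point 𝒳) 0ℓ) → (∀ n → Bor 𝒳 (R n)) → Meas (first R)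
  first-meas R r P = bor-⇔ 𝒳
   (λ { x (n , p , inj₁ (q , earlier)) → subst P (sym (is-first x n q earlier)) p
     ; x (n , p , inj₂ (none , refl)) → subst P (sym (is-zero x none)) p })
   (λ x p → first R x , p , to x)
   (bor-∃ℕ 𝒳 _ λ n → bor-∩ 𝒳 (bor-const 𝒳 (P n)) (bor-∪ 𝒳
    (bor-∩ 𝒳 (r n) (bor-∀ℕ 𝒳 _ λ m → bor-→ 𝒳 (r m) (bor-const 𝒳 (n ≤ m))))
    (bor-∩ 𝒳 (bor-∀ℕ 𝒳 _ λ m → bor-∁ 𝒳 (r m)) (bor-const 𝒳 (n ≡ 0)))))
   where
   to : ∀ x → R (first R x) x × (∀ m → R m x → first R x ≤ m) ⊎ (∀ m → ¬ R m x) × first R x ≡ 0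
   to x with dec (∃[ n ] R n x)
   ... | yes ∃R = inj₁ (proj₂ (least (λ n → R n x) ∃R))
   ... | no ¬∃R = inj₂ ((λ m q → ¬∃R (m , q)) , refl)
   is-first : ∀ x n → R n x → (∀ m → R m x → n ≤ m) → first R x ≡ n
   is-first x n q earlier with dec (∃[ n ] R n x)
   ... | yes ∃R = let k , s , min = least (λ n → R n x) ∃R in ≤-antisym (min n q) (earlier k s)
   ... | no ¬∃R = ⊥-elim (¬∃R (n , q))
   is-zero : ∀ x → (∀ m → ¬ R m x) → first R x ≡ 0
   is-zero x none with dec (∃[ n ] R n x)
   ... | yes (n , q) = ⊥-elim (none n q)
   ... | no _ = refl

 Rectangles : ∀ {X : Set} → (Pred X 0ℓ → Set₁) → Pred (X × X) 0ℓ → Set₁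
 Rectangles Bor R = ∃[ A ] ∃[ B ] Bor A × Bor B × (∀ p → R p → A (proj₁ p) × B (proj₂ p)) × (∀ p → A (proj₁ p) × B (proj₂ p) → R p)

 bor-along : ∀ {𝒳 𝒴} {f g : Point 𝒳 → Point 𝒴} → BorelMap 𝒳 𝒴 f → BorelMap 𝒳 𝒴 g →
  ∀ {E} → σ⟨ Rectangles (Bor 𝒴) ⟩ E → Bor 𝒳 (λ x → E (f x , g x))
 bor-along {𝒳} bf bg (generator (A , B , a , b , to , from)) = bor-⇔ 𝒳 (λ x → from _) (λ x → to _) (bor-∩ 𝒳 (bf A a) (bg B b))
 bor-along {𝒳} bf bg empty = bor-∅ 𝒳
 bor-along {𝒳} {𝒴} bf bg (complement s) = bor-∁ 𝒳 (bor-along {𝒳} {𝒴} bf bg s)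
 bor-along {𝒳} {𝒴} bf bg (union A s) = bor-∃ℕ 𝒳 _ λ n → bor-along {𝒳} {𝒴} bf bg (s n)
 bor-along {𝒳} {𝒴} bf bg (respects (to , from) s) = bor-⇔ 𝒳 (λ _ → to) (λ _ → from) (bor-along {𝒳} {𝒴} bf bg s)

 module LusinNovikov {X : Set} (ρ : PolishMetric X) where
  open PolishMetric ρ using (dense; IsOpen)
  open Metric ρ
  open Polish ρ

  Ball : ℕ → ℕ → Pred X 0ℓ
  Ball k i x = ∃[ z ] dense i ≡ just z × Near k x z

  Ball-borel : ∀ k i → Borel (Ball k i)
  Ball-borel k i with dense i
  ... | just z = respects ((λ near → z , refl , near) , λ { (_ , refl , near) → near }) (ball-borel k z)
  ... | nothing = respects ((λ ()) , λ { (_ , () , _) }) empty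

  polishSpace : BorelSpace
  polishSpace = record
   { Point = X ; Bor = Borel ; bor-∅ = empty ; bor-∁ = complement ; bor-∃ℕ = union
   ; bor-⇔ = λ to from → respects (to _ , from _)
   ; sep = λ n → Ball (proj₁ (unpair n)) (proj₂ (unpair n))
   ; sep-bor = λ n → Ball-borel (proj₁ (unpair n)) (proj₂ (unpair n))
   ; sep-separates = separates }
   where
   separates : ∀ {x y} → x ≢ y → ∃[ n ] Ball (proj₁ (unpair n)) (proj₂ (unpair n)) x × ¬ Ball (proj₁ (unpair n)) (proj₂ (unpair n)) y
   separates {x} {y} x≢y =
    let k , far = ¬∀⇒∃¬ (x≢y ∘ near-≡)
        i , z , eq , near = near-dense x (double k)
        n , eqn = unpair-surjective (double k) i
    in n , subst (λ (k , i) → Ball k i x) (sym eqn) (z , eq , near) ,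
      λ q → apart k i z far eq near (subst (λ (k , i) → Ball k i y) eqn q)
    where
    apart : ∀ k i z → ¬ Near k x y → dense i ≡ just z → Near (double k) x z → ¬ Ball (double k) i y
    apart k i z far eq near (z' , eq' , near') =
     far (near-trans near (near-sym {double k} (subst (Near (double k) y) (just-injective (trans (sym eq') eq)) near')))

  open Measurability polishSpace

  borel⇒bianalytic : ∀ {A} → Borel A → 𝟏.Bianalytic A
  borel⇒bianalytic = 𝟏.σ-bianalytic open-bianalytic

  borel⇒analytic : ∀ {A} → Borel A → 𝟏.Analytic A
  borel⇒analytic b = 𝟏.inside (borel⇒bianalytic b)

  borel²⇒analytic : ∀ {E} → σ⟨ Rectangles Borel ⟩ E → 𝟐.Analytic E
  borel²⇒analytic e = 𝟐.inside (𝟐.σ-bianalytic rectangle e)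
   where
   rectangle : ∀ {R} → Rectangles Borel R → 𝟐.Bianalytic R
   rectangle (A , B , a , b , to , from) = record
    { inside = 𝟐.analytic-⇔ from to (𝟐.analytic-× (𝟐.inside a') (𝟐.inside b'))
    ; outside = 𝟐.analytic-⇔ {λ p → ∃[ n ] Miss n p}
      (λ { p (zero , ¬a) r → ¬a (proj₁ (to p r)) ; p (suc _ , ¬b) r → ¬b (proj₂ (to p r)) })
      (λ p ¬r → outside-of p ¬r (dec (A (proj₁ p))))
      (𝟐.analytic-∃ℕ λ { zero → 𝟐.outside a' ; (suc _) → 𝟐.outside b' }) }
    where
    a' = bianalytic-pullback {space²} {space} proj₁ proj₁ (borel⇒bianalytic a)
    b' = bianalytic-pullback {space²} {space} proj₂ proj₂ (borel⇒bianalytic b)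
    Miss : ℕ → Pred (X × X) 0ℓ
    Miss zero p = ¬ A (proj₁ p)
    Miss (suc _) p = ¬ B (proj₂ p)
    outside-of : ∀ p → ¬ _ → Dec (A (proj₁ p)) → ∃[ n ] Miss n p
    outside-of p ¬r (no ¬a) = 0 , ¬a
    outside-of p ¬r (yes q) = 1 , λ q' → ¬r (from p (q , q'))

  borelMap-from-open : ∀ {f : X → X} → (∀ U → IsOpen U → Borel (U ∘ f)) → BorelMap polishSpace polishSpace f
  borelMap-from-open g _ (generator o) = g _ o
  borelMap-from-open g _ empty = empty
  borelMap-from-open g _ (complement s) = complement (borelMap-from-open g _ s)
  borelMap-from-open g _ (union A s) = union _ λ n → borelMap-from-open g _ (s n)
  borelMap-from-open g _ (respects (to , from) s) = respects (to , from) (borelMap-from-open g _ s)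

  module _ {index : ℕ → X → ℕ} (index-meas : ∀ k → Meas (index k)) where

   Nearᵐ : ℕ → Maybe X → Maybe X → Set
   Nearᵐ k (just z) (just w) = Near k z w
   Nearᵐ k _ _ = ⊥
   Dom : Pred X 0ℓ
   Dom x = ∀ k l → k ≤ l → Nearᵐ k (dense (index k x)) (dense (index l x))
   Dom-borel : Borel Dom
   Dom-borel = bor-∀ℕ polishSpace _ λ k → bor-∀ℕ polishSpace _ λ l → bor-→ polishSpace (bor-const polishSpace (k ≤ l))
    (meas-map₂ _,_ (index-meas k) (index-meas l) (λ (i , j) → Nearᵐ k (dense i) (dense j)))

   value : X → Maybe X → X
   value x (just z) = z
   value x nothing = x
   ζ : ℕ → X → X
   ζ k x = value x (dense (index k x))
   near-value : ∀ {k x} m m' → Nearᵐ k m m' → Near k (value x m) (value x m')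
   near-value (just _) (just _) near = near
   near-ζ : ∀ {x} → Dom x → ∀ {k l} → k ≤ l → Near k (ζ k x) (ζ l x)
   near-ζ {x} dom {k} {l} k≤l = near-value (dense (index k x)) (dense (index l x)) (dom k l k≤l)
   limit : ∀ {x} → Dom x → ∃[ y ] Converges (λ k → ζ k x) y
   limit {x} dom = near-complete (λ k → ζ k x) λ k → double k , λ m n ≤m ≤n →
    near-trans (near-sym {double k} (near-ζ dom ≤m)) (near-ζ dom ≤n)
   ζ-near-limit : ∀ {x} (dom : Dom x) k → Near k (proj₁ (limit dom)) (ζ k x)
   ζ-near-limit {x} dom k = near-closed λ m → let N , near = proj₂ (limit dom) m in
    ζ (N ⊔ k) x , near (N ⊔ k) (m≤m⊔n N k) , near-sym {k} (near-ζ dom (m≤n⊔m N k))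

   g' : ∀ x → Dec (Dom x) → X
   g' x (yes dom) = proj₁ (limit dom)
   g' x (no _) = x
   g : X → X
   g x = g' x (dec (Dom x))

   Inside : Pred X 0ℓ → ℕ → Maybe X → Set
   Inside U k (just z) = ∀ y → Near k y z → U y
   Inside U k nothing = ⊥

   g-borel : BorelMap polishSpace polishSpace g
   g-borel = borelMap-from-open λ U open-U → bor-⇔ polishSpace (λ x → from-cases U x (dec _)) (λ x → to-cases U open-U x (dec _))
    (bor-∪ polishSpace (bor-∩ polishSpace Dom-borel (bor-∃ℕ polishSpace _ λ k → index-meas k (λ i → Inside U k (dense i))))
     (bor-∩ polishSpace (complement Dom-borel) (generator open-U)))
    where
    Cases : Pred X 0ℓ → X → Set
    Cases U x = Dom x × (∃[ k ] Inside U k (dense (index k x))) ⊎ ¬ Dom x × U x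
    inside-value : ∀ {U k x} m → Inside U k m → ∀ y → Near k y (value x m) → U y
    inside-value (just _) p = p
    value-inside : ∀ {U k x} m → Nearᵐ k m m → (∀ y → Near k y (value x m) → U y) → Inside U k m
    value-inside (just _) _ p = p
    from-cases : ∀ U x d → Cases U x → U (g' x d)
    from-cases U x (yes dom) (inj₁ (_ , k , p)) = inside-value (dense (index k x)) p _ (ζ-near-limit dom k)
    from-cases U x (yes dom) (inj₂ (¬dom , _)) = ⊥-elim (¬dom dom)
    from-cases U x (no ¬dom) (inj₁ (dom , _)) = ⊥-elim (¬dom dom)
    from-cases U x (no ¬dom) (inj₂ (_ , p)) = p
    to-cases : ∀ U → IsOpen U → ∀ x d → U (g' x d) → Cases U x
    to-cases U open-U x (no ¬dom) p = inj₂ (¬dom , p)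
    to-cases U open-U x (yes dom) p = let n , ball = near-open open-U p ; k = double n in
     inj₁ (dom , k , value-inside (dense (index k x)) (dom k k ≤-refl) λ y near →
      ball y (near-trans (ζ-near-limit dom k) (near-sym {k} near)))

   limit-map : ∃[ g ] BorelMap polishSpace polishSpace g × (∀ {x y} → (∀ k → Ball (double k) (index k x) y) → g x ≡ y)
   limit-map = g , g-borel , λ {x} {y} index-ball → correct index-ball (dec (Dom x))
    where
    balls-near : ∀ {y k l} → k ≤ l → ∀ {i j} → Ball (double k) i y → Ball (double l) j y → Nearᵐ k (dense i) (dense j)
    balls-near {k = k} k≤l (z , eq , near) (w , eq' , near') rewrite eq | eq' =
     near-trans (near-sym {double k} near) (near-antitone (s≤s (+-mono-≤ k≤l k≤l)) near')
    ball-value : ∀ {x y k i} → Ball k i y → Near k y (value x (dense i))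
    ball-value (z , eq , near) rewrite eq = near
    correct : ∀ {x y} → (∀ k → Ball (double k) (index k x) y) → (d : Dec (Dom x)) → g' x d ≡ y
    correct index-ball (no ¬dom) = ⊥-elim (¬dom λ k l k≤l → balls-near k≤l (index-ball k) (index-ball l))
    correct index-ball (yes dom) = near-≡ λ n → near-trans (ζ-near-limit dom (double n))
     (near-sym {double n} (near-antitone (≤-trans (m≤m+n (double n) (double n)) (n≤1+n _)) (ball-value (index-ball (double n)))))

  module _ {E : X → X → Set} (E-borel : σ⟨ Rectangles Borel ⟩ (λ (x , y) → E x y)) where

   Hits : Pred X 0ℓ → Pred X 0ℓ
   Hits D x = ∃[ y ] E x y × D y

   hits-analytic : ∀ {D} → Borel D → 𝟏.Analytic (Hits D)
   hits-analytic d = analytic-projection (𝟐.analytic-× (borel²⇒analytic E-borel)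
    (analytic-pullback {space²} {space} proj₂ proj₂ (borel⇒analytic d)))

   selector : ∀ {Y D : Pred X 0ℓ} → 𝟏.Analytic Y → Borel D →
    (∀ {x y y'} → Y x → E x y → D y → E x y' → D y' → y ≡ y') →
    ∃[ g ] BorelMap polishSpace polishSpace g × (∀ {x y} → Y x → E x y → D y → g x ≡ y)
   selector {Y} {D} Y-analytic D-borel unique =
    let g , g-borel , g-correct = limit-map index-meas in g , g-borel , λ Yx e p → g-correct (index-ball Yx e p)
    where
    in-ball : ∀ k i → Separated (λ x → Y x × Hits (λ y → D y × Ball k i y) x) (λ x → Y x × Hits (λ y → D y × ¬ Ball k i y) x)
    in-ball k i = lusin-separation
     (𝟏.analytic-× Y-analytic (hits-analytic (bor-∩ polishSpace D-borel (Ball-borel k i))))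
     (𝟏.analytic-× Y-analytic (hits-analytic (bor-∩ polishSpace D-borel (complement (Ball-borel k i)))))
     λ { (Yx , y , Exy , Dy , p) (_ , y' , Exy' , Dy' , ¬p) → ¬p (subst (Ball k i) (unique Yx Exy Dy Exy' Dy') p) }

    R : ℕ → ℕ → Pred X 0ℓ
    R k i x = S (in-ball (double k) i) x
    index : ℕ → X → ℕ
    index k = first polishSpace (R k)
    index-meas : ∀ k → Meas (index k)
    index-meas k = first-meas polishSpace (R k) λ i → S-borel (in-ball (double k) i)

    index-ball : ∀ {x y} → Y x → E x y → D y → ∀ k → Ball (double k) (index k x) y
    index-ball {x} {y} Yx Exy Dy k =
     let i , z , eq , near = near-dense y (double k)
         r = first-sound polishSpace (R k) {x} (i , contains (in-ball (double k) i) (Yx , y , Exy , Dy , z , eq , near))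
     in by-contradiction λ ¬p → avoids (in-ball (double k) (index k x)) (Yx , y , Exy , Dy , ¬p) r

   Cond : List ℕ → Pred X 0ℓ
   Cond c x = All (λ n → sep polishSpace n x) c

   Cell : List ℕ × List (List ℕ) → Pred X 0ℓ
   Cell (c , bad) x = Cond c x × All (λ c' → ¬ Cond c' x) bad

   cells : List (List ℕ) → List (List ℕ) → List (List ℕ × List (List ℕ))
   cells bad [] = []
   cells bad (c ∷ cs) = (c , bad) ∷ cells (c ∷ bad) cs

   cond-borel : ∀ c → Borel (Cond c)
   cond-borel c = bor-All polishSpace c (All-tabulate λ {n} _ → sep-bor polishSpace n)

   cell-borel : ∀ d → Borel (Cell d)
   cell-borel (c , bad) = bor-∩ polishSpace (cond-borel c) (bor-All polishSpace bad (All-tabulate λ {c} _ → complement (cond-borel c)))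

   length-cells : ∀ bad cs → length (cells bad cs) ≡ length cs
   length-cells bad [] = refl
   length-cells bad (c ∷ cs) = cong suc (length-cells (c ∷ bad) cs)

   cells-bad : ∀ bad cs {d} → d ∈ cells bad cs → ∀ {c} → c ∈ bad → c ∈ proj₂ d
   cells-bad bad (c ∷ cs) (here refl) j = j
   cells-bad bad (c ∷ cs) (there i) j = cells-bad (c ∷ bad) cs i (there j)

   cells-disjoint : ∀ bad cs → AllPairs (λ d d' → ∀ {y} → Cell d y → ¬ Cell d' y) (cells bad cs)
   cells-disjoint bad [] = []
   cells-disjoint bad (c ∷ cs) =
    All-tabulate (λ i (p , _) (_ , q) → All-lookup q (cells-bad (c ∷ bad) cs i (here refl)) p) ∷ cells-disjoint (c ∷ bad) cs

   isolate-all : ∀ {x} bad ys → Unique ys → All (E x) ys → All (λ y → All (λ c → ¬ Cond c y) bad) ys →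
    ∃[ cs ] length cs ≡ length ys × All (λ d → Hits (Cell d) x) (cells bad cs)
   isolate-all bad [] _ _ _ = [] , refl , []
   isolate-all bad (y ∷ ys) (y∉ ∷ u) (e ∷ es) (a ∷ as) =
    let c , cy , only = isolating polishSpace y ys
        cs , len , hits = isolate-all (c ∷ bad) ys u es
         (All-tabulate λ i → (λ cond → All-lookup y∉ i (only i cond)) ∷ All-lookup as i)
    in c ∷ cs , cong suc len , (y , e , cy , a) ∷ hits

   Count : ℕ → Pred X 0ℓ
   Count m x = ∃[ ys ] Unique ys × length ys ≡ m × All (E x) ys

   pick : ∀ {x ds} → AllPairs (λ d d' → ∀ {y} → Cell d y → ¬ Cell d' y) ds → All (λ d → Hits (Cell d) x) ds →
    ∃[ ys ] Unique ys × length ys ≡ length ds × All (E x) ys × All (λ y → ∃[ d ] d ∈ ds × Cell d y) ys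
   pick [] [] = [] , [] , refl , [] , []
   pick (dis ∷ diss) ((y , e , p) ∷ hits) =
    let ys , u , len , es , ps = pick diss hits
    in y ∷ ys , All-map (λ { (d , i , q) refl → All-lookup dis i p q }) ps ∷ u , cong suc len , e ∷ es
     , (_ , here refl , p) ∷ All-map (λ (d , i , q) → d , there i , q) ps

   pick-two : ∀ {x ds} → AllPairs (λ d d' → ∀ {y} → Cell d y → ¬ Cell d' y) ds → All (λ d → Hits (Cell d) x) ds →
    ∀ {d y y'} → d ∈ ds → y ≢ y' → E x y → Cell d y → E x y' → Cell d y' →
    ∃[ ys ] Unique ys × length ys ≡ suc (length ds) × All (E x) ys × All (λ y → ∃[ d ] d ∈ ds × Cell d y) ys
   pick-two (dis ∷ diss) (_ ∷ hits) {d} {y} {y'} (here refl) y≢y' e p e' p' =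
    let ys , u , len , es , ps = pick diss hits
        fresh : ∀ {y} → Cell d y → All (y ≢_) ys
        fresh p = All-map (λ { (d , i , q) refl → All-lookup dis i p q }) ps
    in y ∷ y' ∷ ys , (y≢y' ∷ fresh p) ∷ fresh p' ∷ u , cong suc (cong suc len) , e ∷ e' ∷ es
     , (d , here refl , p) ∷ (d , here refl , p') ∷ All-map (λ (d , i , q) → d , there i , q) ps
   pick-two (dis ∷ diss) ((z , e₀ , p₀) ∷ hits) (there i) y≢y' e p e' p' =
    let ys , u , len , es , ps = pick-two diss hits i y≢y' e p e' p'
    in z ∷ ys , All-map (λ { (d , i , q) refl → All-lookup dis i p₀ q }) ps ∷ u , cong suc len , e₀ ∷ es
     , (_ , here refl , p₀) ∷ All-map (λ (d , i , q) → d , there i , q) ps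

   HitsAll : List (List ℕ) → Pred X 0ℓ
   HitsAll cs x = All (λ d → Hits (Cell d) x) (cells [] cs)

   Y : List (List ℕ) → Pred X 0ℓ
   Y cs x = HitsAll cs x × ¬ Count (suc (length cs)) x

   Y-unique : ∀ cs {d x y y'} → d ∈ cells [] cs → Y cs x → E x y → Cell d y → E x y' → Cell d y' → y ≡ y'
   Y-unique cs i (hits , few) e p e' p' = by-contradiction λ y≢y' →
    let ys , u , len , es , _ = pick-two (cells-disjoint [] cs) hits i y≢y' e p e' p'
    in few (ys , u , trans len (cong suc (length-cells [] cs)) , es)

   module _ (cs : List (List ℕ)) (count-borel : Borel (Count (suc (length cs)))) where

    Y-analytic : 𝟏.Analytic (Y cs)
    Y-analytic = 𝟏.analytic-× (𝟏.analytic-All (cells [] cs) (All-tabulate λ {d} _ → hits-analytic (cell-borel d)))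
     (borel⇒analytic (complement count-borel))

    point : ∀ d → d ∈ cells [] cs → ∃[ g ] BorelMap polishSpace polishSpace g × (∀ {x y} → Y cs x → E x y → Cell d y → g x ≡ y)
    point d i = selector Y-analytic (cell-borel d) (Y-unique cs i)

    points : ∃[ gs ] All (BorelMap polishSpace polishSpace) gs × length gs ≡ length cs
     × Borel (Y cs)
     × (∀ {x} → Y cs x → All (E x) (nb gs x) × Unique (nb gs x) × (∀ {y} → E x y → y ∈ nb gs x))
    points = gs , gs-borel , len , bor-⇔ polishSpace Y-complete Y-sound Y'-borel , λ Yx → edges Yx , unique Yx , all Yx
     where
     gs-of : ∀ ds → (∀ {d} → d ∈ ds → d ∈ cells [] cs) → List (X → X)
     gs-of [] _ = []
     gs-of (d ∷ ds) ⊆ = proj₁ (point d (⊆ (here refl))) ∷ gs-of ds (⊆ ∘ there)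
     gs = gs-of (cells [] cs) id
     gs-of-borel : ∀ ds (⊆ : ∀ {d} → d ∈ ds → d ∈ cells [] cs) → All (BorelMap polishSpace polishSpace) (gs-of ds ⊆)
     gs-of-borel [] _ = []
     gs-of-borel (d ∷ ds) ⊆ = proj₁ (proj₂ (point d (⊆ (here refl)))) ∷ gs-of-borel ds (⊆ ∘ there)
     gs-borel = gs-of-borel (cells [] cs) id
     len-of : ∀ ds (⊆ : ∀ {d} → d ∈ ds → d ∈ cells [] cs) → length (gs-of ds ⊆) ≡ length ds
     len-of [] _ = refl
     len-of (d ∷ ds) ⊆ = cong suc (len-of ds (⊆ ∘ there))
     len = trans (len-of (cells [] cs) id) (length-cells [] cs)

     Y'-of : ∀ ds → (∀ {d} → d ∈ ds → d ∈ cells [] cs) → Pred X 0ℓ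
     Y'-of [] _ x = ⊤
     Y'-of (d ∷ ds) ⊆ x = let g = proj₁ (point d (⊆ (here refl))) in (E x (g x) × Cell d (g x)) × Y'-of ds (⊆ ∘ there) x
     Y'-of-borel : ∀ ds (⊆ : ∀ {d} → d ∈ ds → d ∈ cells [] cs) → Borel (Y'-of ds ⊆)
     Y'-of-borel [] _ = bor-const polishSpace ⊤
     Y'-of-borel (d ∷ ds) ⊆ = let g , bg , _ = point d (⊆ (here refl)) in
      bor-∩ polishSpace (bor-∩ polishSpace (bor-along {polishSpace} {polishSpace} {id} {g} (bor-id {polishSpace}) bg E-borel) (bg _ (cell-borel d))) (Y'-of-borel ds (⊆ ∘ there))
     Y'-borel = bor-∩ polishSpace (Y'-of-borel (cells [] cs) id) (complement count-borel)
     hits-of : ∀ ds (⊆ : ∀ {d} → d ∈ ds → d ∈ cells [] cs) {x} → Y'-of ds ⊆ x → All (λ d → Hits (Cell d) x) ds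
     hits-of [] _ _ = []
     hits-of (d ∷ ds) ⊆ ((e , p) , rest) = (_ , e , p) ∷ hits-of ds (⊆ ∘ there) rest
     Y-complete : ∀ x → Y'-of (cells [] cs) id x × ¬ Count (suc (length cs)) x → Y cs x
     Y-complete x (p , few) = hits-of (cells [] cs) id p , few
     of-hits : ∀ ds (⊆ : ∀ {d} → d ∈ ds → d ∈ cells [] cs) {x} → Y cs x → All (λ d → Hits (Cell d) x) ds → Y'-of ds ⊆ x
     of-hits [] _ _ _ = tt
     of-hits (d ∷ ds) ⊆ {x} Yx ((y , e , p) ∷ hits) =
      let eq = sym (proj₂ (proj₂ (point d (⊆ (here refl)))) Yx e p)
      in (subst (E x) eq e , subst (Cell d) eq p) , of-hits ds (⊆ ∘ there) Yx hits
     Y-sound : ∀ x → Y cs x → Y'-of (cells [] cs) id x × ¬ Count (suc (length cs)) x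
     Y-sound x Yx = of-hits (cells [] cs) id Yx (proj₁ Yx) , proj₂ Yx
     edges-of : ∀ ds (⊆ : ∀ {d} → d ∈ ds → d ∈ cells [] cs) {x} → Y'-of ds ⊆ x → All (E x) (nb (gs-of ds ⊆) x)
     edges-of [] _ _ = []
     edges-of (d ∷ ds) ⊆ ((e , _) , rest) = e ∷ edges-of ds (⊆ ∘ there) rest
     edges : ∀ {x} → Y cs x → All (E x) (nb gs x)
     edges Yx = edges-of (cells [] cs) id (of-hits (cells [] cs) id Yx (proj₁ Yx))
     cell-of : ∀ ds (⊆ : ∀ {d} → d ∈ ds → d ∈ cells [] cs) {x} → Y'-of ds ⊆ x → All (λ y → ∃[ d ] d ∈ ds × Cell d y) (nb (gs-of ds ⊆) x)
     cell-of [] _ _ = []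
     cell-of (d ∷ ds) ⊆ ((_ , p) , rest) = (d , here refl , p) ∷ All-map (λ (d , i , q) → d , there i , q) (cell-of ds (⊆ ∘ there) rest)
     unique-of : ∀ ds (⊆ : ∀ {d} → d ∈ ds → d ∈ cells [] cs) → AllPairs (λ d d' → ∀ {y} → Cell d y → ¬ Cell d' y) ds →
      ∀ {x} → Y'-of ds ⊆ x → Unique (nb (gs-of ds ⊆) x)
     unique-of [] _ _ _ = []
     unique-of (d ∷ ds) ⊆ (dis ∷ diss) ((_ , p) , rest) =
      All-map (λ { (d' , i , q) eq → All-lookup dis i p (subst (Cell d') (sym eq) q) }) (cell-of ds (⊆ ∘ there) rest) ∷ unique-of ds (⊆ ∘ there) diss rest
     unique : ∀ {x} → Y cs x → Unique (nb gs x)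
     unique Yx = unique-of (cells [] cs) id (cells-disjoint [] cs) (of-hits (cells [] cs) id Yx (proj₁ Yx))
     all : ∀ {x} → Y cs x → ∀ {y} → E x y → y ∈ nb gs x
     all {x} Yx@(_ , few) {y} e = by-contradiction λ y∉ → few
      ( y ∷ nb gs x , All-tabulate (λ {z} i eq → y∉ (subst (_∈ nb gs x) (sym eq) i)) ∷ unique Yx
      , cong suc (trans (Listₚ.length-map _ gs) len) , e ∷ edges Yx)

   module _ (Δ : ℕ) (bounded : ∀ {x ys} → Unique ys → All (E x) ys → length ys ≤ Δ) where

    EC = List-enumerable (List-enumerable ℕ-enumerable)
    open Enumerable EC using () renaming (enum to decode; enum-surjective to decode-surjective)

    counts : ∀ {x m} → Count m x → ¬ Count (suc m) x → ∃[ n ] length (decode n) ≡ m × Y (decode n) x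
    counts {x} {m} (ys , u , refl , es) few with isolate-all [] ys u es (All-tabulate λ _ → [])
    ... | cs , len , hits with decode-surjective cs
    ... | n , refl = n , len , hits , subst (λ m → ¬ Count (suc m) x) (sym len) few

    count-pred : ∀ {x m} → Count (suc m) x → Count m x
    count-pred (y ∷ ys , _ ∷ u , refl , _ ∷ es) = ys , u , refl , es

    Y⇒count : ∀ {x} cs → Y cs x → Count (length cs) x
    Y⇒count cs (hits , _) = let ys , u , len , es , _ = pick (cells-disjoint [] cs) hits in
     ys , u , trans len (length-cells [] cs) , es

    count-borel : ∀ j m → j + m ≡ suc Δ → Borel (Count m)
    count-borel zero m refl = bor-⇔ polishSpace (λ _ ()) (λ { x (ys , u , eq , es) → <⇒≱ (≤-reflexive (sym eq)) (bounded u es) }) empty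
    count-borel (suc j) m eq = bor-⇔ polishSpace
     (λ { x (inj₁ c) → count-pred c ; x (inj₂ (n , refl , Yx)) → Y⇒count (decode n) Yx })
     (λ x c → exact-or-more x c (dec (Count (suc m) x)))
     (bor-∪ polishSpace more (bor-∃ℕ polishSpace _ level))
     where
     more = count-borel j (suc m) (trans (+-suc j m) eq)
     level : ∀ n → Borel (λ x → length (decode n) ≡ m × Y (decode n) x)
     level n with dec (length (decode n) ≡ m)
     ... | yes refl = bor-⇔ polishSpace (λ _ p → refl , p) (λ _ → proj₂) (proj₁ (proj₂ (proj₂ (proj₂ (points (decode n) more)))))
     ... | no ≢ = bor-⇔ polishSpace (λ _ ()) (λ _ (eq , _) → ≢ eq) empty
     exact-or-more : ∀ x → Count m x → Dec (Count (suc m) x) → Count (suc m) x ⊎ (∃[ n ] length (decode n) ≡ m × Y (decode n) x)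
     exact-or-more x c (yes c') = inj₁ c'
     exact-or-more x c (no few) = inj₂ (counts c few)

    private
     count-borel≤ : ∀ m → m ≤ suc Δ → Borel (Count m)
     count-borel≤ m m≤ = count-borel (suc Δ ∸ m) m (m∸n+n≡m m≤)

    nthOr : List (X → X) → ℕ → X → X
    nthOr [] i = id
    nthOr (g ∷ gs) zero = g
    nthOr (g ∷ gs) (suc i) = nthOr gs i

    nthOr-borel : ∀ {gs} → All (BorelMap polishSpace polishSpace) gs → ∀ i → BorelMap polishSpace polishSpace (nthOr gs i)
    nthOr-borel [] i = bor-id {polishSpace}
    nthOr-borel (b ∷ bs) zero = b
    nthOr-borel (b ∷ bs) (suc i) = nthOr-borel bs i

    nthOr-∈ : ∀ gs {x y} → y ∈ nb gs x → ∃[ i ] i < length gs × nthOr gs i x ≡ y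
    nthOr-∈ (g ∷ gs) (here refl) = 0 , s≤s z≤n , refl
    nthOr-∈ (g ∷ gs) (there p) = let i , i< , eq = nthOr-∈ gs p in suc i , s≤s i< , eq

    ∈-nthOr : ∀ gs i {x} → nthOr gs i x ≢ x → nthOr gs i x ∈ nb gs x
    ∈-nthOr [] i ≢ = ⊥-elim (≢ refl)
    ∈-nthOr (g ∷ gs) zero ≢ = here refl
    ∈-nthOr (g ∷ gs) (suc i) ≢ = there (∈-nthOr gs i ≢)

    nthOr-injective : ∀ gs i j {x} → Unique (nb gs x) → nthOr gs i x ≡ nthOr gs j x → nthOr gs i x ≢ x → i ≡ j
    nthOr-injective [] i j u eq ≢ = ⊥-elim (≢ refl)
    nthOr-injective (g ∷ gs) zero zero u eq ≢ = refl
    nthOr-injective (g ∷ gs) zero (suc j) {x} (g∉ ∷ u) eq ≢ = ⊥-elim (All-lookup g∉ (∈-nthOr gs j (≢ ∘ trans eq)) eq)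
    nthOr-injective (g ∷ gs) (suc i) zero (g∉ ∷ u) eq ≢ = ⊥-elim (All-lookup g∉ (∈-nthOr gs i ≢) (sym eq))
    nthOr-injective (g ∷ gs) (suc i) (suc j) (_ ∷ u) eq ≢ = cong suc (nthOr-injective gs i j u eq ≢)

    lusin-novikov : ∃[ h ] (∀ i → BorelMap polishSpace polishSpace (h i))
     × (∀ {x y} → E x y → ∃[ i ] i < Δ × h i x ≡ y)
     × (∀ {x} i → h i x ≢ x → E x (h i x))
     × (∀ {x} i j → h i x ≡ h j x → h i x ≢ x → i ≡ j)
    lusin-novikov = h , h-borel , h-onto , (λ {x} i ≢ → All-lookup (proj₁ (spec x)) (∈-nthOr (gs (index x)) i ≢))
     , λ {x} i j eq ≢ → nthOr-injective (gs (index x)) i j (proj₁ (proj₂ (spec x))) eq ≢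
     where
     At : ℕ → Pred X 0ℓ
     At n x = length (decode n) ≤ Δ × Y (decode n) x
     gs' : ∀ n → Dec (length (decode n) ≤ Δ) → List (X → X)
     gs' n (yes len≤) = proj₁ (points (decode n) (count-borel≤ _ (s≤s len≤)))
     gs' n (no _) = []
     gs : ℕ → List (X → X)
     gs n = gs' n (dec (length (decode n) ≤ Δ))
     gs-borel : ∀ n d → All (BorelMap polishSpace polishSpace) (gs' n d)
     gs-borel n (yes len≤) = proj₁ (proj₂ (points (decode n) (count-borel≤ _ (s≤s len≤))))
     gs-borel n (no _) = []
     at-borel : ∀ n → Borel (At n)
     at-borel n with dec (length (decode n) ≤ Δ)
     ... | yes len≤ = bor-⇔ polishSpace (λ _ p → len≤ , p) (λ _ → proj₂) (proj₁ (proj₂ (proj₂ (proj₂ (points (decode n) (count-borel≤ _ (s≤s len≤)))))))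
     ... | no ≰ = bor-⇔ polishSpace (λ _ ()) (λ _ (len≤ , _) → ≰ len≤) empty
     largest : ∀ x j m → j + m ≡ suc Δ → Count m x → ∃[ n ] At n x
     largest x zero m refl (ys , u , eq , es) = ⊥-elim (<⇒≱ (≤-reflexive (sym eq)) (bounded u es))
     largest x (suc j) m eq c with dec (Count (suc m) x)
     ... | yes c' = largest x j (suc m) (trans (+-suc j m) eq) c'
     ... | no few with counts c few
     ... | n , len , Yx = n , subst (_≤ Δ) (sym len) (subst (m ≤_) (suc-injective eq) (m≤n+m m j)) , Yx
     index : X → ℕ
     index = first polishSpace At
     at-index : ∀ x → At (index x) x
     at-index x = first-sound polishSpace At (largest x (suc Δ) 0 (+-identityʳ _) ([] , [] , refl , []))
     spec' : ∀ n d {x} → At n x → All (E x) (nb (gs' n d) x) × Unique (nb (gs' n d) x) × (∀ {y} → E x y → y ∈ nb (gs' n d) x)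
     spec' n (yes len≤) (_ , Yx) = proj₂ (proj₂ (proj₂ (proj₂ (points (decode n) (count-borel≤ _ (s≤s len≤)))))) Yx
     spec' n (no ≰) (len≤ , _) = ⊥-elim (≰ len≤)
     spec : ∀ x → All (E x) (nb (gs (index x)) x) × Unique (nb (gs (index x)) x) × (∀ {y} → E x y → y ∈ nb (gs (index x)) x)
     spec x = spec' (index x) (dec _) (at-index x)
     h : ℕ → X → X
     h i x = nthOr (gs (index x)) i x
     h-borel : ∀ i → BorelMap polishSpace polishSpace (h i)
     h-borel i = bor-select {𝒴 = polishSpace} (first-meas polishSpace At at-borel) λ n → nthOr-borel (gs-borel n (dec _)) i
     length-gs : ∀ n d → length (gs' n d) ≤ Δ
     length-gs n (yes len≤) = subst (_≤ Δ) (sym (proj₁ (proj₂ (proj₂ (points (decode n) (count-borel≤ _ (s≤s len≤))))))) len≤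
     length-gs n (no _) = z≤n
     h-onto : ∀ {x y} → E x y → ∃[ i ] i < Δ × h i x ≡ y
     h-onto {x} e = let i , i< , eq = nthOr-∈ (gs (index x)) (proj₂ (proj₂ (spec x)) e) in
      i , ≤-trans i< (length-gs (index x) (dec _)) , eq

 -- Balls in the graph of a family of self-maps

 module _ {X : Set} where

  pow : ℕ → List (X → X) → List (X → X)
  pow zero ts = id ∷ []
  pow (suc n) ts = cartesianProductWith (λ t s → t ∘ s) ts (pow n ts)

  nb⁻ : ∀ {ts : List (X → X)} {x y} → y ∈ nb ts x → ∃[ t ] t ∈ ts × y ≡ t x
  nb⁻ = ∈-map⁻ _

  nb⁺ : ∀ {ts : List (X → X)} {t x} → t ∈ ts → t x ∈ nb ts x
  nb⁺ = ∈-map⁺ _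

  reach-snoc : ∀ n {ts x y z} → y ∈ nb (pow n ts) x → z ∈ nb ts y → z ∈ nb (pow (suc n) ts) x
  reach-snoc n p q with nb⁻ p | nb⁻ q
  ... | s , i , refl | t , j , refl = nb⁺ (∈-cartesianProductWith⁺ _ j i)

  reach-unsnoc : ∀ n {ts x z} → z ∈ nb (pow (suc n) ts) x → ∃[ y ] y ∈ nb (pow n ts) x × z ∈ nb ts y
  reach-unsnoc n {ts} p with nb⁻ p
  ... | _ , i , refl with ∈-cartesianProductWith⁻ _ ts (pow n ts) i
  ... | t , s , j , k , refl = _ , nb⁺ k , nb⁺ j

  reach-trans : ∀ m n {ts x y z} → y ∈ nb (pow m ts) x → z ∈ nb (pow n ts) y → z ∈ nb (pow (n + m) ts) x
  reach-trans m zero p (here refl) = p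
  reach-trans m (suc n) {ts} p q = let _ , q' , r = reach-unsnoc n {ts} q in reach-snoc (n + m) (reach-trans m n p q') r

  reach-1 : ∀ {ts x y} → y ∈ nb ts x → y ∈ nb (pow 1 ts) x
  reach-1 p = reach-snoc 0 (here refl) p

  reach-sym : ∀ n {ts} → Symmetricᵐ ts → Symmetricᵐ (pow n ts)
  reach-sym zero s (here refl) = here refl
  reach-sym (suc n) {ts} s {x} {y} p = let _ , q , r = reach-unsnoc n {ts} p in
   subst (λ m → x ∈ nb (pow m ts) y) (+-comm n 1) (reach-trans 1 n (reach-1 (s r)) (reach-sym n s q))

  reach-refl : ∀ n {ts x} → id ∈ ts → x ∈ nb (pow n ts) x
  reach-refl zero i = here refl
  reach-refl (suc n) i = reach-snoc n (reach-refl n i) (nb⁺ i)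

  reach-mono : ∀ {m n ts x y} → id ∈ ts → m ≤ n → y ∈ nb (pow m ts) x → y ∈ nb (pow n ts) x
  reach-mono {m} {n} {ts} {x} {y} i m≤n p = subst (λ k → y ∈ nb (pow k ts) x) (m∸n+n≡m m≤n) (reach-trans m (n ∸ m) p (reach-refl (n ∸ m) i))

  length-pow : ∀ n ts → length (pow n ts) ≡ length ts ^ n
  length-pow zero ts = refl
  length-pow (suc n) ts = trans (length-product ts) (cong (length ts *_) (length-pow n ts))
   where
   length-product : ∀ us → length (cartesianProductWith (λ t s → t ∘ s) us (pow n ts)) ≡ length us * length (pow n ts)
   length-product [] = refl
   length-product (u ∷ us) = trans (Listₚ.length-++ (map (λ s → u ∘ s) (pow n ts)))
    (cong₂ _+_ (Listₚ.length-map _ (pow n ts)) (length-product us))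

  orb-⊆ : ∀ {ts ts' : List (X → X)} → (∀ {x y} → y ∈ nb ts x → y ∈ nb ts' x) → ∀ {x y} → Orb ts x y → Orb ts' x y
  orb-⊆ f stop = stop
  orb-⊆ f (p ◅ o) = f p ◅ orb-⊆ f o

  finiteOrbits-⊆ : ∀ {ts ts' : List (X → X)} → (∀ {x y} → y ∈ nb ts x → y ∈ nb ts' x) → FiniteOrbits ts' → FiniteOrbits ts
  finiteOrbits-⊆ f fin x = let ys , orb⊆ = fin x in ys , λ y o → orb⊆ y (orb-⊆ f o)

  keep : (X → X → Set) → (X → X) → X → X
  keep Q t x = if ⟦ Q x (t x) ⟧ then t x else x

  keep-true : ∀ (Q : X → X → Set) t {x} → Q x (t x) → keep Q t x ≡ t x
  keep-true Q t q = if-yes q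

  keep-cases : ∀ (Q : X → X → Set) t x → (Q x (t x) × keep Q t x ≡ t x) ⊎ keep Q t x ≡ x
  keep-cases Q t x with dec (Q x (t x))
  ... | yes q = inj₁ (q , refl)
  ... | no _ = inj₂ refl

  nb-keep⁻ : ∀ (Q : X → X → Set) {ts x y} → y ∈ nb (map (keep Q) ts) x → (Q x y × y ∈ nb ts x) ⊎ y ≡ x
  nb-keep⁻ Q p with nb⁻ p
  ... | _ , i , refl with ∈-map⁻ (keep Q) i
  ... | t , j , refl with keep-cases Q t _
  ... | inj₁ (q , eq) = inj₁ (subst (Q _) (sym eq) q , subst (_∈ _) (sym eq) (nb⁺ j))
  ... | inj₂ eq = inj₂ eq

  nb-keep⁺ : ∀ (Q : X → X → Set) {ts x y} → Q x y → y ∈ nb ts x → y ∈ nb (map (keep Q) ts) x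
  nb-keep⁺ Q {ts} q p with nb⁻ p
  ... | t , i , refl = subst (_∈ _) (keep-true Q t q) (nb⁺ (∈-map⁺ (keep Q) i))

  keep-sym : ∀ (Q : X → X → Set) {ts} → (∀ {x y} → Q x y → Q y x) → Symmetricᵐ ts → Symmetricᵐ (map (keep Q) ts)
  keep-sym Q Q-sym s p with nb-keep⁻ Q p
  ... | inj₁ (q , i) = nb-keep⁺ Q (Q-sym q) (s i)
  ... | inj₂ refl = p

 module _ (𝒳 : BorelSpace) where
  private X = Point 𝒳
  open Measurability 𝒳

  pow-borel : ∀ n {ts} → All (BorelMap 𝒳 𝒳) ts → All (BorelMap 𝒳 𝒳) (pow n ts)
  pow-borel zero bs = bor-id {𝒳} ∷ []
  pow-borel (suc n) {ts} bs = All-tabulate λ i → go (∈-cartesianProductWith⁻ _ ts (pow n ts) i)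
   where
   go : ∀ {u} → ∃[ t ] ∃[ s ] t ∈ ts × s ∈ pow n ts × u ≡ t ∘ s → BorelMap 𝒳 𝒳 u
   go (t , s , j , k , refl) A a = All-lookup (pow-borel n bs) k (A ∘ t) (All-lookup bs j A a)

  keep-borel : ∀ (Q : X → X → Set) {ts} → (∀ {t} → BorelMap 𝒳 𝒳 t → Bor 𝒳 (λ x → Q x (t x))) →
   All (BorelMap 𝒳 𝒳) ts → All (BorelMap 𝒳 𝒳) (map (keep Q) ts)
  keep-borel Q q [] = []
  keep-borel Q q (_∷_ {t} b bs) = (λ A a → bor-⇔ 𝒳 (from A) (to A)
    (bor-∪ 𝒳 (bor-∩ 𝒳 (q {t} b) (b A a)) (bor-∩ 𝒳 (bor-∁ 𝒳 (q {t} b)) a))) ∷ keep-borel Q q bs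
   where
   from : ∀ (A : Pred X 0ℓ) x → (Q x (t x) × A (t x)) ⊎ (¬ Q x (t x) × A x) → A (keep Q t x)
   from A x c with dec (Q x (t x))
   from A x (inj₁ (_ , p)) | yes _ = p
   from A x (inj₂ (¬q , _)) | yes q = ⊥-elim (¬q q)
   from A x (inj₁ (q , _)) | no ¬q = ⊥-elim (¬q q)
   from A x (inj₂ (_ , p)) | no _ = p
   to : ∀ (A : Pred X 0ℓ) x → A (keep Q t x) → (Q x (t x) × A (t x)) ⊎ (¬ Q x (t x) × A x)
   to A x p with dec (Q x (t x))
   ... | yes q = inj₁ (q , p)
   ... | no ¬q = inj₂ (¬q , p)

  label-borel : ∀ {L} {{_ : Countable L}} {σ : X → L} (Q : L → L → Set) → Meas σ → ∀ {t} → BorelMap 𝒳 𝒳 t → Bor 𝒳 (λ x → Q (σ x) (σ (t x)))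
  label-borel Q m {t} b = meas-map₂ _,_ m (meas-∘ {f = t} b m) (λ (k , l) → Q k l)

 record Layering (𝒳 : BorelSpace) (ts : List (Point 𝒳 → Point 𝒳)) (s : ℕ) : Set₁ where
  field
   layer : Point 𝒳 → ℕ
   layer-meas : Measurability.Meas 𝒳 layer
   layer< : ∀ x → layer x < s
   components : FiniteOrbits (map (keep (λ x y → layer x ≡ layer y)) ts)

 -- Greedy colouring

 mex : (ns : List ℕ) → ∃[ m ] m ∉ ns × (∀ j → j < m → j ∈ ns)
 mex ns = let m , m∉ , min = least (_∉ ns) (unused ns) in
  m , m∉ , λ j j<m → by-contradiction λ j∉ → <⇒≱ j<m (min j j∉)
  where
  ∈⇒≤sum : ∀ {n} ns → n ∈ ns → n ≤ sum ns
  ∈⇒≤sum (n ∷ ns) (here refl) = m≤m+n n (sum ns)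
  ∈⇒≤sum (m ∷ ns) (there i) = ≤-trans (∈⇒≤sum ns i) (m≤n+m (sum ns) m)
  unused : ∀ ns → ∃[ m ] m ∉ ns
  unused ns = suc (sum ns) , λ i → 1+n≰n (∈⇒≤sum ns i)

 module Greedy (𝒳 : BorelSpace) {ts : List (Point 𝒳 → Point 𝒳)} (ts-borel : All (BorelMap 𝒳 𝒳) ts) (ts-sym : Symmetricᵐ ts)
  {s : ℕ} (lay : Layering 𝒳 ts s) where
  private X = Point 𝒳
  open Measurability 𝒳
  open Layering lay

  record Colours (Earlier : Pred X 0ℓ) (c : X → ℕ) (x : X) : Set where
   field
    proper : ∀ {y} → y ∈ nb ts x → y ≢ x → Earlier y → c y ≢ c x
    mexed : ∀ j → j < c x → ∃[ y ] y ∈ nb ts x × y ≢ x × Earlier y × c y ≡ j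
  open Colours

  colours-⇔ : ∀ {E E' c c' x} → (∀ {y} → y ∈ nb ts x → E y → E' y) → (∀ {y} → y ∈ nb ts x → y ≢ x → E' y → E y) →
   (∀ {y} → y ∈ nb ts x → E' y → c y ≡ c' y) → c x ≡ c' x → Colours E c x → Colours E' c' x
  colours-⇔ {E} {E'} {c} {c'} {x} E⊆E' E'⊆E c≡c' cx≡ col = record
   { proper = λ i y≢x e' eq → proper col i y≢x (E'⊆E i y≢x e') (trans (c≡c' i e') (trans eq (sym cx≡)))
   ; mexed = λ j j< → let y , i , y≢x , e , eq = mexed col j (subst (j <_) (sym cx≡) j<) in
     y , i , y≢x , E⊆E' i e , trans (sym (c≡c' i (E⊆E' i e))) eq }

  colours-borel : ∀ {Earlier c} → Bor 𝒳 Earlier → Meas c → Bor 𝒳 (Colours Earlier c)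
  colours-borel {Earlier} {c} e m = bor-⇔ 𝒳
   (λ x (p , q) → record
    { proper = λ {y} i → All-nb (λ y → y ≢ x → Earlier y → c y ≢ c x) ts i p
    ; mexed = λ j j< → let t , i , r = find (q j j<) in t x , nb⁺ i , r })
   (λ x col → All-tabulate (λ i → proper col (nb⁺ i)) , λ j j< → to x j (mexed col j j<))
   (bor-∩ 𝒳
    (bor-All 𝒳 ts (All-map (λ {t} b → bor-→ 𝒳 (bor-∁ 𝒳 (bor-≡ {𝒳} {𝒳} {t} {id} b (bor-id {𝒳}))) (bor-→ 𝒳 (b _ e)
     (meas-map₂ _,_ (meas-∘ {f = t} b m) m (λ (k , l) → k ≢ l)))) ts-borel))
    (bor-∀ℕ 𝒳 _ λ j → bor-→ 𝒳 (m (j <_)) (bor-Any 𝒳 ts (All-map (λ {t} b →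
     bor-∩ 𝒳 (bor-∁ 𝒳 (bor-≡ {𝒳} {𝒳} {t} {id} b (bor-id {𝒳}))) (bor-∩ 𝒳 (b _ e) (meas-∘ {f = t} b m (_≡ j)))) ts-borel))))
   where
   to : ∀ x j → ∃[ y ] y ∈ nb ts x × y ≢ x × Earlier y × c y ≡ j → Any (λ t → t x ≢ x × Earlier (t x) × c (t x) ≡ j) ts
   to x j (y , i , r) with nb⁻ i
   ... | t , k , refl = lose k r

  recolour : ℕ → (X → ℕ) → (X → ℕ) → X → ℕ
  recolour i c σ x = if ⟦ layer x ≡ i ⟧ then σ x else c x

  recolour-in : ∀ {i} c σ {x} → layer x ≡ i → recolour i c σ x ≡ σ x
  recolour-in c σ eq = if-yes eq

  recolour-out : ∀ {i} c σ {x} → layer x ≢ i → recolour i c σ x ≡ c x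
  recolour-out c σ ≢ = if-no ≢

  greedy-finite : ∀ i c (ys : List X) → ∃[ σ ] (∀ {y} → y ∈ ys → layer y ≡ i → Colours (λ z → layer z < i ⊎ layer z ≡ i × z ∈ ys) (recolour i c σ) y)
  greedy-finite i c [] = (λ _ → 0) , λ ()
  greedy-finite i c (y ∷ ys) with greedy-finite i c ys | dec (layer y ≡ i → y ∈ ys)
  ... | σ , ok | yes y∈ = σ , λ
   { (here refl) eq → grow (ok (y∈ eq) eq) ; (there j) eq → grow (ok j eq) }
   where
   grow : ∀ {x} → Colours (λ z → layer z < i ⊎ layer z ≡ i × z ∈ ys) (recolour i c σ) x → Colours (λ z → layer z < i ⊎ layer z ≡ i × z ∈ y ∷ ys) (recolour i c σ) x
   grow = colours-⇔ (λ { _ (inj₁ lt) → inj₁ lt ; _ (inj₂ (eq , j)) → inj₂ (eq , there j) })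
    (λ { _ _ (inj₁ lt) → inj₁ lt ; _ _ (inj₂ (eq , here refl)) → inj₂ (eq , y∈ eq) ; _ _ (inj₂ (eq , there j)) → inj₂ (eq , j) }) (λ _ _ → refl) refl
  ... | σ , ok | no ¬y∈ = σ' , good
   where
   y∉ : y ∉ ys
   y∉ j = ¬y∈ λ _ → j
   layer-y : layer y ≡ i
   layer-y = by-contradiction λ ≢ → ¬y∈ λ eq → ⊥-elim (≢ eq)
   Old : Pred X 0ℓ
   Old z = layer z < i ⊎ layer z ≡ i × z ∈ ys
   used : (X → X) → List ℕ
   used t = if ⟦ t y ≢ y × Old (t y) ⟧ then recolour i c σ (t y) ∷ [] else []
   used⁻ : ∀ t {j} → j ∈ used t → t y ≢ y × Old (t y) × recolour i c σ (t y) ≡ j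
   used⁻ t j∈ with dec (t y ≢ y × Old (t y))
   used⁻ t (here refl) | yes (≢ , old) = ≢ , old , refl
   used⁻ t () | no _
   used⁺ : ∀ t → t y ≢ y → Old (t y) → recolour i c σ (t y) ∈ used t
   used⁺ t ≢ old = subst (λ b → recolour i c σ (t y) ∈ (if b then recolour i c σ (t y) ∷ [] else [])) (sym (⟦⟧⁺ (≢ , old))) (here refl)
   m = proj₁ (mex (concatMap used ts))
   m∉ = proj₁ (proj₂ (mex (concatMap used ts)))
   below = proj₂ (proj₂ (mex (concatMap used ts)))
   σ' : X → ℕ
   σ' z = if ⟦ z ≡ y ⟧ then m else σ z
   σ'-y : σ' y ≡ m
   σ'-y = if-yes refl
   σ'-other : ∀ {z} → z ≢ y → σ' z ≡ σ z
   σ'-other ≢ = if-no ≢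
   same : ∀ {z} → z ≢ y → recolour i c σ' z ≡ recolour i c σ z
   same {z} z≢y = cong (λ n → if ⟦ layer z ≡ i ⟧ then n else c z) (σ'-other z≢y)
   fresh : ∀ {z} → z ∈ nb ts y → z ≢ y → Old z → recolour i c σ z ≢ m
   fresh z∈ z≢y old eq with nb⁻ z∈
   ... | t , j , refl = m∉ (subst (_∈ concatMap used ts) eq (∈-concat⁺′ (used⁺ t z≢y old) (∈-map⁺ used j)))
   New : Pred X 0ℓ
   New z = layer z < i ⊎ layer z ≡ i × z ∈ y ∷ ys
   older : ∀ {z} → z ≢ y → New z → Old z
   older z≢y (inj₁ lt) = inj₁ lt
   older z≢y (inj₂ (_ , here z≡y)) = ⊥-elim (z≢y z≡y)
   older z≢y (inj₂ (eq , there j)) = inj₂ (eq , j)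
   newer : ∀ {z} → Old z → New z
   newer (inj₁ lt) = inj₁ lt
   newer (inj₂ (eq , j)) = inj₂ (eq , there j)
   good : ∀ {x} → x ∈ y ∷ ys → layer x ≡ i → Colours New (recolour i c σ') x
   good (here refl) eq = record
    { proper = λ z∈ z≢y new eq' → fresh z∈ z≢y (older z≢y new)
      (trans (sym (same z≢y)) (trans eq' (trans (recolour-in c σ' eq) σ'-y)))
    ; mexed = λ j j< → attained j (below j (subst (j <_) (trans (recolour-in c σ' eq) σ'-y) j<)) }
    where
    attained : ∀ j → j ∈ concatMap used ts → ∃[ z ] z ∈ nb ts y × z ≢ y × New z × recolour i c σ' z ≡ j
    attained j j∈ with ∈-concat⁻′ (map used ts) j∈
    ... | _ , k , l with ∈-map⁻ used l
    ... | t , t∈ , refl with used⁻ t k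
    ... | ≢ , old , refl = t y , nb⁺ t∈ , ≢ , newer old , same ≢
   good {x} (there k) eq = record
    { proper = λ {z} z∈ z≢x new → proper-old z∈ z≢x new (dec (z ≡ y))
    ; mexed = λ j j< → let z , z∈ , z≢x , old , eq' = mexed old-col j (subst (j <_) (same x≢y) j<) in
      z , z∈ , z≢x , newer old , trans (same (old≢y old)) eq' }
    where
    old-col = ok k eq
    x≢y : x ≢ y
    x≢y refl = y∉ k
    old≢y : ∀ {z} → Old z → z ≢ y
    old≢y (inj₁ lt) refl = <⇒≢ lt layer-y
    old≢y (inj₂ (_ , j)) refl = y∉ j
    proper-old : ∀ {z} → z ∈ nb ts x → z ≢ x → New z → Dec (z ≡ y) → recolour i c σ' z ≢ recolour i c σ' x
    proper-old z∈ z≢x new (no z≢y) eq' = proper old-col z∈ z≢x (older z≢y new) (trans (sym (same z≢y)) (trans eq' (same x≢y)))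
    proper-old z∈ z≢x new (yes refl) eq' = fresh (ts-sym z∈) (z≢x ∘ sym) (inj₂ (eq , k))
     (trans (sym (same x≢y)) (trans (sym eq') (trans (recolour-in c σ' layer-y) σ'-y)))

  private
   Q : X → X → Set
   Q x y = layer x ≡ layer y

  extend-layer : ∀ i c → Meas c → (∀ x → layer x < i → Colours (λ z → layer z < i) c x) →
   ∃[ c' ] Meas c' × (∀ x → layer x < suc i → Colours (λ z → layer z < suc i) c' x)
  extend-layer i c c-meas old =
   let σ , σ-meas , good = select 𝒳 ℕ-enumerable (keep-borel 𝒳 Q (label-borel 𝒳 _≡_ layer-meas) ts-borel)
        (keep-sym Q sym ts-sym) components Good
        (λ σ m → bor-→ 𝒳 (layer-meas (_≡ i)) (colours-borel (layer-meas (_< suc i)) (recolour-meas m)))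
        good-local exists
   in recolour i c σ , recolour-meas σ-meas , λ x lt → new σ good x (m≤n⇒m<n∨m≡n (≤-pred lt))
   where
   Good : (X → ℕ) → X → Set
   Good σ x = layer x ≡ i → Colours (λ z → layer z < suc i) (recolour i c σ) x
   recolour-meas : ∀ {σ} → Meas σ → Meas (recolour i c σ)
   recolour-meas m = meas-if (layer-meas (_≡ i)) m c-meas
   keep-orb : ∀ {x y} → layer x ≡ layer y → y ∈ nb ts x → Orb (map (keep Q) ts) x y
   keep-orb eq j = nb-keep⁺ Q eq j ◅ stop
   good-local : ∀ σ τ x → (∀ y → Orb (map (keep Q) ts) x y → σ y ≡ τ y) → Good σ x → Good τ x
   good-local σ τ x agree good eq = colours-⇔ (λ _ → id) (λ _ _ → id) (λ {y} j _ → same y j (dec (layer y ≡ i))) (recoloured x eq stop) (good eq)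
    where
    recoloured : ∀ y → layer y ≡ i → Orb (map (keep Q) ts) x y → recolour i c σ y ≡ recolour i c τ y
    recoloured y e o = trans (recolour-in c σ e) (trans (agree y o) (sym (recolour-in c τ e)))
    same : ∀ y → y ∈ nb ts x → Dec (layer y ≡ i) → recolour i c σ y ≡ recolour i c τ y
    same y j (yes e) = recoloured y e (keep-orb (trans eq (sym e)) j)
    same y j (no ≢) = trans (recolour-out c σ ≢) (sym (recolour-out c τ ≢))
   exists : ∀ x → ∃[ σ ] (∀ y → Orb (map (keep Q) ts) x y → Good σ y)
   exists x = let ys , orb⊆ = components x ; σ , ok = greedy-finite i c ys in
    σ , λ y o eq → colours-⇔
     (λ { _ (inj₁ lt) → m≤n⇒m≤1+n lt ; _ (inj₂ (e , _)) → s≤s (≤-reflexive e) })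
     (λ {z} j _ lt → [ inj₁ , (λ e → inj₂ (e , orb⊆ z (o ◅◅ keep-orb (trans eq (sym e)) j))) ]′ (m≤n⇒m<n∨m≡n (≤-pred lt)))
     (λ _ _ → refl) refl (ok (orb⊆ y o) eq)
   new : ∀ σ → (∀ x → Good σ x) → ∀ x → layer x < i ⊎ layer x ≡ i → Colours (λ z → layer z < suc i) (recolour i c σ) x
   new σ good x (inj₂ eq) = good x eq
   new σ good x (inj₁ lt) = record
    { proper = λ {y} j y≢x lt' eq → proper-new j y≢x (m≤n⇒m<n∨m≡n (≤-pred lt')) eq
    ; mexed = λ j j< → let y , k , y≢x , lt' , eq = mexed (old x lt) j (subst (j <_) (out lt) j<) in
      y , k , y≢x , m≤n⇒m≤1+n lt' , trans (out lt') eq }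
    where
    out : ∀ {y} → layer y < i → recolour i c σ y ≡ c y
    out lt = recolour-out c σ (<⇒≢ lt)
    proper-new : ∀ {y} → y ∈ nb ts x → y ≢ x → layer y < i ⊎ layer y ≡ i → recolour i c σ y ≢ recolour i c σ x
    proper-new j y≢x (inj₁ lt') eq = proper (old x lt) j y≢x lt' (trans (sym (out lt')) (trans eq (out lt)))
    proper-new {y} j y≢x (inj₂ e) eq = proper (good y e) (ts-sym j) (y≢x ∘ sym) (m≤n⇒m≤1+n lt) (sym eq)

  greedy : ∃[ c ] Meas c × (∀ x {y} → y ∈ nb ts x → y ≢ x → c y ≢ c x) × (∀ x j → j < c x → ∃[ y ] y ∈ nb ts x × y ≢ x × c y ≡ j)
  greedy = let c , m , col = go s in c , m , (λ x i y≢x → proper (col x (layer< x)) i y≢x (layer< _))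
    , λ x j j< → let y , i , y≢x , _ , eq = mexed (col x (layer< x)) j j< in y , i , y≢x , eq
   where
   go : ∀ i → ∃[ c ] Meas c × (∀ x → layer x < i → Colours (λ z → layer z < i) c x)
   go zero = (λ _ → 0) , meas-const 0 , λ _ ()
   go (suc i) = let c , m , col = go i in extend-layer i c m col

 module _ {A : Set} where

  uniq : List A → List A
  uniq [] = []
  uniq (x ∷ xs) = if ⟦ x ∈ xs ⟧ then uniq xs else x ∷ uniq xs

  uniq-∈⁺ : ∀ {xs x} → x ∈ xs → x ∈ uniq xs
  uniq-∈⁺ {y ∷ xs} i with dec (y ∈ xs)
  uniq-∈⁺ (here refl) | yes j = uniq-∈⁺ j
  uniq-∈⁺ (there i) | yes j = uniq-∈⁺ i
  uniq-∈⁺ (here refl) | no _ = here refl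
  uniq-∈⁺ (there i) | no _ = there (uniq-∈⁺ i)

  uniq-∈⁻ : ∀ {xs x} → x ∈ uniq xs → x ∈ xs
  uniq-∈⁻ {y ∷ xs} i with dec (y ∈ xs)
  uniq-∈⁻ i | yes j = there (uniq-∈⁻ i)
  uniq-∈⁻ (here refl) | no _ = here refl
  uniq-∈⁻ (there i) | no _ = there (uniq-∈⁻ i)

  uniq-unique : ∀ xs → Unique (uniq xs)
  uniq-unique [] = []
  uniq-unique (x ∷ xs) with dec (x ∈ xs)
  ... | yes _ = uniq-unique xs
  ... | no x∉ = All-tabulate (λ { i refl → x∉ (uniq-∈⁻ i) }) ∷ uniq-unique xs

  length-⊆ : ∀ {xs ys : List A} → Unique xs → (∀ {x} → x ∈ xs → x ∈ ys) → length xs ≤ length ys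
  length-⊆ [] ⊆ = z≤n
  length-⊆ {x ∷ xs} (x∉ ∷ u) ⊆ with ∈-∃++ (⊆ (here refl))
  ... | as , bs , refl = subst (suc (length xs) ≤_) (sym (trans (Listₚ.length-++ as) (+-suc (length as) (length bs))))
   (s≤s (subst (length xs ≤_) (Listₚ.length-++ as) (length-⊆ u λ i → drop i (∈-++⁻ as (⊆ (there i))))))
   where
   drop : ∀ {y} → y ∈ xs → y ∈ as ⊎ y ∈ x ∷ bs → y ∈ as ++ bs
   drop i (inj₁ j) = ∈-++⁺ˡ j
   drop i (inj₂ (here refl)) = ⊥-elim (All-lookup x∉ i refl)
   drop i (inj₂ (there j)) = ∈-++⁺ʳ as j

  select-list : Pred A 0ℓ → List A → List A
  select-list P = filter (λ x → dec (P x))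

  length-split : ∀ (P : Pred A 0ℓ) xs → length (select-list P xs) + length (select-list (λ x → ¬ P x) xs) ≡ length xs
  length-split P [] = refl
  length-split P (x ∷ xs) with dec (P x) | dec (¬ P x)
  ... | yes p | yes ¬p = ⊥-elim (¬p p)
  ... | yes p | no _ = cong suc (length-split P xs)
  ... | no _ | yes _ = trans (+-suc _ _) (cong suc (length-split P xs))
  ... | no ¬p | no ¬¬p = ⊥-elim (¬¬p ¬p)

 -- Partial two-colourings and finite sums over their extensions

 data Sign : Set where
  unset plus minus : Sign

 Sign-enumerable : Enumerable Sign
 Sign-enumerable = record { enum = λ { 0 → unset ; 1 → plus ; (suc (suc _)) → minus } ; enum-surjective = λ { unset → 0 , refl ; plus → 1 , refl ; minus → 2 , refl } }

 instance
  Sign-countable : Countable Sign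
  Sign-countable = record { bor-∃ = λ 𝒳 B b → bor-⇔ 𝒳
   (λ { x (inj₁ p) → unset , p ; x (inj₂ (inj₁ p)) → plus , p ; x (inj₂ (inj₂ p)) → minus , p })
   (λ { x (unset , p) → inj₁ p ; x (plus , p) → inj₂ (inj₁ p) ; x (minus , p) → inj₂ (inj₂ p) })
   (bor-∪ 𝒳 (b unset) (bor-∪ 𝒳 (b plus) (b minus))) }

 ind : Bool → ℕ
 ind true = 1
 ind false = 0

 ind-∧ : ∀ a b → ind (a ∧ b) ≡ ind a * ind b
 ind-∧ true b = sym (+-identityʳ (ind b))
 ind-∧ false b = refl

 module _ {X : Set} where

  State : Set
  State = X → Sign

  _[_≔_] : State → X → Sign → State
  (x [ y ≔ s ]) z = if ⟦ z ≡ y ⟧ then s else x z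

  update-here : ∀ x y s → (x [ y ≔ s ]) y ≡ s
  update-here x y s = if-yes refl

  update-there : ∀ x {y z} s → z ≢ y → (x [ y ≔ s ]) z ≡ x z
  update-there x s z≢y = if-no z≢y

  DependsOn : {L : Set} → (State → L) → Pred X 0ℓ → Set
  DependsOn F S = ∀ x x' → (∀ z → S z → x z ≡ x' z) → F x ≡ F x'

  Harmonic : (State → ℕ) → Set
  Harmonic F = ∀ x y → F (x [ y ≔ plus ]) + F (x [ y ≔ minus ]) ≡ 2 * F (x [ y ≔ unset ])

  update-agree : ∀ {S : Pred X 0ℓ} {x x'} y s → (∀ z → S z → x z ≡ x' z) → ∀ z → S z → (x [ y ≔ s ]) z ≡ (x' [ y ≔ s ]) z
  update-agree y s agree z Sz with dec (z ≡ y)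
  ... | yes _ = refl
  ... | no _ = agree z Sz

  total : List X → (State → ℕ) → State → ℕ
  total [] F x = F x
  total (y ∷ ys) F x = total ys F (x [ y ≔ plus ]) + total ys F (x [ y ≔ minus ])

  total-mono : ∀ ys {F G} → (∀ x → F x ≤ G x) → ∀ x → total ys F x ≤ total ys G x
  total-mono [] F≤G x = F≤G x
  total-mono (y ∷ ys) F≤G x = +-mono-≤ (total-mono ys F≤G _) (total-mono ys F≤G _)

  total-cong : ∀ ys {F G} → (∀ x → F x ≡ G x) → ∀ x → total ys F x ≡ total ys G x
  total-cong ys eq x = ≤-antisym (total-mono ys (≤-reflexive ∘ eq) x) (total-mono ys (≤-reflexive ∘ sym ∘ eq) x)

  total-+ : ∀ ys F G x → total ys (λ x → F x + G x) x ≡ total ys F x + total ys G x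
  total-+ [] F G x = refl
  total-+ (y ∷ ys) F G x = trans (cong₂ _+_ (total-+ ys F G _) (total-+ ys F G _))
   (rearrange (total ys F (x [ y ≔ plus ])) (total ys G (x [ y ≔ plus ])) (total ys F (x [ y ≔ minus ])) (total ys G (x [ y ≔ minus ])))
   where
   rearrange : ∀ a b c d → a + b + (c + d) ≡ a + c + (b + d)
   rearrange = solve-∀

  total-const : ∀ ys c x → total ys (λ _ → c) x ≡ 2 ^ length ys * c
  total-const [] c x = sym (+-identityʳ c)
  total-const (y ∷ ys) c x = trans (cong₂ _+_ (total-const ys c _) (total-const ys c _)) (double (2 ^ length ys) c)
   where
   double : ∀ a c → a * c + a * c ≡ 2 * a * c
   double = solve-∀

  total-* : ∀ ys c F x → total ys (λ x → c * F x) x ≡ c * total ys F x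
  total-* [] c F x = refl
  total-* (y ∷ ys) c F x = trans (cong₂ _+_ (total-* ys c F _) (total-* ys c F _)) (sym (*-distribˡ-+ c _ _))

  total-depends : ∀ ys {F S} → DependsOn F S → DependsOn (total ys F) S
  total-depends [] dep = dep
  total-depends (y ∷ ys) dep x x' agree = cong₂ _+_
   (total-depends ys dep _ _ (update-agree y plus agree)) (total-depends ys dep _ _ (update-agree y minus agree))

  total-harmonic : ∀ ys {F S} → Unique ys → Harmonic F → DependsOn F S → ∀ x → (∀ {y} → y ∈ ys → x y ≡ unset) → total ys F x ≡ 2 ^ length ys * F x
  total-harmonic [] {F} _ _ _ x _ = sym (+-identityʳ (F x))
  total-harmonic (y ∷ ys) {F} (y∉ ∷ u) har dep x x-unset = begin
   total ys F (x [ y ≔ plus ]) + total ys F (x [ y ≔ minus ]) ≡⟨ cong₂ _+_ (rec plus) (rec minus) ⟩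
   2 ^ length ys * F (x [ y ≔ plus ]) + 2 ^ length ys * F (x [ y ≔ minus ]) ≡⟨ sym (*-distribˡ-+ (2 ^ length ys) _ _) ⟩
   2 ^ length ys * (F (x [ y ≔ plus ]) + F (x [ y ≔ minus ])) ≡⟨ cong (2 ^ length ys *_) (har x y) ⟩
   2 ^ length ys * (2 * F (x [ y ≔ unset ])) ≡⟨ cong (λ a → 2 ^ length ys * (2 * a)) (dep _ _ λ z _ → same z (dec (z ≡ y))) ⟩
   2 ^ length ys * (2 * F x) ≡⟨ swap (2 ^ length ys) (F x) ⟩
   2 ^ suc (length ys) * F x ∎
   where
   open ≡-Reasoning
   rec : ∀ s → total ys F (x [ y ≔ s ]) ≡ 2 ^ length ys * F (x [ y ≔ s ])
   rec s = total-harmonic ys u har dep (x [ y ≔ s ]) λ {z} i →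
    trans (update-there x s (λ { refl → All-lookup y∉ i refl })) (x-unset (there i))
   same : ∀ z → Dec (z ≡ y) → (x [ y ≔ unset ]) z ≡ x z
   same z (yes refl) = trans (update-here x y unset) (sym (x-unset (here refl)))
   same z (no z≢y) = update-there x unset z≢y
   swap : ∀ a b → a * (2 * b) ≡ 2 * a * b
   swap = solve-∀

  total-independent : ∀ ys {F G S T} → DependsOn F S → DependsOn G T → (∀ {y} → y ∈ ys → S y → ¬ T y) →
   ∀ x → 2 ^ length ys * total ys (λ x → F x * G x) x ≡ total ys F x * total ys G x
  total-independent [] _ _ _ x = +-identityʳ _
  total-independent (y ∷ ys) {F} {G} {S} {T} dF dG apart x = by-cases (dec (S y))
   where
   f = λ s → total ys F (x [ y ≔ s ])
   g = λ s → total ys G (x [ y ≔ s ])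
   p = λ s → total ys (λ x → F x * G x) (x [ y ≔ s ])
   rec : ∀ s → 2 ^ length ys * p s ≡ f s * g s
   rec s = total-independent ys dF dG (apart ∘ there) (x [ y ≔ s ])
   off : ∀ {U : Pred X 0ℓ} → ¬ U y → ∀ z → U z → (x [ y ≔ plus ]) z ≡ (x [ y ≔ minus ]) z
   off ¬U z Uz = trans (update-there x plus (λ { refl → ¬U Uz })) (sym (update-there x minus (λ { refl → ¬U Uz })))
   by-cases : Dec (S y) → 2 ^ suc (length ys) * (p plus + p minus) ≡ (f plus + f minus) * (g plus + g minus)
   by-cases d = begin
    2 ^ suc (length ys) * (p plus + p minus) ≡⟨ distr (2 ^ length ys) (p plus) (p minus) ⟩
    2 * (2 ^ length ys * p plus + 2 ^ length ys * p minus) ≡⟨ cong (2 *_) (cong₂ _+_ (rec plus) (rec minus)) ⟩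
    2 * (f plus * g plus + f minus * g minus) ≡⟨ final d ⟩
    (f plus + f minus) * (g plus + g minus) ∎
    where
    open ≡-Reasoning
    distr : ∀ a b c → 2 * a * (b + c) ≡ 2 * (a * b + a * c)
    distr = solve-∀
    left : ∀ a b c → 2 * (a * b + a * c) ≡ (a + a) * (b + c)
    left = solve-∀
    right : ∀ a b c → 2 * (a * c + b * c) ≡ (a + b) * (c + c)
    right = solve-∀
    final : Dec (S y) → 2 * (f plus * g plus + f minus * g minus) ≡ (f plus + f minus) * (g plus + g minus)
    final (no ¬S) with total-depends ys dF _ _ (off {S} ¬S)
    ... | eq rewrite eq = left (f minus) (g plus) (g minus)
    final (yes Sy) with total-depends ys dG _ _ (off {T} (apart (here refl) Sy))
    ... | eq rewrite eq = right (f plus) (f minus) (g minus)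

  total-witness : ∀ ys F x → 0 < total ys F x → ∃[ x' ] 0 < F x' × (∀ {z} → z ∉ ys → x' z ≡ x z) × (∀ {z} → z ∈ ys → x' z ≢ unset)
  total-witness [] F x 0< = x , 0< , (λ _ → refl) , λ ()
  total-witness (y ∷ ys) F x 0< = pick (total ys F (x [ y ≔ plus ])) refl
   where
   from : ∀ s → s ≢ unset → 0 < total ys F (x [ y ≔ s ]) → ∃[ x' ] 0 < F x' × (∀ {z} → z ∉ y ∷ ys → x' z ≡ x z) × (∀ {z} → z ∈ y ∷ ys → x' z ≢ unset)
   from s s≢ pos = let x' , p , off , on = total-witness ys F (x [ y ≔ s ]) pos in
    x' , p , (λ z∉ → trans (off (z∉ ∘ there)) (update-there x s (z∉ ∘ here))) , λ {z} i → set x' off on z i (dec (z ∈ ys))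
    where
    set : ∀ x' → (∀ {z} → z ∉ ys → x' z ≡ (x [ y ≔ s ]) z) → (∀ {z} → z ∈ ys → x' z ≢ unset) → ∀ z → z ∈ y ∷ ys → Dec (z ∈ ys) → x' z ≢ unset
    set x' off on z i (yes j) = on j
    set x' off on z (here refl) (no j) eq = s≢ (trans (sym (update-here x z s)) (trans (sym (off j)) eq))
    set x' off on z (there i) (no j) = ⊥-elim (j i)
   pick : ∀ n → total ys F (x [ y ≔ plus ]) ≡ n → ∃[ x' ] 0 < F x' × (∀ {z} → z ∉ y ∷ ys → x' z ≡ x z) × (∀ {z} → z ∈ y ∷ ys → x' z ≢ unset)
   pick (suc n) eq = from plus (λ ()) (subst (0 <_) (sym eq) (s≤s z≤n))
   pick zero eq = from minus (λ ()) (subst (λ n → 0 < n + total ys F (x [ y ≔ minus ])) eq 0<)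

  -- The Lovász local lemma, for the uniform measure on the extensions of x₀ to ys
  module LocalLemma (ys : List X) (x₀ : State) {V : Set} (bad : V → State → Bool) (Var : V → Pred X 0ℓ)
   (bad-depends : ∀ v → DependsOn (bad v) (Var v)) (d : ℕ) (0<d : 0 < d)
   (unlikely : ∀ v → 4 * d * total ys (λ x → ind (bad v x)) x₀ ≤ 2 ^ length ys)
   (sparse : ∀ v (S : List V) → Unique S → All (λ u → ∃[ y ] y ∈ ys × Var u y × Var v y) S → length S ≤ d) where

   none : List V → State → Bool
   none [] x = true
   none (v ∷ S) x = not (bad v x) ∧ none S x

   N : (State → Bool) → ℕ
   N P = total ys (λ x → ind (P x)) x₀

   none-⊆ : ∀ {S S'} x → (∀ {v} → v ∈ S' → v ∈ S) → none S x ≡ true → none S' x ≡ true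
   none-⊆ {S} {[]} x ⊆ eq = refl
   none-⊆ {S} {v ∷ S'} x ⊆ eq = cong₂ _∧_ (member S (⊆ (here refl)) eq) (none-⊆ {S} {S'} x (⊆ ∘ there) eq)
    where
    member : ∀ S {v} → v ∈ S → none S x ≡ true → not (bad v x) ≡ true
    member (u ∷ S) i eq with bad u x in eqᵤ
    member (u ∷ S) (here refl) eq | false = cong not eqᵤ
    member (u ∷ S) (there i) eq | false = member S i eq

   none-depends : ∀ S {T : Pred X 0ℓ} → All (λ u → ∀ z → Var u z → T z) S → DependsOn (none S) T
   none-depends [] _ x x' _ = refl
   none-depends (v ∷ S) (⊆ ∷ ⊆s) x x' agree =
    cong₂ (λ a b → not a ∧ b) (bad-depends v x x' λ z p → agree z (⊆ z p)) (none-depends S ⊆s x x' agree)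

   N-mono : ∀ {P Q : State → Bool} → (∀ x → P x ≡ true → Q x ≡ true) → N P ≤ N Q
   N-mono {P} {Q} imp = total-mono ys (λ x → pointwise (P x) (Q x) (imp x)) x₀
    where
    pointwise : ∀ a b → (a ≡ true → b ≡ true) → ind a ≤ ind b
    pointwise false b _ = z≤n
    pointwise true b f rewrite f refl = ≤-refl

   N-split : ∀ v S → N (none S) ≡ N (none (v ∷ S)) + N (λ x → bad v x ∧ none S x)
   N-split v S = trans (total-cong ys (λ x → pointwise (bad v x) (none S x)) x₀) (total-+ ys _ _ x₀)
    where
    pointwise : ∀ a b → ind b ≡ ind (not a ∧ b) + ind (a ∧ b)
    pointwise true b = refl
    pointwise false b = sym (+-identityʳ (ind b))

   union-bound : ∀ S₁ S₂ → N (none S₂) ≤ N (none (S₁ ++ S₂)) + sum (map (λ u → N (λ x → bad u x ∧ none S₂ x)) S₁)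
   union-bound [] S₂ = m≤m+n _ 0
   union-bound (u ∷ S₁) S₂ = ≤-trans (union-bound S₁ S₂) (≤-trans (+-monoˡ-≤ _ (≤-trans (≤-reflexive (N-split u (S₁ ++ S₂)))
     (+-monoʳ-≤ _ (N-mono λ x → weaken x (bad u x))))) (≤-reflexive (+-assoc (N (none (u ∷ S₁ ++ S₂))) _ _)))
    where
    weaken : ∀ x b → b ∧ none (S₁ ++ S₂) x ≡ true → b ∧ none S₂ x ≡ true
    weaken x true = none-⊆ {S₁ ++ S₂} {S₂} x (∈-++⁺ʳ S₁)

   sum-bound : ∀ (f : V → ℕ) c S → (∀ {u} → u ∈ S → 2 * d * f u ≤ c) → 2 * d * sum (map f S) ≤ length S * c
   sum-bound f c [] h = ≤-reflexive (*-zeroʳ (2 * d))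
   sum-bound f c (u ∷ S) h = ≤-trans (≤-reflexive (*-distribˡ-+ (2 * d) (f u) _)) (+-mono-≤ (h (here refl)) (sum-bound f c S (h ∘ there)))

   module _ (v : V) (S : List V) where
    Meets : V → Set
    Meets u = ∃[ y ] y ∈ ys × Var u y × Var v y
    S₁ = select-list Meets S
    S₂ = select-list (λ u → ¬ Meets u) S

    independent : 4 * d * N (λ x → bad v x ∧ none S₂ x) ≤ N (none S₂)
    independent = *-cancelˡ-≤ (2 ^ length ys) {{m^n≢0 2 (length ys)}} (begin
     2 ^ length ys * (4 * d * N (λ x → bad v x ∧ none S₂ x))
      ≡⟨ swap (2 ^ length ys) (4 * d) _ ⟩
     4 * d * (2 ^ length ys * N (λ x → bad v x ∧ none S₂ x))
      ≡⟨ cong (λ n → 4 * d * (2 ^ length ys * n)) (total-cong ys (λ x → ind-∧ (bad v x) (none S₂ x)) x₀) ⟩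
     4 * d * (2 ^ length ys * total ys (λ x → ind (bad v x) * ind (none S₂ x)) x₀)
      ≡⟨ cong (4 * d *_) (total-independent ys {S = Var v} {T = λ z → ∃[ u ] u ∈ S₂ × Var u z}
         (λ x x' agree → cong ind (bad-depends v x x' agree))
         (λ x x' agree → cong ind (none-depends S₂ (All-tabulate λ i z p → _ , i , p) x x' agree))
         (λ { y∈ p (u , i , q) → proj₂ (∈-filter⁻ (λ u → dec (¬ Meets u)) {xs = S} i) (_ , y∈ , q , p) }) x₀) ⟩
     4 * d * (N (bad v) * N (none S₂))
      ≡⟨ sym (*-assoc (4 * d) (N (bad v)) _) ⟩
     4 * d * N (bad v) * N (none S₂)
      ≤⟨ *-monoˡ-≤ (N (none S₂)) (unlikely v) ⟩
     2 ^ length ys * N (none S₂) ∎)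
     where
     open ≤-Reasoning
     swap : ∀ a b c → a * (b * c) ≡ b * (a * c)
     swap = solve-∀

   few-bad : ∀ k S v → length S ≤ k → Unique S → 2 * d * N (λ x → bad v x ∧ none S x) ≤ N (none S)
   few-bad k S v len u = *-cancelˡ-≤ 2 (begin
    2 * (2 * d * N (λ x → bad v x ∧ none S x)) ≡⟨ four d (N (λ x → bad v x ∧ none S x)) ⟩
    4 * d * N (λ x → bad v x ∧ none S x) ≤⟨ *-monoʳ-≤ (4 * d) (N-mono λ x → weaken x (bad v x)) ⟩
    4 * d * N (λ x → bad v x ∧ none (S₂ v S) x) ≤⟨ independent v S ⟩
    N (none (S₂ v S)) ≤⟨ ratio ⟩
    2 * N (none S) ∎)
    where
    open ≤-Reasoning
    four : ∀ d n → 2 * (2 * d * n) ≡ 4 * d * n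
    four = solve-∀
    two : ∀ d n → 2 * d * n ≡ d * n + d * n
    two = solve-∀
    weaken : ∀ x b → b ∧ none S x ≡ true → b ∧ none (S₂ v S) x ≡ true
    weaken x true = none-⊆ {S} {S₂ v S} x (λ i → proj₁ (∈-filter⁻ (λ u → dec (¬ Meets v S u)) i))
    rest : ∀ k → length S ≤ k → ∀ {w} → w ∈ S₁ v S → 2 * d * N (λ x → bad w x ∧ none (S₂ v S) x) ≤ N (none (S₂ v S))
    shorter : ∀ {w} → w ∈ S₁ v S → suc (length (S₂ v S)) ≤ length S
    shorter i = subst (suc (length (S₂ v S)) ≤_) (length-split (Meets v S) S) (+-monoˡ-≤ (length (S₂ v S)) (nonempty i))
     where
     nonempty : ∀ {w} {T : List V} → w ∈ T → 1 ≤ length T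
     nonempty (here _) = s≤s z≤n
     nonempty (there _) = s≤s z≤n
    rest zero len i = ⊥-elim (<⇒≱ (≤-trans (s≤s z≤n) (shorter i)) len)
    rest (suc k) len i = few-bad k (S₂ v S) _ (≤-pred (≤-trans (shorter i) len)) (Unique-filter (λ u → dec (¬ Meets v S u)) u)
    ratio : N (none (S₂ v S)) ≤ 2 * N (none S)
    ratio = *-cancelˡ-≤ d {{>-nonZero 0<d}} (+-cancelʳ-≤ (d * N (none (S₂ v S))) _ _ (begin
     d * N (none (S₂ v S)) + d * N (none (S₂ v S)) ≡⟨ sym (two d _) ⟩
     2 * d * N (none (S₂ v S)) ≤⟨ *-monoʳ-≤ (2 * d) (union-bound (S₁ v S) (S₂ v S)) ⟩
     2 * d * (N (none (S₁ v S ++ S₂ v S)) + Σbad) ≡⟨ *-distribˡ-+ (2 * d) _ Σbad ⟩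
     2 * d * N (none (S₁ v S ++ S₂ v S)) + 2 * d * Σbad
      ≤⟨ +-mono-≤ (*-monoʳ-≤ (2 * d) (N-mono λ x → none-⊆ {S₁ v S ++ S₂ v S} {S} x cover))
              (≤-trans (sum-bound _ _ (S₁ v S) (rest k len)) (*-monoˡ-≤ _ few)) ⟩
     2 * d * N (none S) + d * N (none (S₂ v S)) ≡⟨ cong (_+ d * N (none (S₂ v S))) (assoc d (N (none S))) ⟩
     d * (2 * N (none S)) + d * N (none (S₂ v S)) ∎))
     where
     Σbad = sum (map (λ u → N (λ x → bad u x ∧ none (S₂ v S) x)) (S₁ v S))
     assoc : ∀ d n → 2 * d * n ≡ d * (2 * n)
     assoc = solve-∀
     few : length (S₁ v S) ≤ d
     few = sparse v (S₁ v S) (Unique-filter (λ u → dec (Meets v S u)) u) (All-tabulate λ i → proj₂ (∈-filter⁻ (λ u → dec (Meets v S u)) {xs = S} i))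
     cover : ∀ {w} → w ∈ S → w ∈ S₁ v S ++ S₂ v S
     cover {w} i with dec (Meets v S w)
     ... | yes p = ∈-++⁺ˡ (∈-filter⁺ (λ u → dec (Meets v S u)) i p)
     ... | no ¬p = ∈-++⁺ʳ (S₁ v S) (∈-filter⁺ (λ u → dec (¬ Meets v S u)) i ¬p)

   positive : ∀ S → Unique S → 0 < N (none S)
   positive [] _ = subst (0 <_) (sym (trans (total-const ys 1 x₀) (*-identityʳ _))) (m^n>0 2 (length ys))
   positive (v ∷ S) (_ ∷ u) = ≰⇒> λ zero≥ →
    let n = N (none S)
        eq : N (λ x → bad v x ∧ none S x) ≡ n
        eq = sym (trans (N-split v S) (cong (_+ N (λ x → bad v x ∧ none S x)) (n≤0⇒n≡0 zero≥)))
        2n≤n : n + n ≤ n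
        2n≤n = ≤-trans (≤-trans (≤-reflexive (double n)) (*-monoˡ-≤ n (*-monoʳ-≤ 2 0<d)))
         (subst (λ m → 2 * d * m ≤ n) eq (few-bad (length S) S v ≤-refl u))
    in <⇒≱ (positive S u) (+-cancelˡ-≤ n n 0 (≤-trans 2n≤n (≤-reflexive (sym (+-identityʳ n)))))
    where
    double : ∀ n → n + n ≡ 2 * 1 * n
    double = solve-∀

   local-lemma : ∀ S → Unique S → ∃[ x ] (∀ {v} → v ∈ S → bad v x ≡ false) × (∀ {z} → z ∉ ys → x z ≡ x₀ z) × (∀ {z} → z ∈ ys → x z ≢ unset)
   local-lemma S u = let x , pos , off , on = total-witness ys _ x₀ (positive S u) in x , avoided S x pos , off , on
    where
    avoided : ∀ S x → 0 < ind (none S x) → ∀ {v} → v ∈ S → bad v x ≡ false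
    avoided (u ∷ S) x pos i with bad u x in eq
    avoided (u ∷ S) x pos (here refl) | false = eq
    avoided (u ∷ S) x pos (there i) | false = avoided S x pos i

 blowup : ∀ {X : Set} → List (X → X) → ℕ → ℕ
 blowup ts r = 4 * length ts ^ (r + r)

 module _ (𝒳 : BorelSpace) {ts : List (Point 𝒳 → Point 𝒳)} (ts-borel : All (BorelMap 𝒳 𝒳) ts) (ts-sym : Symmetricᵐ ts) (id∈ts : id ∈ ts)
  (r : ℕ) (F : Point 𝒳 → State → ℕ)
  (F-depends : ∀ v → DependsOn (F v) (λ z → z ∈ nb (pow r ts) v))
  (F-harmonic : ∀ v → Harmonic (F v))
  (F-meas : ∀ x → Measurability.Meas 𝒳 x → Measurability.Meas 𝒳 (λ v → F v x))
  where
  private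
   X = Point 𝒳
   d = length ts ^ (r + r)
   open Measurability 𝒳

   0<d : 0 < d
   0<d = m^n>0 (length ts) {{nz id∈ts}} (r + r)
    where
    nz : ∀ {us : List (X → X)} {t} → t ∈ us → NonZero (length us)
    nz (here _) = _
    nz (there _) = _

   finite-step : ∀ x₀ (ys : List X) → Unique ys → (∀ {y} → y ∈ ys → x₀ y ≡ unset) → ∀ (I : List X) → Unique I →
    ∃[ x ] (∀ {v} → v ∈ I → F v x ≤ 4 * d * F v x₀) × (∀ {z} → z ∉ ys → x z ≡ x₀ z) × (∀ {z} → z ∈ ys → x z ≢ unset)
   finite-step x₀ ys u ys-unset I uI =
    let x , avoid , off , on = local-lemma I uI in x , (λ i → by-contradiction (¬⟦⟧⁻ (avoid i))) , off , on
    where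
    bad : X → State → Bool
    bad v x = ⟦ ¬ F v x ≤ 4 * d * F v x₀ ⟧
    markov : ∀ n → ∀ v → F v x₀ ≡ n → 4 * d * total ys (λ x → ind (bad v x)) x₀ ≤ 2 ^ length ys
    markov n v eq = bound n eq
     where
     open ≤-Reasoning
     sum-F : total ys (F v) x₀ ≡ 2 ^ length ys * F v x₀
     sum-F = total-harmonic ys u (F-harmonic v) (F-depends v) x₀ ys-unset
     ind≤ : ∀ c x → (¬ F v x ≤ 4 * d * F v x₀ → c ≤ F v x) → c * ind (bad v x) ≤ F v x
     ind≤ c x h with dec (¬ F v x ≤ 4 * d * F v x₀)
     ... | yes b = subst (_≤ F v x) (sym (*-identityʳ c)) (h b)
     ... | no _ = subst (_≤ F v x) (sym (*-zeroʳ c)) z≤n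
     scaled : ∀ c → (∀ x → ¬ F v x ≤ 4 * d * F v x₀ → c ≤ F v x) → c * total ys (λ x → ind (bad v x)) x₀ ≤ 2 ^ length ys * F v x₀
     scaled c h = begin
      c * total ys (λ x → ind (bad v x)) x₀ ≡⟨ sym (total-* ys c _ x₀) ⟩
      total ys (λ x → c * ind (bad v x)) x₀ ≤⟨ total-mono ys (λ x → ind≤ c x (h x)) x₀ ⟩
      total ys (F v) x₀ ≡⟨ sum-F ⟩
      2 ^ length ys * F v x₀ ∎
     bound : ∀ n → F v x₀ ≡ n → 4 * d * total ys (λ x → ind (bad v x)) x₀ ≤ 2 ^ length ys
     bound zero eq = begin
      4 * d * total ys (λ x → ind (bad v x)) x₀ ≡⟨ cong (4 * d *_) (n≤0⇒n≡0 zero-total) ⟩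
      4 * d * 0 ≡⟨ *-zeroʳ (4 * d) ⟩
      0 ≤⟨ z≤n ⟩
      2 ^ length ys ∎
      where
      zero-total : total ys (λ x → ind (bad v x)) x₀ ≤ 0
      zero-total = begin
       total ys (λ x → ind (bad v x)) x₀ ≡⟨ sym (*-identityˡ _) ⟩
       1 * total ys (λ x → ind (bad v x)) x₀ ≤⟨ scaled 1 (λ x b → ≤-trans (s≤s z≤n) (≰⇒> b)) ⟩
       2 ^ length ys * F v x₀ ≡⟨ cong (2 ^ length ys *_) eq ⟩
       2 ^ length ys * 0 ≡⟨ *-zeroʳ (2 ^ length ys) ⟩
       0 ∎
     bound (suc n) eq = *-cancelʳ-≤ _ _ (F v x₀) {{subst NonZero (sym eq) _}} (begin
      4 * d * total ys (λ x → ind (bad v x)) x₀ * F v x₀ ≡⟨ swap (4 * d) _ (F v x₀) ⟩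
      4 * d * F v x₀ * total ys (λ x → ind (bad v x)) x₀ ≤⟨ scaled (4 * d * F v x₀) (λ x b → <⇒≤ (≰⇒> b)) ⟩
      2 ^ length ys * F v x₀ ∎)
      where
      swap : ∀ a b c → a * b * c ≡ a * c * b
      swap = solve-∀
    few-neighbours : ∀ v S → Unique S → All (λ w → ∃[ y ] y ∈ ys × y ∈ nb (pow r ts) w × y ∈ nb (pow r ts) v) S → length S ≤ d
    few-neighbours v S uS meets = ≤-trans (length-⊆ uS λ i → near (All-lookup meets i))
      (≤-reflexive (trans (Listₚ.length-map _ (pow (r + r) ts)) (length-pow (r + r) ts)))
     where
     near : ∀ {w} → ∃[ y ] y ∈ ys × y ∈ nb (pow r ts) w × y ∈ nb (pow r ts) v → w ∈ nb (pow (r + r) ts) v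
     near (_ , _ , p , q) = reach-trans r r q (reach-sym r ts-sym p)
    open LocalLemma ys x₀ bad (λ v z → z ∈ nb (pow r ts) v)
     (λ v x x' agree → cong (λ n → ⟦ ¬ n ≤ 4 * d * F v x₀ ⟧) (F-depends v x x' agree)) d 0<d
     (λ v → markov _ v refl) few-neighbours

  borel-local-lemma : (Y : Pred X 0ℓ) → Bor 𝒳 Y → FiniteOrbits (map (keep (λ x y → Y x × Y y)) (pow (r + r) ts)) →
   ∀ x₀ → Meas x₀ → (∀ {z} → Y z → x₀ z ≡ unset) →
   ∃[ x ] Meas x × (∀ {z} → ¬ Y z → x z ≡ x₀ z) × (∀ {z} → Y z → x z ≢ unset) × (∀ v → F v x ≤ blowup ts r * F v x₀)
  borel-local-lemma Y Y-borel finite x₀ x₀-meas Y-unset =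
   let σ , σ-meas , good = select 𝒳 Sign-enumerable
        (keep-borel 𝒳 Q (λ {t} b → bor-∩ 𝒳 Y-borel (b _ Y-borel)) (pow-borel 𝒳 (r + r) ts-borel))
        Q-sym finite Good good-borel good-local exists
   in merge σ , merge-meas σ-meas , (λ ¬Yz → if-no ¬Yz)
    , (λ Yz eq → proj₁ (good _ Yz) (trans (sym (if-yes Yz)) eq))
    , λ v → everywhere σ good v (dec (∃[ y ] y ∈ nb (pow r ts) v × Y y))
   where
   Q : X → X → Set
   Q x y = Y x × Y y
   us = map (keep Q) (pow (r + r) ts)
   Q-sym : Symmetricᵐ us
   Q-sym = keep-sym Q (λ (p , q) → q , p) (reach-sym (r + r) ts-sym)
   merge : State → State
   merge σ z = if ⟦ Y z ⟧ then σ z else x₀ z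
   merge-meas : ∀ {σ} → Meas σ → Meas (merge σ)
   merge-meas m = meas-if Y-borel m x₀-meas
   Fine : State → X → Set
   Fine x v = F v x ≤ 4 * d * F v x₀
   Good : State → X → Set
   Good σ y = Y y → σ y ≢ unset × All (λ t → Fine (merge σ) (t y)) (pow r ts)
   good-borel : ∀ σ → Meas σ → Bor 𝒳 (Good σ)
   good-borel σ m = bor-→ 𝒳 Y-borel (bor-∩ 𝒳 (m (_≢ unset))
    (bor-All 𝒳 (pow r ts) (All-map (λ {t} b → b _ (meas-map₂ _,_ (F-meas (merge σ) (merge-meas m)) (F-meas x₀ x₀-meas) (λ (a , b) → a ≤ 4 * d * b))) (pow-borel 𝒳 r ts-borel))))
   step : ∀ {y z} → Y y → Y z → z ∈ nb (pow (r + r) ts) y → Orb us y z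
   step p q i = nb-keep⁺ Q (p , q) i ◅ stop
   merge-agree : ∀ {σ τ y} → Y y → (∀ z → Orb us y z → σ z ≡ τ z) → ∀ {v} → v ∈ nb (pow r ts) y → ∀ z → z ∈ nb (pow r ts) v → merge σ z ≡ merge τ z
   merge-agree {σ} {τ} {y} Yy agree {v} i z j with dec (Y z)
   ... | yes Yz = agree z (step Yy Yz (reach-trans r r i j))
   ... | no _ = refl
   good-local : ∀ σ τ y → (∀ z → Orb us y z → σ z ≡ τ z) → Good σ y → Good τ y
   good-local σ τ y agree good Yy = let set , fine = good Yy in
    (λ eq → set (trans (agree y stop) eq)) ,
    All-tabulate λ {t} i → subst (_≤ 4 * d * F (t y) x₀) (F-depends (t y) _ _ (merge-agree {σ} {τ} Yy agree (nb⁺ i))) (All-lookup fine i)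
   exists : ∀ x → ∃[ σ ] (∀ y → Orb us x y → Good σ y)
   exists x =
    let orbit , orb⊆ = finite x
        inOrbit = filter (λ y → dec (Y y × Orb us x y)) orbit
        ys = uniq inOrbit
        I₀ = concatMap (nb (pow r ts)) ys
        ys⁻ : ∀ {y} → y ∈ ys → Y y × Orb us x y
        ys⁻ i = proj₂ (∈-filter⁻ (λ y → dec (Y y × Orb us x y)) {xs = orbit} (uniq-∈⁻ i))
        ys⁺ : ∀ {y} → Y y → Orb us x y → y ∈ ys
        ys⁺ {y} Yy o = uniq-∈⁺ (∈-filter⁺ (λ y → dec (Y y × Orb us x y)) (orb⊆ y o) (Yy , o))
        σ , fine , off , on = finite-step x₀ ys (uniq-unique inOrbit) (λ i → Y-unset (proj₁ (ys⁻ i))) (uniq I₀) (uniq-unique I₀)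
    in σ , λ y o Yy → on (ys⁺ Yy o) , All-tabulate λ {t} i →
       subst (_≤ 4 * d * F (t y) x₀)
        (F-depends (t y) _ _ λ z j → agree σ ys off ys⁻ z λ Yz → ys⁺ Yz (o ◅◅ step Yy Yz (reach-trans r r (nb⁺ i) j)))
        (fine (uniq-∈⁺ (∈-concat⁺′ (nb⁺ i) (∈-map⁺ (nb (pow r ts)) (ys⁺ Yy o)))))
    where
    agree : ∀ σ ys → (∀ {z} → z ∉ ys → σ z ≡ x₀ z) → (∀ {y} → y ∈ ys → Y y × Orb us x y) → ∀ z → (Y z → z ∈ ys) → σ z ≡ merge σ z
    agree σ ys off ys⁻ z in-ys with dec (Y z)
    ... | yes _ = refl
    ... | no ¬Yz = off λ i → ¬Yz (proj₁ (ys⁻ i))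
   everywhere : ∀ σ → (∀ x → Good σ x) → ∀ v → Dec (∃[ y ] y ∈ nb (pow r ts) v × Y y) → Fine (merge σ) v
   everywhere σ good v (yes (y , i , Yy)) with nb⁻ (reach-sym r ts-sym i)
   ... | t , j , refl = All-lookup (proj₂ (good y Yy)) j
   everywhere σ good v (no far) = ≤-trans
    (≤-reflexive (F-depends v (merge σ) x₀ λ z i → if-no λ Yz → far (z , i , Yz)))
    (≤-trans (≤-reflexive (sym (*-identityˡ (F v x₀)))) (*-monoˡ-≤ (F v x₀) (*-mono-≤ {1} {4} (s≤s z≤n) 0<d)))

 reach⇒orb : ∀ {X : Set} n {ts : List (X → X)} {x y} → y ∈ nb (pow n ts) x → Orb ts x y
 reach⇒orb zero (here refl) = stop
 reach⇒orb (suc n) {ts} p = let _ , q , r = reach-unsnoc n {ts} p in reach⇒orb n q ◅◅ (r ◅ stop)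

 cover-count : ∀ {X Z : Set} (S : Z → Pred X 0ℓ) a (zs : List Z) →
  (∀ {z} → z ∈ zs → ∀ {us} → Unique us → All (S z) us → length us ≤ a) →
  ∀ {ws} → Unique ws → All (λ w → ∃[ z ] z ∈ zs × S z w) ws → length ws ≤ length zs * a
 cover-count S a [] bound {[]} u cov = z≤n
 cover-count S a [] bound {w ∷ ws} u ((_ , () , _) ∷ _)
 cover-count S a (z ∷ zs) bound {ws} u cov = subst (_≤ a + length zs * a) (length-split (S z) ws) (+-mono-≤
  (bound (here refl) (Unique-filter' (S z)) (All-tabulate λ i → proj₂ (∈-filter⁻ (λ x → dec (S z x)) {xs = ws} i)))
  (cover-count S a zs (bound ∘ there) (Unique-filter' (λ w → ¬ S z w))
   (All-tabulate λ i → let j , ¬s = ∈-filter⁻ (λ x → dec (¬ S z x)) {xs = ws} i in later ¬s (All-lookup cov j))))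
  where
  open import Data.List.Relation.Unary.Unique.Propositional.Properties using (filter⁺)
  Unique-filter' : ∀ P → Unique (select-list P ws)
  Unique-filter' P = filter⁺ (λ x → dec (P x)) u
  later : ∀ {w} → ¬ S z w → ∃[ z' ] z' ∈ z ∷ zs × S z' w → ∃[ z' ] z' ∈ zs × S z' w
  later ¬s (_ , here refl , s) = ⊥-elim (¬s s)
  later ¬s (z' , there i , s) = z' , i , s

 -- A graph of linear growth splits into two Borel parts with finite components:
 -- the union of sparse thin spheres around a maximal separated set, and the rest.
 module LinearGrowth (𝒳 : BorelSpace) {ts : List (Point 𝒳 → Point 𝒳)} (ts-borel : All (BorelMap 𝒳 𝒳) ts) (ts-sym : Symmetricᵐ ts) (id∈ts : id ∈ ts)
  (a : ℕ) (0<a : 0 < a) {s : ℕ} (lay : Layering 𝒳 (pow (a * a + a * a) ts) s)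
  (growth : ∀ x zs → Unique zs → All (λ z → z ∈ nb (pow ((a * a + a * a) + (a * a + a * a) + ((a * a + a * a) + (a * a + a * a))) ts) x) zs → length zs ≤ a * (a * a + a * a))
  where
  private
   X = Point 𝒳
   κ ρ : ℕ
   κ = a * a
   ρ = κ + κ
   open Measurability 𝒳

   b : ℕ → X → List X
   b r x = nb (pow r ts) x

   b-sym : ∀ r {x y} → y ∈ b r x → x ∈ b r y
   b-sym r = reach-sym r ts-sym
   b-mono : ∀ {m n x y} → m ≤ n → y ∈ b m x → y ∈ b n x
   b-mono = reach-mono id∈ts
   b-trans : ∀ m n {x y z} → y ∈ b m x → z ∈ b n y → z ∈ b (n + m) x
   b-trans m n = reach-trans m n {ts}

   0<κ : 0 < κ
   0<κ = *-mono-≤ 0<a 0<a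

   net = Greedy.greedy 𝒳 (pow-borel 𝒳 ρ ts-borel) (reach-sym ρ ts-sym) lay
   colour = proj₁ net
   Z : Pred X 0ℓ
   Z x = colour x ≡ 0
   Z-borel : Bor 𝒳 Z
   Z-borel = proj₁ (proj₂ net) (_≡ 0)
   Z-separated : ∀ {x y} → Z x → Z y → y ∈ b ρ x → y ≡ x
   Z-separated {x} {y} zx zy i = by-contradiction λ y≢x → proj₁ (proj₂ (proj₂ net)) x i y≢x (trans zy (sym zx))
   Z-near : ∀ x → ∃[ z ] z ∈ b ρ x × Z z
   Z-near x = near (colour x) refl
    where
    near : ∀ n → colour x ≡ n → ∃[ z ] z ∈ b ρ x × Z z
    near zero eq = x , reach-refl ρ id∈ts , eq
    near (suc n) eq = let z , i , _ , zz = proj₂ (proj₂ (proj₂ net)) x 0 (subst (0 <_) (sym eq) (s≤s z≤n)) in z , i , zz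

   volume : ℕ → X → ℕ
   volume r x = length (uniq (b r x))

   volume-of : ∀ (fs : List (X → X)) → All (BorelMap 𝒳 𝒳) fs → Meas (λ x → length (uniq (nb fs x)))
   volume-of [] [] = meas-const 0
   volume-of (f ∷ fs) (bf ∷ bfs) = meas-≗ (λ x → sym (if-length (⟦ f x ∈ nb fs x ⟧) (uniq (nb fs x)) (f x)))
    (meas-if (bor-⇔ 𝒳 (λ x i → member x i) (λ x i → unmember x i) (bor-Any 𝒳 fs (All-map (λ {g} bg → bor-≡ {𝒳} {𝒳} {f} {g} bf bg) bfs)))
     (volume-of fs bfs) (meas-map suc (volume-of fs bfs)))
    where
    if-length : ∀ c (xs : List X) y → length (if c then xs else y ∷ xs) ≡ (if c then length xs else suc (length xs))
    if-length true xs y = refl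
    if-length false xs y = refl
    member : ∀ x → Any (λ g → f x ≡ g x) fs → f x ∈ nb fs x
    member x = Anyₚ.map⁺
    unmember : ∀ x → f x ∈ nb fs x → Any (λ g → f x ≡ g x) fs
    unmember x = Anyₚ.map⁻

   volume-meas : ∀ r → Meas (volume r)
   volume-meas r = volume-of (pow r ts) (pow-borel 𝒳 r ts-borel)

   Thin : ℕ → Pred X 0ℓ
   Thin j x = j < ρ × volume (suc (ρ + j)) x ≤ volume (ρ + j) x + a

   Thin-borel : ∀ j → Bor 𝒳 (Thin j)
   Thin-borel j = bor-∩ 𝒳 (bor-const 𝒳 (j < ρ)) (meas-map₂ _,_ (volume-meas (suc (ρ + j))) (volume-meas (ρ + j)) (λ (m , n) → m ≤ n + a))

   volume-bound : ∀ x → volume (ρ + ρ) x ≤ a * ρ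
   volume-bound x = growth x _ (uniq-unique (b (ρ + ρ) x)) (All-tabulate λ i → b-mono (m≤m+n (ρ + ρ) (ρ + ρ)) (uniq-∈⁻ {xs = b (ρ + ρ) x} i))

   thin-exists : ∀ x → ∃[ j ] Thin j x
   thin-exists x = by-contradiction λ none →
    let thick : ∀ i → i ≤ ρ → i * suc a ≤ volume (ρ + i) x
        thick = grow none
    in <⇒≱ (≤-trans (strict ρ (≤-trans 0<κ (m≤m+n κ κ))) (thick ρ ≤-refl)) (volume-bound x)
    where
    strict : ∀ n → 0 < n → a * n < n * suc a
    strict (suc n) _ = ≤-trans (≤-reflexive (cong suc (*-comm a (suc n)))) (subst (suc (suc n * a) ≤_) (sym (*-suc (suc n) a)) (s≤s (m≤n+m (suc n * a) n)))
    grow : ¬ (∃[ j ] Thin j x) → ∀ i → i ≤ ρ → i * suc a ≤ volume (ρ + i) x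
    grow none zero _ = z≤n
    grow none (suc i) i<ρ = subst (λ k → suc i * suc a ≤ volume k x) (sym (+-suc ρ i))
     (≤-trans (≤-trans (+-monoʳ-≤ (suc a) (grow none i (<⇒≤ i<ρ))) (≤-reflexive (trans (+-comm (suc a) _) (+-suc _ a))))
      (≰⇒> λ thin → none (i , i<ρ , thin)))

   rad : X → ℕ
   rad = first 𝒳 Thin
   rad-thin : ∀ x → Thin (rad x) x
   rad-thin x = first-sound 𝒳 Thin (thin-exists x)

   Sphere : X → Pred X 0ℓ
   Sphere z y = y ∈ b (suc (ρ + rad z)) z × y ∉ b (ρ + rad z) z

   sphere-count : ∀ z {us} → Unique us → All (Sphere z) us → length us ≤ a
   sphere-count z {us} u sph = +-cancelʳ-≤ (volume (ρ + rad z) z) _ _ (≤-trans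
    (≤-trans (≤-reflexive (sym (Listₚ.length-++ us)))
     (length-⊆ (Unique-++ u (uniq-unique inner) λ (i , j) → proj₂ (All-lookup sph i) (uniq-∈⁻ {xs = inner} j)) λ i → uniq-∈⁺ (inside (∈-++⁻ us i))))
    (subst (volume (suc (ρ + rad z)) z ≤_) (+-comm (volume (ρ + rad z) z) a) (proj₂ (rad-thin z))))
    where
    inner = b (ρ + rad z) z
    inside : ∀ {y} → y ∈ us ⊎ y ∈ uniq (b (ρ + rad z) z) → y ∈ b (suc (ρ + rad z)) z
    inside (inj₁ i) = proj₁ (All-lookup sph i)
    inside (inj₂ j) = b-mono (n≤1+n (ρ + rad z)) (uniq-∈⁻ {xs = inner} j)

  Sep : Pred X 0ℓ
  Sep y = ∃[ z ] z ∈ b (ρ + ρ) y × Z z × Sphere z y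

  private
   member-borel : ∀ r {t} → BorelMap 𝒳 𝒳 t → Bor 𝒳 (λ y → y ∈ b r (t y))
   member-borel r {t} bt = bor-⇔ 𝒳 (λ y → Anyₚ.map⁺) (λ y → Anyₚ.map⁻)
    (bor-Any 𝒳 (pow r ts) (All-map (λ {u} bu → bor-≡ {𝒳} {𝒳} {id} {u ∘ t} (bor-id {𝒳}) (λ A c → bt (A ∘ u) (bu A c))) (pow-borel 𝒳 r ts-borel)))

   sphere-borel : ∀ {t} → BorelMap 𝒳 𝒳 t → Bor 𝒳 (λ y → Z (t y) × Sphere (t y) y)
   sphere-borel {t} bt = bor-∩ 𝒳 (bt _ Z-borel) (bor-⇔ 𝒳
    (λ { y (j , refl , p) → p }) (λ y p → rad (t y) , refl , p)
    (bor-∃ℕ 𝒳 _ λ j → bor-∩ 𝒳 (meas-∘ {f = t} bt (first-meas 𝒳 Thin Thin-borel) (_≡ j))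
     (bor-∩ 𝒳 (member-borel (suc (ρ + j)) {t} bt) (bor-∁ 𝒳 (member-borel (ρ + j) {t} bt)))))

  Sep-borel : Bor 𝒳 Sep
  Sep-borel = bor-⇔ 𝒳
   (λ y i → let t , j , p = find i in t y , nb⁺ j , p)
   (λ { y (z , i , p) → to y i p })
   (bor-Any 𝒳 (pow (ρ + ρ) ts) (All-map (λ {t} bt → sphere-borel {t} bt) (pow-borel 𝒳 (ρ + ρ) ts-borel)))
   where
   to : ∀ y {z} → z ∈ b (ρ + ρ) y → Z z × Sphere z y → Any (λ t → Z (t y) × Sphere (t y) y) (pow (ρ + ρ) ts)
   to y i p with nb⁻ i
   ... | t , j , refl = lose j p

  complement-finite : FiniteOrbits (map (keep (λ x y → ¬ Sep x × ¬ Sep y)) ts)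
  complement-finite x =
   let z , i , zz = Z-near x
   in b (ρ + rad z) z , λ y o → stays zz (b-mono (m≤m+n ρ (rad z)) (b-sym ρ i)) o
   where
   Q : X → X → Set
   Q x y = ¬ Sep x × ¬ Sep y
   stays : ∀ {z x y} → Z z → x ∈ b (ρ + rad z) z → Orb (map (keep Q) ts) x y → y ∈ b (ρ + rad z) z
   stays zz i stop = i
   stays {z} zz i (p ◅ o) with nb-keep⁻ Q p
   ... | inj₂ refl = stays zz i o
   ... | inj₁ ((_ , ¬sep) , j) = stays zz (by-contradiction λ out → ¬sep
    (z , b-sym (ρ + ρ) (b-mono (subst (_≤ ρ + ρ) (+-suc ρ (rad z)) (+-monoʳ-≤ ρ (proj₁ (rad-thin z)))) (reach-snoc (ρ + rad z) i j))
     , zz , reach-snoc (ρ + rad z) i j , out)) o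

  private
   exit : ∀ {us x} j → (∀ {u w} → w ∈ nb us u → w ∈ nb ts u) → ∀ {v y} → v ∈ b j x → Orb us v y → y ∉ b j x →
    ∃[ u ] ∃[ w ] w ∈ nb us u × u ∈ b j x × w ∈ b (suc j) x × w ∉ b j x
   exit j ⊆ i stop out = ⊥-elim (out i)
   exit {us} {x} j ⊆ {v} i (_◅_ {j = w} p o) out with dec (w ∈ b j x)
   ... | yes k = exit j ⊆ k o out
   ... | no k = v , w , p , i , reach-snoc j i (⊆ p) , k

   distinct-exits : ∀ {x} {P : Pred X 0ℓ} n → (∀ j → j < n → ∃[ w ] P w × w ∈ b (suc j) x × w ∉ b j x) →
    ∃[ ws ] Unique ws × length ws ≡ n × All (λ w → P w × w ∈ b n x) ws
   distinct-exits zero f = [] , [] , refl , []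
   distinct-exits (suc n) f =
    let w , Pw , i , out = f n ≤-refl
        ws , u , len , all = distinct-exits n (λ j j<n → f j (m≤n⇒m≤1+n j<n))
    in w ∷ ws , All-map (λ { (_ , k) refl → out k }) all ∷ u , cong suc len
     , (Pw , i) ∷ All-map (λ (p , k) → p , b-mono (n≤1+n n) k) all

   tentacle : ∀ {z z'} → Orb ts z z' → z' ∉ b ρ z → ∃[ ws ] Unique ws × length ws ≡ κ × All (λ w → w ∈ b κ z) ws
   tentacle {z} {z'} o far =
    let ws , u , len , all = distinct-exits {z} {λ _ → ⊤} κ λ j j<κ →
         let _ , w , _ , _ , i , out = exit j id (reach-refl j id∈ts) o λ k → far (b-mono (≤-trans (<⇒≤ j<κ) (m≤m+n κ κ)) k)
         in w , tt , i , out
    in ws , u , len , All-map proj₂ all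

   tentacles : ∀ zs → Unique zs → All Z zs → (∀ {z} → z ∈ zs → ∃[ z' ] Orb ts z z' × z' ∉ b ρ z) →
    ∃[ ws ] Unique ws × length ws ≡ length zs * κ × All (λ w → ∃[ z ] z ∈ zs × w ∈ b κ z) ws
   tentacles [] _ _ _ = [] , [] , refl , []
   tentacles (z ∷ zs) (z∉ ∷ u) (zz ∷ zzs) far =
    let _ , o , out = far (here refl)
        ws , uw , len , all = tentacle o out
        ws' , uw' , len' , all' = tentacles zs u zzs (far ∘ there)
    in ws ++ ws' , Unique-++ uw uw' (λ (i , j) → let z' , k , near = All-lookup all' j in
        All-lookup z∉ k (sym (Z-separated zz (All-lookup zzs k) (b-trans κ κ (All-lookup all i) (b-sym κ near)))))
     , trans (Listₚ.length-++ ws) (cong₂ _+_ len len')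
     , Allₚ.++⁺ (All-map (λ i → z , here refl , i) all) (All-map (λ (z' , k , near) → z' , there k , near) all')

   net-count : ∀ x zs → Unique zs → All (λ z → Z z × z ∈ b (suc (ρ + ρ + ρ)) x) zs → length zs ≤ a + a
   net-count x [] _ _ = z≤n
   net-count x (z ∷ []) _ _ = ≤-trans 0<a (m≤m+n a a)
   net-count x zs@(z₁ ∷ z₂ ∷ _) u@((z₁≢z₂ ∷ _) ∷ _) near =
    let ws , uw , len , all = tentacles zs u (All-map proj₁ near) (λ i → others i (dec (_ ≡ z₁)))
    in *-cancelʳ-≤ (length zs) (a + a) κ {{>-nonZero 0<κ}} (begin
     length zs * κ ≡⟨ sym len ⟩
     length ws ≤⟨ growth x ws uw (All-map (λ (z , i , k) → b-mono radius (b-trans (suc (ρ + ρ + ρ)) κ (proj₂ (All-lookup near i)) k)) all) ⟩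
     a * (κ + κ) ≡⟨ eq a κ ⟩
     (a + a) * κ ∎)
    where
    open ≤-Reasoning
    eq : ∀ a k → a * (k + k) ≡ (a + a) * k
    eq = solve-∀
    radius : κ + suc (ρ + ρ + ρ) ≤ (ρ + ρ) + (ρ + ρ)
    radius = subst (κ + suc (ρ + ρ + ρ) ≤_) (sym (split κ)) (+-monoʳ-≤ κ (+-monoˡ-≤ (ρ + ρ + ρ) 0<κ))
     where
     split : ∀ k → (k + k + (k + k)) + (k + k + (k + k)) ≡ k + (k + (k + k + (k + k) + (k + k)))
     split = solve-∀
    orbit : ∀ {z z'} → z ∈ zs → z' ∈ zs → Orb ts z z'
    orbit i j = reach⇒orb (suc (ρ + ρ + ρ)) (b-sym (suc (ρ + ρ + ρ)) (proj₂ (All-lookup near i))) ◅◅ reach⇒orb (suc (ρ + ρ + ρ)) (proj₂ (All-lookup near j))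
    apart : ∀ {z z'} → z ∈ zs → z' ∈ zs → z' ≢ z → z' ∉ b ρ z
    apart i j ≢ k = ≢ (Z-separated (proj₁ (All-lookup near i)) (proj₁ (All-lookup near j)) k)
    others : ∀ {z} → z ∈ zs → Dec (z ≡ z₁) → ∃[ z' ] Orb ts z z' × z' ∉ b ρ z
    others i (yes refl) = z₂ , orbit i (there (here refl)) , apart i (there (here refl)) (z₁≢z₂ ∘ sym)
    others i (no z≢z₁) = z₁ , orbit i (here refl) , apart i (here refl) (z≢z₁ ∘ sym)

  sep-finite : FiniteOrbits (map (keep (λ x y → Sep x × Sep y)) ts)
  sep-finite x = b ρ x , λ y o → by-contradiction λ out →
   let ws , u , len , all = distinct-exits {x} {Sep} (suc ρ) λ j j≤ρ →
        let v , w , p , i , i' , out' = exit {map (keep Q) ts} j forget (reach-refl j id∈ts) o λ k → out (b-mono (≤-pred j≤ρ) k)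
        in w , moved j p i out' , i' , out'
       zs = uniq (select-list Z (b (suc (ρ + ρ + ρ)) x))
       few-zs = net-count x zs (uniq-unique (select-list Z (b (suc (ρ + ρ + ρ)) x))) (All-tabulate λ i → let j , zz = ∈-filter⁻ (λ z → dec (Z z)) {xs = b (suc (ρ + ρ + ρ)) x} (uniq-∈⁻ {xs = select-list Z (b (suc (ρ + ρ + ρ)) x)} i) in zz , j)
       few-ws = cover-count Sphere a zs (λ {z} _ u sph → sphere-count z u sph) u
        (All-map (λ { ((z , i , zz , sph) , k) → z , uniq-∈⁺ (∈-filter⁺ (λ z → dec (Z z))
          (subst (λ n → z ∈ b n x) (trans (+-suc (ρ + ρ) ρ) refl) (b-trans (suc ρ) (ρ + ρ) k i)) zz) , sph }) all)
   in 1+n≰n {ρ} (begin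
    suc ρ ≡⟨ sym len ⟩
    length ws ≤⟨ few-ws ⟩
    length zs * a ≤⟨ *-monoˡ-≤ a few-zs ⟩
    (a + a) * a ≡⟨ *-distribʳ-+ a a a ⟩
    ρ ∎)
   where
   open ≤-Reasoning
   Q : X → X → Set
   Q x y = Sep x × Sep y
   forget : ∀ {u w} → w ∈ nb (map (keep Q) ts) u → w ∈ nb ts u
   forget p with nb-keep⁻ Q p
   ... | inj₁ (_ , i) = i
   ... | inj₂ refl = nb⁺ id∈ts
   moved : ∀ {u w} j → w ∈ nb (map (keep Q) ts) u → u ∈ b j x → w ∉ b j x → Sep w
   moved j p i out with nb-keep⁻ Q p
   ... | inj₁ ((_ , sep) , _) = sep
   ... | inj₂ refl = ⊥-elim (out i)

 -- Weights of lists of signs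

 _==_ : Sign → Sign → Bool
 unset == unset = true
 plus == plus = true
 minus == minus = true
 _ == _ = false

 count : Sign → List Sign → ℕ
 count q ss = sum (map (λ s → ind (q == s)) ss)

 weight : ℕ → Bool → Sign → ℕ
 weight j _ unset = suc j
 weight j true plus = suc (suc j)
 weight j true minus = j
 weight j false plus = j
 weight j false minus = suc (suc j)

 wproduct : ℕ → Bool → List Sign → ℕ
 wproduct j e ss = product (map (weight j e) ss)

 wsum : ℕ → List Sign → ℕ
 wsum j ss = wproduct j true ss + wproduct j false ss

 flip-sign : Sign → Sign
 flip-sign unset = unset
 flip-sign plus = minus
 flip-sign minus = plus

 wproduct-formula : ∀ j ss → wproduct j true ss * suc j ^ (count plus ss + count minus ss) ≡ suc (suc j) ^ count plus ss * j ^ count minus ss * suc j ^ length ss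
 wproduct-formula j [] = refl
 wproduct-formula j (unset ∷ ss) = trans (*-assoc (suc j) (wproduct j true ss) (suc j ^ (count plus ss + count minus ss))) (trans (cong (suc j *_) (wproduct-formula j ss))
  (swap (suc j) (suc (suc j) ^ count plus ss * j ^ count minus ss) (suc j ^ length ss)))
  where
  swap : ∀ a b c → a * (b * c) ≡ b * (a * c)
  swap = solve-∀
 wproduct-formula j (plus ∷ ss) = trans (swap₁ (suc (suc j)) (wproduct j true ss) (suc j) (suc j ^ (count plus ss + count minus ss))) (trans (cong (suc (suc j) * suc j *_) (wproduct-formula j ss))
  (swap₂ (suc (suc j)) (suc j) (suc (suc j) ^ count plus ss) (j ^ count minus ss) (suc j ^ length ss)))
  where
  swap₁ : ∀ a b c d → a * b * (c * d) ≡ a * c * (b * d)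
  swap₁ = solve-∀
  swap₂ : ∀ a b c d e → a * b * (c * d * e) ≡ a * c * d * (b * e)
  swap₂ = solve-∀
 wproduct-formula j (minus ∷ ss) rewrite +-suc (count plus ss) (count minus ss) = trans (swap₁ j (wproduct j true ss) (suc j) (suc j ^ (count plus ss + count minus ss))) (trans (cong (j * suc j *_) (wproduct-formula j ss))
  (swap₂ j (suc j) (suc (suc j) ^ count plus ss) (j ^ count minus ss) (suc j ^ length ss)))
  where
  swap₁ : ∀ a b c d → a * b * (c * d) ≡ a * c * (b * d)
  swap₁ = solve-∀
  swap₂ : ∀ a b c d e → a * b * (c * d * e) ≡ c * (a * d) * (b * e)
  swap₂ = solve-∀

 ^-distribʳ-* : ∀ l a b → (a * b) ^ l ≡ a ^ l * b ^ l
 ^-distribʳ-* zero a b = refl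
 ^-distribʳ-* (suc l) a b = trans (cong (a * b *_) (^-distribʳ-* l a b)) (swap a b (a ^ l) (b ^ l))
  where
  swap : ∀ a b c d → a * b * (c * d) ≡ a * c * (b * d)
  swap = solve-∀

 bernoulli-up : ∀ k n → k ^ n * (k + n) ≤ k * suc k ^ n
 bernoulli-up k zero = ≤-reflexive (trans (+-identityʳ (k + 0)) (trans (+-identityʳ k) (sym (*-identityʳ k))))
 bernoulli-up k (suc n) = begin
  k * k ^ n * (k + suc n) ≤⟨ m≤m+n _ (k ^ n * n) ⟩
  k * k ^ n * (k + suc n) + k ^ n * n ≡⟨ eq k (k ^ n) n ⟩
  suc k * (k ^ n * (k + n)) ≤⟨ *-monoʳ-≤ (suc k) (bernoulli-up k n) ⟩
  suc k * (k * suc k ^ n) ≡⟨ swap (suc k) k (suc k ^ n) ⟩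
  k * (suc k * suc k ^ n) ∎
  where
  open ≤-Reasoning
  eq : ∀ k a n → k * a * (k + suc n) + a * n ≡ suc k * (a * (k + n))
  eq = solve-∀
  swap : ∀ a b c → a * (b * c) ≡ b * (a * c)
  swap = solve-∀

 bernoulli-down : ∀ c m → suc c ^ m * suc c ≤ c ^ m * suc c + m * suc c ^ m
 bernoulli-down c zero = ≤-reflexive (sym (+-identityʳ (1 * suc c)))
 bernoulli-down c (suc m) = begin
  suc c * suc c ^ m * suc c ≡⟨ *-assoc (suc c) (suc c ^ m) (suc c) ⟩
  suc c * (suc c ^ m * suc c) ≤⟨ *-monoʳ-≤ (suc c) (bernoulli-down c m) ⟩
  suc c * (c ^ m * suc c + m * suc c ^ m) ≡⟨ eq₁ c (c ^ m) m (suc c ^ m) ⟩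
  c * c ^ m * suc c + suc c * c ^ m + m * (suc c * suc c ^ m) ≤⟨ +-monoˡ-≤ _ (+-monoʳ-≤ (c * c ^ m * suc c) (*-monoʳ-≤ (suc c) (^-monoˡ-≤ m (n≤1+n c)))) ⟩
  c * c ^ m * suc c + suc c * suc c ^ m + m * (suc c * suc c ^ m) ≡⟨ +-assoc (c * c ^ m * suc c) _ _ ⟩
  c * c ^ m * suc c + suc m * (suc c * suc c ^ m) ∎
  where
  open ≤-Reasoning
  eq₁ : ∀ c p m a → suc c * (p * suc c + m * a) ≡ c * p * suc c + suc c * p + m * (suc c * a)
  eq₁ = solve-∀

 power-up : ∀ j l → 2 ^ l * suc j ^ (suc j * l) ≤ suc (suc j) ^ (suc j * l)
 power-up j l = begin
  2 ^ l * suc j ^ (suc j * l) ≡⟨ cong (2 ^ l *_) (sym (^-*-assoc (suc j) (suc j) l)) ⟩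
  2 ^ l * (suc j ^ suc j) ^ l ≡⟨ sym (^-distribʳ-* l 2 (suc j ^ suc j)) ⟩
  (2 * suc j ^ suc j) ^ l ≤⟨ ^-monoˡ-≤ l double ⟩
  (suc (suc j) ^ suc j) ^ l ≡⟨ ^-*-assoc (suc (suc j)) (suc j) l ⟩
  suc (suc j) ^ (suc j * l) ∎
  where
  open ≤-Reasoning
  double : 2 * suc j ^ suc j ≤ suc (suc j) ^ suc j
  double = *-cancelˡ-≤ (suc j) (begin
   suc j * (2 * suc j ^ suc j) ≡⟨ eq (suc j) (suc j ^ suc j) ⟩
   suc j ^ suc j * (suc j + suc j) ≤⟨ bernoulli-up (suc j) (suc j) ⟩
   suc j * suc (suc j) ^ suc j ∎)
   where
   eq : ∀ a b → a * (2 * b) ≡ b * (a + a)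
   eq = solve-∀

 power-down : ∀ j m → m + m ≤ suc j * suc j → (suc j * suc j) ^ m ≤ 2 * (j * suc (suc j)) ^ m
 power-down j m 2m≤ = *-cancelʳ-≤ _ _ (suc c) (+-cancelʳ-≤ (suc c ^ m * suc c) _ _ (begin
  a ^ m * suc c + suc c ^ m * suc c ≡⟨ cong (λ n → n ^ m * suc c + suc c ^ m * suc c) a≡ ⟩
  suc c ^ m * suc c + suc c ^ m * suc c ≤⟨ +-mono-≤ (bernoulli-down c m) (bernoulli-down c m) ⟩
  (c ^ m * suc c + m * suc c ^ m) + (c ^ m * suc c + m * suc c ^ m) ≡⟨ eq₂ (c ^ m) (suc c) m (suc c ^ m) ⟩
  2 * c ^ m * suc c + (m + m) * suc c ^ m ≤⟨ +-monoʳ-≤ (2 * c ^ m * suc c) (*-monoˡ-≤ (suc c ^ m) (subst (m + m ≤_) a≡ 2m≤)) ⟩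
  2 * c ^ m * suc c + suc c * suc c ^ m ≡⟨ cong (2 * c ^ m * suc c +_) (*-comm (suc c) (suc c ^ m)) ⟩
  2 * c ^ m * suc c + suc c ^ m * suc c ∎))
  where
  open ≤-Reasoning
  a = suc j * suc j
  c = j * suc (suc j)
  a≡ : a ≡ suc c
  a≡ = square j
   where
   square : ∀ j → suc j * suc j ≡ suc (j * suc (suc j))
   square = solve-∀
  eq₂ : ∀ p a m q → (p * a + m * q) + (p * a + m * q) ≡ 2 * p * a + (m + m) * q
  eq₂ = solve-∀

 heavy-true : ∀ j l ss → count plus ss + count minus ss ≤ suc j * suc j → count minus ss + suc j * l ≤ count plus ss →
  2 ^ l * suc j ^ length ss ≤ 2 * wproduct j true ss
 heavy-true j l ss few gap = *-cancelʳ-≤ _ _ (suc j ^ (p + m)) {{m^n≢0 (suc j) (p + m)}} (begin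
  2 ^ l * L * suc j ^ (p + m) ≡⟨ swap₁ (2 ^ l) L (suc j ^ (p + m)) ⟩
  2 ^ l * suc j ^ (p + m) * L ≤⟨ *-monoˡ-≤ L main ⟩
  2 * (suc (suc j) ^ p * j ^ m) * L ≡⟨ *-assoc 2 (suc (suc j) ^ p * j ^ m) L ⟩
  2 * (suc (suc j) ^ p * j ^ m * L) ≡⟨ cong (2 *_) (sym (wproduct-formula j ss)) ⟩
  2 * (wproduct j true ss * suc j ^ (p + m)) ≡⟨ sym (*-assoc 2 (wproduct j true ss) (suc j ^ (p + m))) ⟩
  2 * wproduct j true ss * suc j ^ (p + m) ∎)
  where
  open ≤-Reasoning
  p = count plus ss
  m = count minus ss
  L = suc j ^ length ss
  e = p ∸ (m + suc j * l)
  p≡ : p ≡ m + (suc j * l + e)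
  p≡ = trans (sym (m+[n∸m]≡n gap)) (+-assoc m (suc j * l) e)
  swap₁ : ∀ a b c → a * b * c ≡ a * c * b
  swap₁ = solve-∀
  2m≤ : m + m ≤ suc j * suc j
  2m≤ = ≤-trans (+-monoˡ-≤ m (≤-trans (m≤m+n m (suc j * l)) gap)) few
  main : 2 ^ l * suc j ^ (p + m) ≤ 2 * (suc (suc j) ^ p * j ^ m)
  main = subst (λ p → 2 ^ l * suc j ^ (p + m) ≤ 2 * (suc (suc j) ^ p * j ^ m)) (sym p≡) (begin
   2 ^ l * k ^ (m + (kl + e) + m) ≡⟨ cong (2 ^ l *_) exps ⟩
   2 ^ l * (k ^ kl * k ^ e * (k * k) ^ m) ≡⟨ swap₂ (2 ^ l) (k ^ kl) (k ^ e) ((k * k) ^ m) ⟩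
   2 ^ l * k ^ kl * k ^ e * (k * k) ^ m ≤⟨ *-mono-≤ (*-mono-≤ (power-up j l) (^-monoˡ-≤ e (n≤1+n k))) (power-down j m 2m≤) ⟩
   suc k ^ kl * suc k ^ e * (2 * (j * suc k) ^ m) ≡⟨ cong (λ n → suc k ^ kl * suc k ^ e * (2 * n)) (^-distribʳ-* m j (suc k)) ⟩
   suc k ^ kl * suc k ^ e * (2 * (j ^ m * suc k ^ m)) ≡⟨ swap₃ (suc k ^ kl) (suc k ^ e) (j ^ m) (suc k ^ m) ⟩
   2 * (suc k ^ m * (suc k ^ kl * suc k ^ e) * j ^ m) ≡⟨ cong (λ n → 2 * (n * j ^ m)) (sym (trans (^-distribˡ-+-* (suc k) m (kl + e)) (cong (suc k ^ m *_) (^-distribˡ-+-* (suc k) kl e)))) ⟩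
   2 * (suc k ^ (m + (kl + e)) * j ^ m) ∎)
   where
   k = suc j
   kl = suc j * l
   exps : k ^ (m + (kl + e) + m) ≡ k ^ kl * k ^ e * (k * k) ^ m
   exps = begin-equality
    k ^ (m + (kl + e) + m) ≡⟨ ^-distribˡ-+-* k (m + (kl + e)) m ⟩
    k ^ (m + (kl + e)) * k ^ m ≡⟨ cong (_* k ^ m) (trans (^-distribˡ-+-* k m (kl + e)) (cong (k ^ m *_) (^-distribˡ-+-* k kl e))) ⟩
    k ^ m * (k ^ kl * k ^ e) * k ^ m ≡⟨ swap₄ (k ^ m) (k ^ kl * k ^ e) ⟩
    k ^ kl * k ^ e * (k ^ m * k ^ m) ≡⟨ cong (k ^ kl * k ^ e *_) (sym (^-distribʳ-* m k k)) ⟩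
    k ^ kl * k ^ e * (k * k) ^ m ∎
    where
    swap₄ : ∀ a b → a * b * a ≡ b * (a * a)
    swap₄ = solve-∀
   swap₂ : ∀ a b c d → a * (b * c * d) ≡ a * b * c * d
   swap₂ = solve-∀
   swap₃ : ∀ a b c d → a * b * (2 * (c * d)) ≡ 2 * (d * (a * b) * c)
   swap₃ = solve-∀

 wproduct-flip : ∀ j ss → wproduct j true (map flip-sign ss) ≡ wproduct j false ss
 wproduct-flip j [] = refl
 wproduct-flip j (unset ∷ ss) = cong (suc j *_) (wproduct-flip j ss)
 wproduct-flip j (plus ∷ ss) = cong (j *_) (wproduct-flip j ss)
 wproduct-flip j (minus ∷ ss) = cong (suc (suc j) *_) (wproduct-flip j ss)

 count-flip : ∀ q ss → count q (map flip-sign ss) ≡ count (flip-sign q) ss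
 count-flip q [] = refl
 count-flip q (s ∷ ss) = cong₂ _+_ (cong ind (flips q s)) (count-flip q ss)
  where
  flips : ∀ q s → (q == flip-sign s) ≡ (flip-sign q == s)
  flips unset unset = refl
  flips unset plus = refl
  flips unset minus = refl
  flips plus unset = refl
  flips plus plus = refl
  flips plus minus = refl
  flips minus unset = refl
  flips minus plus = refl
  flips minus minus = refl

 Unbalanced : ℕ → List Sign → Set
 Unbalanced b ss = count minus ss + b ≤ count plus ss ⊎ count plus ss + b ≤ count minus ss

 heavy : ∀ j l ss → count plus ss + count minus ss ≤ suc j * suc j → Unbalanced (suc j * l) ss → 2 ^ l * suc j ^ length ss ≤ 2 * wsum j ss
 heavy j l ss few (inj₁ gap) = ≤-trans (heavy-true j l ss few gap) (*-monoʳ-≤ 2 (m≤m+n (wproduct j true ss) (wproduct j false ss)))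
 heavy j l ss few (inj₂ gap) = ≤-trans
  (subst₂ (λ n w → 2 ^ l * suc j ^ n ≤ 2 * w) (Listₚ.length-map flip-sign ss) (wproduct-flip j ss)
   (heavy-true j l (map flip-sign ss)
    (subst₂ (λ a b → a + b ≤ suc j * suc j) (sym (count-flip plus ss)) (sym (count-flip minus ss)) (subst (_≤ suc j * suc j) (+-comm (count plus ss) (count minus ss)) few))
    (subst₂ (λ a b → a + suc j * l ≤ b) (sym (count-flip minus ss)) (sym (count-flip plus ss)) gap)))
  (*-monoʳ-≤ 2 (m≤n+m (wproduct j false ss) (wproduct j true ss)))

 -- Harmonic functions at a point

 module _ {X : Set} where

  HarmonicAt : (State → ℕ) → X → Set
  HarmonicAt F y = ∀ x → F (x [ y ≔ plus ]) + F (x [ y ≔ minus ]) ≡ 2 * F (x [ y ≔ unset ])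

  IndifferentAt : (State → ℕ) → X → Set
  IndifferentAt F y = ∀ x s → F (x [ y ≔ s ]) ≡ F (x [ y ≔ unset ])

  harmonic-+ : ∀ {F G y} → HarmonicAt F y → HarmonicAt G y → HarmonicAt (λ x → F x + G x) y
  harmonic-+ {F} {G} {y} f g x = trans (rearrange (F (x [ y ≔ plus ])) (G (x [ y ≔ plus ])) (F (x [ y ≔ minus ])) (G (x [ y ≔ minus ])))
   (trans (cong₂ _+_ (f x) (g x)) (sym (*-distribˡ-+ 2 (F (x [ y ≔ unset ])) _)))
   where
   rearrange : ∀ a b c d → a + b + (c + d) ≡ a + c + (b + d)
   rearrange = solve-∀

  indifferent-product : ∀ {I : Set} {F : I → State → ℕ} {y} (is : List I) → All (λ i → IndifferentAt (F i) y) is → IndifferentAt (λ x → product (map (λ i → F i x) is)) y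
  indifferent-product [] [] x s = refl
  indifferent-product {F = F} (i ∷ is) (p ∷ ps) x s = cong₂ _*_ (p x s) (indifferent-product {F = F} is ps x s)

  harmonic-product : ∀ {I : Set} {F : I → State → ℕ} {y} (is : List I) → All (λ i → HarmonicAt (F i) y) is →
   AllPairs (λ i j → ¬ IndifferentAt (F i) y → IndifferentAt (F j) y) is → HarmonicAt (λ x → product (map (λ i → F i x) is)) y
  harmonic-product [] [] [] x = refl
  harmonic-product {F = F} {y} (i ∷ is) (h ∷ hs) (r ∷ rs) x with dec (IndifferentAt (F i) y)
  ... | yes p = trans (cong₂ (λ a b → a * R plus + b * R minus) (p x plus) (p x minus))
   (trans (sym (*-distribˡ-+ (F i (x [ y ≔ unset ])) (R plus) (R minus))) (trans (cong (F i (x [ y ≔ unset ]) *_) (harmonic-product {F = F} is hs rs x)) (swap (F i (x [ y ≔ unset ])) (R unset))))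
   where
   R : Sign → ℕ
   R s = product (map (λ i → F i (x [ y ≔ s ])) is)
   swap : ∀ a b → a * (2 * b) ≡ 2 * (a * b)
   swap = solve-∀
  ... | no ¬p = trans (cong₂ (λ a b → F i (x [ y ≔ plus ]) * a + F i (x [ y ≔ minus ]) * b) (q x plus) (q x minus))
   (trans (sym (*-distribʳ-+ (R unset) (F i (x [ y ≔ plus ])) _)) (trans (cong (_* R unset) (h x)) (*-assoc 2 (F i (x [ y ≔ unset ])) (R unset))))
   where
   R : Sign → ℕ
   R s = product (map (λ i → F i (x [ y ≔ s ])) is)
   q : IndifferentAt (λ x → product (map (λ i → F i x) is)) y
   q = indifferent-product {F = F} is (All-map (λ f → f ¬p) r)

  harmonic-sum : ∀ {I : Set} {F : I → State → ℕ} {y} (is : List I) → (∀ i → HarmonicAt (F i) y) → HarmonicAt (λ x → sum (map (λ i → F i x) is)) y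
  harmonic-sum [] h x = refl
  harmonic-sum {F = F} (i ∷ is) h = harmonic-+ {F i} {λ x → sum (map (λ i → F i x) is)} (h i) (harmonic-sum {F = F} is h)

 -- Graphs given by finitely many partial maps to neighbours; a slot is empty at
 -- the points it fixes.
 record Slots (𝒳 : BorelSpace) (K : ℕ) : Set₁ where
  field
   slot : Fin K → Point 𝒳 → Point 𝒳
   slot-borel : ∀ i → BorelMap 𝒳 𝒳 (slot i)
   slot-injective : ∀ i j {x} → slot i x ≡ slot j x → slot i x ≢ x → i ≡ j
   slot-back : ∀ i x → ∃[ j ] slot j (slot i x) ≡ x

  maps : List (Point 𝒳 → Point 𝒳)
  maps = id ∷ tabulate slot

  maps-borel : All (BorelMap 𝒳 𝒳) maps
  maps-borel = bor-id {𝒳} ∷ Allₚ.tabulate⁺ slot-borel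

  slot∈maps : ∀ i {x} → slot i x ∈ nb maps x
  slot∈maps i = there (∈-map⁺ _ (∈-tabulate⁺ i))

  maps⁻ : ∀ {x y} → y ∈ nb maps x → y ≡ x ⊎ ∃[ i ] y ≡ slot i x
  maps⁻ (here refl) = inj₁ refl
  maps⁻ (there p) with ∈-map⁻ _ p
  ... | t , j , refl with ∈-tabulate⁻ j
  ... | i , refl = inj₂ (i , refl)

  maps-sym : Symmetricᵐ maps
  maps-sym {x} {y} p with maps⁻ p
  ... | inj₁ refl = here refl
  ... | inj₂ (i , refl) = let j , eq = slot-back i x in subst (_∈ nb maps (slot i x)) eq (slot∈maps j)

  length-maps : length maps ≡ suc K
  length-maps = cong suc (Listₚ.length-tabulate slot)

  sign : Point 𝒳 → State → Fin K → Sign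
  sign v x i = if ⟦ slot i v ≡ v ⟧ then unset else x (slot i v)

  signs : Point 𝒳 → State → List Sign
  signs v x = map (sign v x) (allFin K)

  degree : Point 𝒳 → ℕ
  degree v = length (select-list (λ i → slot i v ≢ v) (allFin K))

 module _ {𝒳 : BorelSpace} {K : ℕ} (G : Slots 𝒳 K) where
  open Slots G
  open Measurability 𝒳
  private X = Point 𝒳

  signs-meas : ∀ x → Meas x → Meas (λ v → signs v x)
  signs-meas x m = meas-list {σ = λ i v → sign v x i} (allFin K) (All-tabulate λ {i} _ →
   meas-if (bor-≡ {𝒳} {𝒳} {slot i} {id} (slot-borel i) (bor-id {𝒳})) (meas-const unset) (meas-∘ {f = slot i} (slot-borel i) m))

  sign-agree : ∀ {v x x'} i → (slot i v ≢ v → x (slot i v) ≡ x' (slot i v)) → sign v x i ≡ sign v x' i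
  sign-agree {v} i agree with dec (slot i v ≡ v)
  ... | yes _ = refl
  ... | no ≢ = agree ≢

  signs-depends : ∀ v → DependsOn (signs v) (λ z → z ∈ nb maps v)
  signs-depends v x x' agree = Listₚ.map-cong (λ i → sign-agree {v} {x} {x'} i λ _ → agree _ (slot∈maps i)) (allFin K)

  length-signs : ∀ v x → length (signs v x) ≡ K
  length-signs v x = trans (Listₚ.length-map _ (allFin K)) (Listₚ.length-tabulate id)

  counts≤degree : ∀ v x → count plus (signs v x) + count minus (signs v x) ≤ degree v
  counts≤degree v x = go (allFin K)
   where
   go : ∀ is → count plus (map (sign v x) is) + count minus (map (sign v x) is) ≤ length (select-list (λ i → slot i v ≢ v) is)
   go [] = z≤n
   go (i ∷ is) with dec (slot i v ≡ v) | dec (slot i v ≢ v)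
   ... | yes eq | yes ≢ = ⊥-elim (≢ eq)
   ... | yes _ | no _ = go is
   ... | no ≢ | no ¬≢ = ⊥-elim (¬≢ ≢)
   ... | no _ | yes _ with x (slot i v)
   ... | unset = m≤n⇒m≤1+n (go is)
   ... | plus = s≤s (go is)
   ... | minus = subst (_≤ suc (length (select-list (λ i → slot i v ≢ v) is))) (sym (+-suc _ _)) (s≤s (go is))

  module _ (j : ℕ) where

   mass : X → State → ℕ
   mass v x = wsum j (signs v x)

   mass-depends : ∀ v → DependsOn (mass v) (λ z → z ∈ nb maps v)
   mass-depends v x x' agree = cong (wsum j) (signs-depends v x x' agree)

   factor-indifferent : ∀ e v i {y} → (slot i v ≡ y → slot i v ≡ v) → IndifferentAt (λ x → weight j e (sign v x i)) y
   factor-indifferent e v i {y} away x s = cong (weight j e) (sign-agree {v} {x [ y ≔ s ]} {x [ y ≔ unset ]} i λ ≢ →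
    trans (update-there x s (λ eq → ≢ (away eq))) (sym (update-there x unset (λ eq → ≢ (away eq)))))

   factor-harmonic : ∀ e v i y → HarmonicAt (λ x → weight j e (sign v x i)) y
   factor-harmonic e v i y x with dec (slot i v ≡ v) | dec (slot i v ≡ y)
   ... | yes _ | _ = cong (suc j +_) (sym (+-identityʳ (suc j)))
   ... | no _ | no _ = cong (weight j e (x (slot i v)) +_) (sym (+-identityʳ _))
   ... | no ≢ | yes refl = sums e
    where
    sums : ∀ e → weight j e plus + weight j e minus ≡ suc j + (suc j + 0)
    sums true = eq j
     where
     eq : ∀ j → suc (suc j) + j ≡ suc j + (suc j + 0)
     eq = solve-∀
    sums false = eq j
     where
     eq : ∀ j → j + suc (suc j) ≡ suc j + (suc j + 0)
     eq = solve-∀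

   wproduct-signs : ∀ e v x → wproduct j e (signs v x) ≡ product (map (λ i → weight j e (sign v x i)) (allFin K))
   wproduct-signs e v x = cong product (sym (Listₚ.map-∘ {g = weight j e} {f = sign v x} (allFin K)))

   allFin-unique : Unique (allFin K)
   allFin-unique = tabulate⁺ id
    where open import Data.List.Relation.Unary.Unique.Propositional.Properties using (tabulate⁺)

   wproduct-harmonic : ∀ e v y → HarmonicAt (λ x → wproduct j e (signs v x)) y
   wproduct-harmonic e v y x rewrite wproduct-signs e v (x [ y ≔ plus ]) | wproduct-signs e v (x [ y ≔ minus ]) | wproduct-signs e v (x [ y ≔ unset ]) =
    harmonic-product {F = λ i x → weight j e (sign v x i)} (allFin K) (All-tabulate λ {i} _ → factor-harmonic e v i y)
     (pairs allFin-unique) x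
    where
    away : ∀ {i i'} → i ≢ i' → ¬ IndifferentAt (λ x → weight j e (sign v x i)) y → IndifferentAt (λ x → weight j e (sign v x i')) y
    away {i} {i'} i≢i' ¬ind = factor-indifferent e v i' λ eq' → by-contradiction λ ≢' → ¬ind (factor-indifferent e v i λ eq →
     by-contradiction λ ≢ → i≢i' (slot-injective i i' (trans eq (sym eq')) ≢))
    pairs : ∀ {is} → Unique is → AllPairs (λ i i' → ¬ IndifferentAt (λ x → weight j e (sign v x i)) y → IndifferentAt (λ x → weight j e (sign v x i')) y) is
    pairs [] = []
    pairs (p ∷ ps) = All-map away p ∷ pairs ps

   mass-harmonic : ∀ v y → HarmonicAt (mass v) y
   mass-harmonic v y = harmonic-+ {F = λ x → wproduct j true (signs v x)} {G = λ x → wproduct j false (signs v x)} (wproduct-harmonic true v y) (wproduct-harmonic false v y)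

   mass-indifferent : ∀ v {y} → y ∉ nb maps v → IndifferentAt (mass v) y
   mass-indifferent v y∉ x s = mass-depends v _ _ λ z z∈ →
    trans (update-there x s (λ { refl → y∉ z∈ })) (sym (update-there x unset (λ { refl → y∉ z∈ })))

   mass-unset : ∀ v → mass v (λ _ → unset) ≡ 2 * suc j ^ K
   mass-unset v = trans (cong₂ _+_ (go true (allFin K)) (go false (allFin K)))
    (trans (cong (λ n → suc j ^ n + suc j ^ n) (Listₚ.length-tabulate {n = K} id)) (cong (suc j ^ K +_) (sym (+-identityʳ _))))
    where
    sign-unset : ∀ i → sign v (λ _ → unset) i ≡ unset
    sign-unset i with dec (slot i v ≡ v)
    ... | yes _ = refl
    ... | no _ = refl
    weight-unset : ∀ e → weight j e unset ≡ suc j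
    weight-unset true = refl
    weight-unset false = refl
    go : ∀ e is → wproduct j e (map (sign v (λ _ → unset)) is) ≡ suc j ^ length is
    go e [] = refl
    go e (i ∷ is) rewrite sign-unset i | weight-unset e = cong (suc j *_) (go e is)

   mass-heavy : ∀ l v x → degree v ≤ suc j * suc j → Unbalanced (suc j * l) (signs v x) → 2 ^ l * suc j ^ K ≤ 2 * mass v x
   mass-heavy l v x deg unb = subst (λ n → 2 ^ l * suc j ^ n ≤ 2 * mass v x) (length-signs v x)
    (heavy j l (signs v x) (≤-trans (counts≤degree v x) deg) unb)

 module _ {X : Set} where

  reach-pow : ∀ m k {ts : List (X → X)} {x y} → y ∈ nb (pow m (pow k ts)) x → y ∈ nb (pow (m * k) ts) x
  reach-pow zero k (here refl) = here refl
  reach-pow (suc m) k {ts} p = let _ , q , r = reach-unsnoc m {pow k ts} p in reach-trans (m * k) k (reach-pow m k q) r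

  data Insertion (b : X) : List X → List X → Set where
   here : ∀ {xs} → Insertion b xs (b ∷ xs)
   there : ∀ {x xs ys} → Insertion b xs ys → Insertion b (x ∷ xs) (x ∷ ys)

  insertion-length : ∀ {b xs ys} → Insertion b xs ys → length ys ≡ suc (length xs)
  insertion-length here = refl
  insertion-length (there i) = cong suc (insertion-length i)

  insertion-All : ∀ {P : Pred X 0ℓ} {b xs ys} → Insertion b xs ys → P b → All P xs → All P ys
  insertion-All here p ps = p ∷ ps
  insertion-All (there i) p (q ∷ qs) = q ∷ insertion-All i p qs

  insertion-AllPairs : ∀ {R : X → X → Set} → (∀ {x y} → R x y → R y x) → ∀ {b xs ys} → Insertion b xs ys → All (R b) xs → AllPairs R xs → AllPairs R ys
  insertion-AllPairs sy here r rs = r ∷ rs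
  insertion-AllPairs sy (there i) (r ∷ r') (q ∷ qs) = insertion-All i (sy r) q ∷ insertion-AllPairs sy i r' qs

  insertion-⊆ : ∀ {b xs ys} → Insertion b xs ys → ∀ {y} → y ∈ xs → y ∈ ys
  insertion-⊆ here j = there j
  insertion-⊆ (there i) (here refl) = here refl
  insertion-⊆ (there i) (there j) = there (insertion-⊆ i j)

  insertion-∈ : ∀ {b xs ys} → Insertion b xs ys → b ∈ ys
  insertion-∈ here = here refl
  insertion-∈ (there i) = there (insertion-∈ i)

  -- Walks with some marked positions

  positions marked : List (X × Bool) → List X
  positions = map proj₁
  marked [] = []
  marked ((x , true) ∷ qs) = x ∷ marked qs
  marked ((x , false) ∷ qs) = marked qs

  data WalkFrom (us : List (X → X)) : X → List (X × Bool) → Set where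
   [] : ∀ {p} → WalkFrom us p []
   _∷_ : ∀ {p q m qs} → q ∈ nb us p → WalkFrom us q qs → WalkFrom us p ((q , m) ∷ qs)

  detour : ∀ {us} → Symmetricᵐ us → ∀ {p qs t b} → WalkFrom us p qs → t ∈ p ∷ positions qs → b ∈ nb us t →
   ∃[ qs' ] WalkFrom us p qs' × length qs' ≡ 2 + length qs × Insertion b (marked qs) (marked qs')
    × (∀ {y} → y ∈ positions qs' → y ≡ b ⊎ y ≡ t ⊎ y ∈ positions qs)
  detour s {qs = qs} {t} {b} w (here refl) b∈ = (b , true) ∷ (t , false) ∷ qs , b∈ ∷ s b∈ ∷ w , refl , here ,
   λ { (here refl) → inj₁ refl ; (there (here refl)) → inj₂ (inj₁ refl) ; (there (there i)) → inj₂ (inj₂ i) }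
  detour s {qs = (q , m) ∷ qs} (i ∷ w) (there j) b∈ with detour s w j b∈
  ... | qs' , w' , len , ins , pos = (q , m) ∷ qs' , i ∷ w' , cong suc len , insert m ins ,
   λ { (here refl) → inj₂ (inj₂ (here refl)) ; (there k) → [ inj₁ , (λ { (inj₁ eq) → inj₂ (inj₁ eq) ; (inj₂ l) → inj₂ (inj₂ (there l)) }) ]′ (pos k) }
   where
   insert : ∀ m {xs ys : List (X × Bool)} {b} → Insertion b (marked xs) (marked ys) → Insertion b (marked ((q , m) ∷ xs)) (marked ((q , m) ∷ ys))
   insert true i = there i
   insert false i = i

  markings : List (X → X) → ℕ → (X → X) → List (List (X → X))
  markings us zero g = [] ∷ []
  markings us (suc m) g = concatMap (λ t → concatMap (λ ms → ms ∷ ((λ x → t (g x)) ∷ ms) ∷ []) (markings us m (λ x → t (g x)))) us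

  length-concatMap : ∀ {A B : Set} (f : A → List B) c xs → (∀ x → length (f x) ≤ c) → length (concatMap f xs) ≤ length xs * c
  length-concatMap f c [] h = z≤n
  length-concatMap f c (x ∷ xs) h = ≤-trans (≤-reflexive (Listₚ.length-++ (f x))) (+-mono-≤ (h x) (length-concatMap f c xs h))

  length-markings : ∀ us m g → length (markings us m g) ≤ (length us * 2) ^ m
  length-markings us zero g = ≤-refl
  length-markings us (suc m) g = ≤-trans
   (length-concatMap _ ((length us * 2) ^ m * 2) us λ t → ≤-trans (length-concatMap _ 2 (markings us m (λ x → t (g x))) λ _ → ≤-refl)
    (*-monoˡ-≤ 2 (length-markings us m (λ x → t (g x)))))
   (≤-reflexive (swap (length us) ((length us * 2) ^ m)))
   where
   swap : ∀ a b → a * (b * 2) ≡ a * 2 * b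
   swap = solve-∀

  markings-complete : ∀ {us} (g : X → X) {v qs} → WalkFrom us (g v) qs → ∃[ ms ] ms ∈ markings us (length qs) g × nb ms v ≡ marked qs
  markings-complete g [] = [] , here refl , refl
  markings-complete {us} g {v} {(q , m) ∷ qs} (i ∷ w) with nb⁻ i
  ... | t , j , refl with markings-complete {us} (λ x → t (g x)) {v} {qs} w
  ... | ms , k , eq = choose m
   where
   member : ∀ {ns} → ns ∈ ms ∷ ((λ x → t (g x)) ∷ ms) ∷ [] → ns ∈ markings us (suc (length qs)) g
   member l = ∈-concat⁺′ (∈-concat⁺′ l (∈-map⁺ _ k)) (∈-map⁺ _ j)
   choose : ∀ m → ∃[ ns ] ns ∈ markings us (suc (length qs)) g × nb ns v ≡ marked ((t (g v) , m) ∷ qs)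
   choose true = _ , member (there (here refl)) , cong (t (g v) ∷_) eq
   choose false = _ , member (here refl) , eq

  markings-All : ∀ {ℓ} (P : (X → X) → Set ℓ) {us} → (∀ {t g} → t ∈ us → P g → P (λ x → t (g x))) → ∀ m g → P g → All (All P) (markings us m g)
  markings-All P closed zero g p = [] ∷ []
  markings-All P {us} closed (suc m) g p = Allₚ.concat⁺ (Allₚ.map⁺ (All-tabulate λ {t} i →
   Allₚ.concat⁺ (Allₚ.map⁺ (All-map (λ q → q ∷ (closed i p ∷ q) ∷ []) (markings-All P closed m (λ x → t (g x)) (closed i p))))))

 module WalkPotential {𝒳 : BorelSpace} {K : ℕ} (G : Slots 𝒳 K) (δ : ℕ) (2≤δ : 2 ≤ δ) (j n R : ℕ) where
  open Slots G
  open Measurability 𝒳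
  private X = Point 𝒳

  Spaced : X → X → Set
  Spaced p q = ∀ {z} → z ∈ nb maps p → z ∉ nb maps q

  Valid : List (X → X) → X → Set
  Valid ms v = AllPairs Spaced (nb ms v) × length ms ≡ n × All (λ p → p ∈ nb (pow R maps) v) (nb ms v)

  candidates : List (List (X → X))
  candidates = map (id ∷_) (markings (pow (δ + δ + δ) maps) (n + n) id)

  candidates-borel : All (All (BorelMap 𝒳 𝒳)) candidates
  candidates-borel = Allₚ.map⁺ (All-map (bor-id {𝒳} ∷_) (markings-All (BorelMap 𝒳 𝒳)
   (λ {t} {g} i bg A a → bg (A ∘ t) (All-lookup (pow-borel 𝒳 (δ + δ + δ) maps-borel) i A a)) (n + n) id (bor-id {𝒳})))

  summand : List (X → X) → X → State → ℕ
  summand ms v x = if ⟦ Valid ms v ⟧ then product (map (λ u → mass G j (u v) x) ms) else 0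

  potential : X → State → ℕ
  potential v x = sum (map (λ ms → summand ms v x) candidates)

  private
   spaced-borel : ∀ {f g} → BorelMap 𝒳 𝒳 f → BorelMap 𝒳 𝒳 g → Bor 𝒳 (λ v → Spaced (f v) (g v))
   spaced-borel {f} {g} bf bg = bor-⇔ 𝒳
    (λ v all {z} i i' → spaced v all (nb⁻ i) (nb⁻ i'))
    (λ v sp → All-tabulate λ i → All-tabulate λ i' eq → sp (nb⁺ i) (subst (_∈ nb maps (g v)) (sym eq) (nb⁺ i')))
    (bor-All 𝒳 maps (All-map (λ {t} bt → bor-All 𝒳 maps (All-map (λ {t'} bt' →
     bor-∁ 𝒳 (bor-≡ {𝒳} {𝒳} {t ∘ f} {t' ∘ g} (λ A a → bf (A ∘ t) (bt A a)) (λ A a → bg (A ∘ t') (bt' A a)))) maps-borel)) maps-borel))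

    where
    spaced : ∀ v → All (λ t → All (λ t' → t (f v) ≢ t' (g v)) maps) maps → ∀ {z} → ∃[ t ] t ∈ maps × z ≡ t (f v) → ∃[ t ] t ∈ maps × z ≡ t (g v) → ⊥
    spaced v all (t , k , refl) (t' , k' , eq) = All-lookup (All-lookup all k) k' eq

   allPairs-borel : ∀ {ms} → All (BorelMap 𝒳 𝒳) ms → Bor 𝒳 (λ v → AllPairs Spaced (nb ms v))
   allPairs-borel [] = bor-⇔ 𝒳 (λ _ _ → []) (λ _ _ → tt) (bor-const 𝒳 ⊤)
   allPairs-borel (_∷_ {m} {ms} b bs) = bor-⇔ 𝒳 (λ { v (p , ps) → Allₚ.map⁺ p ∷ ps }) (λ { v (p ∷ ps) → Allₚ.map⁻ p , ps })
    (bor-∩ 𝒳 (bor-All 𝒳 ms (All-map (λ {m'} b' → spaced-borel {m} {m'} b b') bs)) (allPairs-borel bs))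

   near-borel : ∀ {ms} → All (BorelMap 𝒳 𝒳) ms → Bor 𝒳 (λ v → All (λ p → p ∈ nb (pow R maps) v) (nb ms v))
   near-borel {ms} bs = bor-⇔ 𝒳 (λ v → Allₚ.map⁺ ∘ All-map Anyₚ.map⁺) (λ v → All-map Anyₚ.map⁻ ∘ Allₚ.map⁻)
    (bor-All 𝒳 ms (All-map (λ {m} b → bor-Any 𝒳 (pow R maps) (All-map (λ {t} bt → bor-≡ {𝒳} {𝒳} {m} {t} b bt) (pow-borel 𝒳 R maps-borel))) bs))

   mass-meas : ∀ {x} → Meas x → ∀ {u} → BorelMap 𝒳 𝒳 u → Meas (λ v → mass G j (u v) x)
   mass-meas {x} m {u} b = meas-∘ {f = u} b (meas-map (wsum j) (signs-meas G x m))

   product-meas : ∀ {x} → Meas x → ∀ {ms} → All (BorelMap 𝒳 𝒳) ms → Meas (λ v → product (map (λ u → mass G j (u v) x) ms))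
   product-meas m [] = meas-const 1
   product-meas m (_∷_ {u} b bs) = meas-map₂ _*_ (mass-meas m {u} b) (product-meas m bs)

  potential-meas : ∀ x → Meas x → Meas (λ v → potential v x)
  potential-meas x m = go candidates-borel
   where
   go : ∀ {mss} → All (All (BorelMap 𝒳 𝒳)) mss → Meas (λ v → sum (map (λ ms → summand ms v x) mss))
   go [] = meas-const 0
   go (bs ∷ bss) = meas-map₂ _+_
    (meas-if (bor-∩ 𝒳 (allPairs-borel bs) (bor-∩ 𝒳 (bor-const 𝒳 _) (near-borel bs))) (product-meas m bs) (meas-const 0)) (go bss)

  potential-depends : ∀ v → DependsOn (potential v) (λ z → z ∈ nb (pow (suc R) maps) v)
  potential-depends v x x' agree = cong sum (Listₚ.map-cong (λ ms → same ms (dec (Valid ms v))) candidates)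
   where
   products : ∀ ms → All (λ p → p ∈ nb (pow R maps) v) (nb ms v) → product (map (λ u → mass G j (u v) x) ms) ≡ product (map (λ u → mass G j (u v) x') ms)
   products [] _ = refl
   products (u ∷ ms) (i ∷ is) = cong₂ _*_ (mass-depends G j (u v) x x' λ z k → agree z (reach-snoc R i k)) (products ms is)
   same : ∀ ms → Dec (Valid ms v) → summand ms v x ≡ summand ms v x'
   same ms (yes val) = trans (if-yes val) (trans (products ms (proj₂ (proj₂ val))) (sym (if-yes val)))
   same ms (no ¬val) = trans (if-no ¬val) (sym (if-no ¬val))

  potential-harmonic : ∀ v → Harmonic (potential v)
  potential-harmonic v x y = harmonic-sum {F = λ ms → summand ms v} candidates (λ ms → harm ms (dec (Valid ms v))) x
   where
   pairs : ∀ {ms} → AllPairs Spaced (nb ms v) → AllPairs (λ u u' → ¬ IndifferentAt (mass G j (u v)) y → IndifferentAt (mass G j (u' v)) y) ms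
   pairs {[]} [] = []
   pairs {u ∷ ms} (p ∷ ps) = All-map (λ {u'} sp ¬ind → mass-indifferent G j (u' v) (sp (by-contradiction λ y∉ → ¬ind (mass-indifferent G j (u v) y∉)))) (Allₚ.map⁻ p) ∷ pairs ps
   harm : ∀ ms → Dec (Valid ms v) → HarmonicAt (summand ms v) y
   harm ms (yes val) x rewrite if-yes {x = product (map (λ u → mass G j (u v) (x [ y ≔ plus ])) ms)} {y = 0} val
    | if-yes {x = product (map (λ u → mass G j (u v) (x [ y ≔ minus ])) ms)} {y = 0} val
    | if-yes {x = product (map (λ u → mass G j (u v) (x [ y ≔ unset ])) ms)} {y = 0} val =
    harmonic-product {F = λ u → mass G j (u v)} ms (All-tabulate λ {u} _ → mass-harmonic G j (u v) y) (pairs (proj₁ val)) x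
   harm ms (no ¬val) x rewrite if-no {x = product (map (λ u → mass G j (u v) (x [ y ≔ plus ])) ms)} {y = 0} ¬val
    | if-no {x = product (map (λ u → mass G j (u v) (x [ y ≔ minus ])) ms)} {y = 0} ¬val
    | if-no {x = product (map (λ u → mass G j (u v) (x [ y ≔ unset ])) ms)} {y = 0} ¬val = refl

  potential-unset : ∀ v → potential v (λ _ → unset) ≤ (length (pow (δ + δ + δ) maps) * 2) ^ (n + n) * (2 * suc j ^ K) ^ n
  potential-unset v = ≤-trans (go candidates) (*-monoˡ-≤ ((2 * suc j ^ K) ^ n)
    (≤-trans (≤-reflexive (Listₚ.length-map (id ∷_) (markings (pow (δ + δ + δ) maps) (n + n) id))) (length-markings (pow (δ + δ + δ) maps) (n + n) id)))
   where
   products : ∀ ms → product (map (λ u → mass G j (u v) (λ _ → unset)) ms) ≡ (2 * suc j ^ K) ^ length ms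
   products [] = refl
   products (u ∷ ms) = cong₂ _*_ (mass-unset G j (u v)) (products ms)
   each : ∀ ms → summand ms v (λ _ → unset) ≤ (2 * suc j ^ K) ^ n
   each ms with dec (Valid ms v)
   ... | yes (_ , len , _) = ≤-reflexive (trans (products ms) (cong ((2 * suc j ^ K) ^_) len))
   ... | no _ = z≤n
   go : ∀ mss → sum (map (λ ms → summand ms v (λ _ → unset)) mss) ≤ length mss * (2 * suc j ^ K) ^ n
   go [] = z≤n
   go (ms ∷ mss) = +-mono-≤ (each ms) (go mss)

  potential-heavy : ∀ v x ms → ms ∈ candidates → Valid ms v → ∀ c → (∀ {p} → p ∈ nb ms v → c ≤ 2 * mass G j p x) → c ^ n ≤ 2 ^ n * potential v x
  potential-heavy v x ms i val@(_ , len , _) c heavy' = begin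
   c ^ n ≡⟨ cong (c ^_) (sym len) ⟩
   c ^ length ms ≤⟨ products ms heavy' ⟩
   2 ^ length ms * product (map (λ u → mass G j (u v) x) ms) ≡⟨ cong₂ (λ m p → 2 ^ m * p) len (sym (if-yes val)) ⟩
   2 ^ n * summand ms v x ≤⟨ *-monoʳ-≤ (2 ^ n) (member i) ⟩
   2 ^ n * potential v x ∎
   where
   open ≤-Reasoning
   products : ∀ ms → (∀ {p} → p ∈ nb ms v → c ≤ 2 * mass G j p x) → c ^ length ms ≤ 2 ^ length ms * product (map (λ u → mass G j (u v) x) ms)
   products [] h = ≤-refl
   products (u ∷ ms) h = ≤-trans (*-mono-≤ (h (here refl)) (products ms (h ∘ there)))
    (≤-reflexive (swap (mass G j (u v) x) (2 ^ length ms) (product (map (λ u → mass G j (u v) x) ms))))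
    where
    swap : ∀ a b c → 2 * a * (b * c) ≡ 2 * b * (a * c)
    swap = solve-∀
   member : ∀ {mss} → ms ∈ mss → summand ms v x ≤ sum (map (λ ms → summand ms v x) mss)
   member (here refl) = m≤m+n _ _
   member {_ ∷ mss} (there i) = ≤-trans (member i) (m≤n+m (sum (map (λ ms → summand ms v x) mss)) _)

  module _ (Bad : Pred X 0ℓ) where

   BothBad : X → X → Set
   BothBad p q = Bad p × Bad q

   near-steps : List (X → X)
   near-steps = id ∷ map (keep BothBad) (pow (δ + δ) maps)

   near-step⇒ : ∀ {p q} → q ∈ nb near-steps p → (Bad p → Bad q) × q ∈ nb (pow (δ + δ) maps) p
   near-step⇒ (here refl) = id , reach-refl (δ + δ) (here refl)
   near-step⇒ (there i) with nb-keep⁻ BothBad i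
   ... | inj₁ ((_ , bad) , k) = (λ _ → bad) , k
   ... | inj₂ refl = id , reach-refl (δ + δ) (here refl)

  -- Dangerous points: everything that is connected to v by steps of length
  -- at most 4 between dangerous points, all within distance R of v, lies in
  -- few balls of radius 2 once the potential at v is small.
  module _ (Bad : Pred X 0ℓ) (v : X) (Bad-v : Bad v) (r : ℕ) (r≤R : r * (δ + δ) ≤ R) (0<n : 0 < n) where

   Cluster : Pred X 0ℓ
   Cluster y = y ∈ nb (pow r (near-steps Bad)) v

   reach-bad : ∀ m {y} → y ∈ nb (pow m (near-steps Bad)) v → Bad y × y ∈ nb (pow (m * (δ + δ)) maps) v
   reach-bad zero (here refl) = Bad-v , here refl
   reach-bad (suc m) p = let _ , q , e = reach-unsnoc m {near-steps Bad} p
                             bad , i = reach-bad m q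
                             f , k = near-step⇒ Bad e
              in f bad , reach-trans (m * (δ + δ)) (δ + δ) i k

   Dominated : List X → Pred X 0ℓ
   Dominated ms y = ∃[ m ] m ∈ ms × y ∈ nb (pow δ maps) m

   boundary : ∀ ms → v ∈ ms → ∀ m → m ≤ r → ∀ {y} → y ∈ nb (pow m (near-steps Bad)) v → ¬ Dominated ms y →
    ∃[ b ] ∃[ u ] Cluster b × ¬ Dominated ms b × Dominated ms u × b ∈ nb (pow (δ + δ) maps) u
   boundary ms v∈ zero _ (here refl) ¬dom = ⊥-elim (¬dom (v , v∈ , reach-refl δ (here refl)))
   boundary ms v∈ (suc m) m≤ {y} p ¬dom with reach-unsnoc m {near-steps Bad} p
   ... | u , q , e with dec (Dominated ms u)
   ... | yes dom = y , u , reach-mono (here refl) m≤ p , ¬dom , dom , proj₂ (near-step⇒ Bad e)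
   ... | no ¬dom' = boundary ms v∈ m (≤-trans (n≤1+n m) m≤) q ¬dom'

   spaced-sym : ∀ {p q} → Spaced p q → Spaced q p
   spaced-sym sp i j = sp j i

   undominated-spaced : ∀ {ms b} → ¬ Dominated ms b → All (Spaced b) ms
   undominated-spaced ¬dom = All-tabulate λ {m} i {z} z∈b z∈m → ¬dom (m , i , reach-mono {ts = maps} (here refl) 2≤δ (reach-snoc 1 {maps} (reach-1 {ts = maps} z∈m) (maps-sym z∈b)))

   record Exploration (k : ℕ) : Set where
    field
     path : List (X × Bool)
     walk : WalkFrom (pow (δ + δ + δ) maps) v path
     path-len : length path ≡ k + k
     count-k : length (marked path) ≡ k
     visited : ∀ {y} → y ∈ positions path → y ∈ v ∷ marked path
     inside : All Cluster (v ∷ marked path)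
     spread : AllPairs Spaced (v ∷ marked path)
   open Exploration

   marked⊆positions : ∀ qs {t : X} → t ∈ v ∷ marked qs → t ∈ v ∷ positions qs
   marked⊆positions qs (here refl) = here refl
   marked⊆positions ((x , true) ∷ qs) (there (here refl)) = there (here refl)
   marked⊆positions ((x , true) ∷ qs) (there (there i)) with marked⊆positions qs (there i)
   ... | here eq = here eq
   ... | there k = there (there k)
   marked⊆positions ((x , false) ∷ qs) (there i) with marked⊆positions qs (there i)
   ... | here eq = here eq
   ... | there k = there (there k)

   enlarge : ∀ {k} (e : Exploration k) {t b} → Cluster b → ¬ Dominated (v ∷ marked (path e)) b → t ∈ v ∷ marked (path e) → b ∈ nb (pow (δ + δ + δ) maps) t → Exploration (suc k)
   enlarge {k} e {t} {b} b∈ ¬dom t∈ near =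
    let qs' , w' , len , ins , pos = detour (reach-sym (δ + δ + δ) maps-sym) (walk e) (marked⊆positions (path e) t∈) near in record
    { path = qs' ; walk = w'
    ; path-len = trans len (trans (cong (2 +_) (path-len e)) (cong suc (sym (+-suc k k))))
    ; count-k = trans (insertion-length ins) (cong suc (count-k e))
    ; visited = λ i → place qs' ins (pos i)
    ; inside = insertion-All (there ins) b∈ (inside e)
    ; spread = insertion-AllPairs spaced-sym (there ins) (undominated-spaced ¬dom) (spread e) }
    where
    place : ∀ qs' → Insertion b (marked (path e)) (marked qs') → ∀ {y} → y ≡ b ⊎ y ≡ t ⊎ y ∈ positions (path e) → y ∈ v ∷ marked qs'
    place qs' ins (inj₁ refl) = there (insertion-∈ ins)
    place qs' ins (inj₂ (inj₁ refl)) = insertion-⊆ (there ins) t∈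
    place qs' ins (inj₂ (inj₂ i)) = insertion-⊆ (there ins) (visited e i)

   explore : (∀ ms → length ms < n → ∃[ y ] Cluster y × ¬ Dominated ms y) → ∀ k → k < n → Exploration k
   explore more zero _ = record
    { path = [] ; walk = [] ; path-len = refl ; count-k = refl ; visited = λ () ; inside = reach-refl r (here refl) ∷ [] ; spread = [] ∷ [] }
   explore more (suc k) k<n =
    let e = explore more k (<⇒≤ k<n)
        y , y∈ , ¬dom = more (v ∷ marked (path e)) (subst (λ m → suc m < n) (sym (count-k e)) k<n)
        b , u , b∈ , ¬dom-b , (t , t∈ , u∈) , bu = boundary (v ∷ marked (path e)) (here refl) r ≤-refl y∈ ¬dom
    in enlarge e b∈ ¬dom-b t∈ (reach-trans δ (δ + δ) u∈ bu)

   heavy-cluster : ∀ c x → (∀ {p} → Bad p → c ≤ 2 * mass G j p x) → (∀ ms → length ms < n → ∃[ y ] Cluster y × ¬ Dominated ms y) → c ^ n ≤ 2 ^ n * potential v x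
   heavy-cluster c x bad-heavy more = go (explore more k (≤-reflexive (sym eq)))
    where
    k = pred n
    eq : n ≡ suc k
    eq = sym (suc-pred n {{>-nonZero 0<n}})
    go : Exploration k → c ^ n ≤ 2 ^ n * potential v x
    go e =
     let ms , i , marks = markings-complete id {v} {(v , false) ∷ (v , false) ∷ path e} (reach-refl (δ + δ + δ) (here refl) ∷ reach-refl (δ + δ + δ) (here refl) ∷ walk e)
     in potential-heavy v x (id ∷ ms)
     (∈-map⁺ (id ∷_) (subst (λ m → ms ∈ markings (pow (δ + δ + δ) maps) m id) len i))
     (subst (AllPairs Spaced ∘ (v ∷_)) (sym marks) (spread e)
     , trans (cong suc (trans (sym (Listₚ.length-map (λ t → t v) ms)) (trans (cong length marks) (count-k e)))) (sym eq)
     , subst (All (λ p → p ∈ nb (pow R maps) v) ∘ (v ∷_)) (sym marks) (All-map (λ cl → reach-mono (here refl) r≤R (proj₂ (reach-bad r cl))) (inside e)))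
     c (λ {p} p∈ → bad-heavy (proj₁ (reach-bad r (All-lookup (inside e) (subst (λ l → p ∈ v ∷ l) marks p∈)))))
     where
     len : suc (suc (length (path e))) ≡ n + n
     len = trans (cong (λ m → suc (suc m)) (path-len e)) (trans (cong suc (sym (+-suc k k))) (cong (λ m → m + m) (sym eq)))

 mex-bound : ∀ {X : Set} (f : X → ℕ) m ys → (∀ i → i < m → ∃[ y ] y ∈ ys × f y ≡ i) → m ≤ length ys
 mex-bound f m ys attained = subst₂ _≤_ (Listₚ.length-upTo m) (Listₚ.length-map f ys)
  (length-⊆ (upTo⁺ m) λ i → let y , k , eq = attained _ (∈-upTo⁻ i) in subst (_∈ map f ys) eq (∈-map⁺ f k))
  where
  open import Data.List.Relation.Unary.Unique.Propositional.Properties using (upTo⁺)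
  open import Data.List.Membership.Propositional.Properties using (∈-upTo⁻)

 radix-injective : ∀ q {a a' c c'} → c < q → c' < q → a * q + c ≡ a' * q + c' → a ≡ a' × c ≡ c'
 radix-injective q {zero} {zero} c< c'< eq = refl , eq
 radix-injective q {zero} {suc a'} {c} {c'} c< c'< eq = ⊥-elim (<⇒≱ c< (subst (q ≤_) (sym eq) (≤-trans (m≤m+n q (a' * q)) (m≤m+n _ c'))))
 radix-injective q {suc a} {zero} {c} {c'} c< c'< eq = ⊥-elim (<⇒≱ c'< (subst (q ≤_) eq (≤-trans (m≤m+n q (a * q)) (m≤m+n _ c))))
 radix-injective q {suc a} {suc a'} {c} {c'} c< c'< eq =
  let a≡ , c≡ = radix-injective q {a} {a'} c< c'< (+-cancelˡ-≡ q _ _ (trans (sym (+-assoc q (a * q) c)) (trans eq (+-assoc q (a' * q) c'))))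
  in cong suc a≡ , c≡

 count-change : ∀ {I : Set} (f g : I → Sign) (Ch : I → Set) → (∀ i → g i ≡ f i ⊎ f i ≡ unset × Ch i) → (∀ {i i'} → Ch i → Ch i' → i ≡ i') →
  ∀ {is} → Unique is → ∀ q → q ≢ unset → count q (map f is) ≤ count q (map g is) × count q (map g is) ≤ suc (count q (map f is))
 count-change f g Ch change only [] q q≢ = z≤n , z≤n
 count-change f g Ch change only {i ∷ is} (i∉ ∷ u) q q≢ with change i
 ... | inj₁ eq rewrite eq = let lo , hi = count-change f g Ch change only u q q≢ in
  +-monoʳ-≤ (ind (q == f i)) lo , subst (ind (q == f i) + count q (map g is) ≤_) (+-suc (ind (q == f i)) _) (+-monoʳ-≤ (ind (q == f i)) hi)
 ... | inj₂ (eq , ch) = +-mono-≤ (no-unset q q≢) (≤-reflexive (cong (count q) (sym (rest i∉))))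
  , +-mono-≤ (ind≤1 (q == g i)) (≤-trans (≤-reflexive (cong (count q) (rest i∉))) (m≤n+m (count q (map f is)) (ind (q == f i))))
  where
  rest : ∀ {js} → All (i ≢_) js → map g js ≡ map f js
  rest [] = refl
  rest {k ∷ _} (i≢ ∷ ps) with change k
  ... | inj₁ e = cong₂ _∷_ e (rest ps)
  ... | inj₂ (_ , ch') = ⊥-elim (i≢ (only ch ch'))
  no-unset : ∀ q → q ≢ unset → ind (q == f i) ≤ ind (q == g i)
  no-unset q q≢ rewrite eq = zero-ind q q≢
   where
   zero-ind : ∀ q → q ≢ unset → ind (q == unset) ≤ ind (q == g i)
   zero-ind unset ≢ = ⊥-elim (≢ refl)
   zero-ind plus ≢ = z≤n
   zero-ind minus ≢ = z≤n
  ind≤1 : ∀ b → ind b ≤ 1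
  ind≤1 true = ≤-refl
  ind≤1 false = z≤n

 -- Colouring one independent layer at a time; points next to an unbalanced
 -- neighbourhood stay uncoloured.
 module PhaseOne {𝒳 : BorelSpace} {K : ℕ} (G : Slots 𝒳 K) {s : ℕ} (layering : ∀ r → Layering 𝒳 (pow r (Slots.maps G)) s)
  (δ : ℕ) (2≤δ : 2 ≤ δ) (j n R b : ℕ) where
  open Slots G
  open Measurability 𝒳
  open WalkPotential G δ 2≤δ j n R
  private
   X = Point 𝒳
   r = suc R

  Q : ℕ
  Q = suc (length (pow δ maps))

  rounds : ℕ
  rounds = s * Q

  private
   open Layering (layering (r + r))
   colouring = Greedy.greedy 𝒳 (pow-borel 𝒳 δ maps-borel) (reach-sym δ maps-sym) (layering δ)
   c = proj₁ colouring
   c-meas = proj₁ (proj₂ colouring)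
   c-proper = proj₁ (proj₂ (proj₂ colouring))

   c<Q : ∀ v → c v < Q
   c<Q v = s≤s (subst (c v ≤_) (Listₚ.length-map _ (pow δ maps)) (mex-bound c (c v) (nb (pow δ maps) v) λ i i< →
    let y , k , _ , eq = proj₂ (proj₂ (proj₂ colouring)) v i i< in y , k , eq))

   round : X → ℕ
   round v = layer v * Q + c v

   round-meas : Meas round
   round-meas = meas-map₂ (λ l c → l * Q + c) layer-meas c-meas

   round< : ∀ v → round v < rounds
   round< v = ≤-trans (≤-trans (≤-reflexive (sym (+-suc (layer v * Q) (c v)))) (+-monoʳ-≤ (layer v * Q) (c<Q v)))
    (≤-trans (≤-reflexive (+-comm (layer v * Q) Q)) (*-monoˡ-≤ Q (layer< v)))

   slot∈2 : ∀ {v} i i' → slot i' v ∈ nb (pow δ maps) (slot i v)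
   slot∈2 {v} i i' = reach-mono {ts = maps} (here refl) 2≤δ (reach-snoc 1 {maps} (reach-1 {ts = maps} (maps-sym (slot∈maps i))) (slot∈maps i'))

  Danger : State → X → Set
  Danger x v = Unbalanced b (signs v x)

  Frozen : State → X → Set
  Frozen x v = Any (λ i → slot i v ≢ v × Danger x (slot i v)) (allFin K)

  Balanced : State → X → Set
  Balanced x v = count plus (signs v x) ≤ count minus (signs v x) + b × count minus (signs v x) ≤ count plus (signs v x) + b

  danger-borel : ∀ x → Meas x → Bor 𝒳 (Danger x)
  danger-borel x m = signs-meas G x m (Unbalanced b)

  frozen-borel : ∀ x → Meas x → Bor 𝒳 (Frozen x)
  frozen-borel x m = bor-Any 𝒳 (allFin K) (All-tabulate λ {i} _ →
   bor-∩ 𝒳 (bor-∁ 𝒳 (bor-≡ {𝒳} {𝒳} {slot i} {id} (slot-borel i) (bor-id {𝒳}))) (slot-borel i _ (danger-borel x m)))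

  frozen-neighbour : ∀ {x v} i → slot i v ≢ v → Danger x v → Frozen x (slot i v)
  frozen-neighbour {x} {v} i moved danger = let k , eq = slot-back i v in
   lose (∈-allFin k) ((λ eq' → moved (trans (sym eq') eq)) , subst (Danger x) (sym eq) danger)

  private
   record Stage (ℓ : ℕ) : Set₁ where
    field
     x : State
     x-meas : Meas x
     balanced : ∀ v → Balanced x v
     done : ∀ v → round v < ℓ → x v ≢ unset ⊎ Frozen x v
     todo : ∀ v → ℓ ≤ round v → x v ≡ unset
     small : ∀ v → potential v x ≤ blowup maps (suc R) ^ ℓ * potential v (λ _ → unset)

   signs-unset : ∀ q → q ≢ unset → ∀ v → count q (signs v (λ _ → unset)) ≡ 0
   signs-unset q q≢ v = go (allFin K)
    where
    go : ∀ is → count q (map (sign v (λ _ → unset)) is) ≡ 0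
    go [] = refl
    go (i ∷ is) = cong₂ _+_ (none q q≢ (dec (slot i v ≡ v))) (go is)
     where
     none : ∀ q → q ≢ unset → (d : Dec (slot i v ≡ v)) → ind (q == (if does d then unset else unset)) ≡ 0
     none unset ≢ d = ⊥-elim (≢ refl)
     none plus ≢ (yes _) = refl
     none plus ≢ (no _) = refl
     none minus ≢ (yes _) = refl
     none minus ≢ (no _) = refl

   start : Stage 0
   start = record
    { x = λ _ → unset ; x-meas = meas-const unset
    ; balanced = λ v → ≤-trans (≤-reflexive (signs-unset plus (λ ()) v)) z≤n , ≤-trans (≤-reflexive (signs-unset minus (λ ()) v)) z≤n
    ; done = λ _ () ; todo = λ _ _ → refl ; small = λ v → ≤-reflexive (sym (*-identityˡ _)) }

   module Step {ℓ : ℕ} (st : Stage ℓ) where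
    open Stage st
    Y : Pred X 0ℓ
    Y v = round v ≡ ℓ × ¬ Frozen x v
    Y-borel : Bor 𝒳 Y
    Y-borel = bor-∩ 𝒳 (round-meas (_≡ ℓ)) (bor-∁ 𝒳 (frozen-borel x x-meas))
    same-layer : ∀ {u v} → round u ≡ ℓ → round v ≡ ℓ → layer u ≡ layer v × c u ≡ c v
    same-layer {u} {v} eq eq' = radix-injective Q (c<Q u) (c<Q v) (trans eq (sym eq'))
    YY SL : X → X → Set
    YY u v = Y u × Y v
    SL u v = layer u ≡ layer v
    Y-finite : FiniteOrbits (map (keep YY) (pow (r + r) maps))
    Y-finite = finiteOrbits-⊆ inclusion components
     where
     inclusion : ∀ {u v} → v ∈ nb (map (keep YY) (pow (r + r) maps)) u → v ∈ nb (map (keep SL) (pow (r + r) maps)) u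
     inclusion p with nb-keep⁻ YY p
     ... | inj₁ (((e , _) , (e' , _)) , i) = nb-keep⁺ SL (proj₁ (same-layer e e')) i
     ... | inj₂ refl = nb-keep⁺ SL refl (reach-refl (r + r) (here refl))

    module _ {x' : State} (x'-meas : Meas x') (off : ∀ {z} → ¬ Y z → x' z ≡ x z) (on : ∀ {z} → Y z → x' z ≢ unset)
     (grows : ∀ v → potential v x' ≤ blowup maps (suc R) * potential v x) where
     signs-off : ∀ v → (∀ i → slot i v ≢ v → ¬ Y (slot i v)) → signs v x' ≡ signs v x
     signs-off v away = Listₚ.map-cong (λ i → sign-agree G {v} {x'} {x} i λ ≢ → off (away i ≢)) (allFin K)
     signs-danger : ∀ v → Danger x v → signs v x' ≡ signs v x
     signs-danger v danger = signs-off v λ i moved (_ , ¬frozen) → ¬frozen (frozen-neighbour {x} i moved danger)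
     change : ∀ v i → sign v x' i ≡ sign v x i ⊎ sign v x i ≡ unset × (slot i v ≢ v × Y (slot i v))
     change v i with dec (slot i v ≡ v) | dec (Y (slot i v))
     ... | yes _ | _ = inj₁ refl
     ... | no ≢ | yes y = inj₂ (todo _ (≤-reflexive (sym (proj₁ y))) , ≢ , y)
     ... | no ≢ | no ¬y = inj₁ (off ¬y)
     only : ∀ v {i i'} → slot i v ≢ v × Y (slot i v) → slot i' v ≢ v × Y (slot i' v) → i ≡ i'
     only v {i} {i'} (≢ , y) (≢' , y') = by-contradiction λ i≢i' →
      c-proper (slot i v) (slot∈2 i i') (λ eq → i≢i' (slot-injective i i' (sym eq) ≢)) (sym (proj₂ (same-layer (proj₁ y) (proj₁ y'))))
     balanced' : ∀ v → Balanced x' v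
     balanced' v with dec (Danger x v)
     ... | yes danger rewrite signs-danger v danger = balanced v
     ... | no ¬danger =
      let p≤ , ≤p = count-change (sign v x) (sign v x') _ (change v) (only v) (allFin-unique G j) plus (λ ())
          m≤ , ≤m = count-change (sign v x) (sign v x') _ (change v) (only v) (allFin-unique G j) minus (λ ())
      in ≤-trans ≤p (≤-trans (≰⇒> (¬danger ∘ inj₁)) (+-monoˡ-≤ b m≤))
       , ≤-trans ≤m (≤-trans (≰⇒> (¬danger ∘ inj₂)) (+-monoˡ-≤ b p≤))
     frozen' : ∀ {v} → Frozen x v → Frozen x' v
     frozen' = Any-map λ {i} (≢ , danger) → ≢ , subst (Unbalanced b) (sym (signs-danger _ danger)) danger
     done' : ∀ v → round v < suc ℓ → x' v ≢ unset ⊎ Frozen x' v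
     done' v lt with m≤n⇒m<n∨m≡n (≤-pred lt)
     ... | inj₁ lt' = [ (λ set → inj₁ λ eq → set (trans (sym (off λ (e , _) → <⇒≢ lt' e)) eq)) , inj₂ ∘ frozen' ]′ (done v lt')
     ... | inj₂ eq with dec (Frozen x v)
     ... | yes f = inj₂ (frozen' f)
     ... | no ¬f = inj₁ (on (eq , ¬f))
     todo' : ∀ v → suc ℓ ≤ round v → x' v ≡ unset
     todo' v ≤round = trans (off λ (e , _) → <⇒≢ ≤round (sym e)) (todo v (<⇒≤ ≤round))
     next : Stage (suc ℓ)
     next = record
      { x = x' ; x-meas = x'-meas ; balanced = balanced' ; done = done' ; todo = todo'
      ; small = λ v → ≤-trans (grows v) (≤-trans (*-monoʳ-≤ (blowup maps (suc R)) (small v)) (≤-reflexive (sym (*-assoc (blowup maps (suc R)) (blowup maps (suc R) ^ ℓ) (potential v (λ _ → unset)))))) }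

   advance : ∀ ℓ → Stage ℓ → Stage (suc ℓ)
   advance ℓ st =
    let x' , x'-meas , off , on , grows = borel-local-lemma 𝒳 maps-borel maps-sym (here refl) r potential potential-depends potential-harmonic potential-meas
         Y Y-borel Y-finite x x-meas (λ {z} (eq , _) → todo z (≤-reflexive (sym eq)))
    in next {x'} x'-meas off on grows
    where
    open Stage st
    open Step st

   stages : ∀ ℓ → Stage ℓ
   stages zero = start
   stages (suc ℓ) = advance ℓ (stages ℓ)

  phase-one : ∃[ x ] Meas x × (∀ v → Balanced x v) × (∀ v → x v ≢ unset ⊎ Frozen x v)
   × (∀ v → potential v x ≤ blowup maps (suc R) ^ rounds * potential v (λ _ → unset))
  phase-one = x , x-meas , balanced , (λ v → done v (round< v)) , small
   where open Stage (stages rounds)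

 module _ {I : Set} where

  length-select : ∀ (P : Pred I 0ℓ) is → length (select-list P is) ≡ sum (map (λ i → ind ⟦ P i ⟧) is)
  length-select P [] = refl
  length-select P (i ∷ is) with dec (P i)
  ... | yes _ = cong suc (length-select P is)
  ... | no _ = length-select P is

  sum-map-+ : ∀ (f g : I → ℕ) is → sum (map (λ i → f i + g i) is) ≡ sum (map f is) + sum (map g is)
  sum-map-+ f g [] = refl
  sum-map-+ f g (i ∷ is) = trans (cong (f i + g i +_) (sum-map-+ f g is)) (swap (f i) (g i) (sum (map f is)) (sum (map g is)))
   where
   swap : ∀ a b c d → a + b + (c + d) ≡ a + c + (b + d)
   swap = solve-∀

  sum-map-≡ : ∀ {f g : I → ℕ} → (∀ i → f i ≡ g i) → ∀ is → sum (map f is) ≡ sum (map g is)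
  sum-map-≡ h is = cong sum (Listₚ.map-cong h is)

 data OneOf (s₁ s₂ s₃ : Sign) : Sign → Set where
  fst : ∀ {s} → s₁ ≡ s → s₂ ≡ unset → s₃ ≡ unset → OneOf s₁ s₂ s₃ s
  snd : ∀ {s} → s₁ ≡ unset → s₂ ≡ s → s₃ ≡ unset → OneOf s₁ s₂ s₃ s
  thd : ∀ {s} → s₁ ≡ unset → s₂ ≡ unset → s₃ ≡ s → OneOf s₁ s₂ s₃ s

 oneOf-ind : ∀ q → q ≢ unset → ∀ {s₁ s₂ s₃ s} → OneOf s₁ s₂ s₃ s → ind (q == s) ≡ ind (q == s₁) + ind (q == s₂) + ind (q == s₃)
 oneOf-ind unset ≢ o = ⊥-elim (≢ refl)
 oneOf-ind plus ≢ (fst refl refl refl) = sym (trans (+-identityʳ _) (+-identityʳ _))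
 oneOf-ind plus ≢ (snd refl refl refl) = sym (+-identityʳ _)
 oneOf-ind plus ≢ (thd refl refl refl) = refl
 oneOf-ind minus ≢ (fst refl refl refl) = sym (trans (+-identityʳ _) (+-identityʳ _))
 oneOf-ind minus ≢ (snd refl refl refl) = sym (+-identityʳ _)
 oneOf-ind minus ≢ (thd refl refl refl) = refl

 module _ {𝒳 : BorelSpace} {K : ℕ} (G : Slots 𝒳 K) where
  open Slots G
  private X = Point 𝒳

  slotCount : (X → Set) → X → ℕ
  slotCount P v = length (select-list (λ i → slot i v ≢ v × P (slot i v)) (allFin K))

  count-signs : ∀ q → q ≢ unset → ∀ x v → count q (signs v x) ≡ slotCount (λ z → x z ≡ q) v
  count-signs q q≢ x v = trans (cong sum (sym (Listₚ.map-∘ {g = λ s → ind (q == s)} {f = sign v x} (allFin K))))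
   (trans (sum-map-≡ pointwise (allFin K)) (sym (length-select _ (allFin K))))
   where
   same : ∀ q s → ind (q == s) ≡ ind ⟦ s ≡ q ⟧
   same unset unset = cong ind (sym (⟦⟧⁺ refl))
   same plus plus = cong ind (sym (⟦⟧⁺ refl))
   same minus minus = cong ind (sym (⟦⟧⁺ refl))
   same unset plus = cong ind (sym (¬⟦⟧⁺ λ ()))
   same unset minus = cong ind (sym (¬⟦⟧⁺ λ ()))
   same plus unset = cong ind (sym (¬⟦⟧⁺ λ ()))
   same plus minus = cong ind (sym (¬⟦⟧⁺ λ ()))
   same minus unset = cong ind (sym (¬⟦⟧⁺ λ ()))
   same minus plus = cong ind (sym (¬⟦⟧⁺ λ ()))
   pointwise : ∀ i → ind (q == sign v x i) ≡ ind ⟦ slot i v ≢ v × x (slot i v) ≡ q ⟧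
   pointwise i with dec (slot i v ≡ v)
   ... | yes eq = trans (same q unset) (cong ind (trans (¬⟦⟧⁺ (q≢ ∘ sym)) (sym (¬⟦⟧⁺ λ (≢ , _) → ≢ eq))))
   ... | no ≢ with dec (x (slot i v) ≡ q)
   ... | yes eq = trans (same q _) (cong ind (trans (⟦⟧⁺ eq) (sym (⟦⟧⁺ (≢ , eq)))))
   ... | no ≢q = trans (same q _) (cong ind (trans (¬⟦⟧⁺ ≢q) (sym (¬⟦⟧⁺ (≢q ∘ proj₂)))))

  slotCount-oneOf : ∀ q → q ≢ unset → ∀ (x₁ x₂ x₃ x : State) → (∀ z → OneOf (x₁ z) (x₂ z) (x₃ z) (x z)) → ∀ v →
   count q (signs v x) ≡ count q (signs v x₁) + count q (signs v x₂) + count q (signs v x₃)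
  slotCount-oneOf q q≢ x₁ x₂ x₃ x one v = begin
   count q (signs v x) ≡⟨ pull x ⟩
   sum (map (λ i → f x i) (allFin K)) ≡⟨ sum-map-≡ pointwise (allFin K) ⟩
   sum (map (λ i → f x₁ i + f x₂ i + f x₃ i) (allFin K)) ≡⟨ sum-map-+ (λ i → f x₁ i + f x₂ i) (f x₃) (allFin K) ⟩
   sum (map (λ i → f x₁ i + f x₂ i) (allFin K)) + sum (map (f x₃) (allFin K)) ≡⟨ cong (_+ sum (map (f x₃) (allFin K))) (sum-map-+ (f x₁) (f x₂) (allFin K)) ⟩
   sum (map (f x₁) (allFin K)) + sum (map (f x₂) (allFin K)) + sum (map (f x₃) (allFin K)) ≡⟨ sym (cong₂ _+_ (cong₂ _+_ (pull x₁) (pull x₂)) (pull x₃)) ⟩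
   count q (signs v x₁) + count q (signs v x₂) + count q (signs v x₃) ∎
   where
   open ≡-Reasoning
   f : State → Fin K → ℕ
   f x i = ind (q == sign v x i)
   pull : ∀ x → count q (signs v x) ≡ sum (map (f x) (allFin K))
   pull x = cong sum (sym (Listₚ.map-∘ {g = λ s → ind (q == s)} {f = sign v x} (allFin K)))
   pointwise : ∀ i → f x i ≡ f x₁ i + f x₂ i + f x₃ i
   pointwise i with dec (slot i v ≡ v)
   ... | yes _ = oneOf-ind q q≢ (fst refl refl refl)
   ... | no _ = oneOf-ind q q≢ (one (slot i v))

  private
   combine : Sign → Sign → Sign → Sign
   combine unset unset s = s
   combine unset s _ = s
   combine s _ _ = s

   combined : ∀ s₁ s₂ s₃ → (s₁ ≢ unset × s₂ ≡ unset × s₃ ≡ unset) ⊎ (s₁ ≡ unset × s₂ ≢ unset × s₃ ≡ unset) ⊎ (s₁ ≡ unset × s₂ ≡ unset × s₃ ≢ unset) →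
    combine s₁ s₂ s₃ ≢ unset × OneOf s₁ s₂ s₃ (combine s₁ s₂ s₃)
   combined unset _ _ (inj₁ (set , _)) = ⊥-elim (set refl)
   combined plus _ _ (inj₁ (set , refl , refl)) = set , fst refl refl refl
   combined minus _ _ (inj₁ (set , refl , refl)) = set , fst refl refl refl
   combined _ unset _ (inj₂ (inj₁ (_ , set , _))) = ⊥-elim (set refl)
   combined _ plus _ (inj₂ (inj₁ (refl , set , refl))) = set , snd refl refl refl
   combined _ minus _ (inj₂ (inj₁ (refl , set , refl))) = set , snd refl refl refl
   combined _ _ _ (inj₂ (inj₂ (refl , refl , set))) = set , thd refl refl refl

  module _ {x₁ x₂ x₃ : X → Sign} {b : ℕ}
   (cases : ∀ z → (x₁ z ≢ unset × x₂ z ≡ unset × x₃ z ≡ unset) ⊎ (x₁ z ≡ unset × x₂ z ≢ unset × x₃ z ≡ unset) ⊎ (x₁ z ≡ unset × x₂ z ≡ unset × x₃ z ≢ unset)) where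

   private
    Close : (X → Sign) → Set
    Close x = ∀ v → count plus (signs v x) ≤ count minus (signs v x) + b × count minus (signs v x) ≤ count plus (signs v x) + b

    x : X → Sign
    x z = combine (x₁ z) (x₂ z) (x₃ z)
    at : ∀ z → x z ≢ unset × OneOf (x₁ z) (x₂ z) (x₃ z) (x z)
    at z = combined (x₁ z) (x₂ z) (x₃ z) (cases z)

   union-balanced : Measurability.Meas 𝒳 x₁ → Measurability.Meas 𝒳 x₂ → Measurability.Meas 𝒳 x₃ → Close x₁ → Close x₂ → Close x₃ →
    ∃[ x ] Measurability.Meas 𝒳 x × (∀ v → x v ≢ unset)
     × (∀ v → count plus (signs v x) + count plus (signs v x) ≤ degree v + (b + b + b))
     × (∀ v → count minus (signs v x) + count minus (signs v x) ≤ degree v + (b + b + b))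
   union-balanced x₁-meas x₂-meas x₃-meas bal₁ bal₂ bal₃ = x , meas-map₂ (λ s (s' , s'') → combine s s' s'') x₁-meas (meas-map₂ _,_ x₂-meas x₃-meas) ,
    (λ v → proj₁ (at v)) , (λ v → proj₁ (bounds v)) , λ v → proj₂ (bounds v)
    where
    open Measurability 𝒳
    bounds : ∀ v → count plus (signs v x) + count plus (signs v x) ≤ degree v + (b + b + b) × count minus (signs v x) + count minus (signs v x) ≤ degree v + (b + b + b)
    bounds v = bound p m p≡ m≡ (proj₁ (bal₁ v)) (proj₁ (bal₂ v)) (proj₁ (bal₃ v)) (counts≤degree G v x)
     , bound m p m≡ p≡ (proj₂ (bal₁ v)) (proj₂ (bal₂ v)) (proj₂ (bal₃ v)) (subst (_≤ degree v) (+-comm p m) (counts≤degree G v x))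
     where
     p = count plus (signs v x)
     m = count minus (signs v x)
     p≡ = slotCount-oneOf plus (λ ()) x₁ x₂ x₃ x (λ z → proj₂ (at z)) v
     m≡ = slotCount-oneOf minus (λ ()) x₁ x₂ x₃ x (λ z → proj₂ (at z)) v
     bound : ∀ p m {p₁ p₂ p₃ m₁ m₂ m₃ d} → p ≡ p₁ + p₂ + p₃ → m ≡ m₁ + m₂ + m₃ → p₁ ≤ m₁ + b → p₂ ≤ m₂ + b → p₃ ≤ m₃ + b → p + m ≤ d → p + p ≤ d + (b + b + b)
     bound p m {m₁ = m₁} {m₂} {m₃} {d} p≡ m≡ h₁ h₂ h₃ le = ≤-trans (+-monoʳ-≤ p (≤-trans (≤-reflexive p≡) (≤-trans (+-mono-≤ (+-mono-≤ h₁ h₂) h₃)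
       (≤-reflexive (trans (swap m₁ m₂ m₃ b) (cong (_+ (b + b + b)) (sym m≡))))))) (≤-trans (≤-reflexive (sym (+-assoc p m (b + b + b)))) (+-monoˡ-≤ (b + b + b) le))
      where
      swap : ∀ x y z b → x + b + (y + b) + (z + b) ≡ x + y + z + (b + b + b)
      swap = solve-∀

  -- Used with δ = 2 and ι = 1.
  module Discrepancy {s : ℕ} (layering : ∀ r → Layering 𝒳 (pow r maps) s) (j t δ ι : ℕ) (2≤δ : 2 ≤ δ) (ι+ι≤δ : ι + ι ≤ δ) (1≤ι : 1 ≤ ι)
   (degree≤ : ∀ v → degree v ≤ suc j * suc j) (slots≤ : suc K ≤ 2 ^ t) where

   open Measurability 𝒳
   private
    l b K₂ rounds′ step : ℕ
    l = 6 * (δ * t) + 6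
    b = suc j * l
    K₂ = length (pow δ maps)
    rounds′ = suc (s * suc K₂)
    step = 2 + t * 2 + t * (16 * δ)

   opaque
    a : ℕ
    a = step * rounds′ * K₂

   private
    ρ B R : ℕ
    ρ = a * a + a * a
    B = (ρ + ρ) + (ρ + ρ)
    R = B * (δ + δ)

   opaque
    n : ℕ
    n = (2 + t * (suc R + suc R)) * rounds′

   private

    length-maps≤ : length maps ≤ 2 ^ t
    length-maps≤ = subst (_≤ 2 ^ t) (sym length-maps) slots≤

    length-pow≤ : ∀ m → length (pow m maps) ≤ 2 ^ (t * m)
    length-pow≤ m = subst₂ _≤_ (sym (length-pow m maps)) (^-*-assoc 2 t m) (^-monoˡ-≤ m length-maps≤)

    0<K₂ : 0 < K₂
    0<K₂ = subst (0 <_) (sym (trans (length-pow δ maps) (cong (_^ δ) length-maps))) (m^n>0 (suc K) δ)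

   opaque
    unfolding a
    0<a : 0 < a
    0<a = *-mono-≤ {1} {step * rounds′} (*-mono-≤ {1} {step} {1} {rounds′} (s≤s z≤n) (s≤s z≤n)) 0<K₂

   private
    0<ρ : 0 < ρ
    0<ρ = ≤-trans (*-mono-≤ 0<a 0<a) (m≤m+n (a * a) (a * a))

   opaque
    unfolding a n
    0<n : 0 < n
    0<n = *-mono-≤ {1} {2 + t * (suc R + suc R)} {1} {rounds′} (s≤s z≤n) (s≤s z≤n)

    nK₂≤aρ : n * K₂ ≤ a * ρ
    nK₂≤aρ = begin
     (2 + t * (suc R + suc R)) * rounds′ * K₂ ≤⟨ *-monoˡ-≤ K₂ (*-monoˡ-≤ rounds′ linear) ⟩
     step * ρ * rounds′ * K₂ ≡⟨ swap step ρ rounds′ K₂ ⟩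
     step * rounds′ * K₂ * ρ ∎
     where
     open ≤-Reasoning
     swap : ∀ a b c d → a * b * c * d ≡ a * c * d * b
     swap = solve-∀
     expand : ∀ ρ δ t → 2 + t * (suc ((ρ + ρ + (ρ + ρ)) * (δ + δ)) + suc ((ρ + ρ + (ρ + ρ)) * (δ + δ))) ≡ (2 + t * 2) * 1 + t * (16 * δ) * ρ
     expand = solve-∀
     linear : 2 + t * (suc R + suc R) ≤ step * ρ
     linear = begin
      2 + t * (suc R + suc R) ≡⟨ expand ρ δ t ⟩
      (2 + t * 2) * 1 + t * (16 * δ) * ρ ≤⟨ +-monoˡ-≤ _ (*-monoʳ-≤ (2 + t * 2) 0<ρ) ⟩
      (2 + t * 2) * ρ + t * (16 * δ) * ρ ≡⟨ sym (*-distribʳ-+ ρ (2 + t * 2) _) ⟩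
      step * ρ ∎

   private
    open WalkPotential G δ 2≤δ j n R
    module One = PhaseOne G layering δ 2≤δ j n R b
    open One using (Danger; Frozen; Balanced)

   opaque
    unfolding n
    blowup-bound : blowup maps (suc R) ^ One.rounds ≤ 2 ^ n
    blowup-bound = begin
     (4 * length maps ^ (suc R + suc R)) ^ One.rounds ≤⟨ ^-monoˡ-≤ One.rounds (*-monoʳ-≤ 4 (subst (length maps ^ (suc R + suc R) ≤_) (^-*-assoc 2 t (suc R + suc R)) (^-monoˡ-≤ (suc R + suc R) length-maps≤))) ⟩
     (4 * 2 ^ (t * (suc R + suc R))) ^ One.rounds ≡⟨ cong (_^ One.rounds) (sym (^-distribˡ-+-* 2 2 (t * (suc R + suc R)))) ⟩
     (2 ^ (2 + t * (suc R + suc R))) ^ One.rounds ≡⟨ ^-*-assoc 2 (2 + t * (suc R + suc R)) One.rounds ⟩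
     2 ^ ((2 + t * (suc R + suc R)) * One.rounds) ≤⟨ ^-monoʳ-≤ 2 (*-monoʳ-≤ (2 + t * (suc R + suc R)) (n≤1+n One.rounds)) ⟩
     2 ^ n ∎
     where open ≤-Reasoning

   opaque
    x₁ : State {X}
    x₁ = proj₁ One.phase-one
    x₁-meas : Meas x₁
    x₁-meas = proj₁ (proj₂ One.phase-one)
    x₁-balanced : ∀ v → Balanced x₁ v
    x₁-balanced = proj₁ (proj₂ (proj₂ One.phase-one))
    x₁-done : ∀ v → x₁ v ≢ unset ⊎ Frozen x₁ v
    x₁-done = proj₁ (proj₂ (proj₂ (proj₂ One.phase-one)))
    x₁-small : ∀ v → potential v x₁ ≤ blowup maps (suc R) ^ One.rounds * potential v (λ _ → unset)
    x₁-small = proj₂ (proj₂ (proj₂ (proj₂ One.phase-one)))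

   private
    Bad : Pred X 0ℓ
    Bad = Danger x₁
    Bad-borel : Bor 𝒳 Bad
    Bad-borel = One.danger-borel x₁ x₁-meas

    potential-too-small : ∀ v → ¬ ((2 ^ l * suc j ^ K) ^ n ≤ 2 ^ n * potential v x₁)
    potential-too-small v large = <⇒≱ smaller (*-cancelʳ-≤ _ _ ((suc j ^ K) ^ n) {{m^n≢0 (suc j ^ K) n {{m^n≢0 (suc j) K}}}} (begin
     2 ^ (l * n) * k ^ n ≡⟨ cong (_* k ^ n) (sym (^-*-assoc 2 l n)) ⟩
     (2 ^ l) ^ n * k ^ n ≡⟨ sym (^-distribʳ-* n (2 ^ l) k) ⟩
     (2 ^ l * k) ^ n ≤⟨ large ⟩
     2 ^ n * potential v x₁ ≤⟨ *-monoʳ-≤ (2 ^ n) (≤-trans (x₁-small v) (*-mono-≤ blowup-bound (potential-unset v))) ⟩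
     2 ^ n * (2 ^ n * ((length (pow (δ + δ + δ) maps) * 2) ^ (n + n) * (2 * k) ^ n))
      ≤⟨ *-monoʳ-≤ (2 ^ n) (*-monoʳ-≤ (2 ^ n) (*-mono-≤ walks (≤-reflexive (^-distribʳ-* n 2 k)))) ⟩
     2 ^ n * (2 ^ n * (2 ^ ((t * (δ + δ + δ) + 1) * (n + n)) * (2 ^ n * k ^ n)))
      ≡⟨ gather (2 ^ n) (2 ^ ((t * (δ + δ + δ) + 1) * (n + n))) (k ^ n) ⟩
     2 ^ n * 2 ^ n * 2 ^ ((t * (δ + δ + δ) + 1) * (n + n)) * 2 ^ n * k ^ n
      ≡⟨ cong (_* k ^ n) powers ⟩
     2 ^ (n + n + (t * (δ + δ + δ) + 1) * (n + n) + n) * k ^ n ∎))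
     where
     open ≤-Reasoning
     k = suc j ^ K
     gather : ∀ a b c → a * (a * (b * (a * c))) ≡ a * a * b * a * c
     gather = solve-∀
     powers : 2 ^ n * 2 ^ n * 2 ^ ((t * (δ + δ + δ) + 1) * (n + n)) * 2 ^ n ≡ 2 ^ (n + n + (t * (δ + δ + δ) + 1) * (n + n) + n)
     powers = sym (trans (^-distribˡ-+-* 2 (n + n + (t * (δ + δ + δ) + 1) * (n + n)) n) (cong (_* 2 ^ n)
      (trans (^-distribˡ-+-* 2 (n + n) ((t * (δ + δ + δ) + 1) * (n + n))) (cong (_* 2 ^ ((t * (δ + δ + δ) + 1) * (n + n))) (^-distribˡ-+-* 2 n n)))))
     walks : (length (pow (δ + δ + δ) maps) * 2) ^ (n + n) ≤ 2 ^ ((t * (δ + δ + δ) + 1) * (n + n))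
     walks = subst ((length (pow (δ + δ + δ) maps) * 2) ^ (n + n) ≤_) (^-*-assoc 2 (t * (δ + δ + δ) + 1) (n + n))
      (^-monoˡ-≤ (n + n) (subst (length (pow (δ + δ + δ) maps) * 2 ≤_) (sym (^-distribˡ-+-* 2 (t * (δ + δ + δ)) 1)) (*-monoˡ-≤ 2 (length-pow≤ (δ + δ + δ)))))
     exponents : ∀ δ t n → suc (n + n + (t * (δ + δ + δ) + 1) * (n + n) + n) + (n + (n ∸ 1) * 0) ≡ suc ((6 * (δ * t) + 6) * n)
     exponents δ t n rewrite *-zeroʳ (n ∸ 1) = eq δ t n
      where
      eq : ∀ δ t n → suc (n + n + (t * (δ + δ + δ) + 1) * (n + n) + n) + (n + 0) ≡ suc ((6 * (δ * t) + 6) * n)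
      eq = solve-∀
     smaller : 2 ^ (n + n + (t * (δ + δ + δ) + 1) * (n + n) + n) < 2 ^ (l * n)
     smaller = ^-monoʳ-< 2 (s≤s (s≤s z≤n)) (+-cancelʳ-≤ 1 _ _ (≤-trans (+-monoʳ-≤ (suc (n + n + (t * (δ + δ + δ) + 1) * (n + n) + n)) 0<n)
      (≤-trans (≤-reflexive (trans (cong (suc (n + n + (t * (δ + δ + δ) + 1) * (n + n) + n) +_) (sym (trans (cong (n +_) (*-zeroʳ (n ∸ 1))) (+-identityʳ n)))) (exponents δ t n)))
       (≤-reflexive (+-comm 1 (l * n))))))

    us : List (X → X)
    us = near-steps Bad

    us-borel : All (BorelMap 𝒳 𝒳) us
    us-borel = bor-id {𝒳} ∷ keep-borel 𝒳 (BothBad Bad) (λ {t} bt → bor-∩ 𝒳 Bad-borel (bt _ Bad-borel)) (pow-borel 𝒳 (δ + δ) maps-borel)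

    us-sym : Symmetricᵐ us
    us-sym (here refl) = here refl
    us-sym (there i) = there (keep-sym (BothBad Bad) (λ (p , q) → q , p) (reach-sym (δ + δ) maps-sym) i)

    us⊆ : ∀ m {x y} → y ∈ nb (pow m us) x → y ∈ nb (pow (m * (δ + δ)) maps) x
    us⊆ m p = reach-pow m (δ + δ) (go m p)
     where
     go : ∀ m {x y} → y ∈ nb (pow m us) x → y ∈ nb (pow m (pow (δ + δ) maps)) x
     go zero (here refl) = here refl
     go (suc m) p = let _ , q , e = reach-unsnoc m {us} p in reach-snoc m (go m q) (proj₂ (near-step⇒ Bad e))

    us-layering : Layering 𝒳 (pow ρ us) s
    us-layering = record
     { layer = layer ; layer-meas = layer-meas ; layer< = layer<
     ; components = finiteOrbits-⊆ inclusion components }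
     where
     open Layering (layering (ρ * (δ + δ)))
     SL : X → X → Set
     SL x y = layer x ≡ layer y
     inclusion : ∀ {x y} → y ∈ nb (map (keep SL) (pow ρ us)) x → y ∈ nb (map (keep SL) (pow (ρ * (δ + δ)) maps)) x
     inclusion p with nb-keep⁻ SL p
     ... | inj₁ (q , i) = nb-keep⁺ SL q (us⊆ ρ i)
     ... | inj₂ refl = nb-keep⁺ SL refl (reach-refl (ρ * (δ + δ)) (here refl))

    growth : ∀ x zs → Unique zs → All (λ z → z ∈ nb (pow B us) x) zs → length zs ≤ a * ρ
    growth x zs u near with dec (Bad x)
    ... | no ¬bad = alone zs u near
     where
     fixed : ∀ m {y} → y ∈ nb (pow m us) x → y ≡ x
     fixed zero (here refl) = refl
     fixed (suc m) p with reach-unsnoc m {us} p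
     ... | u , q , e with fixed m q
     ... | refl with e
     ... | here refl = refl
     ... | there i with nb-keep⁻ (BothBad Bad) i
     ... | inj₁ ((bad , _) , _) = ⊥-elim (¬bad bad)
     ... | inj₂ eq = eq
     alone : ∀ zs → Unique zs → All (λ z → z ∈ nb (pow B us) x) zs → length zs ≤ a * ρ
     alone [] _ _ = z≤n
     alone (z ∷ []) _ _ = *-mono-≤ 0<a 0<ρ
     alone (z ∷ z' ∷ zs) ((z≢z' ∷ _) ∷ _) (i ∷ i' ∷ _) = ⊥-elim (z≢z' (trans (fixed B i) (sym (fixed B i'))))
    ... | yes bad = by-contradiction λ ≰ → potential-too-small x (heavy-cluster Bad x bad B ≤-refl 0<n (2 ^ l * suc j ^ K) x₁
      (λ {p} danger → mass-heavy G j l p x₁ (degree≤ p) danger) (undominated (≰⇒> ≰)))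
     where
     undominated : a * ρ < length zs → ∀ ms → length ms < n → ∃[ y ] Cluster Bad x bad B ≤-refl 0<n y × ¬ Dominated Bad x bad B ≤-refl 0<n ms y
     undominated many ms few = by-contradiction λ none → <⇒≱ many (begin
      length zs ≤⟨ length-⊆ u (λ {z} i → cover none z i (dec (Dominated Bad x bad B ≤-refl 0<n ms z))) ⟩
      length (concatMap (nb (pow δ maps)) ms) ≤⟨ length-concatMap {X = X} (nb (pow δ maps)) K₂ ms (λ m → ≤-reflexive (Listₚ.length-map _ (pow δ maps))) ⟩
      length ms * K₂ ≤⟨ *-monoˡ-≤ K₂ (<⇒≤ few) ⟩
      n * K₂ ≤⟨ nK₂≤aρ ⟩
      a * ρ ∎)
      where
      open ≤-Reasoning
      cover : ¬ (∃[ y ] Cluster Bad x bad B ≤-refl 0<n y × ¬ Dominated Bad x bad B ≤-refl 0<n ms y) → ∀ z → z ∈ zs →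
       Dec (Dominated Bad x bad B ≤-refl 0<n ms z) → z ∈ concatMap (nb (pow δ maps)) ms
      cover none z i (yes (m , k , near')) = ∈-concat⁺′ near' (∈-map⁺ _ k)
      cover none z i (no ¬dom) = ⊥-elim (none (z , All-lookup near i , ¬dom))

    module Thin = LinearGrowth 𝒳 us-borel us-sym (here refl) a 0<a us-layering growth
    open Thin using (Sep; Sep-borel; sep-finite; complement-finite)

    module _ (P : Pred X 0ℓ) (P-finite : FiniteOrbits (map (keep (λ x y → P x × P y)) us)) where
     Near : Pred X 0ℓ
     Near y = ∃[ u ] Bad u × P u × y ∈ nb maps u

     near-finite : ∀ (Y : Pred X 0ℓ) → (∀ {y} → Y y → Near y) → FiniteOrbits (map (keep (λ x y → Y x × Y y)) (pow (ι + ι) maps))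
     near-finite Y near v with dec (Y v)
     ... | no ¬Yv = v ∷ [] , λ y o → fixed o
      where
      fixed : ∀ {y} → Orb (map (keep (λ x y → Y x × Y y)) (pow (ι + ι) maps)) v y → y ∈ v ∷ []
      fixed stop = here refl
      fixed (p ◅ o) with nb-keep⁻ (λ x y → Y x × Y y) p
      ... | inj₁ ((Yv , _) , _) = ⊥-elim (¬Yv Yv)
      ... | inj₂ refl = fixed o
     ... | yes Yv =
      let u , bad , Pu , i = near Yv
          orbit , orb⊆ = P-finite u
      in concatMap (nb maps) orbit , λ y o →
         let u' , o' , i' = follow bad Pu i o in ∈-concat⁺′ i' (∈-map⁺ (nb maps) (orb⊆ u' o'))
      where
      PP YY : X → X → Set
      PP x y = P x × P y
      YY x y = Y x × Y y
      follow : ∀ {u v y} → Bad u → P u → v ∈ nb maps u → Orb (map (keep YY) (pow (ι + ι) maps)) v y →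
       ∃[ u' ] Orb (map (keep PP) us) u u' × y ∈ nb maps u'
      follow bad Pu i stop = _ , stop , i
      follow {u} {v} bad Pu i (_◅_ {j = w} p o) with nb-keep⁻ YY p
      ... | inj₂ refl = follow bad Pu i o
      ... | inj₁ ((_ , Yw) , k) =
       let u' , bad' , Pu' , i' = near Yw
           far = reach-trans 1 (suc (ι + ι)) {maps} (reach-1 {ts = maps} i) (reach-trans (ι + ι) 1 {maps} k (reach-1 {ts = maps} (maps-sym i')))
           close = reach-mono {ts = maps} (here refl) (≤-trans (≤-reflexive (+-comm (suc (ι + ι)) 1)) (+-mono-≤ 2≤δ ι+ι≤δ)) far
           u'' , o' , i'' = follow bad' Pu' i' o
       in u'' , nb-keep⁺ PP {us} (Pu , Pu') (there (nb-keep⁺ (BothBad Bad) (bad , bad') close)) ◅ o' , i''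

     small-mass : blowup maps ι * (2 * suc j ^ K) + blowup maps ι * (2 * suc j ^ K) < 2 ^ l * suc j ^ K
     small-mass = begin-strict
      blowup maps ι * (2 * k) + blowup maps ι * (2 * k) ≡⟨ eq (length maps ^ (ι + ι)) k ⟩
      16 * length maps ^ (ι + ι) * k ≤⟨ *-monoˡ-≤ k (*-monoʳ-≤ 16 (subst (length maps ^ (ι + ι) ≤_) (^-*-assoc 2 t (ι + ι)) (^-monoˡ-≤ (ι + ι) length-maps≤))) ⟩
      16 * 2 ^ (t * (ι + ι)) * k ≡⟨ cong (_* k) (sym (^-distribˡ-+-* 2 4 (t * (ι + ι)))) ⟩
      2 ^ (4 + t * (ι + ι)) * k <⟨ *-monoˡ-< k {{m^n≢0 (suc j) K}} (^-monoʳ-< 2 (s≤s (s≤s z≤n)) exps) ⟩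
      2 ^ l * k ∎
      where
      open ≤-Reasoning
      k = suc j ^ K
      eq : ∀ m k → 4 * m * (2 * k) + 4 * m * (2 * k) ≡ 16 * m * k
      eq = solve-∀
      exps : 4 + t * (ι + ι) < l
      exps = begin-strict
       4 + t * (ι + ι) ≤⟨ +-monoʳ-≤ 4 (*-monoʳ-≤ t ι+ι≤δ) ⟩
       4 + t * δ <⟨ ≤-trans (m≤m+n (5 + t * δ) (1 + 5 * (δ * t))) (≤-reflexive (expand t δ)) ⟩
       6 * (δ * t) + 6 ∎
       where
       expand : ∀ t δ → 5 + t * δ + (1 + 5 * (δ * t)) ≡ 6 * (δ * t) + 6
       expand = solve-∀

     colour-near : ∀ (Y : Pred X 0ℓ) → Bor 𝒳 Y → (∀ {y} → Y y → Near y) →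
      ∃[ x ] Meas x × (∀ {z} → ¬ Y z → x z ≡ unset) × (∀ {z} → Y z → x z ≢ unset) × (∀ v → Balanced x v)
     colour-near Y Y-borel near = finish (borel-local-lemma 𝒳 maps-borel maps-sym (here refl) ι (mass G j)
       (λ v x x' agree → mass-depends G j v x x' λ z i → agree z (reach-mono {ts = maps} (here refl) 1≤ι (reach-1 {ts = maps} i)))
       (λ v x y → mass-harmonic G j v y x) (λ x m → meas-map (wsum j) (signs-meas G x m))
       Y Y-borel (near-finite Y near) (λ _ → unset) (meas-const unset) (λ _ → refl))
      where
      doubled : ∀ m c → m ≤ c → 2 * m ≤ c + c
      doubled m c m≤c = subst (_≤ c + c) (cong (m +_) (sym (+-identityʳ m))) (+-mono-≤ m≤c m≤c)
      safe : ∀ x v → mass G j v x ≤ blowup maps ι * mass G j v (λ _ → unset) → ¬ Danger x v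
      safe x v small danger = <⇒≱ {blowup maps ι * (2 * suc j ^ K) + blowup maps ι * (2 * suc j ^ K)} {2 ^ l * suc j ^ K} small-mass
       (≤-trans {2 ^ l * suc j ^ K} {2 * mass G j v x} (mass-heavy G j l v x (degree≤ v) danger)
        (doubled (mass G j v x) (blowup maps ι * (2 * suc j ^ K)) (≤-trans small (≤-reflexive (cong (blowup maps ι *_) (mass-unset G j v))))))
      balance : ∀ x v → ¬ Danger x v → Balanced x v
      balance x v ¬danger = <⇒≤ (≰⇒> (¬danger ∘ inj₁)) , <⇒≤ (≰⇒> (¬danger ∘ inj₂))
      finish : (∃[ x ] Meas x × (∀ {z} → ¬ Y z → x z ≡ unset) × (∀ {z} → Y z → x z ≢ unset) × (∀ v → mass G j v x ≤ blowup maps ι * mass G j v (λ _ → unset))) →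
       ∃[ x ] Meas x × (∀ {z} → ¬ Y z → x z ≡ unset) × (∀ {z} → Y z → x z ≢ unset) × (∀ v → Balanced x v)
      finish (x , x-meas , off , on , small) = x , x-meas , off , on , λ v → balance x v (safe x v (small v))

    Near₀ Near₁ Y₀ Y₁ : Pred X 0ℓ
    Near₀ v = Any (λ i → Bad (slot i v) × ¬ Sep (slot i v)) (allFin K)
    Near₁ = Near Sep sep-finite
    Y₀ v = x₁ v ≡ unset × Near₀ v
    Y₁ v = x₁ v ≡ unset × ¬ Near₀ v

    Near₀-borel : Bor 𝒳 Near₀
    Near₀-borel = bor-Any 𝒳 (allFin K) (All-tabulate λ {i} _ → slot-borel i _ (bor-∩ 𝒳 Bad-borel (bor-∁ 𝒳 Sep-borel)))

    Y₀-near : ∀ {v} → Y₀ v → Near (λ x → ¬ Sep x) complement-finite v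
    Y₀-near {v} (_ , any) = from (find any)
     where
     from : ∃[ i ] i ∈ allFin K × Bad (slot i v) × ¬ Sep (slot i v) → Near (λ x → ¬ Sep x) complement-finite v
     from (i , _ , bad , ¬sep) = slot i v , bad , ¬sep , maps-sym (slot∈maps i)

    Y₁-near : ∀ {v} → Y₁ v → Near₁ v
    Y₁-near {v} (eq , ¬near) = [ (λ set → ⊥-elim (set eq)) , (λ frozen → from (find frozen)) ]′ (x₁-done v)
     where
     from : ∃[ i ] i ∈ allFin K × slot i v ≢ v × Bad (slot i v) → Near₁ v
     from (i , _ , _ , bad) = slot i v , bad , by-contradiction (λ ¬sep → ¬near (lose (∈-allFin i) (bad , ¬sep))) , maps-sym (slot∈maps i)

    second = colour-near (λ x → ¬ Sep x) complement-finite Y₀ (bor-∩ 𝒳 (x₁-meas (_≡ unset)) Near₀-borel) Y₀-near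
    third = colour-near Sep sep-finite Y₁ (bor-∩ 𝒳 (x₁-meas (_≡ unset)) (bor-∁ 𝒳 Near₀-borel)) Y₁-near

   discrepancy : ∃[ x ] Meas x × (∀ v → x v ≢ unset)
    × (∀ v → count plus (signs v x) + count plus (signs v x) ≤ degree v + (b + b + b))
    × (∀ v → count minus (signs v x) + count minus (signs v x) ≤ degree v + (b + b + b))
   discrepancy = assemble second third
    where
    Phase : Pred X 0ℓ → Set₁
    Phase Y = ∃[ x ] Meas x × (∀ {z} → ¬ Y z → x z ≡ unset) × (∀ {z} → Y z → x z ≢ unset) × (∀ v → Balanced x v)
    assemble : Phase Y₀ → Phase Y₁ → _
    assemble (x₂ , x₂-meas , off₂ , on₂ , bal₂) (x₃ , x₃-meas , off₃ , on₃ , bal₃) =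
     union-balanced (λ z → cases z (dec (x₁ z ≡ unset)) (dec (Near₀ z))) x₁-meas x₂-meas x₃-meas x₁-balanced bal₂ bal₃
     where
     cases : ∀ z → Dec (x₁ z ≡ unset) → Dec (Near₀ z) →
      (x₁ z ≢ unset × x₂ z ≡ unset × x₃ z ≡ unset) ⊎ (x₁ z ≡ unset × x₂ z ≢ unset × x₃ z ≡ unset) ⊎ (x₁ z ≡ unset × x₂ z ≡ unset × x₃ z ≢ unset)
     cases z (no set) _ = inj₁ (set , off₂ (set ∘ proj₁) , off₃ (set ∘ proj₁))
     cases z (yes eq) (yes p) = inj₂ (inj₁ (eq , on₂ (eq , p) , off₃ λ (_ , ¬p) → ¬p p))
     cases z (yes eq) (no ¬p) = inj₂ (inj₂ (eq , off₂ (¬p ∘ proj₂) , on₃ (eq , ¬p)))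

 -- Two-colouring the orbits of two involutions

 module Alternation {X : Set} (f : Bool → X → X) (f-involutive : ∀ s x → f s (f s x) ≡ x) where

  data Path± : Bool → X → X → Set where
   done : ∀ {x} → Path± false x x
   move : ∀ s {q x y} → f s x ≢ x → Path± q (f s x) y → Path± (not q) x y

  alt : Bool → ℕ → X → X
  alt s zero x = x
  alt s (suc n) x = alt (not s) n (f s x)

  Valid : Bool → ℕ → X → Set
  Valid s zero x = ⊤
  Valid s (suc n) x = f s x ≢ x × Valid (not s) n (f s x)

  parity : ℕ → Bool
  parity zero = false
  parity (suc n) = not (parity n)

  private
   not-not : ∀ q → not (not q) ≡ q
   not-not true = refl
   not-not false = refl

   same-or-not : ∀ s s' → s' ≡ s ⊎ s' ≡ not s
   same-or-not true true = inj₁ refl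
   same-or-not true false = inj₂ refl
   same-or-not false true = inj₂ refl
   same-or-not false false = inj₁ refl

  path-snoc : ∀ s {q x y} → Path± q x y → f s y ≢ y → Path± (not q) x (f s y)
  path-snoc s done m = move s m done
  path-snoc s (move s' m' p) m = move s' m' (path-snoc s p m)

  path-sym : ∀ {q x y} → Path± q x y → Path± q y x
  path-sym done = done
  path-sym {x = x} (move s {q} m p) = subst (Path± (not q) _) (f-involutive s x)
   (path-snoc s (path-sym p) λ eq → m (trans (sym eq) (f-involutive s x)))

  path-trans : ∀ {q q' x y z} → Path± q x y → Path± q' y z → Path± (q xor q') x z
  path-trans done p' = p'
  path-trans {q' = q'} (move s {q} m p) p' = subst (λ b → Path± b _ _) (assoc q q') (move s m (path-trans p p'))
   where
   assoc : ∀ q q' → not (q xor q') ≡ not q xor q'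
   assoc true q' = not-not q'
   assoc false q' = refl

  alternating : ∀ {q x y} → Path± q x y → ∃[ s ] ∃[ n ] Valid s n x × alt s n x ≡ y × parity n ≡ q
  alternating done = true , 0 , tt , refl , refl
  alternating {x = x} (move s m p) with alternating p
  ... | s' , zero , _ , eq , par = s , 1 , (m , tt) , eq , cong not par
  ... | s' , suc n , (m' , v) , eq , par with same-or-not s s'
  ... | inj₁ refl = not s , n , subst (Valid (not s) n) (f-involutive s x) v , trans (cong (alt (not s) n) (sym (f-involutive s x))) eq ,
   trans (sym (not-not (parity n))) (cong not par)
  ... | inj₂ refl = s , suc (suc n) , (m , m' , v) , eq , cong not par

  private
   last-step : ∀ s n x → parity n ≡ false → alt s (suc n) x ≡ f s (alt s n x)
   last-step′ : ∀ s n x → parity n ≡ true → alt s (suc n) x ≡ f (not s) (alt s n x)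
   last-step s zero x par = refl
   last-step s (suc n) x par = trans (last-step′ (not s) n (f s x) (trans (sym (not-not (parity n))) (cong not par)))
    (cong (λ b → f b (alt (not s) n (f s x))) (not-not s))
   last-step′ s (suc n) x par = last-step (not s) n (f s x) (trans (sym (not-not (parity n))) (cong not par))

   valid-init : ∀ s n x → Valid s (suc n) x → Valid s n x
   valid-init s zero x v = tt
   valid-init s (suc n) x (m , v) = m , valid-init (not s) n (f s x) v

   -- A closed alternating walk of odd length is a palindrome, so its middle
   -- step does not move.
   no-odd-cycle : ∀ n s x → Valid s n x → alt s n x ≡ x → parity n ≡ true → ⊥
   no-odd-cycle (suc zero) s x (m , _) eq par = m eq
   no-odd-cycle (suc (suc (suc n))) s x (m , v) eq par =
    no-odd-cycle (suc n) (not s) (f s x) (valid-init (not s) (suc n) (f s x) v)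
     (trans (sym (f-involutive s _)) (cong (f s) (trans (sym (last-step s (suc (suc n)) x par′)) eq))) (trans (sym (not-not _)) par)
    where
    par′ : parity (suc (suc n)) ≡ false
    par′ = trans (sym (not-not _)) (cong not par)

  parity-unique : ∀ {x y} → Path± true x y → Path± false x y → ⊥
  parity-unique {x} p p' with alternating (path-trans p (path-sym p'))
  ... | s , n , v , eq , par = no-odd-cycle n s x v eq par

  Connected : X → X → Set
  Connected x y = ∃[ q ] Path± q x y

  two-colouring-on : ∀ ys → Σ[ col ∈ (X → Bool) ] (∀ {y z} → y ∈ ys → Connected y z → ∀ s → f s z ≢ z → col (f s z) ≢ col z)
  two-colouring-on [] = (λ _ → true) , λ ()
  two-colouring-on (y ∷ ys) with two-colouring-on ys
  ... | col , proper = col' , proper'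
   where
   col' : X → Bool
   col' z = if ⟦ Connected y z ⟧ then ⟦ Path± true y z ⟧ else col z
   inside : ∀ {z} → Connected y z → ∀ s → f s z ≢ z → col' (f s z) ≢ col' z
   inside {z} (q , p) s m eq = flips q p (trans (sym (if-yes (not q , path-snoc s p m))) (trans eq (if-yes (q , p))))
    where
    flips : ∀ q → Path± q y z → ⟦ Path± true y (f s z) ⟧ ≢ ⟦ Path± true y z ⟧
    flips true p eq = parity-unique (⟦⟧⁻ (trans eq (⟦⟧⁺ p))) (path-snoc s p m)
    flips false p eq = parity-unique (⟦⟧⁻ (trans (sym eq) (⟦⟧⁺ (path-snoc s p m)))) p
   outside : ∀ {z} → ¬ Connected y z → ∀ s → f s z ≢ z → col (f s z) ≢ col z → col' (f s z) ≢ col' z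
   outside {z} ¬c s m ≢ eq = ≢ (trans (sym (if-no ¬c')) (trans eq (if-no ¬c)))
    where
    ¬c' : ¬ Connected y (f s z)
    ¬c' (q , p) = ¬c (not q , subst (Path± (not q) y) (f-involutive s z)
     (path-snoc s p λ e → m (trans (sym e) (f-involutive s z))))
   proper' : ∀ {x z} → x ∈ y ∷ ys → Connected x z → ∀ s → f s z ≢ z → col' (f s z) ≢ col' z
   proper' (here refl) c s m = inside c s m
   proper' {z = z} (there i) c s m = [ (λ c' → inside c' s m) , (λ ¬c → outside ¬c s m (proper i c s m)) ]′ (toSum (dec (Connected y z)))

 module _ {X : Set} (Near : X → X → Set) (near-sym : ∀ {x y} → Near x y → Near y x) where

  maximal-matching : ∀ ys → Σ[ f ∈ (X → X) ] (∀ x → f (f x) ≡ x) × (∀ x → f x ≢ x → Near x (f x)) ×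
   (∀ {x y} → x ∈ ys → y ∈ ys → Near x y → x ≢ y → f x ≢ x ⊎ f y ≢ y)
  maximal-matching [] = id , (λ _ → refl) , (λ x m → ⊥-elim (m refl)) , λ ()
  maximal-matching (y ∷ ys) with maximal-matching ys
  ... | f , inv , near , max = decide (dec (f y ≢ y)) (dec (∃[ z ] z ∈ ys × Near y z × y ≢ z × f z ≡ z))
   where
   Result = Σ[ f ∈ (X → X) ] (∀ x → f (f x) ≡ x) × (∀ x → f x ≢ x → Near x (f x)) ×
    (∀ {x z} → x ∈ y ∷ ys → z ∈ y ∷ ys → Near x z → x ≢ z → f x ≢ x ⊎ f z ≢ z)
   decide : Dec (f y ≢ y) → Dec (∃[ z ] z ∈ ys × Near y z × y ≢ z × f z ≡ z) → Result
   decide (yes m) _ = f , inv , near , max'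
    where
    max' : ∀ {x z} → x ∈ y ∷ ys → z ∈ y ∷ ys → Near x z → x ≢ z → f x ≢ x ⊎ f z ≢ z
    max' (here refl) _ _ _ = inj₁ m
    max' (there i) (here refl) _ _ = inj₂ m
    max' (there i) (there j) = max i j
   decide (no ¬m) (no none) = f , inv , near , max'
    where
    max' : ∀ {x z} → x ∈ y ∷ ys → z ∈ y ∷ ys → Near x z → x ≢ z → f x ≢ x ⊎ f z ≢ z
    max' (here refl) (here refl) _ ≢ = ⊥-elim (≢ refl)
    max' (here refl) (there j) nr ≢ = inj₂ λ eq → none (_ , j , nr , ≢ , eq)
    max' (there i) (here refl) nr ≢ = inj₁ λ eq → none (_ , i , near-sym nr , (λ e → ≢ (sym e)) , eq)
    max' (there i) (there j) = max i j
   decide (no ¬m) (yes (z , z∈ , nr , y≢z , fz)) = g , g-inv , g-near , max'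
    where
    fy : f y ≡ y
    fy = by-contradiction ¬m
    g : X → X
    g x = if ⟦ x ≡ y ⟧ then z else (if ⟦ x ≡ z ⟧ then y else f x)
    g-y : g y ≡ z
    g-y = if-yes refl
    g-z : g z ≡ y
    g-z = trans (if-no (λ e → y≢z (sym e))) (if-yes refl)
    g-other : ∀ {x} → x ≢ y → x ≢ z → g x ≡ f x
    g-other ≢y ≢z = trans (if-no ≢y) (if-no ≢z)
    f≢ : ∀ {w} x → f w ≡ w → x ≢ w → f x ≢ w
    f≢ x fw x≢w eq = x≢w (trans (sym (inv x)) (trans (cong f eq) fw))
    cases : ∀ {P : X → Set} → P y → P z → (∀ x → x ≢ y → x ≢ z → P x) → ∀ x → P x
    cases py pz po x with dec (x ≡ y) | dec (x ≡ z)
    ... | yes refl | _ = py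
    ... | no _ | yes refl = pz
    ... | no ≢y | no ≢z = po x ≢y ≢z
    g-inv : ∀ x → g (g x) ≡ x
    g-inv = cases (trans (cong g g-y) g-z) (trans (cong g g-z) g-y)
     λ x ≢y ≢z → trans (cong g (g-other ≢y ≢z)) (trans (g-other (f≢ x fy ≢y) (f≢ x fz ≢z)) (inv x))
    g-near : ∀ x → g x ≢ x → Near x (g x)
    g-near = cases (λ _ → subst (Near y) (sym g-y) nr) (λ _ → subst (Near z) (sym g-z) (near-sym nr))
     λ x ≢y ≢z m → subst (Near x) (sym (g-other ≢y ≢z)) (near x (λ e → m (trans (g-other ≢y ≢z) e)))
    keeps : ∀ x → f x ≢ x → g x ≢ x
    keeps = cases (λ m → ⊥-elim (m fy)) (λ m → ⊥-elim (m fz)) λ x ≢y ≢z m e → m (trans (sym (g-other ≢y ≢z)) e)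
    g-y≢ : g y ≢ y
    g-y≢ e = y≢z (trans (sym e) g-y)
    max' : ∀ {x z} → x ∈ y ∷ ys → z ∈ y ∷ ys → Near x z → x ≢ z → g x ≢ x ⊎ g z ≢ z
    max' (here refl) _ _ _ = inj₁ g-y≢
    max' (there i) (here refl) _ _ = inj₂ g-y≢
    max' (there i) (there j) n ≢ = [ (λ m → inj₁ (keeps _ m)) , (λ m → inj₂ (keeps _ m)) ]′ (max i j n ≢)

 -- Pairing consecutive elements of a list

 module _ {I : Set} where

  partner : List I → I → I
  partner [] i = i
  partner (x ∷ []) i = i
  partner (x ∷ y ∷ is) i = if ⟦ i ≡ x ⟧ then y else (if ⟦ i ≡ y ⟧ then x else partner is i)

  private
   partner-x : ∀ {x y is} → partner (x ∷ y ∷ is) x ≡ y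
   partner-x = if-yes refl
   partner-y : ∀ {x y is} → y ≢ x → partner (x ∷ y ∷ is) y ≡ x
   partner-y ≢ = trans (if-no ≢) (if-yes refl)
   partner-other : ∀ {x y is i} → i ≢ x → i ≢ y → partner (x ∷ y ∷ is) i ≡ partner is i
   partner-other ≢x ≢y = trans (if-no ≢x) (if-no ≢y)

  partner-moved : ∀ is i → partner is i ≢ i → i ∈ is × partner is i ∈ is
  partner-moved [] i m = ⊥-elim (m refl)
  partner-moved (x ∷ []) i m = ⊥-elim (m refl)
  partner-moved (x ∷ y ∷ is) i m with dec (i ≡ x) | dec (i ≡ y)
  ... | yes refl | _ = here refl , there (here refl)
  ... | no _ | yes refl = there (here refl) , here refl
  ... | no _ | no _ = let p , q = partner-moved is i m in there (there p) , there (there q)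

  partner-involutive : ∀ {is} → Unique is → ∀ i → partner is (partner is i) ≡ i
  partner-involutive {[]} u i = refl
  partner-involutive {x ∷ []} u i = refl
  partner-involutive {x ∷ y ∷ is} ((x≢y ∷ x∉) ∷ y∉ ∷ u) i = go (dec (i ≡ x)) (dec (i ≡ y))
   where
   p = partner (x ∷ y ∷ is)
   go : Dec (i ≡ x) → Dec (i ≡ y) → p (p i) ≡ i
   go (yes refl) _ = trans (cong p (partner-x {x} {y} {is})) (partner-y {x} {y} {is} λ e → x≢y (sym e))
   go (no ≢x) (yes refl) = trans (cong p (partner-y {x} {y} {is} ≢x)) (partner-x {x} {y} {is})
   go (no ≢x) (no ≢y) = trans (cong p (partner-other {x} {y} {is} ≢x ≢y)) (rest (dec (partner is i ≡ i)))
    where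
    rest : Dec (partner is i ≡ i) → p (partner is i) ≡ i
    rest (yes eq) = trans (cong p eq) (trans (partner-other {x} {y} {is} ≢x ≢y) eq)
    rest (no m) = let _ , j∈ = partner-moved is i m in
     trans (partner-other {x} {y} {is} (λ e → All-lookup x∉ j∈ (sym e)) (λ e → All-lookup y∉ j∈ (sym e))) (partner-involutive u i)

  partner-halves : ∀ (Q : Pred I 0ℓ) {is} → Unique is → (∀ i → partner is i ≢ i → Q i → Q (partner is i) → ⊥) →
   2 * length (select-list Q is) ≤ suc (length is)
  partner-halves Q {[]} u h = z≤n
  partner-halves Q {x ∷ []} u h with dec (Q x)
  ... | yes _ = ≤-refl
  ... | no _ = z≤n
  partner-halves Q {x ∷ y ∷ is} ((x≢y ∷ x∉) ∷ y∉ ∷ u) h = cases (dec (Q x)) (dec (Q y))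
   where
   rec : 2 * length (select-list Q is) ≤ suc (length is)
   rec = partner-halves Q u λ i m q q' → let i∈ , j∈ = partner-moved is i m
                                             eq = partner-other {x} {y} {is} (λ e → All-lookup x∉ i∈ (sym e)) (λ e → All-lookup y∉ i∈ (sym e))
    in h i (λ e → m (trans (sym eq) e)) q (subst Q (sym eq) q')
   n = length (select-list Q is)
   more : ∀ {m} → m ≡ suc n → 2 * m ≤ suc (suc (suc (length is)))
   more refl = ≤-trans (≤-reflexive (*-suc 2 n)) (s≤s (s≤s rec))
   accept : ∀ {i is} → Q i → length (select-list Q (i ∷ is)) ≡ suc (length (select-list Q is))
   accept q = cong length (Listₚ.filter-accept (λ i → dec (Q i)) q)
   reject : ∀ {i is} → ¬ Q i → length (select-list Q (i ∷ is)) ≡ length (select-list Q is)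
   reject ¬q = cong length (Listₚ.filter-reject (λ i → dec (Q i)) ¬q)
   cases : Dec (Q x) → Dec (Q y) → 2 * length (select-list Q (x ∷ y ∷ is)) ≤ suc (suc (suc (length is)))
   cases (yes qx) (yes qy) = ⊥-elim (h x (λ e → x≢y (trans (sym e) (partner-x {x} {y} {is}))) qx (subst Q (sym (partner-x {x} {y} {is})) qy))
   cases (yes qx) (no ¬qy) = more (trans (accept qx) (cong suc (reject ¬qy)))
   cases (no ¬qx) (yes qy) = more (trans (reject ¬qx) (accept qy))
   cases (no ¬qx) (no ¬qy) = subst (λ m → 2 * m ≤ suc (suc (suc (length is)))) (sym (trans (reject ¬qx) (reject ¬qy)))
    (≤-trans rec (s≤s (≤-trans (n≤1+n _) (n≤1+n _))))

 -- Darts, that is, oriented edges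

 module Darts {𝒳 : BorelSpace} {K : ℕ} (G : Slots 𝒳 K) where
  open Slots G
  open Measurability 𝒳
  private X = Point 𝒳

  Dart : Set
  Dart = X × Fin K

  dartSpace : BorelSpace
  dartSpace = record
   { Point = Dart
   ; Bor = λ P → ∀ i → Bor 𝒳 (λ v → P (v , i))
   ; bor-∅ = λ i → bor-∅ 𝒳
   ; bor-∁ = λ a i → bor-∁ 𝒳 (a i)
   ; bor-∃ℕ = λ A a i → bor-∃ℕ 𝒳 _ λ n → a n i
   ; bor-⇔ = λ f g a i → bor-⇔ 𝒳 (λ v → f (v , i)) (λ v → g (v , i)) (a i)
   ; sep = λ n → sepᴰ (unpair n)
   ; sep-bor = λ n → sepᴰ-bor (unpair n)
   ; sep-separates = λ {d} {e} d≢e →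
     let c , p , ¬q = separated d e d≢e
         n , eq = unpair-surjective (proj₁ c) (proj₂ c)
     in n , subst (λ c → sepᴰ c d) (sym eq) p , (λ q → ¬q (subst (λ c → sepᴰ c e) eq q)) }
   where
   sepᴰ : ℕ × ℕ → Pred Dart 0ℓ
   sepᴰ (zero , n) (v , i) = toℕ i ≡ n
   sepᴰ (suc _ , n) (v , i) = sep 𝒳 n v
   sepᴰ-bor : ∀ c i → Bor 𝒳 (λ v → sepᴰ c (v , i))
   sepᴰ-bor (zero , n) i = bor-const 𝒳 _
   sepᴰ-bor (suc _ , n) i = sep-bor 𝒳 n
   separated : ∀ d e → d ≢ e → ∃[ c ] sepᴰ c d × ¬ sepᴰ c e
   separated (v , i) (w , j) ≢ with dec (v ≡ w)
   ... | yes refl = (0 , toℕ i) , refl , λ eq → ≢ (cong (v ,_) (Finₚ.toℕ-injective (sym eq)))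
   ... | no v≢w = let n , p , ¬q = sep-separates 𝒳 v≢w in (1 , n) , p , ¬q

  module 𝒟 = Measurability dartSpace

  dart-map : ∀ {b : Fin K → X → X} {ι : Fin K → X → Fin K} → (∀ i → BorelMap 𝒳 𝒳 (b i)) → (∀ i → Meas (ι i)) →
   BorelMap dartSpace dartSpace (λ (v , i) → b i v , ι i v)
  dart-map {b} {ι} b-bor ι-meas A a i = bor-⇔ 𝒳 (λ { v (j , refl , p) → p }) (λ v p → ι i v , refl , p)
   (bor-∃ 𝒳 _ λ j → bor-∩ 𝒳 (ι-meas i (_≡ j)) (b-bor i _ (a j)))

  load : Pred Dart 0ℓ → X → ℕ
  load P v = length (select-list (λ i → P (v , i)) (allFin K))

  load-mono-at : ∀ {P P' : Pred Dart 0ℓ} v → (∀ {i} → P (v , i) → P' (v , i)) → load P v ≤ load P' v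
  load-mono-at {P} {P'} v f = length-⊆ (Unique-filter (λ i → dec (P (v , i))) (Unique-allFin K))
   λ i∈ → ∈-filter⁺ (λ i → dec (P' (v , i))) (∈-allFin _) (f (proj₂ (∈-filter⁻ (λ i → dec (P (v , i))) {xs = allFin K} i∈)))

  load-mono : ∀ {P P' : Pred Dart 0ℓ} → (∀ {d} → P d → P' d) → ∀ v → load P v ≤ load P' v
  load-mono {P} {P'} f v = load-mono-at {P} {P'} v f

  load≤K : ∀ P v → load P v ≤ K
  load≤K P v = ≤-trans (Listₚ.length-filter _ (allFin K)) (≤-reflexive (Listₚ.length-tabulate id))

  Occupied : Dart → Set
  Occupied (v , i) = slot i v ≢ v

  private
   backIndex : Fin K → X → Fin K
   backIndex i v = if ⟦ slot i v ≡ v ⟧ then i else proj₁ (slot-back i v)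

   slot-backIndex : ∀ i v → slot (backIndex i v) (slot i v) ≡ v
   slot-backIndex i v with dec (slot i v ≡ v)
   ... | yes eq = trans (cong (slot i) eq) eq
   ... | no _ = proj₂ (slot-back i v)

   back-unique : ∀ {i v j} → slot i v ≢ v → slot j (slot i v) ≡ v → backIndex i v ≡ j
   back-unique {i} {v} {j} m eq = slot-injective _ _ (trans (slot-backIndex i v) (sym eq))
    λ e → m (trans (sym e) (slot-backIndex i v))

   backIndex-meas : ∀ i → Meas (backIndex i)
   backIndex-meas i P = bor-⇔ 𝒳
    (λ { v (inj₁ (eq , p)) → subst P (sym (if-yes eq)) p
      ; v (inj₂ (m , j , eq , p)) → subst P (sym (back-unique m eq)) p })
    (λ v p → to v p (dec (slot i v ≡ v)))
    (bor-∪ 𝒳 (bor-∩ 𝒳 fixed (bor-const 𝒳 (P i)))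
     (bor-∩ 𝒳 (bor-∁ 𝒳 fixed) (bor-∃ 𝒳 _ λ j → bor-∩ 𝒳
      (bor-≡ {𝒳} {𝒳} {λ v → slot j (slot i v)} {id} (λ A a → slot-borel i _ (slot-borel j _ a)) (bor-id {𝒳})) (bor-const 𝒳 (P j)))))
    where
    fixed : Bor 𝒳 (λ v → slot i v ≡ v)
    fixed = bor-≡ {𝒳} {𝒳} {slot i} {id} (slot-borel i) (bor-id {𝒳})
    to : ∀ v → P (backIndex i v) → Dec (slot i v ≡ v) → slot i v ≡ v × P i ⊎ slot i v ≢ v × ∃[ j ] slot j (slot i v) ≡ v × P j
    to v p (yes eq) = inj₁ (eq , subst P (if-yes eq) p)
    to v p (no m) = inj₂ (m , backIndex i v , slot-backIndex i v , p)

  rev : Dart → Dart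
  rev (v , i) = slot i v , backIndex i v

  rev-borel : BorelMap dartSpace dartSpace rev
  rev-borel = dart-map slot-borel backIndex-meas

  rev-fixed : ∀ {v i} → slot i v ≡ v → rev (v , i) ≡ (v , i)
  rev-fixed eq = cong₂ _,_ eq (if-yes eq)

  rev-involutive : ∀ d → rev (rev d) ≡ d
  rev-involutive (v , i) = cases (dec (slot i v ≡ v))
   where
   cases : Dec (slot i v ≡ v) → rev (rev (v , i)) ≡ (v , i)
   cases (yes eq) = trans (cong rev (rev-fixed eq)) (rev-fixed eq)
   cases (no m) = cong₂ _,_ (slot-backIndex i v)
    (back-unique (λ e → m (trans (sym e) (slot-backIndex i v))) (cong (slot i) (slot-backIndex i v)))

  occupied-bor : Bor dartSpace Occupied
  occupied-bor i = bor-∁ 𝒳 (bor-≡ {𝒳} {𝒳} {slot i} {id} (slot-borel i) (bor-id {𝒳}))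

  rev-near : ∀ d → proj₁ (rev d) ∈ nb maps (proj₁ d)
  rev-near (v , i) = slot∈maps i

  private
   state : Pred Dart 0ℓ → (Dart → ℕ) → X → Vec (Bool × ℕ) K
   state S c v = tabulateⱽ (λ j → ⟦ S (v , j) ⟧ , c (v , j))

   members : Vec (Bool × ℕ) K → ℕ → List (Fin K)
   members w k = select-list (λ j → lookup w j ≡ (true , k)) (allFin K)

   members-unique : ∀ w k → Unique (members w k)
   members-unique w k = Unique-filter (λ j → dec (lookup w j ≡ (true , k))) (Unique-allFin K)

   member⁻ : ∀ {S c v k j} → j ∈ members (state S c v) k → S (v , j) × c (v , j) ≡ k
   member⁻ {S} {c} {v} {k} {j} i = ⟦⟧⁻ (cong proj₁ eq) , cong proj₂ eq
    where
    eq : (⟦ S (v , j) ⟧ , c (v , j)) ≡ (true , k)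
    eq = trans (sym (Vecₚ.lookup∘tabulate _ j)) (proj₂ (∈-filter⁻ (λ j → dec (lookup (state S c v) j ≡ (true , k))) {xs = allFin K} i))

   member⁺ : ∀ {S c v j} → S (v , j) → j ∈ members (state S c v) (c (v , j))
   member⁺ {S} {c} {v} {j} s = ∈-filter⁺ (λ i → dec (lookup (state S c v) i ≡ (true , c (v , j)))) (∈-allFin j)
    (trans (Vecₚ.lookup∘tabulate _ j) (cong (_, c (v , j)) (⟦⟧⁺ s)))

  mate : Pred Dart 0ℓ → (Dart → ℕ) → Dart → Dart
  mate S c (v , i) = v , partner (members (state S c v) (c (v , i))) i

  mate-moved : ∀ S c {d} → mate S c d ≢ d → S d × S (mate S c d) × c (mate S c d) ≡ c d
  mate-moved S c {v , i} m with partner-moved (members (state S c v) (c (v , i))) i (λ e → m (cong (v ,_) e))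
  ... | p , q = proj₁ (member⁻ {S} {c} p) , member⁻ {S} {c} q

  mate-involutive : ∀ S c d → mate S c (mate S c d) ≡ d
  mate-involutive S c (v , i) = cases (dec (mate S c (v , i) ≡ (v , i)))
   where
   ms : ℕ → List (Fin K)
   ms = members (state S c v)
   cases : Dec (mate S c (v , i) ≡ (v , i)) → mate S c (mate S c (v , i)) ≡ (v , i)
   cases (yes eq) = trans (cong (mate S c) eq) eq
   cases (no m) = cong (v ,_) (trans (cong (λ k → partner (ms k) (partner (ms (c (v , i))) i)) (proj₂ (proj₂ (mate-moved S c m))))
    (partner-involutive (members-unique (state S c v) (c (v , i))) i))

  mate-borel : ∀ {S c} → Bor dartSpace S → 𝒟.Meas c → BorelMap dartSpace dartSpace (mate S c)
  mate-borel {S} {c} s m = dart-map (λ _ → bor-id {𝒳}) λ i →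
   meas-map₂ {σ = state S c} (λ w k → partner (members w k) i)
    (meas-vec λ j → meas-map₂ _,_ (meas-⟦⟧ (s j)) (λ P → m P j)) (λ P → m P i)

  classLoad : Pred Dart 0ℓ → (Dart → ℕ) → X → ℕ → ℕ
  classLoad S c v k = load (λ d → S d × c d ≡ k) v

  mate-halves : ∀ S c (Q : Pred Dart 0ℓ) → (∀ d → mate S c d ≢ d → Q d → Q (mate S c d) → ⊥) →
   ∀ v k → 2 * load (λ d → Q d × S d × c d ≡ k) v ≤ suc (classLoad S c v k)
  mate-halves S c Q h v k = ≤-trans (*-monoʳ-≤ 2 (length-⊆
    (Unique-filter (λ i → dec (Q (v , i) × S (v , i) × c (v , i) ≡ k)) (Unique-allFin K)) smaller))
   (≤-trans (partner-halves (λ i → Q (v , i)) (members-unique (state S c v) k) paired) (s≤s (length-⊆ (members-unique (state S c v) k) larger)))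
   where
   ms : List (Fin K)
   ms = members (state S c v) k
   smaller : ∀ {i} → i ∈ select-list (λ i → Q (v , i) × S (v , i) × c (v , i) ≡ k) (allFin K) → i ∈ select-list (λ i → Q (v , i)) ms
   smaller i∈ with ∈-filter⁻ (λ i → dec (Q (v , i) × S (v , i) × c (v , i) ≡ k)) {xs = allFin K} i∈
   ... | _ , q , s , refl = ∈-filter⁺ (λ i → dec (Q (v , i))) (member⁺ {S} {c} s) q
   larger : ∀ {i} → i ∈ ms → i ∈ select-list (λ i → S (v , i) × c (v , i) ≡ k) (allFin K)
   larger i∈ = ∈-filter⁺ (λ i → dec (S (v , i) × c (v , i) ≡ k)) (∈-allFin _) (member⁻ {S} {c} i∈)
   paired : ∀ i → partner ms i ≢ i → Q (v , i) → Q (v , partner ms i) → ⊥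
   paired i m q q' = h (v , i) (λ e → m (trans (sym (eq i m)) (cong proj₂ e))) q (subst (λ j → Q (v , j)) (sym (eq i m)) q')
    where
    eq : ∀ i → partner ms i ≢ i → proj₂ (mate S c (v , i)) ≡ partner ms i
    eq i m = cong (λ k → partner (members (state S c v) k) i) (proj₂ (member⁻ {S} {c} (proj₁ (partner-moved ms i m))))

 -- Sparse recurrent sets

 module _ {Y : Set} where

  iter : (Y → Y) → ℕ → Y → Y
  iter T zero y = y
  iter T (suc n) y = iter T n (T y)

  iter-+ : ∀ T m n y → iter T (m + n) y ≡ iter T n (iter T m y)
  iter-+ T zero n y = refl
  iter-+ T (suc m) n y = iter-+ T m n (T y)

  iter-comm : ∀ T n y → iter T n (T y) ≡ T (iter T n y)
  iter-comm T zero y = refl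
  iter-comm T (suc n) y = iter-comm T n (T y)

  iter-inverse : ∀ {T T⁻} → (∀ y → T⁻ (T y) ≡ y) → ∀ n y → iter T⁻ n (iter T n y) ≡ y
  iter-inverse inv zero y = refl
  iter-inverse {T} {T⁻} inv (suc n) y = trans (iter-comm T⁻ n _) (trans (cong T⁻ (iter-inverse inv n (T y))) (inv y))

  Periodic : (Y → Y) → ℕ → Y → Set
  Periodic T N y = ∃[ n ] n < N × iter T (suc n) y ≡ y

  Recurrent : (Y → Y) → ℕ → Pred Y 0ℓ → Set
  Recurrent T N S = ∀ y → Periodic T N y ⊎ ∃[ n ] n < N × S (iter T n y)

  periodic-inverse : ∀ {T T⁻} → (∀ y → T⁻ (T y) ≡ y) → ∀ {N y} → Periodic T N y → Periodic T⁻ N y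
  periodic-inverse {T⁻ = T⁻} inv (n , n< , eq) = n , n< , trans (cong (iter T⁻ (suc n)) (sym eq)) (iter-inverse inv (suc n) _)

  periodic-along : ∀ {T T⁻} → (∀ y → T⁻ (T y) ≡ y) → ∀ m {N y} → Periodic T N (iter T m y) → Periodic T N y
  periodic-along {T} {T⁻} inv m {N} {y} (n , n< , eq) = n , n< , (begin
   iter T (suc n) y ≡⟨ sym (iter-inverse inv m _) ⟩
   iter T⁻ m (iter T m (iter T (suc n) y)) ≡⟨ cong (iter T⁻ m) (trans (sym (iter-+ T (suc n) m y)) (trans (cong (λ k → iter T k y) (+-comm (suc n) m)) (iter-+ T m (suc n) y))) ⟩
   iter T⁻ m (iter T (suc n) (iter T m y)) ≡⟨ cong (iter T⁻ m) eq ⟩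
   iter T⁻ m (iter T m y) ≡⟨ iter-inverse inv m y ⟩
   y ∎)
   where open ≡-Reasoning

  iter-back : ∀ {T T⁻} → (∀ y → T⁻ (T y) ≡ y) → ∀ m n y → iter T⁻ m (iter T (n + m) y) ≡ iter T n y
  iter-back {T} {T⁻} inv m n y = trans (cong (iter T⁻ m) (iter-+ T n m y)) (iter-inverse inv m _)

  recurrent-inverse : ∀ {T T⁻} → (∀ y → T⁻ (T y) ≡ y) → (∀ y → T (T⁻ y) ≡ y) → ∀ {N S} → Recurrent T N S → Recurrent T⁻ N S
  recurrent-inverse {T} {T⁻} inv inv' {zero} rec y with rec y
  ... | inj₁ (_ , () , _)
  ... | inj₂ (_ , () , _)
  recurrent-inverse {T} {T⁻} inv inv' {suc N} {S} rec y with rec (iter T⁻ N y)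
  ... | inj₁ per = inj₁ (periodic-along {T⁻} {T} inv' N (periodic-inverse {T} {T⁻} inv per))
  ... | inj₂ (n , s≤s n≤N , s) = inj₂ (N ∸ n , s≤s (m∸n≤m N n) , subst S
   (trans (cong (λ k → iter T n (iter T⁻ k y)) (sym (m∸n+n≡m n≤N))) (iter-back {T⁻} {T} inv' n (N ∸ n) y)) s)

 module Thinning {𝒳 : BorelSpace} {K : ℕ} (G : Slots 𝒳 K) {s : ℕ} (layering : ∀ r → Layering 𝒳 (pow r (Slots.maps G)) s) where
  open Slots G
  open Darts G

  module Lines (T T⁻ : Dart → Dart) (T-borel : BorelMap dartSpace dartSpace T) (T⁻-borel : BorelMap dartSpace dartSpace T⁻)
   (T⁻∘T : ∀ d → T⁻ (T d) ≡ d) (T∘T⁻ : ∀ d → T (T⁻ d) ≡ d)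
   (T-near : ∀ d → proj₁ (T d) ∈ nb maps (proj₁ d)) (T⁻-near : ∀ d → proj₁ (T⁻ d) ∈ nb maps (proj₁ d)) where

   powers : ℕ → List (Dart → Dart)
   powers zero = id ∷ []
   powers (suc n) = iter T (suc n) ∷ iter T⁻ (suc n) ∷ powers n

   power∈ : ∀ {m n d} → m ≤ n → iter T m d ∈ nb (powers n) d × iter T⁻ m d ∈ nb (powers n) d
   power∈ {n = zero} z≤n = here refl , here refl
   power∈ {m} {suc n} m≤ with m≤n⇒m<n∨m≡n m≤
   ... | inj₁ (s≤s m≤n) = let p , q = power∈ m≤n in there (there p) , there (there q)
   ... | inj₂ refl = here refl , there (here refl)

   power⁻ : ∀ n {d e} → e ∈ nb (powers n) d → ∃[ m ] m ≤ n × (e ≡ iter T m d ⊎ e ≡ iter T⁻ m d)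
   power⁻ zero (here refl) = 0 , z≤n , inj₁ refl
   power⁻ (suc n) (here refl) = suc n , ≤-refl , inj₁ refl
   power⁻ (suc n) (there (here refl)) = suc n , ≤-refl , inj₂ refl
   power⁻ (suc n) (there (there i)) = let m , m≤ , eq = power⁻ n i in m , m≤n⇒m≤1+n m≤ , eq

   powers-borel : ∀ n → All (BorelMap dartSpace dartSpace) (powers n)
   powers-borel zero = bor-id {dartSpace} ∷ []
   powers-borel (suc n) = iter-borel T-borel (suc n) ∷ iter-borel T⁻-borel (suc n) ∷ powers-borel n
    where
    iter-borel : ∀ {f} → BorelMap dartSpace dartSpace f → ∀ m → BorelMap dartSpace dartSpace (iter f m)
    iter-borel b zero = bor-id {dartSpace}
    iter-borel b (suc m) A a = b _ (iter-borel b m A a)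

   powers-sym : ∀ n → Symmetricᵐ (powers n)
   powers-sym n {d} i with power⁻ n i
   ... | m , m≤ , inj₁ refl = subst (_∈ nb (powers n) (iter T m d)) (iter-inverse T⁻∘T m d) (proj₂ (power∈ m≤))
   ... | m , m≤ , inj₂ refl = subst (_∈ nb (powers n) (iter T⁻ m d)) (iter-inverse T∘T⁻ m d) (proj₁ (power∈ m≤))

   private
    iter-near : ∀ {f : Dart → Dart} → (∀ d → proj₁ (f d) ∈ nb maps (proj₁ d)) → ∀ m {d} → proj₁ (iter f m d) ∈ nb (pow m maps) (proj₁ d)
    iter-near h zero = here refl
    iter-near {f} h (suc m) {d} = subst (λ e → proj₁ e ∈ nb (pow (suc m) maps) (proj₁ d)) (sym (iter-comm f m d)) (reach-snoc m (iter-near h m) (h _))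

   powers-near : ∀ n {d e} → e ∈ nb (powers n) d → proj₁ e ∈ nb (pow n maps) (proj₁ d)
   powers-near n i with power⁻ n i
   ... | m , m≤ , inj₁ refl = reach-mono (here refl) m≤ (iter-near T-near m)
   ... | m , m≤ , inj₂ refl = reach-mono (here refl) m≤ (iter-near T⁻-near m)

   module Halving {N : ℕ} {S : Pred Dart 0ℓ} (S-bor : Bor dartSpace S) (rec : Recurrent T N S) where
    W : ℕ
    W = N * suc s

    open Layering (layering W)

    Linked : Dart → Dart → Set
    Linked d e = (S d × S e) × layer (proj₁ d) ≡ layer (proj₁ e)

    linked-sym : ∀ {d e} → Linked d e → Linked e d
    linked-sym ((p , q) , eq) = (q , p) , sym eq

    links : List (Dart → Dart)
    links = map (keep Linked) (powers W)

    couple : Dart → Dart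
    couple = mate S (λ _ → 0)

    links-borel : All (BorelMap dartSpace dartSpace) links
    links-borel = keep-borel dartSpace Linked (λ {t} b → bor-∩ dartSpace (bor-∩ dartSpace S-bor (b _ S-bor))
     (label-borel dartSpace {σ = λ d → layer (proj₁ d)} _≡_ (λ P i → layer-meas P) {t} b)) (powers-borel W)

    links-sym : Symmetricᵐ links
    links-sym = keep-sym Linked linked-sym (powers-sym W)

    fin : FiniteOrbits (couple ∷ links)
    fin (v , i) = let ys , orb⊆ = components v in
     cartesianProductWith _,_ ys (allFin K) , λ (w , j) o → ∈-cartesianProductWith⁺ _,_ (orb⊆ w (heads o)) (∈-allFin j)
     where
     heads : ∀ {d e} → Orb (couple ∷ links) d e → Orb (map (keep (λ x y → layer x ≡ layer y)) (pow W maps)) (proj₁ d) (proj₁ e)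
     heads stop = stop
     heads (here refl ◅ o) = heads o
     heads (there p ◅ o) with nb-keep⁻ Linked p
     ... | inj₁ ((_ , eq) , q) = nb-keep⁺ (λ x y → layer x ≡ layer y) eq (powers-near W q) ◅ heads o
     ... | inj₂ refl = heads o

    couple∷links-sym : Symmetricᵐ (couple ∷ links)
    couple∷links-sym {d} (here refl) = here (sym (mate-involutive S _ d))
    couple∷links-sym (there p) = there (links-sym p)

    Split : (Dart → Bool) → Dart → Set
    Split col d = Any (λ t → col (t d) ≢ col d) links

    record Good (col : Dart → Bool) (d : Dart) : Set where
     field
      paired : couple d ≢ d → col (couple d) ≢ col d
      linked : All (λ t → t d ≢ d → Split col d ⊎ Split col (t d)) links
    open Good

    split-bor : ∀ col → 𝒟.Meas col → Bor dartSpace (Split col)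
    split-bor col m = bor-Any dartSpace links (All-map (λ {t} b → 𝒟.meas-map₂ _,_ (𝒟.meas-∘ {f = t} b m) m (λ (a , b) → a ≢ b)) links-borel)

    couple-borel : BorelMap dartSpace dartSpace couple
    couple-borel = mate-borel S-bor (𝒟.meas-const 0)

    moved-bor : ∀ {t} → BorelMap dartSpace dartSpace t → Bor dartSpace (λ d → t d ≢ d)
    moved-bor {t} b = bor-∁ dartSpace (bor-≡ {dartSpace} {dartSpace} {t} {id} b (bor-id {dartSpace}))

    good-bor : ∀ col → 𝒟.Meas col → Bor dartSpace (Good col)
    good-bor col m = bor-⇔ dartSpace (λ d (p , q) → record { paired = p ; linked = q }) (λ d g → paired g , linked g)
     (bor-∩ dartSpace (bor-→ dartSpace (moved-bor couple-borel) (𝒟.meas-map₂ _,_ (𝒟.meas-∘ {f = couple} couple-borel m) m (λ (a , b) → a ≢ b)))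
      (bor-All dartSpace links (All-map (λ {t} b → bor-→ dartSpace (moved-bor b) (bor-∪ dartSpace (split-bor col m) (b _ (split-bor col m)))) links-borel)))

    split-local : ∀ col col' {x d} → (∀ e → Orb (couple ∷ links) x e → col e ≡ col' e) → Orb (couple ∷ links) x d → Split col d → Split col' d
    split-local col col' {x} {d} same o p with find p
    ... | t , t∈ , ≢ = lose t∈ λ eq → ≢ (trans (same _ (o ◅◅ (there (nb⁺ t∈) ◅ stop))) (trans eq (sym (same _ o))))

    good-local : ∀ col col' d → (∀ e → Orb (couple ∷ links) d e → col e ≡ col' e) → Good col d → Good col' d
    good-local col col' d same g = record
     { paired = λ m eq → paired g m (trans (same _ (here refl ◅ stop)) (trans eq (sym (same d stop))))
     ; linked = All-tabulate λ t∈ m → [ (λ p → inj₁ (split-local col col' same stop p)) ,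
       (λ p → inj₂ (split-local col col' same (there (nb⁺ t∈) ◅ stop) p)) ]′ (All-lookup (linked g) t∈ m) }

    exists : ∀ x → ∃[ col ] (∀ d → Orb (couple ∷ links) x d → Good col d)
    exists x = col , good
     where
     ys = proj₁ (fin x)
     matching = maximal-matching (λ d e → e ∈ nb links d) links-sym ys
     f : Bool → Dart → Dart
     f true = proj₁ matching
     f false = couple
     f-involutive : ∀ b d → f b (f b d) ≡ d
     f-involutive true = proj₁ (proj₂ matching)
     f-involutive false = mate-involutive S _
     open Alternation f f-involutive
     col = proj₁ (two-colouring-on ys)
     proper : ∀ {d} → d ∈ ys → ∀ b → f b d ≢ d → col (f b d) ≢ col d
     proper i = proj₂ (two-colouring-on ys) i (false , done)
     matched⇒split : ∀ {d} → d ∈ ys → f true d ≢ d → Split col d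
     matched⇒split {d} i m with nb⁻ (proj₁ (proj₂ (proj₂ matching)) d m)
     ... | t , t∈ , eq = lose t∈ (subst (λ e → col e ≢ col d) eq (proper i true m))
     good : ∀ d → Orb (couple ∷ links) x d → Good col d
     good d o = record
      { paired = proper d∈ false
      ; linked = All-tabulate λ {t} t∈ m →
        let td∈ = proj₂ (fin x) (t d) (o ◅◅ (there (nb⁺ t∈) ◅ stop))
        in [ (λ m → inj₁ (matched⇒split d∈ m)) , (λ m → inj₂ (matched⇒split td∈ m)) ]′
         (proj₂ (proj₂ (proj₂ matching)) d∈ td∈ (nb⁺ t∈) (λ e → m (sym e))) }
      where
      d∈ : d ∈ ys
      d∈ = proj₂ (fin x) d o

    solution : Σ[ col ∈ (Dart → Bool) ] 𝒟.Meas col × (∀ d → Good col d)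
    solution = select dartSpace Bool-enumerable (couple-borel ∷ links-borel) couple∷links-sym fin Good good-bor good-local exists

    module Halves {col : Dart → Bool} (col-meas : 𝒟.Meas col) (good : ∀ d → Good col d) where

     Half : Pred Dart 0ℓ
     Half d = S d × col d ≡ true

     half-bor : Bor dartSpace Half
     half-bor = bor-∩ dartSpace S-bor (col-meas (_≡ true))

     half-load : ∀ v → 2 * load Half v ≤ suc (load S v)
     half-load v = ≤-trans (*-monoʳ-≤ 2 (load-mono {Half} {λ d → Half d × S d × 0 ≡ 0} (λ (p , q) → (p , q) , p , refl) v))
      (≤-trans (mate-halves S (λ _ → 0) Half (λ d m (_ , p) (_ , q) → paired (good d) m (trans q (sym p))) v 0)
       (s≤s (load-mono {λ d → S d × 0 ≡ 0} {S} proj₁ v)))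

     private
      3W = W + W + W

      Visit : Dart → Set
      Visit d = ∃[ n ] n < 3W × Half (iter T n d)

      W≤3W : W ≤ 3W
      W≤3W = ≤-trans (m≤m+n W W) (m≤m+n (W + W) W)

      near-split : ∀ {d o} → o < W → S (iter T (W + o) d) → Split col (iter T (W + o) d) → Visit d
      near-split {d} {o} o<W sd p with find p
      ... | u , u∈ , ≢ with nb-keep⁻ Linked (nb⁺ {t = u} u∈)
      ... | inj₂ e = ⊥-elim (≢ (cong col e))
      ... | inj₁ (((_ , s') , _) , near) = choose (col (iter T (W + o) d)) refl (col (u (iter T (W + o) d))) refl
       where
       W+o< : W + o < W + W
       W+o< = +-monoʳ-< W o<W
       elsewhere : ∃[ n ] n < 3W × u (iter T (W + o) d) ≡ iter T n d
       elsewhere with power⁻ W near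
       ... | m , m≤ , inj₁ e = W + o + m , +-mono-<-≤ W+o< m≤ , trans e (sym (iter-+ T (W + o) m d))
       ... | m , m≤ , inj₂ e = W + o ∸ m , ≤-<-trans (m∸n≤m (W + o) m) (≤-trans W+o< (m≤m+n (W + W) W)) ,
        trans e (trans (cong (λ k → iter T⁻ m (iter T k d)) (sym (m∸n+n≡m (≤-trans m≤ (m≤m+n W o)))))
         (iter-back {T = T} {T⁻} T⁻∘T m (W + o ∸ m) d))
       choose : ∀ c → col (iter T (W + o) d) ≡ c → ∀ c' → col (u (iter T (W + o) d)) ≡ c' → Visit d
       choose true e _ _ = W + o , ≤-trans W+o< (m≤m+n (W + W) W) , sd , e
       choose false e true e' = let n , n< , at = elsewhere in n , n< , subst Half at (s' , e')
       choose false e false e' = ⊥-elim (≢ (trans e' (sym e)))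

      ¬short : ∀ {d} → ¬ Periodic T 3W d → ∀ {r} m → 0 < r → r ≤ W → iter T r (iter T m d) ≢ iter T m d
      ¬short ¬per {suc r} m _ r≤ e = ¬per (periodic-along {T = T} {T⁻} T⁻∘T m (r , ≤-trans r≤ W≤3W , e))

      same-layer-visit : ∀ {d} → ¬ Periodic T 3W d → ∀ {o o'} → o < o' → o' < W → S (iter T (W + o) d) → S (iter T (W + o') d) →
       layer (proj₁ (iter T (W + o) d)) ≡ layer (proj₁ (iter T (W + o') d)) → Visit d
      same-layer-visit {d} ¬per {o} {o'} o<o' o'<W sa sb same = via (nb⁻ (nb-keep⁺ Linked ((sa , sb) , same)
        (subst (_∈ nb (powers W) a) a⇒b (proj₁ (power∈ r≤W)))))
       where
       a b : Dart
       a = iter T (W + o) d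
       b = iter T (W + o') d
       r≤W : o' ∸ o ≤ W
       r≤W = ≤-trans (m∸n≤m o' o) (<⇒≤ o'<W)
       a⇒b : iter T (o' ∸ o) a ≡ b
       a⇒b = trans (sym (iter-+ T (W + o) (o' ∸ o) d)) (cong (λ k → iter T k d)
        (trans (+-assoc W o (o' ∸ o)) (cong (W +_) (m+[n∸m]≡n (<⇒≤ o<o')))))
       b≢a : b ≢ a
       b≢a e = ¬short ¬per (W + o) (m<n⇒0<n∸m o<o') r≤W (trans a⇒b e)
       via : ∃[ t ] t ∈ links × b ≡ t a → Visit d
       via (t , t∈ , eq) = [ near-split (<-trans o<o' o'<W) sa , (λ p → near-split o'<W sb (subst (Split col) (sym eq) p)) ]′
        (All-lookup (linked (good a)) t∈ λ e → b≢a (trans eq e))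

      windows-visit : ∀ {d} → ¬ Periodic T 3W d → (∀ (i : Fin (suc s)) → ∃[ n ] n < N × S (iter T (W + (toℕ i * N + n)) d)) → Visit d
      windows-visit {d} ¬per w = repeated (Finₚ.pigeonhole (n<1+n s) (λ i → fromℕ< (layer< (proj₁ (iter T (W + offset i) d)))))
       where
       offset : Fin (suc s) → ℕ
       offset i = toℕ i * N + proj₁ (w i)
       offset< : ∀ i → offset i < suc (toℕ i) * N
       offset< i = ≤-trans (+-monoʳ-< (toℕ i * N) (proj₁ (proj₂ (w i)))) (≤-reflexive (+-comm (toℕ i * N) N))
       offset<W : ∀ i → offset i < W
       offset<W i = ≤-trans (offset< i) (≤-trans (*-monoˡ-≤ N (Finₚ.toℕ<n i)) (≤-reflexive (*-comm (suc s) N)))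
       repeated : ∃[ i ] ∃[ j ] toℕ i < toℕ j × fromℕ< (layer< (proj₁ (iter T (W + offset i) d))) ≡ fromℕ< (layer< (proj₁ (iter T (W + offset j) d))) → Visit d
       repeated (i , j , i<j , eq) = same-layer-visit ¬per
        (≤-trans (offset< i) (≤-trans (*-monoˡ-≤ N i<j) (m≤m+n _ _))) (offset<W j) (proj₂ (proj₂ (w i))) (proj₂ (proj₂ (w j)))
        (trans (sym (Finₚ.toℕ-fromℕ< _)) (trans (cong toℕ eq) (Finₚ.toℕ-fromℕ< _)))

     half-recurrent : Recurrent T 3W Half
     half-recurrent d = [ inj₁ , (λ ¬per → inj₂ (windows-visit ¬per (window ¬per))) ]′ (toSum (dec (Periodic T 3W d)))
      where
      window : ¬ Periodic T 3W d → ∀ (i : Fin (suc s)) → ∃[ n ] n < N × S (iter T (W + (toℕ i * N + n)) d)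
      window ¬per i with rec (iter T (W + toℕ i * N) d)
      ... | inj₁ (n , n< , e) = ⊥-elim (¬short ¬per (W + toℕ i * N) (s≤s z≤n) (≤-trans n< (m≤m*n N (suc s))) e)
      ... | inj₂ (n , n< , p) = n , n< , subst S (trans (sym (iter-+ T (W + toℕ i * N) n d)) (cong (λ k → iter T k d) (+-assoc W (toℕ i * N) n))) p

    Halved : Set₁
    Halved = ∃[ N' ] Σ[ S' ∈ Pred Dart 0ℓ ] Bor dartSpace S' × (∀ {d} → S' d → S d) × Recurrent T N' S' × (∀ v → 2 * load S' v ≤ suc (load S v))

    halved : Halved
    halved = from solution
     where
     from : Σ[ col ∈ (Dart → Bool) ] 𝒟.Meas col × (∀ d → Good col d) → Halved
     from (col , m , good) = W + W + W , H.Half , H.half-bor , proj₁ , H.half-recurrent , H.half-load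
      where module H = Halves m good

   halve-≤ : ∀ {x n k} → 2 * x ≤ suc n → n ≤ 2 ^ suc k → x ≤ 2 ^ k
   halve-≤ {x} {n} {k} p q = ≮⇒≥ λ k<x → 1+n≰n (≤-trans (≤-trans (≤-reflexive (sym (*-suc 2 (2 ^ k))))
    (*-monoʳ-≤ 2 k<x)) (≤-trans p (s≤s q)))

   thin : ∀ k {N S} → Bor dartSpace S → Recurrent T N S → (∀ v → load S v ≤ 2 ^ k) →
    ∃[ N' ] Σ[ S' ∈ Pred Dart 0ℓ ] Bor dartSpace S' × (∀ {d} → S' d → S d) × Recurrent T N' S' × (∀ v → load S' v ≤ 1)
   thin-after : ∀ k {S S₁ N₁} → Bor dartSpace S₁ → (∀ {d} → S₁ d → S d) → Recurrent T N₁ S₁ → (∀ v → load S₁ v ≤ 2 ^ k) →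
    ∃[ N' ] Σ[ S' ∈ Pred Dart 0ℓ ] Bor dartSpace S' × (∀ {d} → S' d → S d) × Recurrent T N' S' × (∀ v → load S' v ≤ 1)
   thin zero {N} {S} b rec l = N , S , b , id , rec , l
   thin (suc k) {N} {S} b rec l = from (Halving.halved b rec)
    where
    from : Halving.Halved b rec → ∃[ N' ] Σ[ S' ∈ Pred Dart 0ℓ ] Bor dartSpace S' × (∀ {d} → S' d → S d) × Recurrent T N' S' × (∀ v → load S' v ≤ 1)
    from (N₁ , S₁ , b₁ , ⊆ , rec₁ , l₁) = thin-after k {S} {S₁} {N₁} b₁ ⊆ rec₁ λ v → halve-≤ {load S₁ v} {load S v} {k} (l₁ v) (l v)
   thin-after k {S} {S₁} {N₁} b₁ ⊆ rec₁ l₁ with thin k {N₁} {S₁} b₁ rec₁ l₁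
   ... | N' , S' , b' , ⊆' , rec' , l' = N' , S' , b' , (λ {d} p → ⊆ {d} (⊆' {d} p)) , rec' , l'

 -- Cutting the orbits of two involutions

 module Cutting {Y : Set} (g : Bool → Y → Y) (g-involutive : ∀ s y → g s (g s y) ≡ y) (Kd : Pred Y 0ℓ) where

  Cut : Y → Y → Set
  Cut y z = ¬ Kd y × ¬ Kd z

  f : Bool → Y → Y
  f s = keep Cut (g s)

  f-moved : ∀ s {y} → f s y ≢ y → Cut y (g s y) × f s y ≡ g s y
  f-moved s {y} m = [ id , (λ e → ⊥-elim (m e)) ]′ (keep-cases Cut (g s) y)

  f-involutive : ∀ s y → f s (f s y) ≡ y
  f-involutive s y = [ (λ { ((p , q) , e) → trans (cong (f s) e)
    (trans (keep-true Cut (g s) (q , subst (λ z → ¬ Kd z) (sym (g-involutive s y)) p)) (g-involutive s y)) }) ,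
   (λ e → trans (cong (f s) e) e) ]′ (keep-cases Cut (g s) y)

  module F = Alternation f f-involutive
  module A = Alternation g g-involutive

  shift : Bool → Y → Y
  shift s y = g (not s) (g s y)

  alt-shift : ∀ s k m y → A.alt s (k * 2 + m) y ≡ A.alt s m (iter (shift s) k y)
  alt-shift s zero m y = refl
  alt-shift true (suc k) m y = alt-shift true k m (shift true y)
  alt-shift false (suc k) m y = alt-shift false k m (shift false y)

  alt-unrestricted : ∀ s n {y} → F.Valid s n y → F.alt s n y ≡ A.alt s n y × (∀ k → k < n → ¬ Kd (A.alt s k y))
  alt-unrestricted s zero v = refl , λ _ ()
  alt-unrestricted s (suc n) {y} (m , v) with f-moved s m
  ... | (p , _) , e with alt-unrestricted (not s) n (subst (F.Valid (not s) n) e v)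
  ... | eq , avoid = trans (cong (F.alt (not s) n) e) eq , λ { zero _ → p ; (suc k) (s≤s k<) → avoid k k< }

  module _ {N : ℕ} (rec : ∀ s → Recurrent (shift s) N Kd) where

   orbit : Y → List Y
   orbit y = concatMap (λ n → A.alt true n y ∷ A.alt false n y ∷ []) (upTo (suc (N * 2)))

   orbit∋alt : ∀ s {n y} → n ≤ N * 2 → A.alt s n y ∈ orbit y
   orbit∋alt s {n} {y} n≤ = ∈-concat⁺′ {v = A.alt s n y} (here-there s {n}) (∈-map⁺ (λ n → A.alt true n y ∷ A.alt false n y ∷ []) {x = n} (∈-upTo⁺ (s≤s n≤)))
    where
    here-there : ∀ s {n y} → A.alt s n y ∈ A.alt true n y ∷ A.alt false n y ∷ []
    here-there true = here refl
    here-there false = there (here refl)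

   orbit∋ : ∀ s n {y} → F.Valid s n y → A.alt s n y ∈ orbit y
   orbit∋ s n {y} v = [ orbit∋alt s , long ]′ (≤-total n (N * 2))
    where
    long : N * 2 ≤ n → A.alt s n y ∈ orbit y
    long N2≤n with rec s y
    ... | inj₂ (k , k<N , hit) = ⊥-elim (proj₂ (alt-unrestricted s n v) (k * 2 + 0)
     (≤-trans (≤-reflexive (cong suc (+-identityʳ (k * 2)))) (≤-trans (n≤1+n _) (≤-trans (*-monoˡ-≤ 2 k<N) N2≤n)))
     (subst Kd (sym (alt-shift s k 0 y)) hit))
    ... | inj₁ (k , k<N , per) = subst (_∈ orbit y) (sym (trans (cong (λ m → A.alt s m y)
      (trans (m≡m%n+[m/n]*n n P) (+-comm (n % P) (n / P * P)))) (periods (n / P))))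
     (orbit∋alt s (≤-trans (<⇒≤ (m%n<n n P)) (*-monoˡ-≤ 2 k<N)))
     where
     P = suc k * 2
     periods : ∀ q → A.alt s (q * P + n % P) y ≡ A.alt s (n % P) y
     periods zero = refl
     periods (suc q) = trans (cong (λ m → A.alt s m y) (+-assoc P (q * P) (n % P)))
      (trans (alt-shift s (suc k) (q * P + n % P) y) (trans (cong (A.alt s (q * P + n % P)) per) (periods q)))

   connected : ∀ {x y} → Orb (f true ∷ f false ∷ []) x y → F.Connected x y
   connected = go F.done
    where
    go : ∀ {q x y z} → F.Path± q x y → Orb (f true ∷ f false ∷ []) y z → F.Connected x z
    step : ∀ s {q x y z} → F.Path± q x y → Orb (f true ∷ f false ∷ []) (f s y) z → Dec (f s y ≡ y) → F.Connected x z
    go p stop = _ , p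
    go p (here refl ◅ o) = step true p o (dec _)
    go p (there (here refl) ◅ o) = step false p o (dec _)
    step s p o (yes e) = go (subst (F.Path± _ _) (sym e) p) o
    step s p o (no m) = go (F.path-snoc s p m) o

   finite-orbits : FiniteOrbits (f true ∷ f false ∷ [])
   finite-orbits x = orbit x , λ y o → member (connected o)
    where
    member : ∀ {y} → F.Connected x y → y ∈ orbit x
    member (_ , p) with F.alternating p
    ... | s , n , v , e , _ = subst (_∈ orbit x) (trans (sym (proj₁ (alt-unrestricted s n v))) e) (orbit∋ s n v)

 bit : Bool → ℕ
 bit b = if b then 1 else 0

 half-bit : ∀ n b → ⌊ n + n + bit b /2⌋ ≡ n
 half-bit zero true = refl
 half-bit zero false = refl
 half-bit (suc n) b = trans (cong (λ m → ⌊ suc m + bit b /2⌋) (+-suc n n)) (cong suc (half-bit n b))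

 bit-injective : ∀ {a b} → bit a ≡ bit b → a ≡ b
 bit-injective {true} {true} e = refl
 bit-injective {false} {false} e = refl

 xor-both : ∀ {a b c d} → a ≢ b → c ≢ d → a xor c ≡ b xor d
 xor-both {true} {true} p q = ⊥-elim (p refl)
 xor-both {false} {false} p q = ⊥-elim (p refl)
 xor-both {_} {_} {true} {true} p q = ⊥-elim (q refl)
 xor-both {_} {_} {false} {false} p q = ⊥-elim (q refl)
 xor-both {true} {false} {true} {false} p q = refl
 xor-both {true} {false} {false} {true} p q = refl
 xor-both {false} {true} {true} {false} p q = refl
 xor-both {false} {true} {false} {true} p q = refl

 xor-cancelʳ : ∀ {a b} c → a xor c ≡ b xor c → a ≡ b
 xor-cancelʳ {true} {true} c e = refl
 xor-cancelʳ {false} {false} c e = refl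
 xor-cancelʳ {true} {false} true ()
 xor-cancelʳ {true} {false} false ()
 xor-cancelʳ {false} {true} true ()
 xor-cancelʳ {false} {true} false ()

 -- Once a sparse set of edges meeting every long line of rev ∘ mate is removed,
 -- the lines are finite, so they can be coloured alternately; together with the
 -- sides of the bipartition this halves every class at every vertex.
 module Splitting {𝒳 : BorelSpace} {K : ℕ} (G : Slots 𝒳 K) {s : ℕ} (layering : ∀ r → Layering 𝒳 (pow r (Slots.maps G)) s) where
  open Slots G
  open Darts G
  open Thinning G layering

  load-∪ : ∀ (P P' : Pred Dart 0ℓ) v → load (λ d → P d ⊎ P' d) v ≤ load P v + load P' v
  load-∪ P P' v = ≤-trans (length-⊆ (Unique-filter (λ i → dec (P (v , i) ⊎ P' (v , i))) (Unique-allFin K)) split)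
   (≤-reflexive (Listₚ.length-++ (select-list (λ i → P (v , i)) (allFin K))))
   where
   split : ∀ {i} → i ∈ select-list (λ i → P (v , i) ⊎ P' (v , i)) (allFin K) →
    i ∈ select-list (λ i → P (v , i)) (allFin K) ++ select-list (λ i → P' (v , i)) (allFin K)
   split {i} i∈ with proj₂ (∈-filter⁻ (λ i → dec (P (v , i) ⊎ P' (v , i))) {xs = allFin K} i∈)
   ... | inj₁ p = ∈-++⁺ˡ (∈-filter⁺ (λ i → dec (P (v , i))) (∈-allFin i) p)
   ... | inj₂ p = ∈-++⁺ʳ _ (∈-filter⁺ (λ i → dec (P' (v , i))) (∈-allFin i) p)

  Halved : Pred Dart 0ℓ → ℕ → ℕ → Set₁
  Halved E n h = Σ[ Kd ∈ Pred Dart 0ℓ ] Σ[ c' ∈ (Dart → ℕ) ] Bor dartSpace Kd × (∀ {d} → Kd d → Kd (rev d)) × (∀ v → load Kd v ≤ 2) ×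
   𝒟.Meas c' × (∀ {d} → E d × ¬ Kd d → c' (rev d) ≡ c' d) × (∀ d → c' d < n + n) × (∀ v k → classLoad (λ d → E d × ¬ Kd d) c' v k ≤ h)

  module _ {E : Pred Dart 0ℓ} (E-bor : Bor dartSpace E) (E-rev : ∀ {d} → E d → E (rev d)) {x : Point 𝒳 → Bool} (x-meas : Measurability.Meas 𝒳 x)
   (crossing : ∀ {d} → E d → x (proj₁ (rev d)) ≢ x (proj₁ d)) {c : Dart → ℕ} (c-meas : 𝒟.Meas c) (c-rev : ∀ {d} → E d → c (rev d) ≡ c d) where

   private
    g : Bool → Dart → Dart
    g true = mate E c
    g false = rev

    g-borel : ∀ b → BorelMap dartSpace dartSpace (g b)
    g-borel true = mate-borel E-bor c-meas
    g-borel false = rev-borel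

    g-involutive : ∀ b d → g b (g b d) ≡ d
    g-involutive true = mate-involutive E c
    g-involutive false = rev-involutive

    fwd bwd : Dart → Dart
    fwd d = rev (g true d)
    bwd d = g true (rev d)

    fwd-borel : BorelMap dartSpace dartSpace fwd
    fwd-borel A a = g-borel true _ (rev-borel A a)
    bwd-borel : BorelMap dartSpace dartSpace bwd
    bwd-borel A a = rev-borel _ (g-borel true A a)
    bwd∘fwd : ∀ d → bwd (fwd d) ≡ d
    bwd∘fwd d = trans (cong (g true) (rev-involutive (g true d))) (g-involutive true d)
    fwd∘bwd : ∀ d → fwd (bwd d) ≡ d
    fwd∘bwd d = trans (cong rev (g-involutive true (rev d))) (rev-involutive d)
    fwd-near : ∀ d → proj₁ (fwd d) ∈ nb maps (proj₁ d)
    fwd-near d = rev-near (g true d)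
    bwd-near : ∀ d → proj₁ (bwd d) ∈ nb maps (proj₁ d)
    bwd-near d = rev-near d

    module Forward = Lines fwd bwd fwd-borel bwd-borel bwd∘fwd fwd∘bwd fwd-near bwd-near
    module Backward = Lines bwd fwd bwd-borel fwd-borel fwd∘bwd bwd∘fwd bwd-near fwd-near

    iter-rev : ∀ n d → rev (iter bwd n d) ≡ iter fwd n (rev d)
    iter-rev zero d = refl
    iter-rev (suc n) d = iter-rev n (bwd d)

    K<2^K : ∀ k → k ≤ 2 ^ k
    K<2^K zero = z≤n
    K<2^K (suc k) = ≤-trans (+-mono-≤ (m^n>0 2 k) (K<2^K k)) (+-monoʳ-≤ (2 ^ k) (≤-reflexive (sym (+-identityʳ _))))

    light : ∀ S v → load S v ≤ 2 ^ K
    light S v = ≤-trans (load≤K S v) (K<2^K K)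

    record Transversal : Set₁ where
     field
      N : ℕ
      Kd : Pred Dart 0ℓ
      Kd-bor : Bor dartSpace Kd
      Kd-rev : ∀ {d} → Kd d → Kd (rev d)
      Kd-load : ∀ v → load Kd v ≤ 2
      recurrent : Recurrent bwd N Kd

    reversed : ∀ {N₁ S₁} → Recurrent fwd N₁ S₁ → Recurrent bwd N₁ (λ d → S₁ (rev d))
    reversed {N₁} {S₁} rec₁ d with rec₁ (rev d)
    ... | inj₁ (n , n< , e) = inj₁ (n , n< , trans (sym (rev-involutive _)) (trans (cong rev (trans (iter-rev (suc n) d) e)) (rev-involutive d)))
    ... | inj₂ (n , n< , p) = inj₂ (n , n< , subst S₁ (sym (iter-rev n d)) p)

    Thinned : (Dart → Dart) → Pred Dart 0ℓ → Set₁
    Thinned f S = ∃[ N' ] Σ[ S' ∈ Pred Dart 0ℓ ] Bor dartSpace S' × (∀ {d} → S' d → S d) × Recurrent f N' S' × (∀ v → load S' v ≤ 1)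

    combine : ∀ {S₁} → (∀ v → load S₁ v ≤ 1) → Thinned bwd (λ d → S₁ (rev d)) → Transversal
    combine {S₁} load₁ (N₂ , S₂ , bor₂ , ⊆ , rec₂ , load₂) = record
     { N = N₂
     ; Kd = λ d → S₂ d ⊎ S₂ (rev d)
     ; Kd-bor = bor-∪ dartSpace bor₂ (rev-borel _ bor₂)
     ; Kd-rev = λ { {d} (inj₁ p) → inj₂ (subst S₂ (sym (rev-involutive d)) p) ; (inj₂ p) → inj₁ p }
     ; Kd-load = λ v → ≤-trans (load-∪ S₂ (λ d → S₂ (rev d)) v) (+-mono-≤ (load₂ v)
       (≤-trans (load-mono {λ d → S₂ (rev d)} {S₁} (λ {d} p → subst S₁ (rev-involutive d) (⊆ p)) v) (load₁ v)))
     ; recurrent = λ d → Sum.map₂ (λ (n , n< , p) → n , n< , inj₁ p) (rec₂ d) }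

    transversal : Transversal
    transversal = from (Forward.thin K {1} {λ _ → ⊤} (bor-const dartSpace ⊤) (λ d → inj₂ (0 , s≤s z≤n , tt)) (light _))
     where
     from : Thinned fwd (λ _ → ⊤) → Transversal
     from (N₁ , S₁ , bor₁ , _ , rec₁ , load₁) =
      combine {S₁} load₁ (Backward.thin K {N₁} {λ d → S₁ (rev d)} (rev-borel _ bor₁) (reversed {N₁} {S₁} rec₁) (light _))

   module _ (tr : Transversal) where
    open Transversal tr
    open Cutting g g-involutive Kd

    private
     rec : ∀ b → Recurrent (shift b) N Kd
     rec true = recurrent-inverse {T = bwd} {fwd} fwd∘bwd bwd∘fwd {N} {Kd} recurrent
     rec false = recurrent

     f-borel : ∀ b → BorelMap dartSpace dartSpace (f b)
     f-borel b = All-lookup (keep-borel dartSpace Cut (λ {t} bt → bor-∩ dartSpace (bor-∁ dartSpace Kd-bor) (bt _ (bor-∁ dartSpace Kd-bor)))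
      (g-borel b ∷ [])) (here refl)

     fs-sym : Symmetricᵐ (f true ∷ f false ∷ [])
     fs-sym {d} (here refl) = here (sym (f-involutive true d))
     fs-sym {d} (there (here refl)) = there (here (sym (f-involutive false d)))

     Good : (Dart → Bool) → Dart → Set
     Good col d = ∀ b → f b d ≢ d → col (f b d) ≢ col d

     good-bor : ∀ col → 𝒟.Meas col → Bor dartSpace (Good col)
     good-bor col m = bor-⇔ dartSpace (λ { d (p , q) true → p ; d (p , q) false → q }) (λ d p → p true , p false)
      (bor-∩ dartSpace (at true) (at false))
      where
      at : ∀ b → Bor dartSpace (λ d → f b d ≢ d → col (f b d) ≢ col d)
      at b = bor-→ dartSpace (bor-∁ dartSpace (bor-≡ {dartSpace} {dartSpace} {f b} {id} (f-borel b) (bor-id {dartSpace})))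
       (𝒟.meas-map₂ _,_ (𝒟.meas-∘ {f = f b} (f-borel b) m) m (λ (a , b) → a ≢ b))

     coloured : Σ[ col ∈ (Dart → Bool) ] 𝒟.Meas col × (∀ d → Good col d)
     coloured = select dartSpace Bool-enumerable (f-borel true ∷ f-borel false ∷ []) fs-sym (finite-orbits rec) Good good-bor
      (λ col col' d same good b m e → good b m (trans (same _ (step b ◅ stop)) (trans e (sym (same d stop)))))
      (λ d → let col , proper = F.two-colouring-on (d ∷ []) in col , λ e o → proper (here refl) (connected rec o))
      where
      step : ∀ b {d} → f b d ∈ nb (f true ∷ f false ∷ []) d
      step true = here refl
      step false = there (here refl)

    module _ {col : Dart → Bool} (col-meas : 𝒟.Meas col) (good : ∀ d → Good col d) where

     private
      c' : Dart → ℕ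
      c' d = c d + c d + bit (col d xor x (proj₁ d))

      c'-rev : ∀ {d} → E d × ¬ Kd d → c' (rev d) ≡ c' d
      c'-rev {d} (e , ¬k) = cong₂ _+_ (cong₂ _+_ (c-rev e) (c-rev e)) (cong bit (xor-both col≢ (crossing e)))
       where
       cut : Cut d (rev d)
       cut = ¬k , λ k → ¬k (subst Kd (rev-involutive d) (Kd-rev k))
       moves : rev d ≢ d
       moves eq = crossing e (cong (λ d → x (proj₁ d)) eq)
       eq : f false d ≡ rev d
       eq = keep-true Cut rev cut
       col≢ : col (rev d) ≢ col d
       col≢ = subst (λ e → col e ≢ col d) eq (good d false λ e → moves (trans (sym eq) e))

      halved : ∀ {m h} → (∀ v k → classLoad E c v k ≤ m) → m ≤ 2 * h → ∀ v k → classLoad (λ d → E d × ¬ Kd d) c' v k ≤ h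
      halved {m} {h} bound m≤ v k = ≮⇒≥ λ h< → 1+n≰n (≤-trans (≤-trans (≤-reflexive (sym (*-suc 2 h)))
        (*-monoʳ-≤ 2 (≤-trans h< (load-mono {λ d → (E d × ¬ Kd d) × c' d ≡ k} {λ d → (¬ Kd d × c' d ≡ k) × E d × c d ≡ ⌊ k /2⌋} (λ { {d} ((e , ¬k) , refl) → (¬k , refl) , e , sym (half-bit (c d) (col d xor x (proj₁ d))) }) v))))
       (≤-trans (mate-halves E c (λ d → ¬ Kd d × c' d ≡ k) separated v ⌊ k /2⌋) (s≤s (≤-trans (bound v ⌊ k /2⌋) m≤))))
       where
       separated : ∀ d → mate E c d ≢ d → ¬ Kd d × c' d ≡ k → ¬ Kd (mate E c d) × c' (mate E c d) ≡ k → ⊥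
       separated d m (p , e) (q , e') = subst (λ z → col z ≢ col d) eq (good d true λ z → m (trans (sym eq) z))
        (xor-cancelʳ (x (proj₁ d)) (bit-injective (+-cancelˡ-≡ (c d + c d) _ _
         (trans (cong (λ n → n + n + bit (col (mate E c d) xor x (proj₁ d))) (sym (proj₂ (proj₂ (mate-moved E c m))))) (trans e' (sym e))))))
        where
        eq : f true d ≡ mate E c d
        eq = keep-true Cut (mate E c) (p , q)

     labelled : ∀ {m h n} → (∀ v k → classLoad E c v k ≤ m) → m ≤ 2 * h → (∀ d → c d < n) → Halved E n h
     labelled {n = n} bound m≤ c< = Kd , c' , Kd-bor , Kd-rev , Kd-load ,
      𝒟.meas-map₂ (λ k b → k + k + bit b) c-meas (𝒟.meas-map₂ _xor_ col-meas (λ P i → x-meas P)) , c'-rev ,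
      (λ d → below (c< d) (col d xor x (proj₁ d))) , halved bound m≤
      where
      below : ∀ {k} → k < n → ∀ b → k + k + bit b < n + n
      below {k} k< b = ≤-trans (s≤s (+-monoʳ-≤ (k + k) (bit≤1 b)))
       (≤-trans (≤-reflexive (cong suc (trans (+-assoc k k 1) (cong (k +_) (+-comm k 1))))) (+-mono-≤ k< k<))
       where
       bit≤1 : ∀ b → bit b ≤ 1
       bit≤1 true = ≤-refl
       bit≤1 false = z≤n

    split-with : ∀ {m h n} → (∀ v k → classLoad E c v k ≤ m) → m ≤ 2 * h → (∀ d → c d < n) → Halved E n h
    split-with {m} {h} {n} bound m≤ c< = from coloured
     where
     from : Σ[ col ∈ (Dart → Bool) ] 𝒟.Meas col × (∀ d → Good col d) → Halved E n h
     from (_ , m , good) = labelled m good bound m≤ c<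

   split : ∀ {m h n} → (∀ v k → classLoad E c v k ≤ m) → m ≤ 2 * h → (∀ d → c d < n) → Halved E n h
   split = split-with transversal

 layering-⊆ : ∀ {𝒳 s} {ts ts' : List (Point 𝒳 → Point 𝒳)} → (∀ {x y} → y ∈ nb ts x → y ∈ nb ts' x) → Layering 𝒳 ts' s → Layering 𝒳 ts s
 layering-⊆ {ts = ts} {ts'} ⊆ lay = record
  { layer = layer ; layer-meas = layer-meas ; layer< = layer<
  ; components = λ x → let ys , orb⊆ = components x in ys , λ y o → orb⊆ y (sub o) }
  where
  open Layering lay
  Q = λ x y → layer x ≡ layer y
  sub : ∀ {x y} → Orb (map (keep Q) ts) x y → Orb (map (keep Q) ts') x y
  sub stop = stop
  sub (i ◅ o) with nb-keep⁻ Q i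
  ... | inj₁ (q , j) = nb-keep⁺ Q q (⊆ j) ◅ sub o
  ... | inj₂ refl = sub o

 module Colourings {𝒳 : BorelSpace} {K : ℕ} (G : Slots 𝒳 K) {s : ℕ} (layering : ∀ r → Layering 𝒳 (pow r (Slots.maps G)) s) where
  open Slots G
  open Darts G
  private X = Point 𝒳

  dart-layering : ∀ {us} r → (∀ {d e} → e ∈ nb us d → proj₁ e ∈ nb (pow r maps) (proj₁ d)) → Layering dartSpace us s
  dart-layering {us} r near = record
   { layer = λ d → layer (proj₁ d)
   ; layer-meas = λ P i → layer-meas P
   ; layer< = λ d → layer< (proj₁ d)
   ; components = λ (v , i) → let ys , orb⊆ = components v in
     cartesianProductWith _,_ ys (allFin K) , λ (w , j) o → ∈-cartesianProductWith⁺ _,_ (orb⊆ w (heads o)) (∈-allFin j) }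
   where
   open Layering (layering r)
   heads : ∀ {d e} → Orb (map (keep (λ d e → layer (proj₁ d) ≡ layer (proj₁ e))) us) d e → Orb (map (keep (λ x y → layer x ≡ layer y)) (pow r maps)) (proj₁ d) (proj₁ e)
   heads stop = stop
   heads (p ◅ o) with nb-keep⁻ (λ d e → layer (proj₁ d) ≡ layer (proj₁ e)) p
   ... | inj₁ (eq , q) = nb-keep⁺ (λ x y → layer x ≡ layer y) eq (near q) ◅ heads o
   ... | inj₂ refl = heads o

  record Edges (E : Pred Dart 0ℓ) : Set₁ where
   field
    edges-bor : Bor dartSpace E
    edges-rev : ∀ {d} → E d → E (rev d)
    edges-occ : ∀ {d} → E d → Occupied d
  open Edges

  record Colouring (E : Pred Dart 0ℓ) (q : ℕ) : Set₁ where
   field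
    colour : Dart → ℕ
    colour-meas : 𝒟.Meas colour
    colour-rev : ∀ {d} → E d → colour (rev d) ≡ colour d
    colour< : ∀ {d} → E d → colour d < q
    proper : ∀ {v i j} → E (v , i) → E (v , j) → i ≢ j → colour (v , i) ≢ colour (v , j)
  open Colouring

  edges-∩ : ∀ {E P} → Edges E → Bor dartSpace P → (∀ {d} → E d → P d → P (rev d)) → Edges (λ d → E d × P d)
  edges-∩ e b r = record { edges-bor = bor-∩ dartSpace (edges-bor e) b ; edges-rev = λ (p , q) → edges-rev e p , r p q ; edges-occ = λ (p , _) → edges-occ e p }

  edges-∖ : ∀ {E P} → Edges E → Bor dartSpace P → (∀ {d} → E d → P d → P (rev d)) → Edges (λ d → E d × ¬ P d)
  edges-∖ {P = P} e b r = edges-∩ e (bor-∁ dartSpace b) λ {d} p ¬q q → ¬q (subst P (rev-involutive d) (r (edges-rev e p) q))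

  colouring-⊆ : ∀ {E E' q q'} → (∀ {d} → E d → E' d) → q' ≤ q → Colouring E' q' → Colouring E q
  colouring-⊆ f q≤ c = record
   { colour = colour c ; colour-meas = colour-meas c ; colour-rev = λ e → colour-rev c (f e)
   ; colour< = λ e → ≤-trans (colour< c (f e)) q≤ ; proper = λ e e' → proper c (f e) (f e') }

  colouring-∪ : ∀ {E P q q'} → Edges E → Bor dartSpace P → (∀ {d} → E d → P d → P (rev d)) →
   Colouring (λ d → E d × P d) q → Colouring (λ d → E d × ¬ P d) q' → Colouring E (q + q')
  colouring-∪ {E} {P} {q} {q'} e b r c c' = record
   { colour = col
   ; colour-meas = 𝒟.meas-if b (colour-meas c) (𝒟.meas-map (q +_) (colour-meas c'))
   ; colour-rev = λ {d} ed → rev-cases ed (dec (P d))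
   ; colour< = λ {d} ed → bound ed (dec (P d))
   ; proper = λ {v} {i} {j} ei ej i≢j → proper-cases ei ej i≢j (dec (P (v , i))) (dec (P (v , j))) }
   where
   col : Dart → ℕ
   col d = if ⟦ P d ⟧ then colour c d else q + colour c' d
   col-in : ∀ {d} → P d → col d ≡ colour c d
   col-in p = if-yes p
   col-out : ∀ {d} → ¬ P d → col d ≡ q + colour c' d
   col-out p = if-no p
   rev-cases : ∀ {d} → E d → Dec (P d) → col (rev d) ≡ col d
   rev-cases ed (yes p) = trans (col-in (r ed p)) (trans (colour-rev c (ed , p)) (sym (col-in p)))
   rev-cases {d} ed (no ¬p) = trans (col-out λ p → ¬p (subst P (rev-involutive d) (r (edges-rev e ed) p)))
    (trans (cong (q +_) (colour-rev c' (ed , ¬p))) (sym (col-out ¬p)))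
   bound : ∀ {d} → E d → Dec (P d) → col d < q + q'
   bound ed (yes p) = subst (_< q + q') (sym (col-in p)) (≤-trans (colour< c (ed , p)) (m≤m+n q q'))
   bound ed (no ¬p) = subst (_< q + q') (sym (col-out ¬p)) (+-monoʳ-< q (colour< c' (ed , ¬p)))
   apart : ∀ {d d'} → E d → P d → ¬ P d' → col d ≢ col d'
   apart {d} {d'} ed p ¬p' eq = <⇒≱ (colour< c (ed , p)) (≤-trans (m≤m+n q _) (≤-reflexive (trans (sym (col-out ¬p')) (trans (sym eq) (col-in p)))))
   proper-cases : ∀ {v i j} → E (v , i) → E (v , j) → i ≢ j → Dec (P (v , i)) → Dec (P (v , j)) → col (v , i) ≢ col (v , j)
   proper-cases ei ej i≢j (yes p) (yes p') eq = proper c (ei , p) (ej , p') i≢j (trans (sym (col-in p)) (trans eq (col-in p')))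
   proper-cases ei ej i≢j (yes p) (no ¬p') eq = apart ei p ¬p' eq
   proper-cases ei ej i≢j (no ¬p) (yes p') eq = apart ej p' ¬p (sym eq)
   proper-cases ei ej i≢j (no ¬p) (no ¬p') eq = proper c' (ei , ¬p) (ej , ¬p') i≢j
    (+-cancelˡ-≡ q _ _ (trans (sym (col-out ¬p)) (trans eq (col-out ¬p'))))

  private
   module Oriented {E : Pred Dart 0ℓ} (edges : Edges E) {rank : X → ℕ} (rank-meas : Measurability.Meas 𝒳 rank)
    (rank-proper : ∀ x {y} → y ∈ nb maps x → y ≢ x → rank y ≢ rank x) where

    Up : Pred Dart 0ℓ
    Up d = rank (proj₁ d) < rank (proj₁ (rev d))

    end : Bool → Dart → Dart
    end true d = d
    end false d = rev d

    canon : Dart → Dart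
    canon d = end ⟦ Up d ⟧ d

    end-borel : ∀ b → BorelMap dartSpace dartSpace (end b)
    end-borel true = bor-id {dartSpace}
    end-borel false = rev-borel

    up-bor : Bor dartSpace Up
    up-bor = label-borel dartSpace {σ = λ d → rank (proj₁ d)} _<_ (λ P i → rank-meas P) rev-borel

    canon-borel : BorelMap dartSpace dartSpace canon
    canon-borel = 𝒟.bor-select {𝒴 = dartSpace} {f = end} (𝒟.meas-⟦⟧ up-bor) end-borel

    canon-up : ∀ {d} → Up d → canon d ≡ d
    canon-up u = cong (λ b → end b _) (⟦⟧⁺ u)
    canon-down : ∀ {d} → ¬ Up d → canon d ≡ rev d
    canon-down ¬u = cong (λ b → end b _) (¬⟦⟧⁺ ¬u)

    rev-up : ∀ {d} → Occupied d → ¬ Up d → Up (rev d)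
    rev-up {d} o ¬u = subst (λ e → rank (proj₁ (rev d)) < rank (proj₁ e)) (sym (rev-involutive d))
     (≤∧≢⇒< (≮⇒≥ ¬u) (rank-proper (proj₁ d) (rev-near d) o))
    rev-down : ∀ {d} → Up d → ¬ Up (rev d)
    rev-down {d} u u' = <-asym u (subst (λ e → rank (proj₁ (rev d)) < rank (proj₁ e)) (rev-involutive d) u')

    canon-rev : ∀ {d} → E d → canon (rev d) ≡ canon d
    canon-rev {d} e = [ (λ u → trans (canon-down (rev-down u)) (trans (rev-involutive d) (sym (canon-up u)))) ,
     (λ ¬u → trans (canon-up (rev-up (edges-occ edges e) ¬u)) (sym (canon-down ¬u))) ]′ (toSum (dec (Up d)))

    canon-end : ∀ b {d} → E d → canon (end b d) ≡ canon d
    canon-end true e = refl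
    canon-end false e = canon-rev e

    end-canon : ∀ d → ∃[ b ] end b (canon d) ≡ d
    end-canon d = [ (λ u → true , canon-up u) , (λ ¬u → false , trans (cong rev (canon-down ¬u)) (rev-involutive d)) ]′ (toSum (dec (Up d)))

    Canonical : Pred Dart 0ℓ
    Canonical d = E d × canon d ≡ d

    end-E : ∀ b {d} → E d → E (end b d)
    end-E true e = e
    end-E false e = edges-rev edges e

    canonical : ∀ {d} → E d → Canonical (canon d)
    canonical {d} e = end-E ⟦ Up d ⟧ e , canon-end ⟦ Up d ⟧ e

    turn : Fin K → Dart → Dart
    turn j d = proj₁ d , j

    step : Bool × Fin K → Dart → Dart
    step (b , j) d = canon (turn j (end b d))

    steps : List (Dart → Dart)
    steps = map step (cartesianProductWith _,_ (true ∷ false ∷ []) (allFin K))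

    step∈ : ∀ b j {d} → step (b , j) d ∈ nb steps d
    step∈ b j = nb⁺ (∈-map⁺ step (∈-cartesianProductWith⁺ _,_ (b∈ b) (∈-allFin j)))
     where
     b∈ : ∀ b → b ∈ true ∷ false ∷ []
     b∈ true = here refl
     b∈ false = there (here refl)

    step⁻ : ∀ {d e} → e ∈ nb steps d → ∃[ b ] ∃[ j ] e ≡ step (b , j) d
    step⁻ i with nb⁻ i
    ... | _ , k , refl with ∈-map⁻ step k
    ... | (b , j) , _ , refl = b , j , refl

    Q : Dart → Dart → Set
    Q d e = Canonical d × Canonical e

    us : List (Dart → Dart)
    us = map (keep Q) steps

    us-borel : All (BorelMap dartSpace dartSpace) us
    us-borel = keep-borel dartSpace Q (λ b → bor-∩ dartSpace can (b _ can)) (Allₚ.map⁺ (All-tabulate λ {bj} _ → step-borel bj))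
     where
     can : Bor dartSpace Canonical
     can = bor-∩ dartSpace (edges-bor edges) (bor-≡ {dartSpace} {dartSpace} {canon} {id} canon-borel (bor-id {dartSpace}))
     step-borel : ∀ bj → BorelMap dartSpace dartSpace (step bj)
     step-borel (b , j) A a = end-borel b _ (dart-map (λ _ → bor-id {𝒳}) (λ _ → Measurability.meas-const 𝒳 j) _ (canon-borel A a))

    us-sym : Symmetricᵐ us
    us-sym {d} {e} i with nb-keep⁻ Q {steps} i
    ... | inj₂ refl = i
    ... | inj₁ ((cd , ce) , k) with step⁻ k
    ... | b , j , refl with end-canon (turn j (end b d))
    ... | b' , eq = nb-keep⁺ Q (ce , cd) (subst (_∈ nb steps e) back (step∈ b' (proj₂ (end b d))))
     where
     back : canon (turn (proj₂ (end b d)) (end b' (canon (turn j (end b d))))) ≡ d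
     back = trans (cong (λ a → canon (turn (proj₂ (end b d)) a)) eq) (trans (canon-end b (proj₁ cd)) (proj₂ cd))

    near : ∀ {d e} → e ∈ nb us d → proj₁ e ∈ nb (pow 2 maps) (proj₁ d)
    near i with nb-keep⁻ Q {steps} i
    ... | inj₂ refl = reach-refl 2 {maps} (here refl)
    ... | inj₁ (_ , k) with step⁻ k
    near {d} i | inj₁ (_ , k) | b , j , refl = reach-trans 1 1 {maps} (reach-1 {ts = maps} (end-near b d)) (reach-1 {ts = maps} (end-near ⟦ Up (turn j (end b d)) ⟧ (turn j (end b d))))
     where
     end-near : ∀ b d → proj₁ (end b d) ∈ nb maps (proj₁ d)
     end-near true d = here refl
     end-near false d = rev-near d

    greedy-darts : ∃[ c ] 𝒟.Meas c × (∀ d {e} → e ∈ nb us d → e ≢ d → c e ≢ c d) × (∀ d j → j < c d → ∃[ e ] e ∈ nb us d × e ≢ d × c e ≡ j)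
    greedy-darts = Greedy.greedy dartSpace us-borel us-sym (dart-layering 2 near)

    module _ {γ : Dart → ℕ} (γ-meas : 𝒟.Meas γ) (γ-proper : ∀ d {e} → e ∈ nb us d → e ≢ d → γ e ≢ γ d)
     (γ-mex : ∀ d j → j < γ d → ∃[ e ] e ∈ nb us d × e ≢ d × γ e ≡ j) where

     dart-colouring : ∀ {D} → (∀ v → load E v ≤ D) → Colouring E (suc (D + D))
     dart-colouring {D} load≤ = record
      { colour = λ d → γ (canon d)
      ; colour-meas = 𝒟.meas-∘ {f = canon} canon-borel (γ-meas)
      ; colour-rev = λ e → cong γ (canon-rev e)
      ; colour< = λ e → s≤s (bound (canonical e))
      ; proper = λ {v} {i} {j} ei ej i≢j eq → separated ei ej i≢j (sym eq) }
      where
      separated : ∀ {v i j} → E (v , i) → E (v , j) → i ≢ j → γ (canon (v , j)) ≢ γ (canon (v , i))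
      separated {v} {i} {j} ei ej i≢j = γ-proper (canon (v , i))
       (nb-keep⁺ Q (canonical ei , canonical ej) (subst (_∈ nb steps (canon (v , i))) at (step∈ b j))) different
       where
       b = proj₁ (end-canon (v , i))
       at : step (b , j) (canon (v , i)) ≡ canon (v , j)
       at = cong (λ a → canon (turn j a)) (proj₂ (end-canon (v , i)))
       different : canon (v , j) ≢ canon (v , i)
       different eq with ⟦ Up (v , i) ⟧ | ⟦ Up (v , j) ⟧
       ... | true | true = i≢j (sym (cong proj₂ eq))
       ... | false | false = i≢j (cong proj₂ (trans (sym (rev-involutive (v , i))) (trans (cong rev (sym eq)) (rev-involutive (v , j)))))
       ... | true | false = edges-occ edges ej (cong proj₁ eq)
       ... | false | true = edges-occ edges ei (sym (cong proj₁ eq))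
      around : Bool → Dart → List Dart
      around b d = map (λ j → step (b , j) d) (select-list (λ j → E (turn j (end b d))) (allFin K))
      around-length : ∀ b d → length (around b d) ≤ D
      around-length b d = ≤-trans (≤-reflexive (Listₚ.length-map (λ j → step (b , j) d) (select-list (λ j → E (turn j (end b d))) (allFin K)))) (load≤ (proj₁ (end b d)))
      around∋ : ∀ b j {d} → E (step (b , j) d) → step (b , j) d ∈ around true d ++ around false d
      around∋ b j {d} e = pick b e
       where
       E-canon : ∀ {a} → E (canon a) → E a
       E-canon {a} e = let b , eq = end-canon a in subst E eq (end-E b e)
       in-around : ∀ b → E (step (b , j) d) → step (b , j) d ∈ around b d
       in-around b e = ∈-map⁺ (λ j → step (b , j) d) (∈-filter⁺ (λ j → dec (E (turn j (end b d)))) (∈-allFin j) (E-canon e))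
       pick : ∀ b → E (step (b , j) d) → step (b , j) d ∈ around true d ++ around false d
       pick true e = ∈-++⁺ˡ (in-around true e)
       pick false e = ∈-++⁺ʳ (around true d) (in-around false e)
      bound : ∀ {d} → Canonical d → γ d ≤ D + D
      bound {d} cd = ≤-trans (≤-reflexive (sym (Listₚ.length-upTo (γ d)))) (≤-trans
       (length-⊆ {ys = map γ (around true d ++ around false d)} (Unique-upTo (γ d)) λ i → attained (∈-upTo⁻ i))
       (≤-trans (≤-reflexive (trans (Listₚ.length-map γ (around true d ++ around false d)) (Listₚ.length-++ (around true d) {around false d}))) (+-mono-≤ (around-length true d) (around-length false d))))
       where
       attained : ∀ {j} → j < γ d → j ∈ map γ (around true d ++ around false d)
       attained {j} j< with γ-mex d j j<
       ... | e , i , e≢d , refl with nb-keep⁻ Q {steps} i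
       ... | inj₂ e≡d = ⊥-elim (e≢d e≡d)
       ... | inj₁ ((_ , ce) , k) with step⁻ k
       ... | b , j' , refl = ∈-map⁺ γ (around∋ b j' (proj₁ ce))

  greedy-colouring : ∀ {E D} → Edges E → (∀ v → load E v ≤ D) → Colouring E (suc (D + D))
  greedy-colouring {E} {D} edges load≤ = oriented (Greedy.greedy 𝒳 maps-borel maps-sym (layering-⊆ (λ {x} {y} i → reach-1 {ts = maps} {x} {y} i) (layering 1)))
   where
   oriented : ∃[ c ] Measurability.Meas 𝒳 c × (∀ x {y} → y ∈ nb maps x → y ≢ x → c y ≢ c x) × (∀ x j → j < c x → ∃[ y ] y ∈ nb maps x × y ≢ x × c y ≡ j) → Colouring E (suc (D + D))
   oriented (rank , rank-meas , rank-proper , _) = coloured greedy-darts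
    where
    open Oriented edges rank-meas rank-proper
    coloured : ∃[ c ] 𝒟.Meas c × (∀ d {e} → e ∈ nb us d → e ≢ d → c e ≢ c d) × (∀ d j → j < c d → ∃[ e ] e ∈ nb us d × e ≢ d × c e ≡ j) → Colouring E (suc (D + D))
    coloured (_ , m , p , q) = dart-colouring m p q load≤

 module Bipartite {𝒳 : BorelSpace} {K : ℕ} (G : Slots 𝒳 K) {s : ℕ} (layering : ∀ r → Layering 𝒳 (pow r (Slots.maps G)) s)
  {x : Point 𝒳 → Bool} (x-meas : Measurability.Meas 𝒳 x) where
  open Slots G
  open Darts G
  open Colourings G layering
  open Edges
  private X = Point 𝒳

  load-single : ∀ {P v i j} → load P v ≤ 1 → P (v , i) → P (v , j) → i ≡ j
  load-single {P} {v} {i} {j} l p q = by-contradiction λ i≢j → 1+n≰n (≤-trans (length-⊆ {xs = i ∷ j ∷ []} ((i≢j ∷ []) ∷ [] ∷ [])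
   λ { (here refl) → ∈-filter⁺ (λ i → dec (P (v , i))) (∈-allFin i) p
    ; (there (here refl)) → ∈-filter⁺ (λ i → dec (P (v , i))) (∈-allFin j) q }) l)

  load-none : ∀ {P : Pred Dart 0ℓ} → (∀ {d} → ¬ P d) → ∀ v → load P v ≡ 0
  load-none {P} none v = cong length (Listₚ.filter-none (λ i → dec (P (v , i))) (All-tabulate {xs = allFin K} λ _ → none))

  class-mono : ∀ S S' c → (∀ {d} → S d → S' d) → ∀ v k → classLoad S c v k ≤ classLoad S' c v k
  class-mono S S' c f v k = load-mono {λ d → S d × c d ≡ k} {λ d → S' d × c d ≡ k} (λ {d} (e , eq) → f {d} e , eq) v

  class≤load : ∀ S c v k → classLoad S c v k ≤ load S v
  class≤load S c v k = load-mono {λ d → S d × c d ≡ k} {S} proj₁ v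

  load-classes : ∀ h {E c m} → (∀ {d} → E d → c d < h) → (∀ v k → classLoad E c v k ≤ m) → ∀ v → load E v ≤ h * m
  load-classes zero {E} c< cl v = ≤-reflexive (load-none {E} (λ {d} e → n≮0 (c< {d} e)) v)
  load-classes (suc h) {E} {c} {m} c< cl v = ≤-trans (load-mono {E} {λ d → (E d × ¬ c d < h) ⊎ (E d × c d < h)} (λ {d} e → [ inj₂ ∘ (e ,_) , inj₁ ∘ (e ,_) ]′ (toSum (dec (c d < h)))) v)
   (≤-trans (Splitting.load-∪ G layering (λ d → E d × ¬ c d < h) (λ d → E d × c d < h) v)
    (+-mono-≤ (≤-trans (load-mono {λ d → E d × ¬ c d < h} {λ d → E d × c d ≡ h} (λ {d} (e , ≮) → e , ≤-antisym (≤-pred (c< {d} e)) (≮⇒≥ ≮)) v) (cl v h))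
     (load-classes h {λ d → E d × c d < h} {c} proj₂ (λ v k → ≤-trans (class-mono (λ d → E d × c d < h) E c proj₁ v k) (cl v k)) v)))

  Crossing : Pred Dart 0ℓ → Set
  Crossing E = ∀ {d} → E d → x (proj₁ (rev d)) ≢ x (proj₁ d)

  record Labelling (E : Pred Dart 0ℓ) (n m : ℕ) : Set₁ where
   field
    label : Dart → ℕ
    label-meas : 𝒟.Meas label
    label-rev : ∀ {d} → E d → label (rev d) ≡ label d
    label< : ∀ d → label d < n
    class≤ : ∀ v k → classLoad E label v k ≤ m

  rounds : ∀ r {q n m E} → Edges E → Crossing E → Labelling E n (2 ^ r * m) →
   (∀ {E'} → Edges E' → Crossing E' → Labelling E' (2 ^ r * n) m → Colouring E' q) → Colouring E (r * 5 + q)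
  rounds zero {q} {n} {m} edges cross lab finish = finish edges cross record
   { label = label ; label-meas = label-meas ; label-rev = label-rev
   ; label< = λ d → ≤-trans (label< d) (≤-reflexive (sym (*-identityˡ n)))
   ; class≤ = λ v k → ≤-trans (class≤ v k) (≤-reflexive (*-identityˡ m)) }
   where open Labelling lab
  rounds (suc r) {q} {n} {m} {E} edges cross lab finish = from (Splitting.split G layering (edges-bor edges) (edges-rev edges) x-meas cross
   (Labelling.label-meas lab) (Labelling.label-rev lab) {h = 2 ^ r * m} (Labelling.class≤ lab) (≤-reflexive (*-assoc 2 (2 ^ r) m)) (Labelling.label< lab))
   where
   double : ∀ a n → a * (n + n) ≡ 2 * a * n
   double = solve-∀
   from : Splitting.Halved G layering E n (2 ^ r * m) → Colouring E (suc r * 5 + q)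
   from (Kd , c' , Kd-bor , Kd-rev , Kd-load , c'-meas , c'-rev , c'< , c'-load) =
    colouring-∪ edges Kd-bor (λ _ → Kd-rev)
     (greedy-colouring (edges-∩ edges Kd-bor (λ _ → Kd-rev)) λ v → ≤-trans (load-mono {λ d → E d × Kd d} {Kd} proj₂ v) (Kd-load v))
     (rounds r {n = n + n} {m} (edges-∖ edges Kd-bor (λ _ → Kd-rev)) (λ (e , _) → cross e)
      (record { label = c' ; label-meas = c'-meas ; label-rev = c'-rev ; label< = c'< ; class≤ = c'-load })
      λ {E'} edges' cross' lab' → finish edges' cross' (subst (λ k → Labelling E' k m) (double (2 ^ r) n) lab'))

  power-colouring : ∀ κ {E} → Edges E → Crossing E → (∀ v → load E v ≤ 2 ^ κ) → Colouring E (κ * 5 + 2 ^ κ)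
  power-colouring κ {E} edges cross load≤ = rounds κ {2 ^ κ} {1} {1} edges cross
   (record { label = λ _ → 0 ; label-meas = 𝒟.meas-const 0 ; label-rev = λ _ → refl ; label< = λ _ → s≤s z≤n
       ; class≤ = λ v k → ≤-trans (class≤load E (λ _ → 0) v k) (≤-trans (load≤ v) (≤-reflexive (sym (*-identityʳ _)))) })
   finish
   where
   finish : ∀ {E'} → Edges E' → Crossing E' → Labelling E' (2 ^ κ * 1) 1 → Colouring E' (2 ^ κ)
   finish {E'} _ _ lab = record
    { colour = label ; colour-meas = label-meas ; colour-rev = label-rev
    ; colour< = λ {d} _ → ≤-trans (label< d) (≤-reflexive (*-identityʳ _))
    ; proper = λ {v} {i} {j} ei ej i≢j eq → i≢j (load-single {λ d → E' d × label d ≡ label (v , i)} (class≤ v _) (ei , refl) (ej , sym eq)) }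
    where open Labelling lab

  -- The classes are grouped greedily along the binary digits of n m.
  group : ∀ κ {m' w n E c} → let m = suc m' in Edges E → Crossing E → 𝒟.Meas c → (∀ {d} → E d → c (rev d) ≡ c d) → (∀ {d} → E d → c d < n) →
   (∀ v k → classLoad E c v k ≤ m) → suc (m + m) + κ * 5 ≤ w → n * m < 2 ^ κ → Colouring E (n * m + κ * w)
  group zero {n = zero} edges cross c-meas c-rev c< cl w≥ n< = record
   { colour = λ _ → 0 ; colour-meas = 𝒟.meas-const 0 ; colour-rev = λ _ → refl
   ; colour< = λ e → ⊥-elim (n≮0 (c< e)) ; proper = λ e → ⊥-elim (n≮0 (c< e)) }
  group zero {n = suc _} edges cross c-meas c-rev c< cl w≥ (s≤s ())
  group (suc κ) {m'} {w} {n} {E} {c} edges cross c-meas c-rev c< cl w≥ n< = [ small , large ]′ (toSum (dec (n * suc m' < 2 ^ κ)))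
   where
   m = suc m'
   h = 2 ^ κ / m
   w≥' : suc (m + m) + κ * 5 ≤ w
   w≥' = ≤-trans (+-monoʳ-≤ (suc (m + m)) (m≤n+m (κ * 5) 5)) w≥
   small : n * m < 2 ^ κ → Colouring E (n * m + suc κ * w)
   small n<' = colouring-⊆ id (+-monoʳ-≤ (n * m) (m≤n+m (κ * w) w)) (group κ edges cross c-meas c-rev c< cl w≥' n<')
   large : ¬ n * m < 2 ^ κ → Colouring E (n * m + suc κ * w)
   large n≮ = colouring-⊆ id budget (colouring-∪ edges (c-meas (_< h)) (λ e → subst (_< h) (sym (c-rev e)))
     (power-colouring κ (edges-∩ edges (c-meas (_< h)) (λ e → subst (_< h) (sym (c-rev e)))) (λ (e , _) → cross e) λ v →
      ≤-trans (load-classes h {λ d → E d × c d < h} {c} proj₂ (λ v k → ≤-trans (class-mono (λ d → E d × c d < h) E c proj₁ v k) (cl v k)) v) (m/n*n≤m (2 ^ κ) m))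
     (colouring-∪ above (c-meas (_≡ h)) at-rev
      (greedy-colouring (edges-∩ above (c-meas (_≡ h)) at-rev) λ v → ≤-trans (load-mono {λ d → (E d × ¬ c d < h) × c d ≡ h} {λ d → E d × c d ≡ h} (λ ((e , _) , eq) → e , eq) v) (cl v h))
      (group κ {c = λ d → c d ∸ suc h} (edges-∖ above (c-meas (_≡ h)) at-rev) (λ ((e , _) , _) → cross e) (𝒟.meas-map (_∸ suc h) c-meas)
       (λ ((e , _) , _) → cong (_∸ suc h) (c-rev e)) (λ p@((e , _) , _) → ∸-monoˡ-< (c< e) (beyond p))
       (λ v k → ≤-trans (load-mono {λ d → ((E d × ¬ c d < h) × c d ≢ h) × c d ∸ suc h ≡ k} {λ d → E d × c d ≡ k + suc h} (λ {d} (p@((e , _) , _) , eq) → e , trans (sym (m∸n+n≡m (beyond {d} p))) (cong (_+ suc h) eq)) v) (cl v (k + suc h))) w≥' rest<)))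
    where
    above : Edges (λ d → E d × ¬ c d < h)
    above = edges-∖ edges (c-meas (_< h)) (λ e → subst (_< h) (sym (c-rev e)))
    at-rev : ∀ {d} → E d × ¬ c d < h → c d ≡ h → c (rev d) ≡ h
    at-rev (e , _) eq = trans (c-rev e) eq
    beyond : ∀ {d} → (E d × ¬ c d < h) × c d ≢ h → suc h ≤ c d
    beyond ((_ , ≮) , ≢) = ≤∧≢⇒< (≮⇒≥ ≮) λ eq → ≢ (sym eq)
    2^κ≤ : 2 ^ κ ≤ suc h * m
    2^κ≤ = ≤-trans (≤-reflexive (m≡m%n+[m/n]*n (2 ^ κ) m)) (+-monoˡ-≤ (h * m) (<⇒≤ (m%n<n (2 ^ κ) m)))
    n'm : (n ∸ suc h) * m ≤ n * m ∸ 2 ^ κ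
    n'm = ≤-trans (≤-reflexive (*-distribʳ-∸ m n (suc h))) (∸-monoʳ-≤ (n * m) 2^κ≤)
    rest< : (n ∸ suc h) * m < 2 ^ κ
    rest< = ≤-<-trans n'm (≤-trans (∸-monoˡ-< n< (≮⇒≥ n≮)) (≤-reflexive (trans (m+n∸m≡n (2 ^ κ) (2 ^ κ + 0)) (+-identityʳ _))))
    arrange : ∀ a b c d e → a + b + (c + (d + e)) ≡ (d + b) + ((c + a) + e)
    arrange = solve-∀
    budget : κ * 5 + 2 ^ κ + (suc (m + m) + ((n ∸ suc h) * m + κ * w)) ≤ n * m + suc κ * w
    budget = ≤-trans (≤-reflexive (arrange (κ * 5) (2 ^ κ) (suc (m + m)) ((n ∸ suc h) * m) (κ * w)))
     (+-mono-≤ (≤-trans (+-monoˡ-≤ (2 ^ κ) n'm) (≤-reflexive (m∸n+n≡m (≮⇒≥ n≮)))) (+-monoˡ-≤ (κ * w) w≥'))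

  bipartite-colouring : ∀ r κ {m' w E} → let m = suc m' in Edges E → Crossing E → (∀ v → load E v ≤ 2 ^ r * m) →
   2 ^ r * m < 2 ^ κ → suc (m + m) + κ * 5 ≤ w → Colouring E (r * 5 + (2 ^ r * m + κ * w))
  bipartite-colouring r κ {m'} {w} {E} edges cross load≤ size w≥ = rounds r {n = 1} {suc m'} edges cross
   (record { label = λ _ → 0 ; label-meas = 𝒟.meas-const 0 ; label-rev = λ _ → refl ; label< = λ _ → s≤s z≤n
       ; class≤ = λ v k → ≤-trans (class≤load E (λ _ → 0) v k) (load≤ v) })
   finish
   where
   finish : ∀ {E'} → Edges E' → Crossing E' → Labelling E' (2 ^ r * 1) (suc m') → Colouring E' (2 ^ r * suc m' + κ * w)
   finish edges' cross' lab = group κ {m'} {w} {2 ^ r} edges' cross' label-meas label-rev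
     (λ {d} _ → ≤-trans (label< d) (≤-reflexive (*-identityʳ _))) class≤ w≥ size
    where open Labelling lab

 pow-⊆ : ∀ {X : Set} {ts ts' : List (X → X)} → (∀ {x y} → y ∈ nb ts x → y ∈ nb ts' x) → ∀ n {x y} → y ∈ nb (pow n ts) x → y ∈ nb (pow n ts') x
 pow-⊆ ⊆ zero i = i
 pow-⊆ {ts = ts} {ts'} ⊆ (suc n) i = let y , p , q = reach-unsnoc n {ts} i in reach-snoc n {ts'} (pow-⊆ ⊆ n p) (⊆ q)

 module Masking {𝒳 : BorelSpace} {K : ℕ} (G : Slots 𝒳 K) {s : ℕ} (layering : ∀ r → Layering 𝒳 (pow r (Slots.maps G)) s)
  {E : Pred (Darts.Dart G) 0ℓ} (edges : Colourings.Edges G layering E) where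
  open Slots G
  open Darts G
  open Colourings G layering
  open Edges edges
  open Measurability 𝒳
  private
   X = Point 𝒳

   pick : Bool → Fin K → X → X
   pick true i = slot i
   pick false i = id

   slotᴱ : Fin K → X → X
   slotᴱ i v = pick ⟦ E (v , i) ⟧ i v

   slotᴱ-in : ∀ {i v} → E (v , i) → slotᴱ i v ≡ slot i v
   slotᴱ-in {i} {v} e = cong (λ b → pick b i v) (⟦⟧⁺ e)

   slotᴱ-out : ∀ {i v} → ¬ E (v , i) → slotᴱ i v ≡ v
   slotᴱ-out {i} {v} ¬e = cong (λ b → pick b i v) (¬⟦⟧⁺ ¬e)

   slotᴱ-moved : ∀ {i v} → slotᴱ i v ≢ v → E (v , i)
   slotᴱ-moved m = by-contradiction λ ¬e → m (slotᴱ-out ¬e)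

  masked : Slots 𝒳 K
  masked = record
   { slot = slotᴱ
   ; slot-borel = λ i → bor-select {𝒴 = 𝒳} {f = λ b → pick b i} (meas-⟦⟧ (edges-bor i)) (λ { true → slot-borel i ; false → bor-id {𝒳} })
   ; slot-injective = λ i j eq m →
     let ei = slotᴱ-moved m
         ej = slotᴱ-moved λ e → m (trans eq e)
     in slot-injective i j (trans (sym (slotᴱ-in ei)) (trans eq (slotᴱ-in ej))) λ e → m (trans (slotᴱ-in ei) e)
   ; slot-back = λ i v → back i v (dec (E (v , i))) }
   where
   back : ∀ i v → Dec (E (v , i)) → ∃[ j ] slotᴱ j (slotᴱ i v) ≡ v
   back i v (yes e) = j , trans (cong (slotᴱ j) (slotᴱ-in e)) (trans (slotᴱ-in (edges-rev e)) (cong proj₁ (rev-involutive (v , i))))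
    where
    j = proj₂ (rev (v , i))
   back i v (no ¬e) = i , trans (cong (slotᴱ i) (slotᴱ-out ¬e)) (slotᴱ-out ¬e)

  maps-⊆ : ∀ {x y} → y ∈ nb (Slots.maps masked) x → y ∈ nb maps x
  maps-⊆ {x} p with Slots.maps⁻ masked p
  ... | inj₁ refl = here refl
  ... | inj₂ (i , refl) = inside (dec (E (x , i)))
   where
   inside : Dec (E (x , i)) → slotᴱ i x ∈ nb maps x
   inside (yes e) = subst (_∈ nb maps x) (sym (slotᴱ-in e)) (slot∈maps i)
   inside (no ¬e) = subst (_∈ nb maps x) (sym (slotᴱ-out ¬e)) (here refl)

  masked-layering : ∀ r → Layering 𝒳 (pow r (Slots.maps masked)) s
  masked-layering r = layering-⊆ (λ {x} {y} → pow-⊆ maps-⊆ r {x} {y}) (layering r)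

  masked-degree : ∀ v → Slots.degree masked v ≤ load E v
  masked-degree v = length-⊆ (Unique-filter (λ i → dec (slotᴱ i v ≢ v)) (Unique-allFin K))
   λ i∈ → ∈-filter⁺ (λ i → dec (E (v , i))) (∈-allFin _) (slotᴱ-moved (proj₂ (∈-filter⁻ (λ i → dec (slotᴱ i v ≢ v)) {xs = allFin K} i∈)))

  masked-count : ∀ (P : Pred X 0ℓ) v → load (λ d → E d × P (proj₁ (rev d))) v ≤ slotCount masked P v
  masked-count P v = length-⊆ (Unique-filter (λ i → dec (E (v , i) × P (slot i v))) (Unique-allFin K)) λ i∈ →
   let e , p = proj₂ (∈-filter⁻ (λ i → dec (E (v , i) × P (slot i v))) {xs = allFin K} i∈)
   in ∈-filter⁺ (λ i → dec (slotᴱ i v ≢ v × P (slotᴱ i v))) (∈-allFin _) ((λ eq → edges-occ e (trans (sym (slotᴱ-in e)) eq)) , subst P (sym (slotᴱ-in e)) p)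

  excess : ℕ → ℕ → ℕ
  excess j t = suc j * (6 * (2 * t) + 6) + suc j * (6 * (2 * t) + 6) + suc j * (6 * (2 * t) + 6)

  bipartition : ∀ j t → (∀ v → load E v ≤ suc j * suc j) → suc K ≤ 2 ^ t →
   Σ[ x ∈ (X → Bool) ] Meas x × (∀ b v → let n = load (λ d → E d × x (proj₁ (rev d)) ≡ b) v in n + n ≤ load E v + excess j t)
  bipartition j t load≤ K≤ = from (Discrepancy.discrepancy masked masked-layering j t 2 1 ≤-refl ≤-refl ≤-refl
    (λ v → ≤-trans (masked-degree v) (load≤ v)) K≤)
   where
   Balanced : (X → Sign) → Sign → Set
   Balanced σ q = ∀ v → let n = count q (Slots.signs masked v σ) in n + n ≤ Slots.degree masked v + excess j t
   from : ∃[ σ ] Meas σ × (∀ v → σ v ≢ unset) × Balanced σ plus × Balanced σ minus →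
    Σ[ x ∈ (X → Bool) ] Meas x × (∀ b v → let n = load (λ d → E d × x (proj₁ (rev d)) ≡ b) v in n + n ≤ load E v + excess j t)
   from (σ , σ-meas , σ≢ , plus≤ , minus≤) = x , meas-map (λ q → ⟦ q ≡ plus ⟧) σ-meas , λ { true → balanced plus (λ ()) plus≤ (λ v → ⟦⟧⁻) ; false → balanced minus (λ ()) minus≤ negative }
    where
    x : X → Bool
    x v = ⟦ σ v ≡ plus ⟧
    negative : ∀ v → x v ≡ false → σ v ≡ minus
    negative v eq with σ v | σ≢ v | ¬⟦⟧⁻ eq
    ... | unset | ≢ | _ = ⊥-elim (≢ refl)
    ... | plus | _ | ≢ = ⊥-elim (≢ refl)
    ... | minus | _ | _ = refl
    balanced : ∀ q → q ≢ unset → Balanced σ q → ∀ {b} → (∀ v → x v ≡ b → σ v ≡ q) → ∀ v →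
     let n = load (λ d → E d × x (proj₁ (rev d)) ≡ b) v in n + n ≤ load E v + excess j t
    balanced q q≢ bal {b} sound v = ≤-trans (+-mono-≤ le le) (≤-trans (bal v) (+-monoˡ-≤ (excess j t) (masked-degree v)))
     where
     le : load (λ d → E d × x (proj₁ (rev d)) ≡ b) v ≤ count q (Slots.signs masked v σ)
     le = ≤-trans (load-mono {λ d → E d × x (proj₁ (rev d)) ≡ b} {λ d → E d × σ (proj₁ (rev d)) ≡ q} (λ (e , p) → e , sound _ p) v)
      (≤-trans (masked-count (λ z → σ z ≡ q) v) (≤-reflexive (sym (count-signs masked q q≢ σ v))))

 half-≤ : ∀ {n} B c → n + n ≤ B + c + B → n ≤ B + ⌊ c /2⌋
 half-≤ {n} B c le = ≤-trans (≤-reflexive (n≡⌊n+n/2⌋ n)) (≤-trans (⌊n/2⌋-mono le) (≤-reflexive (trans (cong ⌊_/2⌋ (swap B c)) (halve B c))))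
  where
  swap : ∀ B c → B + c + B ≡ B + B + c
  swap = solve-∀
  halve : ∀ B c → ⌊ B + B + c /2⌋ ≡ B + ⌊ c /2⌋
  halve zero c = refl
  halve (suc B) c = trans (cong (λ m → ⌊ suc m + c /2⌋) (+-suc B B)) (cong suc (halve B c))

 ⌊n/2⌋+⌊n/2⌋≤n : ∀ n → ⌊ n /2⌋ + ⌊ n /2⌋ ≤ n
 ⌊n/2⌋+⌊n/2⌋≤n n = ≤-trans (+-monoʳ-≤ ⌊ n /2⌋ (⌊n/2⌋≤⌈n/2⌉ n)) (≤-reflexive (⌊n/2⌋+⌈n/2⌉≡n n))

 -- The number of colours beyond the degree that a bipartite graph of degree
 -- at most 2 · 4^r costs.
 bipartite-cost : ℕ → ℕ
 bipartite-cost r = r * 5 + (2 ^ r + (2 + (r + r)) * (suc (suc (2 * 2 ^ r) + suc (2 * 2 ^ r)) + (2 + (r + r)) * 5))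

 module Recursion {𝒳 : BorelSpace} {K : ℕ} (G : Slots 𝒳 K) {s : ℕ} (layering : ∀ r → Layering 𝒳 (pow r (Slots.maps G)) s)
  (r j t : ℕ) (2^r≡ : 2 ^ r ≡ suc j) (K≤ : K ≤ suc j * suc j) (t≥ : suc K ≤ 2 ^ t) where
  open Darts G
  open Colourings G layering
  open Edges

  excess : ℕ
  excess = suc j * (6 * (2 * t) + 6) + suc j * (6 * (2 * t) + 6) + suc j * (6 * (2 * t) + 6)

  module _ (B : ℕ) (B≡ : B ≡ excess) (B≤ : B ≤ suc j * suc j) where

   private
    k = suc j

    bipartite : ∀ {x : Point 𝒳 → Bool} (x-meas : Measurability.Meas 𝒳 x) {E D} → Edges E → Bipartite.Crossing G layering x-meas E →
     (∀ v → load E v ≤ D) → D ≤ 2 * (k * k) → Colouring E (D + bipartite-cost r)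
    bipartite x-meas {E} {D} edges cross load≤ D≤ = colouring-⊆ id cost
     (Bipartite.bipartite-colouring G layering x-meas r κ {m'} {w} edges cross (λ v → ≤-trans (load≤ v) D≤rm) rm<κ w≥)
     where
     k' = 2 ^ r
     instance
      k'≢0 : NonZero k'
      k'≢0 = m^n≢0 2 r
     κ = 2 + (r + r)
     m' = D / k'
     w = suc (suc (2 * k') + suc (2 * k')) + κ * 5
     D≤' : D ≤ 2 * (k' * k')
     D≤' = subst (λ k → D ≤ 2 * (k * k)) (sym 2^r≡) D≤
     m'≤ : m' ≤ 2 * k'
     m'≤ = *-cancelʳ-≤ m' (2 * k') k' (≤-trans (m/n*n≤m D k') (≤-trans D≤' (≤-reflexive (sym (*-assoc 2 k' k')))))
     rm≤ : k' * suc m' ≤ D + k'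
     rm≤ = ≤-trans (≤-reflexive (trans (*-comm k' (suc m')) (+-comm k' (m' * k')))) (+-monoˡ-≤ k' (m/n*n≤m D k'))
     D≤rm : D ≤ k' * suc m'
     D≤rm = ≤-trans (≤-reflexive (m≡m%n+[m/n]*n D k')) (≤-trans (+-monoˡ-≤ (m' * k') (<⇒≤ (m%n<n D k'))) (≤-reflexive (*-comm (suc m') k')))
     0<k' : 0 < k'
     0<k' = m^n>0 2 r
     rm<κ : k' * suc m' < 2 ^ κ
     rm<κ = begin-strict
      k' * suc m' ≤⟨ rm≤ ⟩
      D + k' ≤⟨ +-mono-≤ D≤' (m≤m*n k' k') ⟩
      2 * (k' * k') + k' * k' <⟨ m<m+n (2 * (k' * k') + k' * k') (*-mono-≤ 0<k' 0<k') ⟩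
      2 * (k' * k') + k' * k' + k' * k' ≡⟨ four (k' * k') ⟩
      4 * (k' * k') ≡⟨ cong (4 *_) (sym (^-distribˡ-+-* 2 r r)) ⟩
      4 * 2 ^ (r + r) ≡⟨ sym (^-distribˡ-+-* 2 2 (r + r)) ⟩
      2 ^ κ ∎
      where
      open ≤-Reasoning
      four : ∀ a → 2 * a + a + a ≡ 4 * a
      four = solve-∀
     w≥ : suc (suc m' + suc m') + κ * 5 ≤ w
     w≥ = +-monoˡ-≤ (κ * 5) (s≤s (+-mono-≤ (s≤s m'≤) (s≤s m'≤)))
     cost : r * 5 + (k' * suc m' + κ * w) ≤ D + bipartite-cost r
     cost = ≤-trans (+-monoʳ-≤ (r * 5) (+-monoˡ-≤ (κ * w) rm≤)) (≤-reflexive (arrange (r * 5) D k' (κ * w)))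
      where
      arrange : ∀ a b c d → a + (b + c + d) ≡ b + (a + (c + d))
      arrange = solve-∀

   edge-colouring : ∀ ℓ {c E} → c < 2 ^ ℓ → c ≤ k * k → Edges E → (∀ v → load E v ≤ B + c) →
    Colouring E (c + (ℓ * (B + bipartite-cost r) + suc (B + B)))
   edge-colouring zero {zero} c< c≤ edges load≤ = greedy-colouring edges (λ v → ≤-trans (load≤ v) (≤-reflexive (+-identityʳ B)))
   edge-colouring zero {suc _} (s≤s ())
   edge-colouring (suc ℓ) {c} {E} c< c≤ edges load≤ = from (Masking.bipartition G layering edges j t (λ v → ≤-trans (load≤K E v) K≤) t≥)
    where
    W = bipartite-cost r
    c' = ⌊ c /2⌋
    c'+c'≤ : c' + c' ≤ c
    c'+c'≤ = ⌊n/2⌋+⌊n/2⌋≤n c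
    c'≤ : c' ≤ k * k
    c'≤ = ≤-trans (⌊n/2⌋≤n c) c≤
    c'< : c' < 2 ^ ℓ
    c'< = *-cancelˡ-< 2 c' (2 ^ ℓ) (≤-trans (s≤s (≤-trans (≤-reflexive (cong (c' +_) (+-identityʳ c'))) c'+c'≤)) c<)
    cost : B + c' + W + (c' + (ℓ * (B + W) + suc (B + B))) ≤ c + (suc ℓ * (B + W) + suc (B + B))
    cost = ≤-trans (≤-reflexive (arrange B c' W (ℓ * (B + W)) (suc (B + B)))) (+-monoˡ-≤ (B + W + ℓ * (B + W) + suc (B + B)) c'+c'≤)
     where
     arrange : ∀ B c W a b → B + c + W + (c + (a + b)) ≡ c + c + (B + W + a + b)
     arrange = solve-∀
    from : Σ[ x ∈ (Point 𝒳 → Bool) ] Measurability.Meas 𝒳 x × (∀ b v → let n = load (λ d → E d × x (proj₁ (rev d)) ≡ b) v in n + n ≤ load E v + excess) →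
     Colouring E (c + (suc ℓ * (B + W) + suc (B + B)))
    from (x , x-meas , balanced) = colouring-⊆ id cost (colouring-∪ edges cross-bor cross-rev
      (bipartite x-meas (edges-∩ edges cross-bor cross-rev) proj₂ (λ v → ≤-trans (load-mono-at {λ d → E d × Cross d} {λ d → E d × x (proj₁ (rev d)) ≡ not (x v)} v λ (e , ≢) → e , other ≢) (side (not (x v)) v))
       (≤-trans (+-mono-≤ B≤ c'≤) (≤-reflexive (cong (k * k +_) (sym (+-identityʳ (k * k)))))))
      (edge-colouring ℓ c'< c'≤ (edges-∖ edges cross-bor cross-rev) (λ v → ≤-trans (load-mono-at {λ d → E d × ¬ Cross d} {λ d → E d × x (proj₁ (rev d)) ≡ x v} v λ (e , ¬≢) → e , by-contradiction ¬≢) (side (x v) v))))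
     where
     other : ∀ {a b} → a ≢ b → a ≡ not b
     other {true} {true} ≢ = ⊥-elim (≢ refl)
     other {true} {false} ≢ = refl
     other {false} {true} ≢ = refl
     other {false} {false} ≢ = ⊥-elim (≢ refl)
     Cross : Pred Dart 0ℓ
     Cross d = x (proj₁ (rev d)) ≢ x (proj₁ d)
     cross-bor : Bor dartSpace Cross
     cross-bor = label-borel dartSpace {σ = λ d → x (proj₁ d)} (λ a b → b ≢ a) (λ P i → x-meas P) rev-borel
     cross-rev : ∀ {d} → E d → Cross d → Cross (rev d)
     cross-rev {d} _ ≢ eq = ≢ (sym (trans (cong (λ e → x (proj₁ e)) (sym (rev-involutive d))) eq))
     side : ∀ b v → load (λ d → E d × x (proj₁ (rev d)) ≡ b) v ≤ B + c'
     side b v = half-≤ B c (≤-trans (balanced b v) (+-mono-≤ (load≤ v) (≤-reflexive (sym B≡))))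

 -- Partial sums of the exponential series over ℚ

 module ExponentialSums where
  open Data.Rational.Solver.+-*-Solver using (solve; _:+_; _:*_; _:=_; con; :-_)

  opaque
   ι : ℕ → ℚ
   ι n = ℤ.+ n ℚ./ 1

   toℚᵘ-ι : ∀ n → ℚ.toℚᵘ (ι n) ℚᵘ.≃ ℚᵘ.mkℚᵘ (ℤ.+ n) 0
   toℚᵘ-ι n = ℚ.toℚᵘ-fromℚᵘ (ℚᵘ.mkℚᵘ (ℤ.+ n) 0)

   ι-+ : ∀ m n → ι (m + n) ≡ ι m ℚ.+ ι n
   ι-+ m n = ℚ.toℚᵘ-injective (ℚᵘ.≃-trans (toℚᵘ-ι (m + n)) (ℚᵘ.≃-sym (ℚᵘ.≃-trans (ℚ.toℚᵘ-homo-+ (ι m) (ι n))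
    (ℚᵘ.≃-trans (ℚᵘ.+-cong (toℚᵘ-ι m) (toℚᵘ-ι n)) (ℚᵘ.*≡* (cong (ℤ._* ℤ.+ 1) (cong₂ ℤ._+_ (ℤ.*-identityʳ (ℤ.+ m)) (ℤ.*-identityʳ (ℤ.+ n)))))))))

   ι-* : ∀ m n → ι (m * n) ≡ ι m ℚ.* ι n
   ι-* m n = ℚ.toℚᵘ-injective (ℚᵘ.≃-trans (toℚᵘ-ι (m * n)) (ℚᵘ.≃-sym (ℚᵘ.≃-trans (ℚ.toℚᵘ-homo-* (ι m) (ι n))
    (ℚᵘ.≃-trans (ℚᵘ.*-cong (toℚᵘ-ι m) (toℚᵘ-ι n)) (ℚᵘ.*≡* (cong (ℤ._* ℤ.+ 1) (sym (ℤ.pos-* m n))))))))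

   ι-≤ : ∀ {m n} → m ≤ n → ι m ℚ.≤ ι n
   ι-≤ {m} {n} m≤n = ℚ.toℚᵘ-cancel-≤ (ℚᵘ.≤-respˡ-≃ (ℚᵘ.≃-sym (toℚᵘ-ι m)) (ℚᵘ.≤-respʳ-≃ (ℚᵘ.≃-sym (toℚᵘ-ι n))
    (ℚᵘ.*≤* (ℤ.*-monoʳ-≤-nonNeg (ℤ.+ 1) (ℤ.+≤+ m≤n)))))

   ι-≡ : ∀ n → ι n ≡ ℤ.+ n ℚ./ 1
   ι-≡ n = refl

   ι-0 : ι 0 ≡ 0ℚ
   ι-0 = refl

   ι-1 : ι 1 ≡ 1ℚ
   ι-1 = refl

   u : ℕ → ℚ
   u n = (ℤ.+ 1 ℚ./ n !) {{n !≢0}}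

   u-step : ∀ n → ι (suc n) ℚ.* u (suc n) ≡ u n
   u-step n = go (n !) {{n !≢0}} {{suc n !≢0}}
    where
    go : ∀ f {{nz : NonZero f}} {{nz' : NonZero (suc n * f)}} → ι (suc n) ℚ.* (ℤ.+ 1 ℚ./ (suc n * f)) ≡ ℤ.+ 1 ℚ./ f
    go (suc f) = ℚ.toℚᵘ-injective (ℚᵘ.≃-trans (ℚ.toℚᵘ-homo-* (ι (suc n)) (ℤ.+ 1 ℚ./ (suc n * suc f)))
     (ℚᵘ.≃-trans (ℚᵘ.*-cong (toℚᵘ-ι (suc n)) (ℚ.toℚᵘ-fromℚᵘ (ℚᵘ.mkℚᵘ (ℤ.+ 1) (f + n * suc f))))
      (ℚᵘ.≃-trans (ℚᵘ.*≡* (cong ℤ.+_ (eq n f))) (ℚᵘ.≃-sym (ℚ.toℚᵘ-fromℚᵘ (ℚᵘ.mkℚᵘ (ℤ.+ 1) f))))))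
     where
     eq : ∀ n f → suc n * 1 * suc f ≡ 1 * (1 * suc (f + n * suc f))
     eq = solve-∀

   0≤u : ∀ n → 0ℚ ℚ.≤ u n
   0≤u n = ℚ.nonNegative⁻¹ (u n) {{ℚ.normalize-nonNeg 1 (n !) {{n !≢0}}}}

   u-≡ : ∀ n → u n ≡ (ℤ.+ 1 ℚ./ n !) {{n !≢0}}
   u-≡ n = refl

   u-0 : u 0 ≡ 1ℚ
   u-0 = refl

  0<ι1 : 0ℚ ℚ.< ι 1
  0<ι1 = subst (0ℚ ℚ.<_) (sym ι-1) (ℚ.positive⁻¹ 1ℚ)

  ι-cancel-≤ : ∀ {m n} → ι m ℚ.≤ ι n → m ≤ n
  ι-cancel-≤ {m} {n} le = ≮⇒≥ λ n<m → ℚ.<-irrefl refl (ℚ.<-≤-trans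
   (subst (ℚ._< ι 1 ℚ.+ ι n) (ℚ.+-identityˡ (ι n)) (ℚ.+-monoˡ-< (ι n) 0<ι1))
   (ℚ.≤-trans (ℚ.≤-reflexive (sym (ι-+ 1 n))) (ℚ.≤-trans (ι-≤ n<m) le)))

  0≤ι : ∀ n → 0ℚ ℚ.≤ ι n
  0≤ι n = ℚ.≤-trans (ℚ.≤-reflexive (sym ι-0)) (ι-≤ {0} {n} z≤n)

  ≤-mulʳ : ∀ {p q r} → 0ℚ ℚ.≤ r → p ℚ.≤ q → p ℚ.* r ℚ.≤ q ℚ.* r
  ≤-mulʳ {r = r} 0≤r = ℚ.*-monoʳ-≤-nonNeg r {{ℚ.nonNegative 0≤r}}

  ≤-mulˡ : ∀ {p q r} → 0ℚ ℚ.≤ r → p ℚ.≤ q → r ℚ.* p ℚ.≤ r ℚ.* q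
  ≤-mulˡ {r = r} 0≤r = ℚ.*-monoˡ-≤-nonNeg r {{ℚ.nonNegative 0≤r}}

  0≤* : ∀ {p q} → 0ℚ ℚ.≤ p → 0ℚ ℚ.≤ q → 0ℚ ℚ.≤ p ℚ.* q
  0≤* {p} {q} 0≤p 0≤q = subst (ℚ._≤ p ℚ.* q) (ℚ.*-zeroˡ q) (≤-mulʳ 0≤q 0≤p)

  0≤+ : ∀ {p q} → 0ℚ ℚ.≤ p → 0ℚ ℚ.≤ q → 0ℚ ℚ.≤ p ℚ.+ q
  0≤+ 0≤p 0≤q = ℚ.+-mono-≤ 0≤p 0≤q

  pw : ℚ → ℕ → ℚ
  pw x zero = 1ℚ
  pw x (suc n) = x ℚ.* pw x n

  term : ℕ → ℚ → ℚ
  term n x = u n ℚ.* pw x n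

  E : ℚ → ℕ → ℚ
  E x zero = 0ℚ
  E x (suc n) = E x n ℚ.+ term n x

  term-step : ∀ n x → ι (suc n) ℚ.* term (suc n) x ≡ x ℚ.* term n x
  term-step n x = trans (arrange (ι (suc n)) (u (suc n)) x (pw x n)) (trans (cong (ℚ._* (x ℚ.* pw x n)) (u-step n)) (arrange' (u n) x (pw x n)))
   where
   arrange : ∀ a b c d → a ℚ.* (b ℚ.* (c ℚ.* d)) ≡ a ℚ.* b ℚ.* (c ℚ.* d)
   arrange a b c d = sym (ℚ.*-assoc a b (c ℚ.* d))
   arrange' : ∀ a b c → a ℚ.* (b ℚ.* c) ≡ b ℚ.* (a ℚ.* c)
   arrange' = solve 3 (λ a b c → a :* (b :* c) := b :* (a :* c)) refl

  0≤pw : ∀ {x} → 0ℚ ℚ.≤ x → ∀ n → 0ℚ ℚ.≤ pw x n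
  0≤pw 0≤x zero = ℚ.<⇒≤ (ℚ.positive⁻¹ 1ℚ)
  0≤pw 0≤x (suc n) = 0≤* 0≤x (0≤pw 0≤x n)

  0≤term : ∀ {x} → 0ℚ ℚ.≤ x → ∀ n → 0ℚ ℚ.≤ term n x
  0≤term 0≤x n = 0≤* (0≤u n) (0≤pw 0≤x n)

  pw-mono : ∀ {x y} → 0ℚ ℚ.≤ x → x ℚ.≤ y → ∀ n → pw x n ℚ.≤ pw y n
  pw-mono 0≤x x≤y zero = ℚ.≤-refl
  pw-mono 0≤x x≤y (suc n) = ℚ.≤-trans (≤-mulʳ (0≤pw 0≤x n) x≤y) (≤-mulˡ (ℚ.≤-trans 0≤x x≤y) (pw-mono 0≤x x≤y n))

  E-mono : ∀ {x y} → 0ℚ ℚ.≤ x → x ℚ.≤ y → ∀ n → E x n ℚ.≤ E y n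
  E-mono 0≤x x≤y zero = ℚ.≤-refl
  E-mono 0≤x x≤y (suc n) = ℚ.+-mono-≤ (E-mono 0≤x x≤y n) (≤-mulˡ (0≤u n) (pw-mono 0≤x x≤y n))

  E-suc : ∀ {x} → 0ℚ ℚ.≤ x → ∀ n → E x n ℚ.≤ E x (suc n)
  E-suc {x} 0≤x n = subst (ℚ._≤ E x (suc n)) (ℚ.+-identityʳ (E x n)) (ℚ.+-monoʳ-≤ (E x n) (0≤term 0≤x n))

  0≤E : ∀ {x} → 0ℚ ℚ.≤ x → ∀ n → 0ℚ ℚ.≤ E x n
  0≤E 0≤x zero = ℚ.≤-refl
  0≤E 0≤x (suc n) = 0≤+ (0≤E 0≤x n) (0≤term 0≤x n)

  module Product (x y : ℚ) where

   g diag : ℕ → ℕ → ℚ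
   g a b = term a y ℚ.* term b x
   diag a zero = g a zero
   diag a (suc b) = g a (suc b) ℚ.+ diag (suc a) b

   private
    g-x : ∀ a b → ι (suc b) ℚ.* g a (suc b) ≡ x ℚ.* g a b
    g-x a b = trans (swap (ι (suc b)) (term a y) (term (suc b) x)) (trans (cong (term a y ℚ.*_) (term-step b x)) (swap (term a y) x (term b x)))
     where
     swap : ∀ p q r → p ℚ.* (q ℚ.* r) ≡ q ℚ.* (p ℚ.* r)
     swap = solve 3 (λ p q r → p :* (q :* r) := q :* (p :* r)) refl
    g-y : ∀ a b → ι (suc a) ℚ.* g (suc a) b ≡ y ℚ.* g a b
    g-y a b = trans (sym (ℚ.*-assoc (ι (suc a)) (term (suc a) y) (term b x)))
     (trans (cong (ℚ._* term b x) (term-step a y)) (ℚ.*-assoc y (term a y) (term b x)))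

   diag-step : ∀ a b → ι (a + suc b) ℚ.* diag a (suc b) ≡ ι a ℚ.* g a (suc b) ℚ.+ (x ℚ.+ y) ℚ.* diag a b
   diag-step a b = begin
    ι (a + suc b) ℚ.* (g a (suc b) ℚ.+ diag (suc a) b)
     ≡⟨ ℚ.*-distribˡ-+ (ι (a + suc b)) (g a (suc b)) (diag (suc a) b) ⟩
    ι (a + suc b) ℚ.* g a (suc b) ℚ.+ ι (a + suc b) ℚ.* diag (suc a) b
     ≡⟨ cong₂ ℚ._+_ (trans (cong (ℚ._* g a (suc b)) (ι-+ a (suc b))) (trans (ℚ.*-distribʳ-+ (g a (suc b)) (ι a) (ι (suc b)))
        (cong (ι a ℚ.* g a (suc b) ℚ.+_) (g-x a b)))) (rest b) ⟩
    ι a ℚ.* g a (suc b) ℚ.+ x ℚ.* g a b ℚ.+ (y ℚ.* g a b ℚ.+ (x ℚ.+ y) ℚ.* later b)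
     ≡⟨ collect (ι a ℚ.* g a (suc b)) x y (g a b) (later b) ⟩
    ι a ℚ.* g a (suc b) ℚ.+ (x ℚ.+ y) ℚ.* (g a b ℚ.+ later b)
     ≡⟨ cong (λ z → ι a ℚ.* g a (suc b) ℚ.+ (x ℚ.+ y) ℚ.* z) (sym (unfold b)) ⟩
    ι a ℚ.* g a (suc b) ℚ.+ (x ℚ.+ y) ℚ.* diag a b
     ∎
    where
    open ≡-Reasoning
    later : ℕ → ℚ
    later zero = 0ℚ
    later (suc b) = diag (suc a) b
    unfold : ∀ b → diag a b ≡ g a b ℚ.+ later b
    unfold zero = sym (ℚ.+-identityʳ _)
    unfold (suc b) = refl
    rest : ∀ b → ι (a + suc b) ℚ.* diag (suc a) b ≡ y ℚ.* g a b ℚ.+ (x ℚ.+ y) ℚ.* later b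
    rest zero = trans (cong (λ n → ι n ℚ.* g (suc a) 0) (+-comm a 1)) (trans (g-y a 0)
     (sym (trans (cong (y ℚ.* g a 0 ℚ.+_) (ℚ.*-zeroʳ (x ℚ.+ y))) (ℚ.+-identityʳ _))))
    rest (suc b) = trans (cong (λ n → ι n ℚ.* diag (suc a) (suc b)) (+-suc a (suc b)))
     (trans (diag-step (suc a) b) (cong (ℚ._+ (x ℚ.+ y) ℚ.* diag (suc a) b) (g-y a (suc b))))
    collect : ∀ p x y g l → p ℚ.+ x ℚ.* g ℚ.+ (y ℚ.* g ℚ.+ (x ℚ.+ y) ℚ.* l) ≡ p ℚ.+ (x ℚ.+ y) ℚ.* (g ℚ.+ l)
    collect = solve 5 (λ p x y g l → p :+ x :* g :+ (y :* g :+ (x :+ y) :* l) := p :+ (x :+ y) :* (g :+ l)) refl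

   diag-term : ∀ m → diag 0 m ≡ term m (x ℚ.+ y)
   diag-term zero = trans (cong (term 0 y ℚ.*_) (trans (ℚ.*-identityʳ (u 0)) u-0)) (ℚ.*-identityʳ (term 0 y))
   diag-term (suc m) = ι-cancel (begin
    ι (suc m) ℚ.* diag 0 (suc m) ≡⟨ trans (diag-step 0 m) (cong (λ z → z ℚ.* g 0 (suc m) ℚ.+ (x ℚ.+ y) ℚ.* diag 0 m) ι-0) ⟩
    0ℚ ℚ.* g 0 (suc m) ℚ.+ (x ℚ.+ y) ℚ.* diag 0 m ≡⟨ trans (cong (ℚ._+ (x ℚ.+ y) ℚ.* diag 0 m) (ℚ.*-zeroˡ (g 0 (suc m)))) (ℚ.+-identityˡ _) ⟩
    (x ℚ.+ y) ℚ.* diag 0 m ≡⟨ cong ((x ℚ.+ y) ℚ.*_) (diag-term m) ⟩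
    (x ℚ.+ y) ℚ.* term m (x ℚ.+ y) ≡⟨ sym (term-step m (x ℚ.+ y)) ⟩
    ι (suc m) ℚ.* term (suc m) (x ℚ.+ y) ∎)
    where
    open ≡-Reasoning
    positive : ℚ.Positive (ι (suc m))
    positive = ℚ.positive (ℚ.<-≤-trans 0<ι1 (ι-≤ {1} {suc m} (s≤s z≤n)))
    ι-cancel : ∀ {p q} → ι (suc m) ℚ.* p ≡ ι (suc m) ℚ.* q → p ≡ q
    ι-cancel eq = ℚ.≤-antisym (ℚ.*-cancelˡ-≤-pos (ι (suc m)) {{positive}} (ℚ.≤-reflexive eq))
     (ℚ.*-cancelˡ-≤-pos (ι (suc m)) {{positive}} (ℚ.≤-reflexive (sym eq)))

   triangle : ℕ → ℕ → ℚ
   triangle a zero = 0ℚ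
   triangle a (suc n) = term a y ℚ.* E x (suc n) ℚ.+ triangle (suc a) n

   private
    triangle-step : ∀ a n → triangle a (suc n) ≡ triangle a n ℚ.+ diag a n
    triangle-step a zero = trans (ℚ.+-identityʳ _) (trans (cong (term a y ℚ.*_) (ℚ.+-identityˡ (term 0 x))) (sym (ℚ.+-identityˡ _)))
    triangle-step a (suc n) = trans (cong (term a y ℚ.* E x (suc (suc n)) ℚ.+_) (triangle-step (suc a) n))
     (arrange (term a y) (E x (suc n)) (term (suc n) x) (triangle (suc a) n) (diag (suc a) n))
     where
     arrange : ∀ t e s r d → t ℚ.* (e ℚ.+ s) ℚ.+ (r ℚ.+ d) ≡ t ℚ.* e ℚ.+ r ℚ.+ (t ℚ.* s ℚ.+ d)
     arrange = solve 5 (λ t e s r d → t :* (e :+ s) :+ (r :+ d) := t :* e :+ r :+ (t :* s :+ d)) refl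

   triangle-E : ∀ n → triangle 0 n ≡ E (x ℚ.+ y) n
   triangle-E zero = refl
   triangle-E (suc n) = trans (triangle-step 0 n) (cong₂ ℚ._+_ (triangle-E n) (diag-term n))

  private
   0≤1 : 0ℚ ℚ.≤ ι 1
   0≤1 = 0≤ι 1

   ι2* : ∀ p → ι 2 ℚ.* p ≡ p ℚ.+ p
   ι2* p = trans (cong (ℚ._* p) (trans (ι-+ 1 1) (cong₂ ℚ._+_ ι-1 ι-1))) (trans (ℚ.*-distribʳ-+ p 1ℚ 1ℚ) (cong₂ ℚ._+_ (ℚ.*-identityˡ p) (ℚ.*-identityˡ p)))

   term-0 : ∀ x → term 0 x ≡ 1ℚ
   term-0 x = trans (ℚ.*-identityʳ (u 0)) u-0

   term-halves : ∀ {y L} → 0ℚ ℚ.≤ y → y ℚ.≤ ι L → ∀ a → 1 ≤ L → L + L ≤ suc a → term (suc a) y ℚ.+ term (suc a) y ℚ.≤ term a y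
   term-halves {y} {L} 0≤y y≤L a 1≤L 2L≤ = ℚ.*-cancelˡ-≤-pos (ι L) {{ℚ.positive (ℚ.<-≤-trans 0<ι1 (ι-≤ 1≤L))}} (begin
    ι L ℚ.* (t ℚ.+ t) ≡⟨ double (ι L) t ⟩
    (ι L ℚ.+ ι L) ℚ.* t ≡⟨ cong (ℚ._* t) (sym (ι-+ L L)) ⟩
    ι (L + L) ℚ.* t ≤⟨ ≤-mulʳ (0≤term 0≤y (suc a)) (ι-≤ 2L≤) ⟩
    ι (suc a) ℚ.* t ≡⟨ term-step a y ⟩
    y ℚ.* term a y ≤⟨ ≤-mulʳ (0≤term 0≤y a) y≤L ⟩
    ι L ℚ.* term a y ∎)
    where
    open ℚ.≤-Reasoning
    t = term (suc a) y
    double : ∀ l t → l ℚ.* (t ℚ.+ t) ≡ (l ℚ.+ l) ℚ.* t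
    double = solve 2 (λ l t → l :* (t :+ t) := (l :+ l) :* t) refl

  module _ {x : ℚ} (0≤x : 0ℚ ℚ.≤ x) where
   open Product x (ι 1)

   private
    tail≤ : ∀ a n → triangle (suc a) n ℚ.≤ term (suc a) (ι 1) ℚ.* E x n ℚ.+ term (suc a) (ι 1) ℚ.* E x n
    tail≤ a zero = 0≤+ z z
     where
     z = 0≤* (0≤term 0≤1 (suc a)) (ℚ.≤-refl {0ℚ})
    tail≤ a (suc n) = ℚ.+-monoʳ-≤ (t ℚ.* E x (suc n)) (begin
     triangle (suc (suc a)) n ≤⟨ tail≤ (suc a) n ⟩
     t' ℚ.* E x n ℚ.+ t' ℚ.* E x n ≡⟨ sym (ℚ.*-distribʳ-+ (E x n) t' t') ⟩
     (t' ℚ.+ t') ℚ.* E x n ≤⟨ ≤-mulʳ (0≤E 0≤x n) (term-halves {L = 1} 0≤1 ℚ.≤-refl (suc a) (s≤s z≤n) (s≤s (s≤s z≤n))) ⟩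
     t ℚ.* E x n ≤⟨ ≤-mulˡ (0≤term 0≤1 (suc a)) (E-suc 0≤x n) ⟩
     t ℚ.* E x (suc n) ∎)
     where
     open ℚ.≤-Reasoning
     t = term (suc a) (ι 1)
     t' = term (suc (suc a)) (ι 1)

    term-1 : term 1 (ι 1) ≡ 1ℚ
    term-1 = trans (sym (ℚ.*-identityˡ _)) (trans (cong (ℚ._* term 1 (ι 1)) (sym ι-1))
     (trans (term-step 0 (ι 1)) (trans (cong₂ ℚ._*_ ι-1 (term-0 (ι 1))) (ℚ.*-identityʳ 1ℚ))))

   E-plus-1 : ∀ n → E (x ℚ.+ ι 1) n ℚ.≤ ι 4 ℚ.* E x n
   E-plus-1 zero = ℚ.≤-reflexive (sym (ℚ.*-zeroʳ (ι 4)))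
   E-plus-1 (suc n) = begin
    E (x ℚ.+ ι 1) (suc n) ≡⟨ sym (triangle-E (suc n)) ⟩
    term 0 (ι 1) ℚ.* e ℚ.+ triangle 1 n ≤⟨ ℚ.+-mono-≤ (ℚ.≤-reflexive (trans (cong (ℚ._* e) (term-0 (ι 1))) (ℚ.*-identityˡ e)))
                                  (ℚ.≤-trans (tail≤ 0 n) (ℚ.≤-reflexive (cong₂ ℚ._+_ one one))) ⟩
    e ℚ.+ (E x n ℚ.+ E x n) ≤⟨ ℚ.+-mono-≤ (ℚ.≤-trans (ℚ.≤-reflexive (sym (ℚ.+-identityʳ e))) (ℚ.+-monoʳ-≤ e (0≤E 0≤x (suc n))))
                                  (ℚ.+-mono-≤ (E-suc 0≤x n) (E-suc 0≤x n)) ⟩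
    (e ℚ.+ e) ℚ.+ (e ℚ.+ e) ≡⟨ sym (trans (cong (ℚ._* e) (ι-* 2 2)) (trans (ℚ.*-assoc (ι 2) (ι 2) e) (trans (ι2* (ι 2 ℚ.* e)) (cong₂ ℚ._+_ (ι2* e) (ι2* e))))) ⟩
    ι 4 ℚ.* e ∎
    where
    open ℚ.≤-Reasoning
    e = E x (suc n)
    one : term 1 (ι 1) ℚ.* E x n ≡ E x n
    one = trans (cong (ℚ._* E x n) term-1) (ℚ.*-identityˡ (E x n))

  E-0≤1 : ∀ n → E 0ℚ n ℚ.≤ 1ℚ
  E-0≤1 zero = ℚ.<⇒≤ (ℚ.positive⁻¹ 1ℚ)
  E-0≤1 (suc n) = ℚ.≤-reflexive (E-0 n)
   where
   E-0 : ∀ n → E 0ℚ (suc n) ≡ 1ℚ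
   E-0 zero = trans (ℚ.+-identityˡ _) (term-0 0ℚ)
   E-0 (suc n) = trans (cong₂ ℚ._+_ (E-0 n) (trans (cong (u (suc n) ℚ.*_) (ℚ.*-zeroˡ (pw 0ℚ n))) (ℚ.*-zeroʳ (u (suc n))))) (ℚ.+-identityʳ 1ℚ)

  E-≤-4^ : ∀ i {x} → 0ℚ ℚ.≤ x → x ℚ.≤ ι i → ∀ n → E x n ℚ.≤ ι (4 ^ i)
  E-≤-4^ i 0≤x x≤i n = ℚ.≤-trans (E-mono 0≤x x≤i n) (natural i)
   where
   natural : ∀ i → E (ι i) n ℚ.≤ ι (4 ^ i)
   natural zero = subst₂ (λ p q → E p n ℚ.≤ q) (sym ι-0) (sym ι-1) (E-0≤1 n)
   natural (suc i) = ℚ.≤-trans (ℚ.≤-reflexive (cong (λ z → E z n) (trans (cong ι (+-comm 1 i)) (ι-+ i 1))))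
    (ℚ.≤-trans (E-plus-1 (0≤ι i) n) (ℚ.≤-trans (≤-mulˡ (0≤ι 4) (natural i)) (ℚ.≤-reflexive (sym (ι-* 4 (4 ^ i))))))

  ∣E∣≤ : ∀ x n → ℚ.∣ E x n ∣ ℚ.≤ E ℚ.∣ x ∣ n
  ∣E∣≤ x zero = ℚ.≤-refl
  ∣E∣≤ x (suc n) = ℚ.≤-trans (ℚ.∣p+q∣≤∣p∣+∣q∣ (E x n) (term n x)) (ℚ.+-mono-≤ (∣E∣≤ x n) (ℚ.≤-reflexive
   (trans (ℚ.∣p*q∣≡∣p∣*∣q∣ (u n) (pw x n)) (cong₂ ℚ._*_ (ℚ.0≤p⇒∣p∣≡p (0≤u n)) (∣pw∣ n)))))
   where
   ∣pw∣ : ∀ n → ℚ.∣ pw x n ∣ ≡ pw ℚ.∣ x ∣ n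
   ∣pw∣ zero = refl
   ∣pw∣ (suc n) = trans (ℚ.∣p*q∣≡∣p∣*∣q∣ x (pw x n)) (cong (ℚ.∣ x ∣ ℚ.*_) (∣pw∣ n))

  -∣∣≤ : ∀ p → ℚ.- ℚ.∣ p ∣ ℚ.≤ p
  -∣∣≤ p = [ (λ eq → ℚ.≤-trans (ℚ.neg-antimono-≤ (ℚ.0≤∣p∣ p)) (subst (0ℚ ℚ.≤_) eq (ℚ.0≤∣p∣ p))) ,
   (λ eq → ℚ.≤-reflexive (trans (cong ℚ.-_ eq) (neg-neg p))) ]′ (ℚ.∣p∣≡p∨∣p∣≡-p p)
   where
   neg-neg : ∀ p → ℚ.- (ℚ.- p) ≡ p
   neg-neg = solve 1 (λ p → :- (:- p) := p) refl

  -- For x < 0 the exponential sums cannot all stay above 2, as their Cauchy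
  -- product with the sums at − x is 1.
  module _ {x : ℚ} {L : ℕ} (1≤L : 1 ≤ L) (x≤0 : x ℚ.≤ 0ℚ) (-L≤x : ℚ.- x ℚ.≤ ι L) (p : ℕ) where
   private
    y = ℚ.- x
    C = 4 ^ L
    k = p * (C * C)
    A = L + L + k

    0≤y : 0ℚ ℚ.≤ y
    0≤y = ℚ.neg-antimono-≤ x≤0

    ∣x∣≡y : ℚ.∣ x ∣ ≡ y
    ∣x∣≡y = trans (sym (ℚ.∣-p∣≡∣p∣ x)) (ℚ.0≤p⇒∣p∣≡p 0≤y)

    -C≤E : ∀ n → ℚ.- ι C ℚ.≤ E x n
    -C≤E n = ℚ.≤-trans (ℚ.neg-antimono-≤ (ℚ.≤-trans (∣E∣≤ x n) (subst (λ z → E z n ℚ.≤ ι C) (sym ∣x∣≡y) (E-≤-4^ L 0≤y -L≤x n)))) (-∣∣≤ (E x n))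

    term≤C : ∀ a → term a y ℚ.≤ ι C
    term≤C a = ℚ.≤-trans (ℚ.≤-trans (ℚ.≤-reflexive (sym (ℚ.+-identityˡ (term a y)))) (ℚ.+-monoˡ-≤ (term a y) (0≤E 0≤y a)))
     (E-≤-4^ L 0≤y -L≤x (suc a))

    term-small : ∀ k a → L + L + k ≤ a → ι (2 ^ k) ℚ.* term a y ℚ.≤ ι C
    term-small zero a le = ℚ.≤-trans (ℚ.≤-reflexive (trans (cong (ℚ._* term a y) ι-1) (ℚ.*-identityˡ (term a y)))) (term≤C a)
    term-small (suc k) zero le = ⊥-elim (n≮0 (subst (_≤ 0) (+-suc (L + L) k) le))
    term-small (suc k) (suc a) le = ℚ.≤-trans (ℚ.≤-reflexive (trans (cong (ℚ._* term (suc a) y) (trans (cong ι (*-comm 2 (2 ^ k))) (ι-* (2 ^ k) 2)))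
      (trans (ℚ.*-assoc (ι (2 ^ k)) (ι 2) (term (suc a) y)) (cong (ι (2 ^ k) ℚ.*_) (ι2* (term (suc a) y))))))
     (ℚ.≤-trans (≤-mulˡ (0≤ι (2 ^ k)) (term-halves 0≤y -L≤x a 1≤L (≤-trans (m≤m+n (L + L) (suc k)) le)))
      (term-small k a (≤-pred (≤-trans (≤-reflexive (sym (+-suc (L + L) k))) le))))

    open Product x y

    P = ι (2 ^ k)

    unfold : ∀ a n → P ℚ.* triangle a (suc n) ≡ P ℚ.* term a y ℚ.* E x (suc n) ℚ.+ P ℚ.* triangle (suc a) n
    unfold a n = trans (ℚ.*-distribˡ-+ P (term a y ℚ.* E x (suc n)) (triangle (suc a) n)) (cong (ℚ._+ P ℚ.* triangle (suc a) n) (sym (ℚ.*-assoc P (term a y) (E x (suc n)))))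

    far : ∀ n a → A ≤ a → ℚ.- ι (n * (C * C)) ℚ.≤ P ℚ.* triangle a n
    far zero a le = ℚ.≤-reflexive (trans (cong ℚ.-_ ι-0) (sym (ℚ.*-zeroʳ P)))
    far (suc n) a le = ℚ.≤-trans (ℚ.≤-reflexive (trans (cong ℚ.-_ (ι-+ (C * C) (n * (C * C)))) (ℚ.neg-distrib-+ (ι (C * C)) (ι (n * (C * C))))))
     (subst (ℚ.- ι (C * C) ℚ.+ ℚ.- ι (n * (C * C)) ℚ.≤_) (sym (unfold a n)) (ℚ.+-mono-≤ summand (far n (suc a) (m≤n⇒m≤1+n le))))
     where
     summand : ℚ.- ι (C * C) ℚ.≤ P ℚ.* term a y ℚ.* E x (suc n)
     summand = ℚ.≤-trans (ℚ.≤-trans (ℚ.≤-reflexive (trans (cong ℚ.-_ (ι-* C C)) (ℚ.neg-distribˡ-* (ι C) (ι C))))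
       (ℚ.≤-trans (ℚ.≤-reflexive (trans (sym (ℚ.neg-distribˡ-* (ι C) (ι C))) (ℚ.neg-distribʳ-* (ι C) (ι C))))
        (≤-neg (term-small k a le))))
      (≤-mulˡ (0≤* (0≤ι (2 ^ k)) (0≤term 0≤y a)) (-C≤E (suc n)))
      where
      ≤-neg : ∀ {q} → q ℚ.≤ ι C → ι C ℚ.* ℚ.- ι C ℚ.≤ q ℚ.* ℚ.- ι C
      ≤-neg {q} le = subst₂ ℚ._≤_ (ℚ.neg-distribʳ-* (ι C) (ι C)) (ℚ.neg-distribʳ-* q (ι C)) (ℚ.neg-antimono-≤ (≤-mulʳ (0≤ι C) le))

   negative-impossible : (∀ n → p ≤ n → n ≤ p + suc A → ι 2 ℚ.≤ E x n) → ⊥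
   negative-impossible large = ℚ.<-irrefl refl (ℚ.<-≤-trans too-small (ℚ.≤-trans lower upper))
    where
    k<2^k : ∀ k → k < 2 ^ k
    k<2^k zero = s≤s z≤n
    k<2^k (suc k) = +-mono-≤ (≤-trans (s≤s z≤n) (k<2^k k)) (≤-trans (k<2^k k) (m≤m+n (2 ^ k) 0))
    near : ∀ d a → a + d ≡ suc A → ℚ.- ι k ℚ.≤ P ℚ.* triangle a (d + p)
    near zero a eq = far p a (≤-trans (n≤1+n A) (≤-reflexive (sym (trans (sym (+-identityʳ a)) eq))))
    near (suc d) a eq = ℚ.≤-trans (near d (suc a) (trans (sym (+-suc a d)) eq))
     (subst (P ℚ.* triangle (suc a) (d + p) ℚ.≤_) (sym (unfold a (d + p)))
      (ℚ.≤-trans (ℚ.≤-reflexive (sym (ℚ.+-identityˡ _))) (ℚ.+-monoˡ-≤ _ (0≤* (0≤* (0≤ι (2 ^ k)) (0≤term 0≤y a))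
       (ℚ.≤-trans (0≤ι 2) (large (suc (d + p)) (≤-trans (m≤n+m p d) (n≤1+n _))
        (≤-trans (≤-reflexive (trans (sym (+-suc d p)) (trans (+-suc d p) (+-comm (suc d) p)))) (+-monoʳ-≤ p (≤-trans (m≤n+m (suc d) a) (≤-reflexive eq))))))))))
    q = A + p
    lower : P ℚ.* ι 2 ℚ.+ ℚ.- ι k ℚ.≤ P ℚ.* triangle 0 (suc q)
    lower = subst (P ℚ.* ι 2 ℚ.+ ℚ.- ι k ℚ.≤_) (sym (unfold 0 q)) (ℚ.+-mono-≤
     (subst (P ℚ.* ι 2 ℚ.≤_) (cong (ℚ._* E x (suc q)) (trans (sym (ℚ.*-identityʳ P)) (cong (P ℚ.*_) (sym (term-0 y)))))
      (≤-mulˡ (0≤ι (2 ^ k)) (large (suc q) (≤-trans (m≤n+m p A) (n≤1+n q)) (≤-reflexive (+-comm (suc A) p)))))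
     (near A 1 refl))
    upper : P ℚ.* triangle 0 (suc q) ℚ.≤ P
    upper = ℚ.≤-trans (≤-mulˡ (0≤ι (2 ^ k)) (ℚ.≤-trans (ℚ.≤-reflexive (trans (triangle-E (suc q)) (cong (λ z → E z (suc q)) (ℚ.+-inverseʳ x)))) (E-0≤1 (suc q))))
     (ℚ.≤-reflexive (ℚ.*-identityʳ P))
    too-small : P ℚ.< P ℚ.* ι 2 ℚ.+ ℚ.- ι k
    too-small = subst₂ ℚ._<_ (cancel P (ι k)) (cong (ℚ._+ ℚ.- ι k) (sym (trans (ℚ.*-comm P (ι 2)) (ι2* P))))
     (ℚ.+-monoˡ-< (ℚ.- ι k) (ℚ.+-monoʳ-< P (ℚ.<-≤-trans (subst (ℚ._< ι 1 ℚ.+ ι k) (ℚ.+-identityˡ (ι k)) (ℚ.+-monoˡ-< (ι k) 0<ι1))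
      (ℚ.≤-trans (ℚ.≤-reflexive (sym (ι-+ 1 k))) (ι-≤ (k<2^k k))))))
     where
     cancel : ∀ p q → p ℚ.+ q ℚ.+ ℚ.- q ≡ p
     cancel = solve 2 (λ p q → p :+ q :+ :- q := p) refl

  open ℝ

  natural-bound : ∀ p → ∃[ n ] p ℚ.≤ ι n
  natural-bound p@(ℚ.mkℚ (ℤ.+ a) d c) = a , ℚ.toℚᵘ-cancel-≤ (ℚᵘ.≤-respʳ-≃ (ℚᵘ.≃-sym (toℚᵘ-ι a))
   (ℚᵘ.*≤* (ℤ.*-monoˡ-≤-nonNeg (ℤ.+ a) (ℤ.+≤+ (s≤s z≤n)))))
  natural-bound (ℚ.mkℚ ℤ.-[1+ a ] d c) = 0 , ℚ.≤-trans (ℚ.*≤* ℤ.-≤+) (0≤ι 0)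

  approx-E : ∀ l n m → approx (expPartialSum l n) m ≡ E (approx l m) n
  approx-E l zero m = refl
  approx-E l (suc n) m = cong₂ ℚ._+_ (approx-E l n m) (cong₂ ℚ._*_ (sym (u-≡ n)) (approx-^ n))
   where
   approx-^ : ∀ n → approx (l ^ᵣ n) m ≡ pw (approx l m) n
   approx-^ zero = refl
   approx-^ (suc n) = cong (approx l m ℚ.*_) (approx-^ n)

  Eventually : (ℕ → Set) → Set
  Eventually P = ∃[ N ] (∀ n → N ≤ n → P n)

  eventually-× : ∀ {P Q} → Eventually P → Eventually Q → Eventually (λ n → P n × Q n)
  eventually-× (M , p) (N , q) = M ⊔ N , λ n ≤n → p n (m⊔n≤o⇒m≤o M N ≤n) , q n (m⊔n≤o⇒n≤o M N ≤n)

  eventually-range : ∀ {P : ℕ → ℕ → Set} p → (∀ n → p ≤ n → Eventually (P n)) → ∀ N → Eventually (λ m → ∀ n → p ≤ n → n ≤ N → P n m)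
  eventually-range {P} p ev zero = [ (λ p≤ → let M , h = ev 0 p≤ in M , λ { m M≤ zero _ _ → h m M≤ ; m _ (suc n) _ () }) ,
   (λ p≰ → 0 , λ { m _ zero p≤ _ → ⊥-elim (p≰ p≤) ; m _ (suc n) _ () }) ]′ (toSum (dec (p ≤ 0)))
  eventually-range {P} p ev (suc N) with eventually-range p ev N | dec (p ≤ suc N)
  ... | M , h | yes p≤ = let M' , h' = ev (suc N) p≤ in M ⊔ M' , λ m ≤m n p≤n n≤ →
   [ (λ n< → h m (m⊔n≤o⇒m≤o M M' ≤m) n p≤n (≤-pred n<)) , (λ { refl → h' m (m⊔n≤o⇒n≤o M M' ≤m) }) ]′ (m≤n⇒m<n∨m≡n n≤)
  ... | M , h | no p≰ = M , λ m ≤m n p≤n n≤ →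
   [ (λ n< → h m ≤m n p≤n (≤-pred n<)) , (λ { refl → ⊥-elim (p≰ p≤n) }) ]′ (m≤n⇒m<n∨m≡n n≤)

  0<1ℚ : 0ℚ ℚ.< 1ℚ
  0<1ℚ = ℚ.positive⁻¹ 1ℚ

  sqrt-lower : ∀ s {Δ h} → 1 ≤ h → 4 * (h * h) ≤ Δ → s IsSqrtOf fromℕ Δ → Eventually (λ n → ι h ℚ.≤ approx s n)
  sqrt-lower s {Δ} {h} 1≤h 4h²≤Δ (0≤s , _ , Δ≤s²) = let N , both = eventually-× (0≤s 1ℚ 0<1ℚ) (Δ≤s² 1ℚ 0<1ℚ) in
   N , λ n N≤n → large n (both n N≤n)
   where
   large : ∀ n → 0ℚ ℚ.≤ approx s n ℚ.+ 1ℚ × ℤ.+ Δ ℚ./ 1 ℚ.≤ approx s n ℚ.* approx s n ℚ.+ 1ℚ → ι h ℚ.≤ approx s n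
   large n (0≤sₙ+1 , Δ≤) = ℚ.≮⇒≥ λ sₙ<h → <⇒≱ 4h²> (≤-trans 4h²≤Δ (ι-cancel-≤ (begin
    ι Δ ≡⟨ ι-≡ Δ ⟩
    ℤ.+ Δ ℚ./ 1 ≤⟨ Δ≤ ⟩
    sₙ ℚ.* sₙ ℚ.+ 1ℚ ≤⟨ ℚ.+-monoˡ-≤ 1ℚ (square sₙ<h) ⟩
    ι h ℚ.* ι h ℚ.+ 1ℚ ≡⟨ cong₂ ℚ._+_ (sym (ι-* h h)) (sym ι-1) ⟩
    ι (h * h) ℚ.+ ι 1 ≡⟨ sym (ι-+ (h * h) 1) ⟩
    ι (h * h + 1) ∎)))
    where
    open ℚ.≤-Reasoning
    sₙ = approx s n
    4h²> : h * h + 1 < 4 * (h * h)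
    4h²> = ≤-trans (≤-reflexive (sym (+-suc (h * h) 1))) (+-monoʳ-≤ (h * h) (+-mono-≤ 1≤h² (≤-trans 1≤h² (m≤m+n (h * h) (h * h + 0)))))
     where
     1≤h² : 1 ≤ h * h
     1≤h² = *-mono-≤ 1≤h 1≤h
    square : sₙ ℚ.< ι h → sₙ ℚ.* sₙ ℚ.≤ ι h ℚ.* ι h
    square sₙ<h = subst₂ ℚ._≤_ (ℚ.+-identityˡ _) (difference (ι h) sₙ) (ℚ.+-monoˡ-≤ (sₙ ℚ.* sₙ) (0≤* 0≤h-s 0≤h+s))
     where
     0≤h-s : 0ℚ ℚ.≤ ι h ℚ.- sₙ
     0≤h-s = subst (ℚ._≤ ι h ℚ.- sₙ) (ℚ.+-inverseʳ sₙ) (ℚ.+-monoˡ-≤ (ℚ.- sₙ) (ℚ.<⇒≤ sₙ<h))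
     0≤h+s : 0ℚ ℚ.≤ ι h ℚ.+ sₙ
     0≤h+s = ℚ.≤-trans 0≤sₙ+1 (ℚ.≤-trans (ℚ.≤-reflexive (ℚ.+-comm sₙ 1ℚ)) (ℚ.+-monoˡ-≤ sₙ (ℚ.≤-trans (ℚ.≤-reflexive (sym ι-1)) (ι-≤ 1≤h))))
     difference : ∀ a b → (a ℚ.+ ℚ.- b) ℚ.* (a ℚ.+ b) ℚ.+ b ℚ.* b ≡ a ℚ.* a
     difference = solve 2 (λ a b → (a :+ :- b) :* (a :+ b) :+ b :* b := a :* a) refl

  log-lower : ∀ l {Δ c} → 4 ^ (c + 2) ≤ Δ → l IsLogOf fromℕ Δ → Eventually (λ n → ι c ℚ.≤ approx l n)
  log-lower l {Δ} {c} 4^≤Δ log with cauchy l 1ℚ 0<1ℚ | log 1ℚ 0<1ℚ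
  ... | M , close | p , sums = [ (λ above → M , λ n M≤n → ℚ.≮⇒≥ λ lₙ<c → above (n , M≤n , lₙ<c)) , (λ (n , M≤n , lₙ<c) → ⊥-elim (refute n M≤n lₙ<c)) ]′
    (Sum.swap (toSum (dec (∃[ n ] M ≤ n × approx l n ℚ.< ι c))))
   where
   L = proj₁ (natural-bound (ℚ.∣ approx l M ∣ ℚ.+ 1ℚ))
   large : ∀ n → p ≤ n → Eventually (λ m → ι Δ ℚ.≤ E (approx l m) n ℚ.+ ι 2)
   large n p≤n = let N , h = proj₂ (sums n p≤n) 1ℚ 0<1ℚ in N , λ m N≤m → ℚ.≤-trans (ℚ.≤-reflexive (ι-≡ Δ)) (ℚ.≤-trans (h m N≤m)
    (ℚ.≤-reflexive (trans (cong (λ z → z ℚ.+ 1ℚ ℚ.+ 1ℚ) (approx-E l n m)) (trans (ℚ.+-assoc (E (approx l m) n) 1ℚ 1ℚ)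
     (cong (E (approx l m) n ℚ.+_) (trans (cong₂ ℚ._+_ (sym ι-1) (sym ι-1)) (sym (ι-+ 1 1))))))))
   difference : ∀ a b → b ℚ.+ (a ℚ.+ ℚ.- b) ≡ a
   difference = solve 2 (λ a b → b :+ (a :+ :- b) := a) refl
   neg-neg : ∀ p → ℚ.- (ℚ.- p) ≡ p
   neg-neg = solve 1 (λ p → :- (:- p) := p) refl
   p≤∣p∣ : ∀ p → p ℚ.≤ ℚ.∣ p ∣
   p≤∣p∣ p = subst₂ ℚ._≤_ (neg-neg p) (trans (neg-neg _) (ℚ.∣-p∣≡∣p∣ p)) (ℚ.neg-antimono-≤ (-∣∣≤ (ℚ.- p)))
   near : ∀ {m n} → M ≤ m → M ≤ n → approx l m ℚ.≤ approx l n ℚ.+ 1ℚ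
   near {m} {n} ≤m ≤n = subst (ℚ._≤ approx l n ℚ.+ 1ℚ) (difference (approx l m) (approx l n))
    (ℚ.+-monoʳ-≤ (approx l n) (ℚ.≤-trans (p≤∣p∣ _) (close m n ≤m ≤n)))
   lower : ∀ m → M ≤ m → ℚ.- approx l m ℚ.≤ ι (suc L)
   lower m M≤m = ℚ.≤-trans (subst₂ ℚ._≤_ (left (approx l m) (approx l M)) (right (approx l m) (approx l M) 1ℚ)
     (ℚ.+-monoʳ-≤ (ℚ.- approx l m ℚ.+ ℚ.- approx l M) (near ≤-refl M≤m)))
    (ℚ.≤-trans (ℚ.+-monoˡ-≤ 1ℚ (ℚ.≤-trans (p≤∣p∣ (ℚ.- approx l M)) (ℚ.≤-reflexive (ℚ.∣-p∣≡∣p∣ (approx l M)))))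
     (ℚ.≤-trans (proj₂ (natural-bound (ℚ.∣ approx l M ∣ ℚ.+ 1ℚ))) (ι-≤ (n≤1+n L))))
    where
    left : ∀ a b → ℚ.- a ℚ.+ ℚ.- b ℚ.+ b ≡ ℚ.- a
    left = solve 2 (λ a b → :- a :+ :- b :+ b := :- a) refl
    right : ∀ a b o → ℚ.- a ℚ.+ ℚ.- b ℚ.+ (a ℚ.+ o) ≡ ℚ.- b ℚ.+ o
    right = solve 3 (λ a b o → :- a :+ :- b :+ (a :+ o) := :- b :+ o) refl
   horizon = p + suc (suc L + suc L + p * (4 ^ suc L * 4 ^ suc L))
   refute : ∀ n → M ≤ n → approx l n ℚ.< ι c → ⊥
   refute n M≤n lₙ<c = let N , h = eventually-range p large horizon in
    at (M ⊔ N) (m≤m⊔n M N) (h (M ⊔ N) (m≤n⊔m M N))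
    where
    at : ∀ m → M ≤ m → (∀ n → p ≤ n → n ≤ horizon → ι Δ ℚ.≤ E (approx l m) n ℚ.+ ι 2) → ⊥
    at m M≤m big = [ negative , (λ 0≤l → <⇒≱ growth (≤-trans 4^≤Δ (ι-cancel-≤ (ℚ.≤-trans (big p ≤-refl (m≤m+n p _))
      (ℚ.≤-trans (ℚ.+-monoˡ-≤ (ι 2) (E-≤-4^ (c + 1) 0≤l l≤ p)) (ℚ.≤-reflexive (sym (ι-+ (4 ^ (c + 1)) 2)))))))) ]′ (ℚ.≤-total (approx l m) 0ℚ)
     where
     l≤ : approx l m ℚ.≤ ι (c + 1)
     l≤ = ℚ.≤-trans (near M≤m M≤n) (ℚ.≤-trans (ℚ.+-monoˡ-≤ 1ℚ (ℚ.<⇒≤ lₙ<c)) (ℚ.≤-reflexive (trans (cong (ι c ℚ.+_) (sym ι-1)) (sym (ι-+ c 1)))))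
     1≤4^ : 1 ≤ 4 ^ (c + 1)
     1≤4^ = m^n>0 4 (c + 1)
     growth : 4 ^ (c + 1) + 2 < 4 ^ (c + 2)
     growth = ≤-trans (≤-reflexive (sym (+-suc (4 ^ (c + 1)) 2))) (≤-trans
      (+-monoʳ-≤ (4 ^ (c + 1)) (+-mono-≤ 1≤4^ (+-mono-≤ 1≤4^ (≤-trans 1≤4^ (m≤m+n _ 0)))))
      (≤-reflexive (cong (4 ^_) (sym (+-suc c 1)))))
     negative : approx l m ℚ.≤ 0ℚ → ⊥
     negative l≤0 = negative-impossible {approx l m} {suc L} (s≤s z≤n) l≤0 (lower m M≤m) p λ n p≤n n≤ →
      subst₂ ℚ._≤_ (shift (ι 2) (ι 2)) (shift (E (approx l m) n) (ι 2)) (ℚ.+-monoˡ-≤ (ℚ.- ι 2)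
       (ℚ.≤-trans (ℚ.≤-reflexive (sym (ι-+ 2 2))) (ℚ.≤-trans (ι-≤ (≤-trans 4≤4^ 4^≤Δ)) (big n p≤n n≤))))
      where
      shift : ∀ a b → a ℚ.+ b ℚ.+ ℚ.- b ≡ a
      shift = solve 2 (λ a b → a :+ b :+ :- b := a) refl
      4≤4^ : 4 ≤ 4 ^ (c + 2)
      4≤4^ = ^-monoʳ-≤ 4 {1} {c + 2} (≤-trans (s≤s z≤n) (m≤n+m 2 c))

  √*log³-lower : ∀ √Δ logΔ {Δ h c χ} → 1 ≤ h → 4 * (h * h) ≤ Δ → 4 ^ (c + 2) ≤ Δ → √Δ IsSqrtOf fromℕ Δ → logΔ IsLogOf fromℕ Δ →
   χ ≤ Δ + h * (c * (c * c)) → fromℕ χ ≤ᵣ fromℕ Δ +ᵣ √Δ *ᵣ logΔ ^ᵣ 3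
  √*log³-lower s l {Δ} {h} {c} {χ} 1≤h 4h²≤ 4^≤ sqrt log χ≤ ε 0<ε =
   let N , both = eventually-× (sqrt-lower s 1≤h 4h²≤ sqrt) (log-lower l {c = c} 4^≤ log)
   in N , λ n N≤n → let h≤s , c≤l = both n N≤n in ℚ.≤-trans (bound (approx s n) (approx l n) h≤s c≤l)
    (weaken (approx (fromℕ Δ +ᵣ s *ᵣ l ^ᵣ 3) n))
   where
   weaken : ∀ p → p ℚ.≤ p ℚ.+ ε
   weaken p = ℚ.≤-trans (ℚ.≤-reflexive (sym (ℚ.+-identityʳ p))) (ℚ.+-monoʳ-≤ p (ℚ.<⇒≤ 0<ε))
   bound : ∀ s l → ι h ℚ.≤ s → ι c ℚ.≤ l → ℤ.+ χ ℚ./ 1 ℚ.≤ ℤ.+ Δ ℚ./ 1 ℚ.+ s ℚ.* (l ℚ.* (l ℚ.* (l ℚ.* 1ℚ)))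
   bound s l h≤s c≤l = begin
    ℤ.+ χ ℚ./ 1 ≡⟨ sym (ι-≡ χ) ⟩
    ι χ ≤⟨ ι-≤ χ≤ ⟩
    ι (Δ + h * (c * (c * c))) ≡⟨ trans (ι-+ Δ (h * (c * (c * c)))) (cong (ι Δ ℚ.+_) (trans (ι-* h _) (cong (ι h ℚ.*_) (trans (ι-* c _) (cong (ι c ℚ.*_) (ι-* c c)))))) ⟩
    ι Δ ℚ.+ ι h ℚ.* (ι c ℚ.* (ι c ℚ.* ι c)) ≤⟨ ℚ.+-monoʳ-≤ (ι Δ) (*-mono (0≤ι h) h≤s 0≤ccc (*-mono (0≤ι c) c≤l 0≤cc (*-mono (0≤ι c) c≤l (0≤ι c) c≤l))) ⟩
    ι Δ ℚ.+ s ℚ.* (l ℚ.* (l ℚ.* l)) ≡⟨ cong₂ (λ a b → a ℚ.+ s ℚ.* (l ℚ.* (l ℚ.* b))) (ι-≡ Δ) (sym (ℚ.*-identityʳ l)) ⟩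
    ℤ.+ Δ ℚ./ 1 ℚ.+ s ℚ.* (l ℚ.* (l ℚ.* (l ℚ.* 1ℚ))) ∎
    where
    open ℚ.≤-Reasoning
    0≤cc = 0≤* (0≤ι c) (0≤ι c)
    0≤ccc = 0≤* (0≤ι c) 0≤cc
    *-mono : ∀ {a b a' b'} → 0ℚ ℚ.≤ a → a ℚ.≤ a' → 0ℚ ℚ.≤ b → b ℚ.≤ b' → a ℚ.* b ℚ.≤ a' ℚ.* b'
    *-mono 0≤a a≤ 0≤b b≤ = ℚ.≤-trans (≤-mulʳ 0≤b a≤) (≤-mulˡ (ℚ.≤-trans 0≤a a≤) b≤)

 -- Numerical estimates

 between-powers : ∀ n {Δ} → 4 ^ n ≤ Δ → ∃[ m ] n ≤ m × 4 ^ m ≤ Δ × Δ < 4 ^ suc m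
 between-powers n {Δ} 4^n≤Δ = from (least (λ m → Δ < 4 ^ suc m) (Δ , large Δ))
  where
  large : ∀ n → n < 4 ^ suc n
  large zero = s≤s z≤n
  large (suc n) = +-mono-≤ (m^n>0 4 (suc n)) (≤-trans (large n) (m≤m+n (4 ^ suc n) _))
  from : ∃[ m ] Δ < 4 ^ suc m × (∀ m' → Δ < 4 ^ suc m' → m ≤ m') → ∃[ m ] n ≤ m × 4 ^ m ≤ Δ × Δ < 4 ^ suc m
  from (m , Δ< , min) = m , ≮⇒≥ (λ m<n → <⇒≱ Δ< (≤-trans (^-monoʳ-≤ 4 m<n) 4^n≤Δ)) , below m min , Δ<
   where
   below : ∀ m → (∀ m' → Δ < 4 ^ suc m' → m ≤ m') → 4 ^ m ≤ Δ
   below zero min = ≤-trans (m^n>0 4 n) 4^n≤Δ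
   below (suc m) min = ≮⇒≥ λ lt → 1+n≰n (min m lt)

 4^≡2^ : ∀ r → 4 ^ r ≡ 2 ^ (r + r)
 4^≡2^ r = trans (^-*-assoc 2 2 r) (cong (2 ^_) (cong (r +_) (+-identityʳ r)))

 linear≤2^ : ∀ d → 72 * (10 + d) + 18 ≤ 2 ^ (10 + d)
 linear≤2^ zero = ≤ᵇ⇒≤ 738 1024 tt
 linear≤2^ (suc d) = begin
  72 * (10 + suc d) + 18 ≡⟨ step d ⟩
  72 * (10 + d) + 18 + 72 ≤⟨ +-mono-≤ (linear≤2^ d) (≤-trans (≤-trans (≤ᵇ⇒≤ 72 738 tt) (m≤n+m 738 (72 * d))) (≤-trans (≤-reflexive (split d)) (≤-trans (linear≤2^ d) (m≤m+n _ 0)))) ⟩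
  2 * 2 ^ (10 + d) ∎
  where
  open ≤-Reasoning
  step : ∀ d → 72 * (10 + suc d) + 18 ≡ 72 * (10 + d) + 18 + 72
  step = solve-∀
  split : ∀ d → 72 * d + 738 ≡ 72 * (10 + d) + 18
  split = solve-∀

 module Estimates (c : ℕ) (c≥ : 6480 ≤ c) where

  r h k : ℕ
  r = c + 3
  h = 2 ^ (c + 1)
  k = 2 ^ r

  k≡4h : k ≡ 4 * h
  k≡4h = trans (cong (2 ^_) (shift c)) (^-distribˡ-+-* 2 2 (c + 1))
   where
   shift : ∀ c → c + 3 ≡ 2 + (c + 1)
   shift = solve-∀

  4h²≡ : 4 * (h * h) ≡ 4 ^ (c + 2)
  4h²≡ = sym (trans (4^≡2^ (c + 2)) (trans (cong (2 ^_) (shift c)) (trans (^-distribˡ-+-* 2 2 (c + 1 + (c + 1))) (cong (4 *_) (^-distribˡ-+-* 2 (c + 1) (c + 1))))))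
   where
   shift : ∀ c → c + 2 + (c + 2) ≡ 2 + (c + 1 + (c + 1))
   shift = solve-∀

  linear≤k : 72 * r + 18 ≤ k
  linear≤k = subst (λ r → 72 * r + 18 ≤ 2 ^ r) eq (linear≤2^ (c ∸ 7))
   where
   eq : 10 + (c ∸ 7) ≡ r
   eq = trans (+-assoc 3 7 (c ∸ 7)) (trans (cong (3 +_) (m+[n∸m]≡n (≤-trans (≤ᵇ⇒≤ 7 6480 tt) c≥))) (+-comm 3 c))

  B : ℕ
  B = k * (6 * (2 * (r + r)) + 6) + k * (6 * (2 * (r + r)) + 6) + k * (6 * (2 * (r + r)) + 6)

  B≡ : B ≡ k * (72 * r + 18)
  B≡ = eq k r
   where
   eq : ∀ k r → k * (6 * (2 * (r + r)) + 6) + k * (6 * (2 * (r + r)) + 6) + k * (6 * (2 * (r + r)) + 6) ≡ k * (72 * r + 18)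
   eq = solve-∀

  B≤ : B ≤ k * k
  B≤ = ≤-trans (≤-reflexive B≡) (*-monoʳ-≤ k linear≤k)

  private
   10r+13≤k : 10 * r + 13 ≤ k
   10r+13≤k = ≤-trans (≤-trans (m≤m+n (10 * r + 13) (62 * r + 5)) (≤-reflexive (eq r))) linear≤k
    where
    eq : ∀ r → 10 * r + 13 + (62 * r + 5) ≡ 72 * r + 18
    eq = solve-∀

   r5≤k : r * 5 ≤ k
   r5≤k = ≤-trans (≤-trans (m≤m+n (r * 5) (5 * r + 13)) (≤-reflexive (eq r))) 10r+13≤k
    where
    eq : ∀ r → r * 5 + (5 * r + 13) ≡ 10 * r + 13
    eq = solve-∀

   cost≤ : bipartite-cost r ≤ k * (12 + 10 * r)
   cost≤ = begin
    r * 5 + (k + (2 + (r + r)) * (suc (suc (2 * k) + suc (2 * k)) + (2 + (r + r)) * 5))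
     ≡⟨ cong (λ z → r * 5 + (k + (2 + (r + r)) * z)) (inner k r) ⟩
    r * 5 + (k + (2 + (r + r)) * (4 * k + (10 * r + 13)))
     ≤⟨ +-mono-≤ r5≤k (+-monoʳ-≤ k (*-monoʳ-≤ (2 + (r + r)) (+-monoʳ-≤ (4 * k) 10r+13≤k))) ⟩
    k + (k + (2 + (r + r)) * (4 * k + k))
     ≡⟨ outer k r ⟩
    k * (12 + 10 * r)
     ∎
    where
    open ≤-Reasoning
    inner : ∀ k r → suc (suc (2 * k) + suc (2 * k)) + (2 + (r + r)) * 5 ≡ 4 * k + (10 * r + 13)
    inner = solve-∀
    outer : ∀ k r → k + (k + (2 + (r + r)) * (4 * k + k)) ≡ k * (12 + 10 * r)
    outer = solve-∀

   1≤r : 1 ≤ r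
   1≤r = ≤-trans (s≤s z≤n) (m≤n+m 3 c)

   1≤k : 1 ≤ k
   1≤k = m^n>0 2 r

   r≤2c : r ≤ 2 * c
   r≤2c = +-monoʳ-≤ c (≤-trans (≤-trans (≤ᵇ⇒≤ 3 6480 tt) c≥) (m≤m+n c 0))

  cost : (r + r) * (B + bipartite-cost r) + suc (B + B) ≤ h * (c * (c * c))
  cost = begin
   (r + r) * (B + bipartite-cost r) + suc (B + B)
    ≤⟨ +-mono-≤ (*-monoʳ-≤ (r + r) (+-mono-≤ (≤-reflexive B≡) cost≤)) (+-mono-≤ 1≤k (≤-reflexive (cong₂ _+_ B≡ B≡))) ⟩
   (r + r) * (k * (72 * r + 18) + k * (12 + 10 * r)) + (k + (k * (72 * r + 18) + k * (72 * r + 18)))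
    ≡⟨ expand k r ⟩
   k * (164 * (r * r) + 204 * r + 37)
    ≤⟨ *-monoʳ-≤ k (+-mono-≤ (+-monoʳ-≤ (164 * (r * r)) (*-monoʳ-≤ 204 (m≤m*n r r {{>-nonZero 1≤r}}))) (*-monoʳ-≤ 37 (*-mono-≤ 1≤r 1≤r))) ⟩
   k * (164 * (r * r) + 204 * (r * r) + 37 * (r * r))
    ≤⟨ ≤-reflexive (trans (cong (_* (164 * (r * r) + 204 * (r * r) + 37 * (r * r))) k≡4h) (collect h (r * r))) ⟩
   h * (1620 * (r * r))
    ≤⟨ *-monoʳ-≤ h (*-monoʳ-≤ 1620 (*-mono-≤ r≤2c r≤2c)) ⟩
   h * (1620 * (2 * c * (2 * c)))
    ≡⟨ cong (h *_) (square c) ⟩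
   h * (6480 * (c * c))
    ≤⟨ *-monoʳ-≤ h (*-monoˡ-≤ (c * c) c≥) ⟩
   h * (c * (c * c))
    ∎
   where
   open ≤-Reasoning
   expand : ∀ k r → (r + r) * (k * (72 * r + 18) + k * (12 + 10 * r)) + (k + (k * (72 * r + 18) + k * (72 * r + 18))) ≡ k * (164 * (r * r) + 204 * r + 37)
   expand = solve-∀
   collect : ∀ h s → 4 * h * (164 * s + 204 * s + 37 * s) ≡ h * (1620 * s)
   collect = solve-∀
   square : ∀ c → 1620 * (2 * c * (2 * c)) ≡ 6480 * (c * c)
   square = solve-∀

 -- Walks and paths

 module _ {V : Set} (G : Graph V) where
  open Graph G

  private
   suffix : ∀ {x y z n} (w : Walk G y z n) → Unique (vertices G w) → x ∈ vertices G w → ∃[ m ] m ≤ n × Path G x z m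
   suffix [] u (here refl) = 0 , z≤n , [] , u
   suffix (e ∷ w) u (here refl) = _ , ≤-refl , e ∷ w , u
   suffix (e ∷ w) (_ ∷ u) (there i) = let m , m≤ , p = suffix w u i in m , m≤n⇒m≤1+n m≤ , p

  walk⇒path : ∀ {x y n} → Walk G x y n → ∃[ m ] m ≤ n × Path G x y m
  walk⇒path [] = 0 , z≤n , [] , [] ∷ []
  walk⇒path {x} (e ∷ w) with walk⇒path w
  ... | m , m≤ , w' , u with dec (x ∈ vertices G w')
  ... | yes x∈ = let m' , m'≤ , p = suffix w' u x∈ in m' , ≤-trans m'≤ (m≤n⇒m≤1+n m≤) , p
  ... | no x∉ = suc m , s≤s m≤ , e ∷ w' , All-tabulate (λ { i refl → x∉ i }) ∷ u

  walk-++ : ∀ {x y z m n} → Walk G x y m → Walk G y z n → Walk G x z (m + n)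
  walk-++ [] w' = w'
  walk-++ (e ∷ w) w' = e ∷ walk-++ w w'

 module Interface (V : StandardBorelSpace) where
  open StandardBorelSpace V
  ρ : PolishMetric Carrier
  ρ = proj₁ standard
  open LusinNovikov ρ
  open PolishMetric ρ using (IsOpen)

  to-borel : ∀ {A} → IsBorel A → σ⟨ IsOpen ⟩ A
  to-borel {A} = Equivalence.to (proj₂ standard A)

  from-borel : ∀ {A} → σ⟨ IsOpen ⟩ A → IsBorel A
  from-borel {A} = Equivalence.from (proj₂ standard A)

  to-square : ∀ {R} → IsBorel² R → σ⟨ Rectangles (Bor polishSpace) ⟩ R
  to-square (generator (A , B , a , b , ⊆ , ⊇)) = generator (A , B , to-borel a , to-borel b , (λ p → ⊆ {p}) , (λ p → ⊇ {p}))
  to-square empty = empty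
  to-square (complement c) = complement (to-square c)
  to-square (union A a) = union A (λ n → to-square (a n))
  to-square (respects eq c) = respects eq (to-square c)

  private
   rectangle : ∀ {A B} → σ⟨ IsOpen ⟩ A → σ⟨ IsOpen ⟩ B → IsBorel² (λ p → A (proj₁ p) × B (proj₂ p))
   rectangle {A} {B} a b = generator (A , B , from-borel a , from-borel b , id , id)

   along₁ : ∀ {A} → σ⟨ IsOpen ⟩ A → IsBorel² (λ p → A (proj₁ p))
   along₁ a = respects (proj₁ , λ p → p , tt) (rectangle a (bor-const polishSpace ⊤))

   along₂ : ∀ {A} → σ⟨ IsOpen ⟩ A → IsBorel² (λ p → A (proj₂ p))
   along₂ a = respects (proj₂ , λ p → tt , p) (rectangle (bor-const polishSpace ⊤) a)

  square : BorelSpace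
  square = record
   { Point = Carrier × Carrier
   ; Bor = IsBorel²
   ; bor-∅ = empty
   ; bor-∁ = complement
   ; bor-∃ℕ = λ A a → respects (id , id) (union A a)
   ; bor-⇔ = λ f g → respects ((λ {p} → f p) , (λ {p} → g p))
   ; sep = λ n → sep² (unpair n)
   ; sep-bor = λ n → sep²-bor (unpair n)
   ; sep-separates = λ {p} {q} p≢q →
     let c , s , ¬s = separated p q p≢q
         n , eq = unpair-surjective (proj₁ c) (proj₂ c)
     in n , subst (λ c → sep² c p) (sym eq) s , (λ s → ¬s (subst (λ c → sep² c q) eq s)) }
   where
   sep² : ℕ × ℕ → Pred (Carrier × Carrier) 0ℓ
   sep² (zero , n) p = sep polishSpace n (proj₁ p)
   sep² (suc _ , n) p = sep polishSpace n (proj₂ p)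
   sep²-bor : ∀ c → IsBorel² (sep² c)
   sep²-bor (zero , n) = along₁ (sep-bor polishSpace n)
   sep²-bor (suc _ , n) = along₂ (sep-bor polishSpace n)
   separated : ∀ p q → p ≢ q → ∃[ c ] sep² c p × ¬ sep² c q
   separated (x , y) (x' , y') ≢ with dec (x ≡ x')
   ... | no x≢x' = let n , s = sep-separates polishSpace x≢x' in (0 , n) , s
   ... | yes refl = let n , s = sep-separates polishSpace (λ e → ≢ (cong (x ,_) e)) in (1 , n) , s

  module _ (G : BorelGraph V) {Δ : ℕ} (degree : HasMaximumDegree (BorelGraph.graph G) Δ) where
   open BorelGraph G
   open Graph graph

   private
    bounded : ∀ {x ys} → Unique ys → All (Adj x) ys → length ys ≤ Δ
    bounded {x} u es with proj₁ degree x
    ... | n , (zs , _ , ∈⇔ , refl) , n≤ = ≤-trans (length-⊆ u λ {y} i → Equivalence.from (∈⇔ y) (All-lookup es i)) n≤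

   Neighbours : Set₁
   Neighbours = Σ[ h ∈ (ℕ → Carrier → Carrier) ] (∀ i → BorelMap polishSpace polishSpace (h i)) × (∀ {x y} → Adj x y → ∃[ i ] i < Δ × h i x ≡ y)
    × (∀ {x} i → h i x ≢ x → Adj x (h i x)) × (∀ {x} i j → h i x ≡ h j x → h i x ≢ x → i ≡ j)

   neighbours : Neighbours
   neighbours = lusin-novikov (to-square adj-borel) Δ bounded

   module _ {h : ℕ → Carrier → Carrier} (h-borel : ∀ i → BorelMap polishSpace polishSpace (h i)) (h-onto : ∀ {x y} → Adj x y → ∃[ i ] i < Δ × h i x ≡ y)
    (h-adj : ∀ {x} i → h i x ≢ x → Adj x (h i x)) (h-injective : ∀ {x} i j → h i x ≡ h j x → h i x ≢ x → i ≡ j) where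

    slots : Slots polishSpace Δ
    slots = record
     { slot = λ i → h (toℕ i)
     ; slot-borel = λ i → h-borel (toℕ i)
     ; slot-injective = λ i j eq m → Finₚ.toℕ-injective (h-injective (toℕ i) (toℕ j) eq m)
     ; slot-back = λ i x → back i x (dec (h (toℕ i) x ≡ x)) }
     where
     back : ∀ i x → Dec (h (toℕ i) x ≡ x) → ∃[ j ] h (toℕ j) (h (toℕ i) x) ≡ x
     back i x (yes eq) = i , trans (cong (h (toℕ i)) eq) eq
     back i x (no m) = let j , j< , eq = h-onto (adj-sym (h-adj (toℕ i) m)) in
      fromℕ< j< , trans (cong (λ n → h n (h (toℕ i) x)) (Finₚ.toℕ-fromℕ< j<)) eq

    open Slots slots

    reach⇒walk : ∀ n {x y} → y ∈ nb (pow n maps) x → ∃[ m ] m ≤ n × Walk graph x y m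
    reach⇒walk zero (here refl) = 0 , z≤n , []
    reach⇒walk (suc n) {x} p with reach-unsnoc n {maps} p
    ... | y , q , r with reach⇒walk n q | maps⁻ r
    ... | m , m≤ , w | inj₁ refl = m , m≤n⇒m≤1+n m≤ , w
    ... | m , m≤ , w | inj₂ (i , refl) = last-step (dec (slot i y ≡ y))
     where
     last-step : Dec (slot i y ≡ y) → ∃[ m ] m ≤ suc n × Walk graph x (slot i y) m
     last-step (yes eq) = m , m≤n⇒m≤1+n m≤ , subst (λ z → Walk graph x z m) (sym eq) w
     last-step (no moved) = m + 1 , ≤-trans (≤-reflexive (+-comm m 1)) (s≤s m≤) , walk-++ graph w (h-adj (toℕ i) moved ∷ [])

    module _ (R : ℕ) {s : ℕ} (separation : BorelSeparation {V} (graph ^ᴳ R) s) where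
     open BorelSeparation separation

     private
      index : Carrier → Fin (suc s)
      index x = proj₁ (partition x)

      x∈U : ∀ x → U (index x) x
      x∈U x = proj₁ (proj₂ (partition x))

      same : Carrier → Carrier → Set
      same x y = toℕ (index x) ≡ toℕ (index y)

      in-U : ∀ {x y} → same x y → U (index x) y
      in-U {x} {y} eq = subst (λ i → U i y) (sym (Finₚ.toℕ-injective eq)) (x∈U y)

     components-finite : FiniteOrbits (map (keep same) (pow R maps))
     components-finite x = map Refinement.value ys , λ y o → collect y (orbit-walk (x∈U x) o)
      where
      i = index x
      H = induced (graph ^ᴳ R) (U i)
      ys = proj₁ (finite i (x ⊩ [ x∈U x ]))
      orbit-walk : ∀ {y z} (u : U i y) → Orb (map (keep same) (pow R maps)) y z → ∃[ n ] Σ[ u' ∈ U i z ] Walk H (y ⊩ [ u ]) (z ⊩ [ u' ]) n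
      orbit-walk u stop = 0 , u , []
      orbit-walk {y} u (_◅_ {j = y'} p o) = step (nb-keep⁻ same p) (dec (y ≡ y'))
       where
       u' : same y y' → U i y'
       u' eq = subst (λ j → U j y') (proj₂ (proj₂ (partition y)) u) (in-U {y} {y'} eq)
       step : (same y y' × y' ∈ nb (pow R maps) y) ⊎ y' ≡ y → Dec (y ≡ y') → ∃[ n ] Σ[ u'' ∈ U i _ ] Walk H (y ⊩ [ u ]) (_ ⊩ [ u'' ]) n
       step _ (yes refl) = orbit-walk u o
       step (inj₂ refl) (no y≢y') = ⊥-elim (y≢y' refl)
       step (inj₁ (eq , q)) (no y≢y') =
        let m , m≤ , w = reach⇒walk R q
            m' , m'≤ , p = walk⇒path graph w
            n , u'' , w' = orbit-walk (u' eq) o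
        in suc n , u'' , (y≢y' , m' , ≤-trans m'≤ m≤ , p) ∷ w'
      collect : ∀ y → ∃[ n ] Σ[ u ∈ U i y ] Walk H (x ⊩ [ x∈U x ]) (y ⊩ [ u ]) n → y ∈ map Refinement.value ys
      collect y (n , u , w) = let m , _ , p = walk⇒path H w in ∈-map⁺ Refinement.value (proj₂ (finite i (x ⊩ [ x∈U x ])) (y ⊩ [ u ]) (m , p))

     separation-layering : ∀ {a} → s ≤ a → Layering polishSpace (pow R maps) (suc a)
     separation-layering s≤a = record
      { layer = λ x → toℕ (index x)
      ; layer-meas = λ P → bor-⇔ polishSpace
        (λ { x (i , p , q) → subst (λ i → P (toℕ i)) (sym (proj₂ (proj₂ (partition x)) p)) q }) (λ x q → index x , x∈U x , q)
        (bor-∃ polishSpace _ λ i → bor-∩ polishSpace (to-borel (borel i)) (bor-const polishSpace (P (toℕ i))))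
      ; layer< = λ x → ≤-trans (Finₚ.toℕ<n (index x)) (s≤s s≤a)
      ; components = components-finite }

    open Darts slots using (rev; rev-involutive; Occupied; Dart; dartSpace)

    module _ {q : ℕ} (col : Dart → ℕ) (col-meas : Measurability.Meas dartSpace col) (col-rev : ∀ {d} → Occupied d → col (rev d) ≡ col d)
     (col< : ∀ {d} → Occupied d → col d < q)
     (col-proper : ∀ {v i j} → Occupied (v , i) → Occupied (v , j) → i ≢ j → col (v , i) ≢ col (v , j)) where

     private
      index : ∀ {x y} → Adj x y → Fin Δ
      index e = fromℕ< (proj₁ (proj₂ (h-onto e)))

      slot-index : ∀ {x y} (e : Adj x y) → slot (index e) x ≡ y
      slot-index {x} e = trans (cong (λ n → h n x) (Finₚ.toℕ-fromℕ< (proj₁ (proj₂ (h-onto e))))) (proj₂ (proj₂ (h-onto e)))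

      occupied : ∀ {x y} (e : Adj x y) → Occupied (x , index e)
      occupied e eq = adj-irrefl (trans (sym eq) (slot-index e)) e

      index-unique : ∀ {x y} (e : Adj x y) i → slot i x ≡ y → index e ≡ i
      index-unique e i eq = slot-injective _ _ (trans (slot-index e) (sym eq)) (occupied e)

      rev-index : ∀ {x y} (e : Adj x y) (e' : Adj y x) → rev (x , index e) ≡ (y , index e')
      rev-index {x} {y} e e' = cong₂ _,_ (slot-index e) (sym (index-unique e' j
        (trans (cong (slot j) (sym (slot-index e))) (cong proj₁ (rev-involutive (x , index e))))))
       where
       j = proj₂ (rev (x , index e))

     edge-colouring : BorelEdgeColouring {V} graph q
     edge-colouring = record
      { colour = λ e → fromℕ< (col< (occupied e))
      ; colour-sym = λ e e' → Finₚ.fromℕ<-cong _ _ (trans (sym (col-rev (occupied e))) (cong col (rev-index e e'))) (col< (occupied e)) (col< (occupied e'))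
      ; borel = λ c → bor-⇔ square (λ p → edge c p) (λ p → dart c p)
        (bor-∃ square _ λ i → bor-∩ square
         (bor-≡ {square} {polishSpace} {λ p → slot i (proj₁ p)} {proj₂} (λ A a → along₁ (slot-borel i A a)) (λ A a → along₂ a))
         (along₁ (bor-∩ polishSpace (bor-∁ polishSpace (bor-≡ {polishSpace} {polishSpace} {slot i} {id} (slot-borel i) (bor-id {polishSpace}))) (col-meas (_≡ toℕ c) i))))
      ; proper = λ {x} {y} {z} e e' y≢z eq → col-proper (occupied e) (occupied e')
        (λ i≡ → y≢z (trans (sym (slot-index e)) (trans (cong (λ i → slot i x) i≡) (slot-index e'))))
        (trans (sym (Finₚ.toℕ-fromℕ< (col< (occupied e)))) (trans (cong toℕ eq) (Finₚ.toℕ-fromℕ< (col< (occupied e'))))) }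
      where
      edge : ∀ c p → ∃[ i ] slot i (proj₁ p) ≡ proj₂ p × slot i (proj₁ p) ≢ proj₁ p × col (proj₁ p , i) ≡ toℕ c →
       Σ[ e ∈ Adj (proj₁ p) (proj₂ p) ] fromℕ< (col< (occupied e)) ≡ c
      edge c (x , _) (i , refl , m , eq) = e , Finₚ.toℕ-injective (trans (Finₚ.toℕ-fromℕ< (col< (occupied e))) (trans (cong (λ i → col (x , i)) (index-unique e i refl)) eq))
       where
       e = h-adj (toℕ i) m
      dart : ∀ c p → Σ[ e ∈ Adj (proj₁ p) (proj₂ p) ] fromℕ< (col< (occupied e)) ≡ c →
       ∃[ i ] slot i (proj₁ p) ≡ proj₂ p × slot i (proj₁ p) ≢ proj₁ p × col (proj₁ p , i) ≡ toℕ c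
      dart c (x , y) (e , eq) = index e , slot-index e , occupied e , trans (sym (Finₚ.toℕ-fromℕ< (col< (occupied e)))) (cong toℕ eq)

 module _ {c : ℕ} (c≥ : 6480 ≤ c) {Δ : ℕ} (Δ< : Δ < 4 ^ suc (c + 2)) where
  open Estimates c c≥

  slots-colouring : ∀ {𝒳 s} (G : Slots 𝒳 Δ) (layering : ∀ r → Layering 𝒳 (pow r (Slots.maps G)) s) →
   Colourings.Colouring G layering (Darts.Occupied G) (Δ + h * (c * (c * c)))
  slots-colouring G layering = colouring-⊆ id (+-monoʳ-≤ Δ cost) (edge-colouring B B≡excess B≤′ (r + r) Δ<2^2r (<⇒≤ Δ<k²) all-edges
    λ v → ≤-trans (load≤K Occupied v) (m≤n+m Δ B))
   where
   open Darts G
   open Colourings G layering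
   j = pred k
   k≡ : k ≡ suc j
   k≡ = sym (suc-pred k {{m^n≢0 2 r}})
   Δ<2^2r : Δ < 2 ^ (r + r)
   Δ<2^2r = subst (Δ <_) (trans (cong (4 ^_) (sym (+-suc c 2))) (4^≡2^ r)) Δ<
   Δ<k² : Δ < suc j * suc j
   Δ<k² = subst (λ k → Δ < k * k) k≡ (≤-trans Δ<2^2r (≤-reflexive (^-distribˡ-+-* 2 r r)))
   open Recursion G layering r j (r + r) k≡ (<⇒≤ Δ<k²) Δ<2^2r
   B≡excess : B ≡ excess
   B≡excess = cong (λ k → k * (6 * (2 * (r + r)) + 6) + k * (6 * (2 * (r + r)) + 6) + k * (6 * (2 * (r + r)) + 6)) k≡
   B≤′ : B ≤ suc j * suc j
   B≤′ = subst (λ k → B ≤ k * k) k≡ B≤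
   all-edges : Edges Occupied
   all-edges = record
    { edges-bor = occupied-bor
    ; edges-rev = λ {d} o e → o (trans (sym e) (cong proj₁ (rev-involutive d)))
    ; edges-occ = id }

  few-colours : ∀ {V} (G : BorelGraph V) → HasMaximumDegree (BorelGraph.graph G) Δ → ∀ {a} → IsAsymptoticSeparationIndex G a →
   BorelEdgeColouring {V} (BorelGraph.graph G) (Δ + h * (c * (c * c)))
  few-colours {V} G degree {a} (asi , _) = from (neighbours G degree)
   where
   open Interface V
   from : Neighbours G degree → BorelEdgeColouring {V} (BorelGraph.graph G) (Δ + h * (c * (c * c)))
   from (f , f-borel , f-onto , f-adj , f-injective) =
    edge-colouring G degree f-borel f-onto f-adj f-injective colour colour-meas colour-rev colour< proper
    where
    layering : ∀ r → Layering _ (pow r (Slots.maps (slots G degree f-borel f-onto f-adj f-injective))) (suc a)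
    layering r = let s , (separation , _) , s≤a = asi r in separation-layering G degree f-borel f-onto f-adj f-injective r separation s≤a
    open Colourings.Colouring (slots-colouring (slots G degree f-borel f-onto f-adj f-injective) layering)

 index-bound : ∀ m → 6480 + 2 ≤ m → ∀ {Δ} → 4 ^ m ≤ Δ → Δ < 4 ^ suc m → ∀ {V} (G : BorelGraph V) → HasMaximumDegree (BorelGraph.graph G) Δ →
  ∀ {a} → IsAsymptoticSeparationIndex G a → ∀ √Δ logΔ → √Δ IsSqrtOf fromℕ Δ → logΔ IsLogOf fromℕ Δ →
  ∃[ χ′ ] IsBorelChromaticIndex G χ′ × fromℕ χ′ ≤ᵣ fromℕ Δ +ᵣ √Δ *ᵣ logΔ ^ᵣ 3
 index-bound m m≥ {Δ} 4^m≤Δ Δ< {V} G degree asi √Δ logΔ sqrt log = from (m ∸ 2) (m∸n+n≡m {m} {2} (≤-trans (m≤n+m 2 6480) m≥))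
  where
  from : ∀ c → c + 2 ≡ m → ∃[ χ′ ] IsBorelChromaticIndex G χ′ × fromℕ χ′ ≤ᵣ fromℕ Δ +ᵣ √Δ *ᵣ logΔ ^ᵣ 3
  from c refl = bounded (least (BorelEdgeColouring {V} (BorelGraph.graph G)) (Δ + h * (c * (c * c)) , few-colours c≥ Δ< G degree asi))
   where
   c≥ : 6480 ≤ c
   c≥ = +-cancelʳ-≤ 2 6480 c m≥
   open Estimates c c≥
   bounded : ∃[ n ] BorelEdgeColouring {V} (BorelGraph.graph G) n × (∀ q → BorelEdgeColouring {V} (BorelGraph.graph G) q → n ≤ q) →
    ∃[ χ′ ] IsBorelChromaticIndex G χ′ × fromℕ χ′ ≤ᵣ fromℕ Δ +ᵣ √Δ *ᵣ logΔ ^ᵣ 3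
   bounded (n , colouring , minimal) = n , (colouring , minimal) ,
    ExponentialSums.√*log³-lower √Δ logΔ {c = c} (m^n>0 2 (c + 1)) (≤-trans (≤-reflexive 4h²≡) 4^m≤Δ) 4^m≤Δ sqrt log
     (minimal _ (few-colours c≥ Δ< G degree asi))

open Classical

theorem1p49 :
    (∀ {ℓ} → ExcludedMiddle ℓ) →
    ∃[ Δ₀ ] (∀ (V : StandardBorelSpace) (G : BorelGraph V) (Δ : ℕ) →
      HasMaximumDegree (BorelGraph.graph G) Δ →
      Δ₀ ≤ Δ →
      (∃[ a ] IsAsymptoticSeparationIndex G a) →
      ∀ (√Δ logΔ : ℝ) → √Δ IsSqrtOf fromℕ Δ → logΔ IsLogOf fromℕ Δ →
      ∃[ χ′ ] IsBorelChromaticIndex G χ′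
            × fromℕ χ′ ≤ᵣ fromℕ Δ +ᵣ √Δ *ᵣ logΔ ^ᵣ 3)
theorem1p49 em = 4 ^ (6480 + 2) , λ V G Δ degree Δ≥ (a , asi) √Δ logΔ sqrt log →
  let m , m≥ , 4^m≤Δ , Δ< = between-powers em (6480 + 2) Δ≥
  in index-bound em m m≥ 4^m≤Δ Δ< G degree asi √Δ logΔ sqrt log
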